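{- For every even integer $k\ge 6$ there exists $n_0$ such that the following holds for every $n\in \frac k2 \mathbb{N}$ with $n\ge n_0$. If $\mathcal{H}$ is a $k$-uniform hypergraph on $n$ vertices such that \[ \delta_{k-1}(\mathcal{H})> \begin{cases} n/2 -k+1 &\text{ if $n\in k\mathbb N$ and $n/2 - n/k$ is even,}\\ \lfloor n/2\rfloor -k+2 &\text{ otherwise, } \end{cases} \] then $\mathcal{H}$ contains a Hamilton $(k/2)$-cycle.
   Context: A $k$-uniform hypergraph ($k$-graph) $\mathcal{H}$ consists of a vertex set $V$ and an edge set $E\subseteq\binom{V}{k}$. For a set $S$ of $d$ vertices ($1\le d\le k-1$), $\deg_{\mathcal{H}}(S)$ is the number of edges containing $S$, and $\delta_d(\mathcal{H})$ is the minimum of $\deg_{\mathcal{H}}(S)$ over all $d$-vertex sets $S$. For $1\le \ell<k$, a $k$-graph is an $\ell$-cycle if its vertices can be ordered cyclically so that each edge consists of $k$ consecutive vertices and every two consecutive edges (in the natural order of the edges) share exactly $\ell$ vertices. A Hamilton $\ell$-cycle of $\mathcal{H}$ is an $\ell$-cycle that is a spanning subhypergraph of $\mathcal{H}$. -}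

module Defs where

open import Data.Nat using (ℕ; zero; suc; _+_; _*_; _∸_; _/_; _<_)
open import Data.Nat.DivMod using (_mod_)
open import Data.Nat.Divisibility using (_∣_)
open import Data.Bool using (Bool; true; false)
open import Data.Fin using (Fin)
open import Data.Fin.Subset using (Subset; ∣_∣; _⊆_; ⁅_⁆; _∪_; ⊥; inside; outside)
open import Data.Fin.Subset.Properties using (_⊆?_)
open import Data.Fin.Permutation using (Permutation′; _⟨$⟩ʳ_)
open import Data.Vec using () renaming ([] to []ᵥ; _∷_ to _∷ᵥ_)
open import Data.List using (List; []; _∷_; _++_; map; foldr; upTo; length; filter)
open import Data.Product using (Σ; _×_)
open import Data.Empty renaming (⊥ to Empty)
open import Data.Integer using (ℤ; +_; _-_) renaming (_<_ to _<ℤ_; _+_ to _+ℤ_)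
open import Relation.Binary.PropositionalEquality using (_≡_)
open import Relation.Nullary using (¬_; Dec; yes; no)
open import Relation.Unary using (Decidable)

record Hypergraph (k n : ℕ) : Set where
  field
    edge    : Subset n → Bool
    uniform : ∀ e → edge e ≡ true → ∣ e ∣ ≡ k
open Hypergraph public

allSubsets : (n : ℕ) → List (Subset n)
allSubsets zero    = []ᵥ ∷ []
allSubsets (suc n) = map (outside ∷ᵥ_) (allSubsets n) ++ map (inside ∷ᵥ_) (allSubsets n)

IsEdgeContaining : ∀ {k n} → Hypergraph k n → Subset n → Subset n → Set
IsEdgeContaining H S e = edge H e ≡ true × S ⊆ e

isEdgeContaining? : ∀ {k n} (H : Hypergraph k n) (S : Subset n) → Decidable (IsEdgeContaining H S)
isEdgeContaining? H S e with edge H e | S ⊆? e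
... | true  | yes p = yes (Data.Product._,_ Relation.Binary.PropositionalEquality.refl p)
... | true  | no ¬p = no (λ q → ¬p (Data.Product.proj₂ q))
... | false | _     = no (λ { (() Data.Product., _) })

degree : ∀ {k n} → Hypergraph k n → Subset n → ℕ
degree {n = n} H S = length (filter (isEdgeContaining? H S) (allSubsets n))

MinDegreeAbove : ∀ {k n} → Hypergraph k n → ℕ → ℤ → Set
MinDegreeAbove {n = n} H d t = (S : Subset n) → ∣ S ∣ ≡ d → t <ℤ + degree H S

Special : ℕ → ℕ → Set
Special zero    n = Empty
Special (suc k) n = (suc k ∣ n) × (2 ∣ (n / 2 ∸ n / suc k))

window : ∀ {n} → Permutation′ n → ℕ → ℕ → Subset n
window {zero}  σ a k = ⊥
window {suc m} σ a k = foldr (λ j acc → ⁅ σ ⟨$⟩ʳ ((a + j) mod suc m) ⁆ ∪ acc) ⊥ (upTo k)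

-- H contains a Hamilton ℓ-cycle: there is a cyclic ordering σ of all the
-- vertices and t with t(k-ℓ) = n such that, for each i < t, the k consecutive
-- vertices starting at position i(k-ℓ) form an edge of H (so consecutive
-- edges overlap in exactly ℓ vertices and every vertex is covered).
HasHamiltonCycle : ∀ {k n} → Hypergraph k n → ℕ → Set
HasHamiltonCycle {k} {n} H ℓ =
  Σ (Permutation′ n) λ σ → Σ ℕ λ t →
    (t * (k ∸ ℓ) ≡ n) × ((i : ℕ) → i < t → edge H (window σ (i * (k ∸ ℓ)) k) ≡ true)

{-# OPTIONS --safe #-}
module Submission where

module Base where

  open import Data.Nat public using (ℕ; zero; suc; _+_; _*_; _∸_; _^_; _≤_; _<_; z≤n; s≤s; _≤?_; _<?_; pred; NonZero; nonZero; >-nonZero)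
  open import Data.Nat.Properties public renaming (_≟_ to _≟ℕ_) using
    ( ≤-refl; ≤-trans; ≤-reflexive; +-comm; +-assoc; *-comm; *-assoc; +-identityʳ; *-identityʳ; *-zeroʳ
    ; *-distribˡ-+; *-distribʳ-+; +-mono-≤; *-mono-≤; *-monoʳ-≤; *-monoˡ-≤; +-monoʳ-≤; +-monoˡ-≤; m≤m+n; m≤n+m
    ; ≰⇒>; ≮⇒≥; <⇒≱; ≤-total; ≤-antisym; n≤1+n; +-cancelˡ-≡; +-cancelʳ-≡; suc-injective; m+[n∸m]≡n; +-suc
    ; ≤ᵇ⇒≤; <-irrefl; 1+n≰n; *-cancelʳ-≤; *-cancelˡ-≤; +-cancelˡ-≤; +-cancelʳ-≤; ≤-pred; *-cancelˡ-≡; *-suc )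
  open import Data.Nat.Tactic.RingSolver public using (solve; solve-∀)
  open import Data.Bool public using (Bool; true; false; not; _∧_; _∨_; _xor_; if_then_else_)
  open import Data.Fin public using (Fin; toℕ)
  open import Data.Fin.Properties public using () renaming (_≟_ to _≟ᶠ_)
  open import Data.List public using (List; []; _∷_; [_]; _++_; map; concat; concatMap; length; allFin; foldr; take; drop)
  open import Data.List.Properties public using (length-++; length-map; ++-identityʳ; ++-assoc; length-take; length-drop; take++drop≡id)
  open import Data.List.Relation.Unary.Any public using (Any; here; there)
  open import Data.List.Relation.Unary.All public using (All; []; _∷_)
  open import Data.List.Relation.Unary.AllPairs public using ([]; _∷_)
  open import Data.List.Relation.Unary.Unique.Propositional public using (Unique)
  open import Data.List.Membership.Propositional public using (_∈_; _∉_)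
  open import Data.List.Membership.Propositional.Properties public using (∈-++⁺ˡ; ∈-++⁺ʳ; ∈-++⁻; ∈-∃++; ∈-allFin)
  open import Data.List.Relation.Binary.Permutation.Propositional public
    using (_↭_; prep; swap; ↭-refl; ↭-sym; ↭-trans; ↭-reflexive)
  open import Data.List.Relation.Binary.Permutation.Propositional.Properties public
    using (∈-resp-↭; ↭-length; shift; shifts; drop-∷; ++-comm; ++⁺; ++⁺ˡ; ++⁺ʳ; map⁺)
  open import Data.Product public using (Σ; ∃; _×_; _,_; proj₁; proj₂)
  open import Data.Sum public using (_⊎_; inj₁; inj₂; [_,_]′)
  open import Data.Empty public using (⊥; ⊥-elim)
  open import Data.Unit public using (⊤; tt)
  open import Relation.Nullary public using (¬_; Dec; yes; no; does)
  open import Relation.Binary.PropositionalEquality public using (_≡_; _≢_; refl; sym; trans; cong; cong₂; subst; subst₂; ≢-sym)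
  open import Function public using (_∘_; id; _$_; case_of_)

  import Data.List.Membership.DecPropositional as DecMembership

  import Data.List.Relation.Unary.All.Properties as All′
  import Data.List.Relation.Unary.AllPairs.Properties as AllPairs′
  import Data.List.Relation.Binary.Permutation.Setoid.Properties as SetoidPerm
  import Data.List.Relation.Binary.Permutation.Propositional.Properties as PermProps
  import Data.List.Relation.Binary.Permutation.Propositional as PermBase
  import Algebra.Solver.CommutativeMonoid as CMSolver
  open import Relation.Binary.PropositionalEquality using (setoid)

  infixl 6 _⊕_
  infixr 6.5 _⊗_

  _⊕_ : ∀ {a b c d} → a ≤ b → c ≤ d → a + c ≤ b + d
  _⊕_ = +-mono-≤

  _⊗_ : ∀ c {a b} → a ≤ b → c * a ≤ c * b
  c ⊗ h = *-monoʳ-≤ c h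

  abstract
    lin : ∀ {x y a b} s → a ≤ b → x + b + s ≡ y + a → x ≤ y
    lin {x} {y} {a} {b} s h eq = +-cancelʳ-≤ b x y (≤-trans (m≤m+n (x + b) s) (≤-trans (≤-reflexive eq) (+-monoʳ-≤ y h)))

    absurd : ∀ s {a b} {C : Set} → a ≤ b → a ≡ b + (s + 1) → C
    absurd s {a} {b} h refl = ⊥-elim (1+n≰n (≤-trans (≤-trans (≤-reflexive (+-comm 1 b)) (+-monoʳ-≤ b (m≤n+m 1 s))) h))

  cancel : ∀ c {a b} → 1 ≤ c → c * a ≤ c * b → a ≤ b
  cancel c h k = *-cancelˡ-≤ c {{ >-nonZero h }} k

  eq≤ : ∀ {a b : ℕ} → a ≡ b → a ≤ b
  eq≤ = ≤-reflexive

  eq≥ : ∀ {a b : ℕ} → a ≡ b → b ≤ a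
  eq≥ e = ≤-reflexive (sym e)

  ⟦_⟧ : Bool → ℕ
  ⟦ true ⟧ = 1
  ⟦ false ⟧ = 0

  ⟦⟧≤1 : ∀ b → ⟦ b ⟧ ≤ 1
  ⟦⟧≤1 true = ≤-refl
  ⟦⟧≤1 false = z≤n

  ⟦⟧-≤ : ∀ b {k} → (b ≡ true → 1 ≤ k) → ⟦ b ⟧ ≤ k
  ⟦⟧-≤ true h = h refl
  ⟦⟧-≤ false h = z≤n

  ⟦⟧-true : ∀ {b} → b ≡ true → 1 ≤ ⟦ b ⟧
  ⟦⟧-true refl = ≤-refl

  ⟦∧⟧ : ∀ a b → ⟦ a ∧ b ⟧ ≡ ⟦ a ⟧ * ⟦ b ⟧
  ⟦∧⟧ true b = sym (+-identityʳ ⟦ b ⟧)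
  ⟦∧⟧ false b = refl

  ∧-elim : ∀ {a b} → a ∧ b ≡ true → a ≡ true × b ≡ true
  ∧-elim {true} {true} _ = refl , refl

  ∧-intro : ∀ {a b} → a ≡ true → b ≡ true → a ∧ b ≡ true
  ∧-intro refl refl = refl

  ∧-fst : ∀ {a b} → a ∧ b ≡ true → a ≡ true
  ∧-fst {a} p = proj₁ (∧-elim {a} p)

  ∧-snd : ∀ {a b} → a ∧ b ≡ true → b ≡ true
  ∧-snd {a} p = proj₂ (∧-elim {a} p)

  true≢false : ∀ {b} {C : Set} → b ≡ true → b ≡ false → C
  true≢false refl ()

  bool-case : ∀ b → b ≡ true ⊎ b ≡ false
  bool-case true = inj₁ refl
  bool-case false = inj₂ refl

  not-true : ∀ {b} → not b ≡ true → b ≡ false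
  not-true {false} _ = refl

  not-false : ∀ {b} → b ≡ false → not b ≡ true
  not-false refl = refl

  decided : ∀ {P : Set} (d : Dec P) → does d ≡ true → P
  decided (yes p) _ = p

  undecided : ∀ {P : Set} (d : Dec P) → does d ≡ false → ¬ P
  undecided (no p) _ = p

  decide : ∀ {P : Set} (d : Dec P) → P → does d ≡ true
  decide (yes p) _ = refl
  decide (no p) q = ⊥-elim (p q)

  module _ {A : Set} where

    ∑ : List A → (A → ℕ) → ℕ
    ∑ [] f = 0
    ∑ (x ∷ xs) f = f x + ∑ xs f

    ∑-mono∈ : ∀ xs {f g : A → ℕ} → (∀ x → x ∈ xs → f x ≤ g x) → ∑ xs f ≤ ∑ xs g
    ∑-mono∈ [] h = z≤n
    ∑-mono∈ (x ∷ xs) h = h x (here refl) ⊕ ∑-mono∈ xs (λ y y∈ → h y (there y∈))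

    ∑-mono : ∀ xs {f g : A → ℕ} → (∀ x → f x ≤ g x) → ∑ xs f ≤ ∑ xs g
    ∑-mono xs h = ∑-mono∈ xs (λ x _ → h x)

    ∑-cong : ∀ xs {f g : A → ℕ} → (∀ x → f x ≡ g x) → ∑ xs f ≡ ∑ xs g
    ∑-cong [] h = refl
    ∑-cong (x ∷ xs) h = cong₂ _+_ (h x) (∑-cong xs h)

    ∑-+ : ∀ xs (f g : A → ℕ) → ∑ xs (λ x → f x + g x) ≡ ∑ xs f + ∑ xs g
    ∑-+ [] f g = refl
    ∑-+ (x ∷ xs) f g = trans (cong (f x + g x +_) (∑-+ xs f g)) (interchange (f x) (g x) (∑ xs f) (∑ xs g))
      where
      interchange : ∀ a b c d → a + b + (c + d) ≡ a + c + (b + d)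
      interchange = solve-∀

    ∑-* : ∀ xs c (f : A → ℕ) → ∑ xs (λ x → c * f x) ≡ c * ∑ xs f
    ∑-* [] c f = sym (*-zeroʳ c)
    ∑-* (x ∷ xs) c f = trans (cong (c * f x +_) (∑-* xs c f)) (sym (*-distribˡ-+ c (f x) (∑ xs f)))

    ∑-*ʳ : ∀ xs c (f : A → ℕ) → ∑ xs (λ x → f x * c) ≡ ∑ xs f * c
    ∑-*ʳ xs c f = trans (∑-cong xs (λ x → *-comm (f x) c)) (trans (∑-* xs c f) (*-comm c (∑ xs f)))

    ∑-const : ∀ xs c → ∑ xs (λ _ → c) ≡ length xs * c
    ∑-const [] c = refl
    ∑-const (x ∷ xs) c = cong (c +_) (∑-const xs c)

    ∑-zero : ∀ xs → ∑ xs (λ _ → 0) ≡ 0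
    ∑-zero xs = trans (∑-const xs 0) (*-zeroʳ (length xs))

    ∑-++ : ∀ xs ys (f : A → ℕ) → ∑ (xs ++ ys) f ≡ ∑ xs f + ∑ ys f
    ∑-++ [] ys f = refl
    ∑-++ (x ∷ xs) ys f = trans (cong (f x +_) (∑-++ xs ys f)) (sym (+-assoc (f x) (∑ xs f) (∑ ys f)))

    ∑-↭ : ∀ {xs ys} (f : A → ℕ) → xs ↭ ys → ∑ xs f ≡ ∑ ys f
    ∑-↭ f PermBase.refl = refl
    ∑-↭ f (prep x p) = cong (f x +_) (∑-↭ f p)
    ∑-↭ f (swap {xs} {ys} x y p) = trans (cong (λ s → f x + (f y + s)) (∑-↭ f p)) (exchange (f x) (f y) (∑ ys f))
      where
      exchange : ∀ a b c → a + (b + c) ≡ b + (a + c)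
      exchange = solve-∀
    ∑-↭ f (PermBase.trans p q) = trans (∑-↭ f p) (∑-↭ f q)

    ∑-find : ∀ xs {f g : A → ℕ} → ∑ xs f < ∑ xs g → ∃ λ x → x ∈ xs × f x < g x
    ∑-find (x ∷ xs) {f} {g} h with f x <? g x
    ... | yes p = x , here refl , p
    ... | no p with ∑-find xs {f} {g} (+-cancelˡ-≤ (f x) _ _ (≤-trans (≤-reflexive (+-suc (f x) _)) (≤-trans h (+-monoˡ-≤ _ (≮⇒≥ p)))))
    ... | y , y∈ , q = y , there y∈ , q

    #_of_ : (A → Bool) → List A → ℕ
    # p of xs = ∑ xs (λ x → ⟦ p x ⟧)

    #-find : ∀ xs (p : A → Bool) → 1 ≤ # p of xs → ∃ λ x → x ∈ xs × p x ≡ true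
    #-find (x ∷ xs) p h with p x in eq
    ... | true = x , here refl , eq
    ... | false with #-find xs p h
    ... | y , y∈ , q = y , there y∈ , q

    #≤length : ∀ xs (p : A → Bool) → # p of xs ≤ length xs
    #≤length xs p = ≤-trans (∑-mono xs (λ x → ⟦⟧≤1 (p x))) (≤-reflexive (trans (∑-const xs 1) (*-identityʳ _)))

    #-all : ∀ (p : A → Bool) xs → (∀ {v} → v ∈ xs → p v ≡ true) → # p of xs ≡ length xs
    #-all p [] h = refl
    #-all p (x ∷ xs) h rewrite h (here refl) = cong suc (#-all p xs (λ i → h (there i)))

    #-pos : ∀ {xs x} (p : A → Bool) → x ∈ xs → p x ≡ true → 1 ≤ # p of xs
    #-pos p (here refl) h rewrite h = s≤s z≤n
    #-pos p (there {y} x∈) h = ≤-trans (#-pos p x∈ h) (m≤n+m _ ⟦ p y ⟧)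

    search : ∀ xs (p : A → Bool) → (∃ λ x → x ∈ xs × p x ≡ true) ⊎ (∀ x → x ∈ xs → p x ≡ false)
    search [] p = inj₂ (λ x ())
    search (x ∷ xs) p with p x in eq | search xs p
    ... | true | _ = inj₁ (x , here refl , eq)
    ... | false | inj₁ (y , y∈ , q) = inj₁ (y , there y∈ , q)
    ... | false | inj₂ h = inj₂ (λ { y (here refl) → eq ; y (there y∈) → h y y∈ })

    #-++ : ∀ xs ys p → # p of (xs ++ ys) ≡ # p of xs + # p of ys
    #-++ xs ys p = ∑-++ xs ys _

    Disj : List A → List A → Set
    Disj xs ys = ∀ {v} → v ∈ xs → v ∈ ys → ⊥

    Unique-↭ : ∀ {xs ys : List A} → xs ↭ ys → Unique xs → Unique ys
    Unique-↭ p = SetoidPerm.Unique-resp-↭ (setoid A) (PermBase.↭⇒↭ₛ p)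

    ∉⇒All≢ : ∀ {x : A} {xs} → x ∉ xs → All (x ≢_) xs
    ∉⇒All≢ {xs = []} h = []
    ∉⇒All≢ {xs = y ∷ xs} h = (λ e → h (here e)) ∷ ∉⇒All≢ (λ i → h (there i))

    All≢⇒∉ : ∀ {x : A} {xs} → All (x ≢_) xs → x ∉ xs
    All≢⇒∉ (p ∷ ps) (here e) = p e
    All≢⇒∉ (p ∷ ps) (there i) = All≢⇒∉ ps i

    unique-∷ : ∀ {x : A} {xs} → x ∉ xs → Unique xs → Unique (x ∷ xs)
    unique-∷ h u = ∉⇒All≢ h ∷ u

    unique-head : ∀ {x : A} {xs} → Unique (x ∷ xs) → x ∉ xs
    unique-head (h ∷ _) = All≢⇒∉ h

    unique-tail : ∀ {x : A} {xs} → Unique (x ∷ xs) → Unique xs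
    unique-tail (_ ∷ u) = u

    disj-∷ : ∀ {v : A} {xs ys} → v ∉ ys → Disj xs ys → Disj (v ∷ xs) ys
    disj-∷ p d (here refl) j = p j
    disj-∷ p d (there i) j = d i j

    unique-++ : ∀ {xs ys : List A} → Unique xs → Unique ys → Disj xs ys → Unique (xs ++ ys)
    unique-++ {[]} _ u _ = u
    unique-++ {x ∷ xs} (h ∷ u) v d = unique-∷
      (λ i → [ All≢⇒∉ h , d (here refl) ]′ (∈-++⁻ xs i)) (unique-++ u v (λ i → d (there i)))

    unique-ˡ : ∀ xs {ys : List A} → Unique (xs ++ ys) → Unique xs
    unique-ˡ [] u = []
    unique-ˡ (x ∷ xs) (h ∷ u) = All′.++⁻ˡ xs h ∷ unique-ˡ xs u

    unique-ʳ : ∀ xs {ys : List A} → Unique (xs ++ ys) → Unique ys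
    unique-ʳ [] u = u
    unique-ʳ (x ∷ xs) (h ∷ u) = unique-ʳ xs u

    unique-disj : ∀ xs {ys : List A} → Unique (xs ++ ys) → Disj xs ys
    unique-disj (x ∷ xs) (h ∷ u) (here refl) j = All≢⇒∉ (All′.++⁻ʳ xs h) j
    unique-disj (x ∷ xs) (h ∷ u) (there i) j = unique-disj xs u i j

    -- A duplicate-free sublist can be split off: the way every vertex set is complemented below.
    complement : ∀ {xs ys : List A} → Unique xs → (∀ {v} → v ∈ xs → v ∈ ys) → ∃ λ zs → ys ↭ xs ++ zs
    complement {[]} {ys} u s = ys , ↭-refl
    complement {x ∷ xs} {ys} (h ∷ u) s with ∈-∃++ (s (here refl))
    ... | as , bs , refl with complement {xs} {as ++ bs} u sub
      where
      sub : ∀ {v} → v ∈ xs → v ∈ as ++ bs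
      sub i with ∈-resp-↭ (shift x as bs) (s (there i))
      ... | here refl = ⊥-elim (All≢⇒∉ h i)
      ... | there j = j
    ... | zs , p = zs , ↭-trans (shift x as bs) (prep x p)

    split : ∀ k (xs : List A) → k ≤ length xs → ∃ λ as → ∃ λ bs → xs ≡ as ++ bs × length as ≡ k
    split zero xs _ = [] , xs , refl , refl
    split (suc k) (x ∷ xs) (s≤s h) with split k xs h
    ... | as , bs , refl , e = x ∷ as , bs , refl , cong suc e

  module _ {A B : Set} where

    ∑-swap : ∀ xs (ys : List B) (f : A → B → ℕ) → ∑ xs (λ x → ∑ ys (f x)) ≡ ∑ ys (λ y → ∑ xs (λ x → f x y))
    ∑-swap [] ys f = sym (∑-zero ys)
    ∑-swap (x ∷ xs) ys f = trans (cong (∑ ys (f x) +_) (∑-swap xs ys f)) (sym (∑-+ ys (f x) (λ y → ∑ xs (λ x → f x y))))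

    ∑-map : ∀ (g : A → B) xs (f : B → ℕ) → ∑ (map g xs) f ≡ ∑ xs (λ x → f (g x))
    ∑-map g [] f = refl
    ∑-map g (x ∷ xs) f = cong (f (g x) +_) (∑-map g xs f)

    ∑-concatMap : ∀ (g : A → List B) xs (f : B → ℕ) → ∑ (concatMap g xs) f ≡ ∑ xs (λ x → ∑ (g x) f)
    ∑-concatMap g [] f = refl
    ∑-concatMap g (x ∷ xs) f = trans (∑-++ (g x) (concatMap g xs) f) (cong (∑ (g x) f +_) (∑-concatMap g xs f))

  module _ {A B : Set} (xs : List A) (ys : List B) where

    ∑₂ : (A → B → ℕ) → ℕ
    ∑₂ f = ∑ xs (λ x → ∑ ys (f x))

    ∑₂-mono : ∀ {f g} → (∀ x y → f x y ≤ g x y) → ∑₂ f ≤ ∑₂ g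
    ∑₂-mono h = ∑-mono xs (λ x → ∑-mono ys (h x))

    ∑₂-+ : ∀ f g → ∑₂ (λ x y → f x y + g x y) ≡ ∑₂ f + ∑₂ g
    ∑₂-+ f g = trans (∑-cong xs (λ x → ∑-+ ys (f x) (g x))) (∑-+ xs _ _)

    ∑₂-ˡ : ∀ f → ∑₂ (λ x _ → f x) ≡ length ys * ∑ xs f
    ∑₂-ˡ f = trans (∑-cong xs (λ x → ∑-const ys (f x))) (∑-* xs (length ys) f)

    ∑₂-ʳ : ∀ g → ∑₂ (λ _ y → g y) ≡ length xs * ∑ ys g
    ∑₂-ʳ g = ∑-const xs (∑ ys g)

    ∑₂-× : ∀ f g → ∑₂ (λ x y → f x * g y) ≡ ∑ xs f * ∑ ys g
    ∑₂-× f g = trans (∑-cong xs (λ x → ∑-* ys (f x) g)) (∑-*ʳ xs (∑ ys g) f)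

    ∑₂-find : ∀ {p : A → B → Bool} → 1 ≤ ∑₂ (λ x y → ⟦ p x y ⟧) → ∃ λ x → ∃ λ y → p x y ≡ true
    ∑₂-find {p} h =
      let x , _ , k = ∑-find xs {λ _ → 0} (≤-trans (≤-reflexive (cong suc (∑-zero xs))) h)
          y , _ , l = #-find ys (p x) k
      in x , y , l

  concat-↭ : ∀ {A : Set} {xss yss : List (List A)} → xss ↭ yss → concat xss ↭ concat yss
  concat-↭ PermBase.refl = ↭-refl
  concat-↭ (prep x p) = ++⁺ˡ x (concat-↭ p)
  concat-↭ (swap {xs} {ys} x y p) = ↭-trans (shifts x y) (++⁺ˡ y (++⁺ˡ x (concat-↭ p)))
  concat-↭ (PermBase.trans p q) = ↭-trans (concat-↭ p) (concat-↭ q)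

  concat-++ : ∀ {A : Set} (xss yss : List (List A)) → concat (xss ++ yss) ≡ concat xss ++ concat yss
  concat-++ [] yss = refl
  concat-++ (xs ∷ xss) yss = trans (cong (xs ++_) (concat-++ xss yss)) (sym (++-assoc xs (concat xss) (concat yss)))

  module PermSolver {A : Set} where
    open CMSolver (PermProps.++-commutativeMonoid {A = A}) public using (_⊜_) renaming (solve to perm; _⊕_ to _∙_)

  open PermSolver public using (perm; _⊜_; _∙_)

  module Vertices (n : ℕ) where

    V : Set
    V = Fin n

    infix 7 _∈ᵇ_

    open DecMembership (_≟ᶠ_ {n}) using (_∈?_) public

    _∈ᵇ_ : V → List V → Bool
    v ∈ᵇ F = does (v ∈? F)

    ∨-≤ : ∀ a b → ⟦ a ∨ b ⟧ ≤ ⟦ a ⟧ + ⟦ b ⟧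
    ∨-≤ true b = s≤s z≤n
    ∨-≤ false b = ≤-refl

    abstract
      hits : List V → List V → Bool
      hits F [] = false
      hits F (v ∷ w) = v ∈ᵇ F ∨ hits F w

      hits-disj : ∀ F w → hits F w ≡ false → Disj w F
      hits-disj F (v ∷ w) h i j with v ∈? F
      hits-disj F (v ∷ w) h (here refl) j | no p = p j
      hits-disj F (v ∷ w) h (there i) j | no p = hits-disj F w h i j

      disj-hits : ∀ F w → Disj w F → hits F w ≡ false
      disj-hits F [] d = refl
      disj-hits F (v ∷ w) d with v ∈? F
      ... | yes p = ⊥-elim (d (here refl) p)
      ... | no p = disj-hits F w (λ i → d (there i))

      hits-∷ : ∀ F v w → ⟦ hits F (v ∷ w) ⟧ ≤ ⟦ v ∈ᵇ F ⟧ + ⟦ hits F w ⟧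
      hits-∷ F v w = ∨-≤ (v ∈ᵇ F) (hits F w)

      hits-[] : ∀ F → hits F [] ≡ false
      hits-[] F = refl

    unique? : ∀ (xs : List V) → Dec (Unique xs)
    unique? = AllPairs.allPairs? (λ a b → ¬? (a ≟ᶠ b))
      where
      import Data.List.Relation.Unary.AllPairs as AllPairs
      open import Relation.Nullary using (¬?)

    rest : ∀ {xs : List V} → Unique xs → ∃ λ zs → allFin n ↭ xs ++ zs
    rest u = complement u (λ _ → ∈-allFin _)

    allFin-unique : Unique (allFin n)
    allFin-unique = allFin⁺ n
      where open import Data.List.Relation.Unary.Unique.Propositional.Properties using (allFin⁺)

    #-elem : ∀ F → # (_∈ᵇ F) of allFin n ≤ length F
    #-elem F = ≤-trans (∑-mono (allFin n) le) (≤-trans (≤-reflexive (∑-swap (allFin n) F _)) (≤-trans (∑-mono F one) (≤-reflexive (trans (∑-const F 1) (*-identityʳ _)))))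
      where
      le : ∀ v → ⟦ v ∈ᵇ F ⟧ ≤ ∑ F (λ f → ⟦ does (f ≟ᶠ v) ⟧)
      le v = ⟦⟧-≤ (v ∈ᵇ F) (λ h → #-pos (λ f → does (f ≟ᶠ v)) (decided (v ∈? F) h) (decide (v ≟ᶠ v) refl))
      uniq : ∀ f xs → Unique xs → ∑ xs (λ v → ⟦ does (f ≟ᶠ v) ⟧) ≤ 1
      uniq f [] u = z≤n
      uniq f (x ∷ xs) (h ∷ u) with f ≟ᶠ x
      ... | no _ = uniq f xs u
      ... | yes refl = s≤s (≤-trans (∑-mono∈ xs λ v v∈ → ⟦⟧-≤ (does (f ≟ᶠ v)) λ e → case decided (f ≟ᶠ v) e of λ { refl → ⊥-elim (All≢⇒∉ h v∈) }) (≤-reflexive (∑-zero xs)))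
      one : ∀ f → ∑ (allFin n) (λ v → ⟦ does (f ≟ᶠ v) ⟧) ≤ 1
      one f = uniq f (allFin n) allFin-unique

    length-allFin : length (allFin n) ≡ n
    length-allFin = Data.List.Properties.length-tabulate id
      where import Data.List.Properties

    ∑-V : ∀ c → ∑ (allFin n) (λ _ → c) ≡ n * c
    ∑-V c = trans (∑-const (allFin n) c) (cong (_* c) length-allFin)

    abstract
      tup : ℕ → List (List V)
      tup zero = [] ∷ []
      tup (suc j) = concatMap (λ v → map (v ∷_) (tup j)) (allFin n)

      ∑-tup₀ : ∀ f → ∑ (tup 0) f ≡ f []
      ∑-tup₀ f = +-identityʳ (f [])

      ∑-tup : ∀ j f → ∑ (tup (suc j)) f ≡ ∑ (allFin n) (λ v → ∑ (tup j) (λ w → f (v ∷ w)))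
      ∑-tup j f = trans (∑-concatMap _ (allFin n) f) (∑-cong (allFin n) (λ v → ∑-map (v ∷_) (tup j) f))

      ∑-U : ∀ j c → ∑ (tup j) (λ _ → c) ≡ n ^ j * c
      ∑-U zero c = refl
      ∑-U (suc j) c = trans (∑-tup j _) (trans (∑-cong (allFin n) (λ v → ∑-U j c)) (trans (∑-V (n ^ j * c)) (sym (*-assoc n (n ^ j) c))))

      length-tup : ∀ j → length (tup j) ≡ n ^ j
      length-tup j = trans (sym (trans (∑-const (tup j) 1) (*-identityʳ _))) (trans (∑-U j 1) (*-identityʳ _))

      ∈-tup : ∀ j w → length w ≡ j → w ∈ tup j
      ∈-tup zero [] _ = here refl
      ∈-tup (suc j) (v ∷ w) e = ∈-concatMap⁺ (λ v → map (v ∷_) (tup j)) {xs = allFin n}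
          (Any-map (λ { refl → ∈-map⁺ (v ∷_) (∈-tup j w (suc-injective e)) }) (∈-allFin v))
        where
        open import Data.List.Membership.Propositional.Properties using (∈-concatMap⁺; ∈-map⁺)
        open import Data.List.Relation.Unary.Any using () renaming (map to Any-map)

      tup-length : ∀ j {w} → w ∈ tup j → length w ≡ j
      tup-length zero (here refl) = refl
      tup-length (suc j) {w} i with find (∈-concatMap⁻ (λ v → map (v ∷_) (tup j)) {xs = allFin n} i)
        where
        open import Data.List.Membership.Propositional using (find)
        open import Data.List.Membership.Propositional.Properties using (∈-concatMap⁻)
      ... | v , _ , k with ∈-map⁻ (v ∷_) k
        where open import Data.List.Membership.Propositional.Properties using (∈-map⁻)
      ... | w′ , k′ , refl = cong suc (tup-length j k′)

    hits-count : ∀ F j → # (hits F) of tup (suc j) ≤ suc j * length F * n ^ j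
    hits-count F j = ≤-trans total (≤-trans (+-monoʳ-≤ (l * n ^ j) (tail j)) (≤-reflexive (collect l (n ^ j) j)))
      where
      l = length F
      h : ℕ → ℕ
      h j = # (hits F) of tup j
      total : # (hits F) of tup (suc j) ≤ l * n ^ j + n * h j
      total = ≤-trans (≤-reflexive (∑-tup j _)) (≤-trans (∑-mono (allFin n) (λ v → ≤-trans (∑-mono (tup j) (λ w → hits-∷ F v w)) (≤-reflexive (trans (∑-+ (tup j) _ _) (cong (_+ h j) (trans (∑-U j _) (*-comm (n ^ j) _)))))))
        (≤-trans (≤-reflexive (trans (∑-+ (allFin n) _ _) (cong₂ _+_ (∑-*ʳ (allFin n) (n ^ j) _) (∑-V (h j))))) (+-monoˡ-≤ _ (*-monoˡ-≤ (n ^ j) (#-elem F)))))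
      shuffle : ∀ n j l N → n * (suc j * l * N) ≡ suc j * l * (n * N)
      shuffle = solve-∀
      tail : ∀ j → n * h j ≤ j * l * n ^ j
      tail zero = ≤-trans (*-monoʳ-≤ n (≤-reflexive (trans (∑-tup₀ _) (cong ⟦_⟧ (hits-[] F))))) (≤-reflexive (*-zeroʳ n))
      tail (suc j) = ≤-trans (*-monoʳ-≤ n (hits-count F j)) (≤-reflexive (shuffle n j l (n ^ j)))
      collect : ∀ l N j → l * N + j * l * N ≡ suc j * l * N
      collect = solve-∀

module Arithmetic where

  open Base

  abstract
    ring-1 : ∀ m → m ≡ m * 1 * (1 * 1)
    ring-1 = solve-∀

    ring-2 : ∀ m k → m * k ≡ m * 1 * (1 * k)
    ring-2 = solve-∀

    ring-3 : ∀ m k → m * m * k ≡ m * m * (1 * k)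
    ring-3 = solve-∀

    ring-4 : ∀ x → 24000 * x ≡ 6000 * (4 * x)
    ring-4 = solve-∀

    ring-5 : ∀ s x m → s * (4 * (x * m)) ≡ s * (4 * x * m)
    ring-5 = solve-∀

    ring-6 : ∀ m β → 4 * m * m + 2 * β * m + 2 * β * m ≡ 4 * (m + β) * m
    ring-6 = solve-∀

    ring-7 : ∀ a → a ≡ a * 1 * 1
    ring-7 = solve-∀

    ring-8 : ∀ G n m j N → 2 * G + n * (4 * m * suc j * N) + 2 * m * (n * N) + 2 * m * (n * N) ≡ 2 * G + 4 * m * suc (suc j) * (n * N)
    ring-8 = solve-∀

    ring-9 : ∀ s n N X Y F j m β → s * (n * N) + (s * (2 * X + 4 * m * suc j * N) + 2 * s * (Y + suc j * F * N) + s * N * (4 * m * m + 2 * m * β) + N * n) + 0 ≡ 2 * s * Y + n * N + (s * (n * N) + 2 * s * X + s * N * (4 * m * suc j + 2 * suc j * F) + N * (s * (4 * m * m + 2 * β * m)))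
    ring-9 = solve-∀

    ring-10 : ∀ s n N M X Y H F m β → (N * (n * M)) + (2 * (s * X) + 2 * s * (Y + (N * H + N * H)) + 4 * s * N * (m * F * M) + 4 * s * N * m * M * (β + m) + N * M * n) + 0 ≡ 2 * s * Y + (2 * (N * (n * M)) + 2 * s * X + 4 * s * N * H + 4 * s * N * m * M * F + N * M * (s * (4 * (m + β) * m)))
    ring-10 = solve-∀

    ring-11 : ∀ f a b c d w → f * ((a + (b + (c + d))) * w) ≡ f * (a * w) + (f * (b * w) + (f * (c * w) + f * (d * w)))
    ring-11 = solve-∀

    ring-12 : ∀ a → a ≡ 1 * (a * 1)
    ring-12 = solve-∀

    ring-13 : ∀ s N z g u F → N * N + (s * N * (5 * z) + 5 * s * N * (g + u) + 5 * s * (5 * F) + 25 * (3 * (N * N)) + N * N * (s + (s + 0))) + 0 ≡ 5 * s * N * g + (s * N * (2 * N) + 5 * s * N * z + 5 * s * (N * u) + 25 * (s * F) + N * N * 76)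
    ring-13 = solve-∀

    ring-14 : ∀ s N d a b R → 5 * (s * N) + 10 * s * d + 2 * s * (5 * a) + 2 * s * (5 * b) + (s * R * 10 + N * 6) + 1 ≡ 5 * (2 * s * d + N) + 10 * s * (a + b + R) + 2 * s * N + 2 * s * N + s * N + N + (0 + 1)
    ring-14 = solve-∀

    ring-15 : ∀ N z i S → 1 * N + (5 * z + 5 * (i + S) + N) + 0 ≡ 5 * S + (2 * N + 5 * z + 5 * i)
    ring-15 = solve-∀

    ring-16 : ∀ a b c → a * (b * c) ≡ b * (a * c)
    ring-16 = solve-∀

    ring-17 : ∀ s N x y c E1 Exy Exc F → 2 * (s * F) + (x * (2 * s * y + N) + (2 * s * E1 + x * N) + 2 * s * (Exy + Exc) + 2 * s * (x * c) + 2 * s * x * N + 2 * (N * N) + 2 * N * N) + 0 ≡ 2 * (2 * (N * N)) + (x * (s * N) + s * (x * N) + 2 * s * E1 + 2 * s * (Exc + F) + 2 * s * x * (c + y) + 2 * (s * Exy) + 2 * N * x)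
    ring-17 = solve-∀

    ring-18 : ∀ s N E F → s * (E + F) + (N * N + 2 * (N * N)) + 0 ≡ 3 * (N * N) + (s * E + s * F)
    ring-18 = solve-∀

    ring-19 : ∀ s N i j → 8 * s * (2 * N) + (20 * (2 * s * (i + j) + N) + s * N + N * s) + (2 * s * N + 5980 * N) ≡ 8 * s * (5 * j) + (20 * (s * N) + s * (40 * i) + N * 6000)
    ring-19 = solve-∀

    ring-20 : ∀ s N i j k r → 2 * (s * r * 10 + N * 6) + (10 * (2 * s * (i + j) + N) + 10 * (2 * s * (i + k) + N) + s * N + N * s + 20 * s * N) + 5968 * N ≡ 2 * (s * N) + (10 * (s * N) + 10 * (s * N) + s * (40 * i) + N * 6000 + 20 * s * (j + k + r))
    ring-20 = solve-∀

    ring-21 : ∀ s N i j → N * (s * j) + (s * j * (40 * i) + 40 * (3 * (N * N))) + 0 ≡ N * (120 * N) + (s * j * N + 40 * (s * (i * j)))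
    ring-21 = solve-∀

    ring-22 : ∀ s N j k r → s * r * 10 + N * 6 + (10 * s * (j + k) + 10 * (120 * N) + 10 * (120 * N) + N * s) + 3594 * N ≡ s * N + (10 * s * r + 10 * (s * j) + 10 * (s * k) + N * 6000)
    ring-22 = solve-∀

    ring-23 : ∀ s N i j → 2 * s * (2 * N) + (5 * (2 * s * (i + j) + N) + 10 * (120 * N) + N * s) + 4795 * N ≡ 2 * s * (5 * i) + (5 * (s * N) + 10 * (s * j) + N * 6000)
    ring-23 = solve-∀

    ring-24 : ∀ s N i o ij ik E1 EI EJ EK EO → 2 * s * i * (2 * N) + (5 * (2 * s * E1 + i * N) + 10 * s * (EI + (EJ + (EK + EO))) + 10 * (N * N) + 10 * s * ij + 10 * (3 * (N * N)) + 10 * s * ik + 10 * (3 * (N * N)) + 10 * s * (i * o) + 70 * N * (40 * i) + i * N * s) + 3195 * i * N ≡ 2 * s * i * (5 * o) + (5 * (s * (i * N)) + 10 * s * E1 + 10 * (s * EI) + 10 * s * EJ + 10 * (s * ij) + 10 * s * EK + 10 * (s * ik) + 10 * s * EO + 70 * N * N + i * N * 6000)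
    ring-24 = solve-∀

    ring-25 : ∀ s b m → s * 4 * (b * m) ≡ s * (4 * b * m)
    ring-25 = solve-∀

    ring-26 : ∀ a b → a * (b * 1) + a * (b * 0) ≡ a * b
    ring-26 = solve-∀

    ring-27 : ∀ a b → a * (b * 0) + a * (b * 1) ≡ a * b
    ring-27 = solve-∀

    ring-28 : ∀ a b c d → a * ((b + c) * d) ≡ a * (b * d) + a * (c * d)
    ring-28 = solve-∀

    ring-29 : ∀ N a b s X u v F → 25 * (N * N) + (s * 5 * a * (5 * b) + s * N * (5 * a) + 25 * s * (X + F + (N * u + N * v)) + 25 * s * (5 * F) + 25 * s * (5 * F) + 275 * (3 * (N * N)) + N * N * s) + 0 ≡ 25 * (s * X) + (s * 5 * a * N + s * N * N + 25 * s * (a * b) + 25 * s * (N * u) + 25 * s * (N * v) + 275 * (s * F) + N * N * 850)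
    ring-29 = solve-∀

    ring-30 : ∀ m c → 2 * m + 2 * m + c ≡ 4 * m + c
    ring-30 = solve-∀

    ring-31 : ∀ m c f → c + (2 * m + f) ≡ 2 * m + c + f
    ring-31 = solve-∀

    ring-32 : ∀ m c → c + 2 * m + c ≡ 2 * c + 2 * m
    ring-32 = solve-∀

    ring-33 : ∀ c f → c + (c + f) ≡ 2 * c + f
    ring-33 = solve-∀

    ring-34 : ∀ m c k → 2 * c + 2 * m + 2 * m + k ≡ 2 * c + 4 * m + k
    ring-34 = solve-∀

    ring-35 : ∀ m c k f → k + (2 * c + 2 * m + f) + 2 * m ≡ 2 * c + 4 * m + k + f
    ring-35 = solve-∀

    ring-36 : ∀ j m L K → j * (m * suc K) * (2 * (4 * m * L + 2 * m) + 4 * m) ≡ 8 * j * (m * m * (suc L * suc K))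
    ring-36 = solve-∀

    ring-37 : ∀ x y z → x * (y * z) ≡ z * (y * x)
    ring-37 = solve-∀

    ring-38 : ∀ r g q → suc q * r + suc q * g + 0 ≡ q * (r + g) + (r + g)
    ring-38 = solve-∀

    ring-39 : ∀ l q x → q * l * x ≡ l * (q * x)
    ring-39 = solve-∀

    ring-40 : ∀ m L → 4 * m + (4 * m * L + 2 * m) ≡ 4 * m * suc L + 2 * m
    ring-40 = solve-∀

    ring-41 : ∀ a b c → suc (a + (b + c)) ≡ a + b + suc c
    ring-41 = solve-∀

    ring-42 : ∀ g g′ x′ c → 4 * (g + g′) + (4 * (4 * c + c) + 5 * x′) + 0 ≡ 5 * (4 * c + x′) + (4 * g + 4 * g′)
    ring-42 = solve-∀

    ring-43 : ∀ c k x a w → suc (c * (k + a) + (x + w)) ≡ suc (c * k + x) + (c * a + w)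
    ring-43 = solve-∀

    ring-44 : ∀ c a w s y → c + s + y + (c * a + w) ≡ c * suc a + (s + (w + y))
    ring-44 = solve-∀

    ring-45 : ∀ c → c + 4 * c ≡ 5 * c
    ring-45 = solve-∀

    ring-46 : ∀ c x y → suc (c * 1 + suc (x + y)) ≡ c + (suc x + 0) + suc y
    ring-46 = solve-∀

    ring-47 : ∀ c → suc (4 * c + c) ≡ 5 * c + 1
    ring-47 = solve-∀

    ring-48 : ∀ c x y z → suc (c * 2 + suc (x + (y + suc z))) ≡ c + (suc x + (suc z + 0)) + suc (y + c)
    ring-48 = solve-∀

    ring-49 : ∀ a n a′ w → a + n + suc (a′ + w) ≡ 1 + a + w + (a′ + n)
    ring-49 = solve-∀

    ring-50 : ∀ a f w w′ → suc f + w + (a + w′) ≡ 1 + a + w + (f + w′)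
    ring-50 = solve-∀

    ring-51 : ∀ c x → suc (c * 1 + x) ≡ c + (suc x + 0) + 0
    ring-51 = solve-∀

    ring-52 : ∀ μ k → suc (suc μ + μ + 2 * suc μ * k) ≡ 2 * suc μ * suc k
    ring-52 = solve-∀

    ring-53 : ∀ n m β p R D ρ b g → 150 * p * n + 300 * (p * D) + 300 * R * b + 12 * n * (25 * R) + 75 * p * (4 * ρ) + 125 * p * (3 * g) + 600 * p * m * p + 300 * p * β * 1 + 600 * p * m * 1 + p * (1200 * ((m + β) * m)) + 1 ≡ 150 * p * (2 * D + 4 * m) + 300 * (p * (β + 2 * m * p) + (b * R + p * ρ)) + 300 * R * n + 12 * n * p + 75 * p * (5 * g) + 125 * p * n + 600 * p * m * β + 300 * p * β * m + 600 * p * m * m + p * n + p * n + (11 * (p * n) + 600 * p * m * m + 300 * p * β * m + 1)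
    ring-53 = solve-∀

    ring-54 : ∀ s x m → 4 * s * (x * m) ≡ s * (4 * x * m)
    ring-54 = solve-∀

    ring-55 : ∀ m u → 2 * m + (2 * m + (2 * m + 2 * m)) + (16 * u + (16 * u + (3 * m + 3 * m))) ≡ 14 * m + 32 * u
    ring-55 = solve-∀

    ring-56 : ∀ a b c d x → a + (b + (c + (d + x))) ≡ a + (b + (c + d)) + x
    ring-56 = solve-∀

    ring-57 : ∀ u → 16 * u + (16 * u + (3 * u + 3 * u)) ≡ 38 * u
    ring-57 = solve-∀

    ring-58 : ∀ u j → u + u + j * u ≡ (2 + j) * u
    ring-58 = solve-∀

    ring-59 : ∀ K → suc (suc (2 * K)) ≡ 2 * suc K
    ring-59 = solve-∀

    ring-60 : ∀ n D f β m → 2 * n + 4 * D + 4 * f + 8 * m + 24000 * β + 1 ≡ 2 * (2 * D + 4 * m) + 4 * f + 4 * (100 * β) + 8 * β + n + n + (23592 * β + 1)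
    ring-60 = solve-∀

    ring-61 : ∀ s M a b c → s * M + s * M + s * M + 2 * s * (a + b + c) + 1 + M * 6000 ≡ 2 * s * a + M + (2 * s * b + M) + (2 * s * c + M) + 2 * s * M + M + M * s + (5996 * M + 1)
    ring-61 = solve-∀

    ring-62 : ∀ u → u + (u + (u + 30 * u)) ≡ 33 * u
    ring-62 = solve-∀

    ring-63 : ∀ u → u + (100 * u + 2000 * u) ≡ 2101 * u
    ring-63 = solve-∀

    ring-64 : ∀ u → 2 * u + (2 * u + 2000 * u) ≡ 2004 * u
    ring-64 = solve-∀

    ring-65 : ∀ u → u + (2 * u + (2 * u + 2000 * u)) ≡ 2005 * u
    ring-65 = solve-∀

    ring-66 : ∀ u → 2 * u + 2 * u ≡ 4 * u
    ring-66 = solve-∀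

    ring-67 : ∀ j r s → j + r + s ≡ r + s + j
    ring-67 = solve-∀

    ring-68 : ∀ μ → suc (suc (μ + μ)) ≡ 2 * suc μ
    ring-68 = solve-∀

    ring-69 : ∀ μ D j x y → j + (x + y) + 4 + (D + (suc μ + μ)) + (D + (suc μ + μ)) + j ≡ 2 * D + 4 * suc μ + (x + j) + (y + j) + 1 + (0 + 1)
    ring-69 = solve-∀

    ring-70 : ∀ m → m + (m + m) ≡ 3 * m
    ring-70 = solve-∀

    ring-71 : ∀ m → m + m + m ≡ 3 * m
    ring-71 = solve-∀

    ring-72 : ∀ u → 2 * u + 2100 * u + 66 * u ≡ 2168 * u
    ring-72 = solve-∀

    ring-73 : ∀ u → 2 * u + 2400 * u + 2000 * u ≡ 4402 * u
    ring-73 = solve-∀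

    ring-74 : ∀ x a y Y → x + a + (y + Y) ≡ x + y + (a + Y)
    ring-74 = solve-∀

    ring-75 : ∀ x y g j X b → x + y + (g * j + (X + b)) ≡ g * j + (x + X + (y + b))
    ring-75 = solve-∀

    ring-76 : ∀ x y g k X b → g + (x + y) + (g * k + (X + b)) ≡ g * suc k + (x + X + (y + b))
    ring-76 = solve-∀

    ring-77 : ∀ m f g k → m * f + (m * g + m * k) ≡ m * (f + (g + k))
    ring-77 = solve-∀

    ring-78 : ∀ k → 2 + 2 * k ≡ 2 * suc k
    ring-78 = solve-∀

    ring-79 : ∀ x₁ a x Y → x₁ + a + x + Y ≡ x₁ + x + (a + Y)
    ring-79 = solve-∀

    ring-80 : ∀ g j x₁ x X c → x₁ + x + (g * j + (X + c)) ≡ g * j + (x₁ + x + X) + c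
    ring-80 = solve-∀

    ring-81 : ∀ y₁ y Y c → y₁ + y + Y + c ≡ y₁ + c + y + Y
    ring-81 = solve-∀

    ring-82 : ∀ x₁ a x r₁ d r y₁ c y → x₁ + a + x + (r₁ + d + r) + (y₁ + c + y) ≡ x₁ + y₁ + r₁ + (a + c + d + (x + y + r))
    ring-82 = solve-∀

    ring-83 : ∀ x y r x′ y′ r′ → x + x′ + (y + y′) + (r + r′) ≡ x + y + r + (x′ + y′ + r′)
    ring-83 = solve-∀

    ring-84 : ∀ j x₁ x X → 1 * j + (x₁ + x + X) ≡ x + j + (x₁ + X)
    ring-84 = solve-∀

    ring-85 : ∀ y k x₁ X → y + k + (x₁ + X) ≡ y + (x₁ + X + k)
    ring-85 = solve-∀

    ring-86 : ∀ y y₁ Y → y + (y₁ + Y) ≡ y₁ + y + Y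
    ring-86 = solve-∀

    ring-87 : ∀ K → 10 * suc K + (2 * (4 * suc K) + 2 * K) ≡ 18 * suc K + 2 * K
    ring-87 = solve-∀

    ring-88 : ∀ K → suc (18 * suc K + 2 * K) + 1 ≡ 20 * suc K
    ring-88 = solve-∀

    ring-89 : ∀ m k → 2 * m * (4 * k) ≡ 8 * (m * k)
    ring-89 = solve-∀

    ring-90 : ∀ x k z → x + z + k ≡ k + x + z
    ring-90 = solve-∀

    ring-91 : ∀ m k f → m * k + f + 2 * m + m * k ≡ f + 2 * m * suc k
    ring-91 = solve-∀

    ring-92 : ∀ m k → 2 * m * (10 * k) ≡ 20 * (m * k)
    ring-92 = solve-∀

    ring-93 : ∀ m k → m * (10 * k) ≡ 10 * (m * k)
    ring-93 = solve-∀

    ring-94 : ∀ K → 2 * (4 * K) + 2 * K ≡ 10 * K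
    ring-94 = solve-∀

    ring-95 : ∀ M → 50 * M + (2 * (60 * M) + 2 * M) ≡ 172 * M
    ring-95 = solve-∀

    ring-96 : ∀ u → 3 * u + (3 * u + 900 * u) ≡ 906 * u
    ring-96 = solve-∀

    ring-97 : ∀ m k → 2 * m * k ≡ m * (2 * k)
    ring-97 = solve-∀

    ring-98 : ∀ m k → 2 * m * (60 * (m * k)) ≡ 120 * (m * m * k)
    ring-98 = solve-∀

    ring-99 : ∀ p′ q′ q j x₁ x → p′ + p′ + q′ + q + (4 * j + (x₁ + x + 0)) ≡ p′ + (j + j) + x₁ + (q′ + x) + (p′ + (j + j) + q)
    ring-99 = solve-∀

    ring-100 : ∀ p′ q′ q y₁ y M → q + y₁ + (p′ + y + 2 * (60 * M)) + (p′ + q′) ≡ p′ + p′ + q′ + q + (y₁ + y + 2 * (60 * M))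
    ring-100 = solve-∀

    ring-101 : ∀ M p q p′ q′ x₁ y₁ r₁ x y → 2 * p′ + (p + q + (p + x₁) + (q′ + x) + 50 * M + 2 * M) + (2 * y₁ + y + 68 * M + r₁) ≡ 2 * p + ((p′ + q′) + (q + y₁) + (p′ + y + 2 * (60 * M)) + (x₁ + y₁ + r₁) + x)
    ring-101 = solve-∀

    ring-102 : ∀ M j x₁ y₁ r₁ x y → 4 * j + (y₁ + y + 2 * (60 * M) + 50 * M + 2 * M) + (2 * x₁ + x + r₁ + 68 * M) ≡ 4 * (60 * M) + (4 * j + (x₁ + x + 0) + (x₁ + y₁ + r₁) + y)
    ring-102 = solve-∀

    ring-103 : ∀ pr p₂ px y k a → pr + (p₂ + px) + y + k + (1 + a) ≡ pr + 1 + (p₂ + (a + k) + (px + y))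
    ring-103 = solve-∀

    ring-104 : ∀ qr q₂ qx x a → qr + 1 + (q₂ + a + (qx + x)) ≡ qr + (q₂ + qx) + x + (1 + a)
    ring-104 = solve-∀

    ring-105 : ∀ p p′ → p + p′ + 1 + 1 ≡ p + 1 + (p′ + 1)
    ring-105 = solve-∀

    ring-106 : ∀ q q′ a b c d → q + (a + b) + (q′ + (c + d)) ≡ q + q′ + (a + d) + (b + c)
    ring-106 = solve-∀

    ring-107 : ∀ p₁ p₂ p₃ x y r → p₁ + (p₂ + p₃) + y ≡ p₁ + x * 0 + (p₂ + y * 1 + (p₃ + r * 0))
    ring-107 = solve-∀

    ring-108 : ∀ q₁ q₂ q₃ x y r → q₁ + x * 1 + (q₂ + y * 0 + (q₃ + r * 0)) ≡ q₁ + (q₂ + q₃) + x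
    ring-108 = solve-∀

    ring-109 : ∀ m k → 2 * m * (200 * (m * k)) ≡ 400 * (m * m * k)
    ring-109 = solve-∀

    ring-110 : ∀ m p q p′ q′ → m * (p + q) + m * (p′ + q′) ≡ m * (p + p′ + (q + q′))
    ring-110 = solve-∀

    ring-111 : ∀ u → 3 * u + 1000 * u + 66 * u ≡ 1069 * u
    ring-111 = solve-∀

    ring-112 : ∀ p a x pG b → p + (a + x) + (pG + b) ≡ pG + x + p + (a + b)
    ring-112 = solve-∀

    ring-113 : ∀ q b y qG a → qG + y + q + (a + b) ≡ q + (b + y) + (qG + a)
    ring-113 = solve-∀

    ring-114 : ∀ z → 2 * (z + 3) ≡ 2 * z + 6
    ring-114 = solve-∀

    ring-115 : ∀ p q pG qG x y → p + q + (pG + qG + (x + y)) ≡ pG + x + p + (qG + y + q)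
    ring-115 = solve-∀

    ring-116 : ∀ a b → a + (b + 1) ≡ suc (a + b)
    ring-116 = solve-∀

    ring-117 : ∀ m → m + (m + m) ≡ m * 3
    ring-117 = solve-∀

    ring-118 : ∀ D μ j x y → 2 * D + 4 * suc μ + (x + j + (y + j)) + 0 ≡ j + (x + y) + 4 + j + (D + (μ + μ) + (D + (μ + μ)))
    ring-118 = solve-∀

    ring-119 : ∀ H n D μ → 2 * H + (n + (2 * D + 4 * suc μ)) + 0 ≡ 2 * (D + (μ + μ)) + (H + H + (n + 4))
    ring-119 = solve-∀

    ring-120 : ∀ m k → m * (33 * (m * k)) ≡ 33 * (m * m * k)
    ring-120 = solve-∀

    ring-121 : ∀ a x b y r → a + x + (b + y) + (r + 0) ≡ a + b + r + (x + y)
    ring-121 = solve-∀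

    ring-122 : ∀ m a b → m * (a + b) ≡ m * b + m * a
    ring-122 = solve-∀

    ring-123 : ∀ z h w → 2 * z + (h + h + w + 6) + 0 ≡ 2 * h + (2 * z + 6 + w)
    ring-123 = solve-∀

    ring-124 : ∀ p q w x y → p + q + (w + (x + y)) ≡ x + p + (y + q) + w
    ring-124 = solve-∀

    ring-125 : ∀ m h → m * (h + h) ≡ h * m + h * m
    ring-125 = solve-∀

    ring-126 : ∀ m k → m * (2 * (33 * (m * k)) + 6) ≡ 66 * (m * m * k) + 6 * m
    ring-126 = solve-∀

    ring-127 : ∀ u → u + (u + u) + 100 * u ≡ 103 * u
    ring-127 = solve-∀

    ring-128 : ∀ n D m → n + 6 + (2 * D + 4 * m) ≡ 2 * D + 4 * m + (n + 4 + 1) + (0 + 1)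
    ring-128 = solve-∀

    ring-129 : ∀ u → 3 * u + (3 * u + 33 * u) ≡ 39 * u
    ring-129 = solve-∀

    ring-130 : ∀ h → h + h + 6 ≡ suc (suc (suc h)) + suc (suc (suc h))
    ring-130 = solve-∀

    ring-131 : ∀ h → h + h + 3 ≡ suc (suc h + suc h)
    ring-131 = solve-∀

    ring-132 : ∀ n D m → n + 6 + (2 * D + 4 * m) ≡ 2 * D + 4 * m + (n + 4 + 0) + (1 + 1)
    ring-132 = solve-∀

    ring-133 : ∀ n D m → n + 5 + (2 * D + 4 * m) ≡ 2 * D + 4 * m + (n + 4 + 0) + (0 + 1)
    ring-133 = solve-∀

    ring-134 : ∀ m → m ≡ 1 * (m * 1 * (1 * 1))
    ring-134 = solve-∀

    ring-135 : ∀ r → suc (25 * (5 * r + 2) + 4 * r) + 51 * r + 0 ≡ 180 * r + 51 * 1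
    ring-135 = solve-∀

    ring-136 : ∀ x m b → suc (suc x * (4 * m * suc b)) + b ≡ suc (suc x * (4 * m)) * suc b
    ring-136 = solve-∀

    ring-137 : ∀ m y b r → 5000 * (m * m * (y * b * (180 * r))) ≡ 5000 * (m * m * (y * 180)) * (b * r)
    ring-137 = solve-∀

    ring-138 : ∀ m b → suc b * m + suc b * m + (suc b * m + suc b * m) ≡ 4 * m * suc b
    ring-138 = solve-∀

    ring-139 : ∀ C → C + (C + 2) ≡ C + C + 2 + 0
    ring-139 = solve-∀

    ring-140 : ∀ C → suc (C + C + 2 + 0) + (2 * C + 1) ≡ 4 * suc C
    ring-140 = solve-∀

    ring-141 : ∀ C x → C * (suc (suc (x + x))) ≡ 2 * (C * suc x)
    ring-141 = solve-∀

    ring-142 : ∀ x X k → x * (x * X) + suc k * (x * X) + k * X ≡ suc x * (x * X + k * X)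
    ring-142 = solve-∀

    ring-143 : ∀ x Y → suc x * (x * Y) ≡ x * (suc x * Y)
    ring-143 = solve-∀

    ring-144 : ∀ x X → x * (2 * X) + X ≡ x * X + suc x * X
    ring-144 = solve-∀

    ring-145 : ∀ a b A B → a * b * (A * B) ≡ a * A * (b * B)
    ring-145 = solve-∀

    ring-146 : ∀ r → 4 * (r * r) ≡ r * (4 * r)
    ring-146 = solve-∀

    ring-147 : ∀ s m c b r → s * (4 * (2 * (c * (b * r))) * m) ≡ s * (4 * (2 * c) * m) * b * r
    ring-147 = solve-∀

    ring-148 : ∀ a → 1 + a * 2 + 5 ≡ 2 * a + (2 * 2 + 2)
    ring-148 = solve-∀

    ring-149 : ∀ m h → m * (h + h) ≡ h * m * 2
    ring-149 = solve-∀

    ring-150 : ∀ a c → 2 * a + (2 * c + 2) ≡ 2 * suc (a + c)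
    ring-150 = solve-∀

    ring-151 : ∀ m D → 2 * (m * 2 + D) ≡ 2 * D + 4 * m
    ring-151 = solve-∀

module Xor where

  open Base
  open import Data.Bool.Properties public using (xor-comm; xor-assoc; not-involutive) renaming (xor-same to xor-self)
  open import Data.Bool.Solver using (module xor-∧-Solver)
  open xor-∧-Solver using (con; _:+_; _:*_; _:=_) renaming (solve to solveᵇ)

  bool-≟ : ∀ (a b : Bool) → a ≡ b ⊎ a ≡ not b
  bool-≟ true true = inj₁ refl
  bool-≟ true false = inj₂ refl
  bool-≟ false true = inj₂ refl
  bool-≟ false false = inj₁ refl

  abstract
    xor-cancel : ∀ a b c → a xor b ≡ a xor c → b ≡ c
    xor-cancel true true true _ = refl
    xor-cancel true false false _ = refl
    xor-cancel false b c h = h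

    xor-swap : ∀ a b c → a xor (b xor c) ≡ b xor (a xor c)
    xor-swap = solveᵇ 3 (λ a b c → a :+ (b :+ c) := b :+ (a :+ c)) refl

    not-xor : ∀ a b → not a xor b ≡ not (a xor b)
    not-xor = solveᵇ 2 (λ a b → (con true :+ a) :+ b := con true :+ (a :+ b)) refl

    xor-undoˡ : ∀ a b → a xor (a xor b) ≡ b
    xor-undoˡ = solveᵇ 2 (λ a b → a :+ (a :+ b) := b) refl

    xor-undoʳ : ∀ a b → (a xor b) xor b ≡ a
    xor-undoʳ = solveᵇ 2 (λ a b → (a :+ b) :+ b := a) refl

    xor-common : ∀ c a b → (c xor a) xor (c xor b) ≡ a xor b
    xor-common = solveᵇ 3 (λ c a b → (c :+ a) :+ (c :+ b) := a :+ b) refl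

    xor-commonʳ : ∀ a b → (true xor (a xor b)) xor a ≡ true xor b
    xor-commonʳ = solveᵇ 2 (λ a b → (con true :+ (a :+ b)) :+ a := con true :+ b) refl

    xor-transpose : ∀ a b {c} → a xor b ≡ c → a ≡ c xor b
    xor-transpose a b refl = sym (xor-undoʳ a b)

    xor-not : ∀ c → c xor not c ≡ true
    xor-not = solveᵇ 1 (λ c → c :+ (con true :+ c) := con true) refl

    not-xor-true : ∀ c → not (c xor true) ≡ c
    not-xor-true = solveᵇ 1 (λ c → con true :+ (c :+ con true) := c) refl

    not-xor-false : ∀ c → not (c xor false) ≡ not c xor false
    not-xor-false = solveᵇ 1 (λ c → con true :+ (c :+ con false) := (con true :+ c) :+ con false) refl

    not-xor-flip : ∀ c → not (c xor true) ≡ not (not (c xor false))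
    not-xor-flip = solveᵇ 1 (λ c → con true :+ (c :+ con true) := con true :+ (con true :+ (c :+ con false))) refl

    not-not-xor : ∀ c → not (not c xor false) ≡ c
    not-not-xor = solveᵇ 1 (λ c → con true :+ ((con true :+ c) :+ con false) := c) refl

    xor-agree : ∀ a b a′ b′ → (b ≡ b′ → a ≡ a′) → (a ≡ a′ → b ≡ b′) → a xor b ≡ a′ xor b′
    xor-agree a b a′ b′ p q = [ (λ h → cong₂ _xor_ h (q h)) , (λ h → [ (λ k → cong₂ _xor_ (p k) k) , both h ]′ (bool-≟ b b′)) ]′ (bool-≟ a a′)
      where
      both : ∀ {a b a′ b′} → a ≡ not a′ → b ≡ not b′ → a xor b ≡ a′ xor b′
      both {a′ = a′} {b′} refl refl = xor-common true a′ b′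

    xor-exchange : ∀ a b x y z → a xor b ≡ x xor y → a xor (x xor z) ≡ b xor (y xor z)
    xor-exchange a b x y z h = trans (solveᵇ 4 (λ a b x z → a :+ (x :+ z) := ((a :+ b) :+ (x :+ z)) :+ b) refl a b x z)
      (trans (cong (λ w → (w xor (x xor z)) xor b) h) (solveᵇ 4 (λ b x y z → ((x :+ y) :+ (x :+ z)) :+ b := b :+ (y :+ z)) refl b x y z))

    xor-differ : ∀ t a b → t xor a ≡ true → t xor b ≡ false → a xor b ≡ true
    xor-differ t a b p q = trans (sym (xor-common t a b)) (cong₂ _xor_ p q)

    xor-between : ∀ a b c → a xor c ≡ true → a xor (b xor c) ≡ not b
    xor-between a b c h = trans (xor-swap a b c) (trans (cong (b xor_) h) (xor-comm b true))

    xor-around : ∀ b w a → w xor a ≡ false → a xor ((b xor (not b xor w)) xor a) ≡ not a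
    xor-around b w a h = trans (solveᵇ 3 (λ b w a → a :+ ((b :+ ((con true :+ b) :+ w)) :+ a) := con true :+ ((w :+ a) :+ a)) refl b w a) (cong (λ z → not (z xor a)) h)

    not-xor₂ : ∀ a b c d → a ≡ not b → not ((a xor c) xor d) ≡ (b xor c) xor d
    not-xor₂ _ b c d refl = solveᵇ 3 (λ b c d → con true :+ (((con true :+ b) :+ c) :+ d) := (b :+ c) :+ d) refl b c d

    select-+ : ∀ a b a′ b′ c → ((a xor a′) ∧ not c) xor ((b xor b′) ∧ c) ≡ ((a ∧ not c) xor (b ∧ c)) xor ((a′ ∧ not c) xor (b′ ∧ c))
    select-+ = solveᵇ 5 (λ a b a′ b′ c → ((a :+ a′) :* (con true :+ c)) :+ ((b :+ b′) :* c) := ((a :* (con true :+ c)) :+ (b :* c)) :+ ((a′ :* (con true :+ c)) :+ (b′ :* c))) refl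

    select-same : ∀ a c → (a ∧ not c) xor (a ∧ c) ≡ a
    select-same = solveᵇ 2 (λ a c → (a :* (con true :+ c)) :+ (a :* c) := a) refl

    select-injective : ∀ a b a′ b′ c → a xor b ≡ a′ xor b′ → (a ∧ not c) xor (b ∧ c) ≡ (a′ ∧ not c) xor (b′ ∧ c) → a ≡ a′
    select-injective a b a′ b′ false e h = trans (sym (s a b)) (trans h (s a′ b′))
      where
      s : ∀ a b → (a ∧ true) xor (b ∧ false) ≡ a
      s = solveᵇ 2 (λ a b → (a :* con true) :+ (b :* con false) := a) refl
    select-injective a b a′ b′ true e h = xor-cancel b a a′ (trans (xor-comm b a) (trans e (trans (cong (a′ xor_) (sym b≡)) (xor-comm a′ b))))
      where
      s : ∀ a b → (a ∧ false) xor (b ∧ true) ≡ b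
      s = solveᵇ 2 (λ a b → (a :* con false) :+ (b :* con true) := b) refl
      b≡ : b ≡ b′
      b≡ = trans (sym (s a b)) (trans h (s a′ b′))

    xor-alternate : ∀ a b → a xor b ≡ true → ⟦ a ⟧ + ⟦ b ⟧ ≡ 1
    xor-alternate true false _ = refl
    xor-alternate false true _ = refl

module Constants where

  open Base
  open Arithmetic
  open import Data.Nat.Properties using (^-distribˡ-+-*; ^-*-assoc; ^-monoˡ-≤; ^-monoʳ-≤; m^n>0)

  record Scale (s m n : ℕ) : Set where
    field
      β L κ K p₀ : ℕ
      n-large  : s * (4 * (m + β) * m) ≤ n
      κ-pos    : 1 ≤ κ
      p₀-large : 25 * (5 * κ + 2) ≤ p₀
      K-large  : κ * p₀ + n ≤ κ * K
      β-large  : 5000 * (m * m * (suc L * suc K)) ≤ β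
      L-large  : n ^ m * n ^ m * pred (2 * s) ^ L < (2 * s) ^ L

  abstract
    b<2^b : ∀ b → suc b ≤ 2 ^ b
    b<2^b zero = ≤-refl
    b<2^b (suc b) = ≤-trans (s≤s (b<2^b b)) (≤-trans (+-monoˡ-≤ (2 ^ b) (m^n>0 2 b)) (≤-reflexive (cong (2 ^ b +_) (sym (+-identityʳ (2 ^ b))))))

    linear≤exponential : ∀ C i → C * suc (C + C + 2 + i) ≤ 2 ^ (C + C + 2 + i)
    linear≤exponential C zero = ≤-trans (*-mono-≤ (≤-trans (n≤1+n C) (b<2^b C)) base) (≤-reflexive (trans (sym (^-distribˡ-+-* 2 C (C + 2))) (cong (2 ^_) (ring-139 C))))
      where
      base : suc (C + C + 2 + 0) ≤ 2 ^ (C + 2)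
      base = ≤-trans (m≤m+n _ (2 * C + 1)) (≤-trans (≤-reflexive (ring-140 C)) (≤-trans (*-monoʳ-≤ 4 (b<2^b C)) (≤-reflexive (trans (*-comm 4 (2 ^ C)) (sym (^-distribˡ-+-* 2 C 2))))))
    linear≤exponential C (suc i) = subst (λ z → C * suc z ≤ 2 ^ z) (sym (+-suc (C + C + 2) i)) (≤-trans (*-monoʳ-≤ C (s≤s (s≤s (m≤n+m (C + C + 2 + i) (C + C + 2 + i)))))
        (≤-trans (≤-reflexive (ring-141 C (C + C + 2 + i))) (*-monoʳ-≤ 2 (linear≤exponential C i))))

    power-step : ∀ x k → x ^ suc k + k * x ^ k ≤ x * suc x ^ k
    power-step x zero = ≤-reflexive (+-identityʳ _)
    power-step x (suc k) = ≤-trans (m≤m+n _ (k * x ^ k)) (≤-trans (≤-reflexive (ring-142 x (x ^ k) k)) (≤-trans (*-monoʳ-≤ (suc x) (power-step x k)) (≤-reflexive (ring-143 x (suc x ^ k)))))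

    -- (1 + 1/x)^(1 + x) ≥ 2.
    doubling : ∀ x → 1 ≤ x → 2 * x ^ suc x ≤ suc x ^ suc x
    doubling x h = cancel x h (≤-trans (≤-trans (m≤m+n _ (x ^ suc x)) (≤-reflexive (ring-144 x (x ^ suc x)))) (power-step x (suc x)))

    *-^ : ∀ a b k → (a * b) ^ k ≡ a ^ k * b ^ k
    *-^ a b zero = refl
    *-^ a b (suc k) = trans (cong (a * b *_) (*-^ a b k)) (ring-145 a b (a ^ k) (b ^ k))

    doubling-power : ∀ x j → 1 ≤ x → 2 ^ j * x ^ (suc x * j) ≤ suc x ^ (suc x * j)
    doubling-power x j h = ≤-trans (≤-reflexive (trans (cong (2 ^ j *_) (sym (^-*-assoc x (suc x) j))) (sym (*-^ 2 (x ^ suc x) j)))) (≤-trans (^-monoˡ-≤ j (doubling x h)) (≤-reflexive (^-*-assoc (suc x) (suc x) j)))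

    bracket : ∀ k n → 1 ≤ n → n < 4 ^ k → ∃ λ b → 4 ^ b ≤ n × n < 4 ^ suc b
    bracket zero n h k = ⊥-elim (1+n≰n (≤-trans k h))
    bracket (suc k) n h l with n <? 4 ^ k
    ... | yes p = bracket k n h p
    ... | no p = k , ≮⇒≥ p , l

    4^≡ : ∀ b → 4 ^ b ≡ 2 ^ b * 2 ^ b
    4^≡ b = *-^ 2 2 b

    n<4^n : ∀ n → n < 4 ^ n
    n<4^n n = ≤-trans (b<2^b n) (^-monoˡ-≤ n {2} {4} (s≤s (s≤s z≤n)))

    scale′ : ∀ s m x b n → 2 * s ≡ suc x → 1 ≤ x → 1 ≤ m → 4 ^ b ≤ n → n < 4 ^ suc b →
      s * (4 * (2 * (5000 * (m * m * (suc (suc x * (4 * m)) * 180)))) * m) * suc b ≤ 2 ^ b → Scale s m n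
    scale′ s m x b n 2s≡ hx hm lo hi small = record
      { β = β ; L = L ; κ = ρ ; K = K ; p₀ = p₀
      ; n-large = ≤-trans (*-monoʳ-≤ s (*-monoˡ-≤ m (*-monoʳ-≤ 4 (≤-trans (+-monoˡ-≤ β m≤β) (≤-reflexive (cong (β +_) (sym (+-identityʳ β))))))))
          (≤-trans (*-monoʳ-≤ s (*-monoˡ-≤ m (*-monoʳ-≤ 4 (*-monoʳ-≤ 2 β≤)))) (≤-trans (≤-reflexive (ring-147 s m (5000 * (m * m * (suc (suc x * (4 * m)) * 180))) (suc b) ρ)) (≤-trans (*-monoˡ-≤ ρ small) (≤-trans (≤-reflexive (sym (4^≡ b))) lo))))
      ; κ-pos = m^n>0 2 b
      ; p₀-large = ≤-refl
      ; K-large = ≤-trans (+-monoʳ-≤ (ρ * p₀) (≤-trans (n≤1+n n) (≤-trans hi (≤-reflexive (trans (cong (4 *_) (4^≡ b)) (ring-146 ρ)))))) (≤-reflexive (sym (*-distribˡ-+ ρ p₀ (4 * ρ))))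
      ; β-large = ≤-refl
      ; L-large = subst (λ z → n ^ m * n ^ m * pred z ^ L < z ^ L) (sym 2s≡) (≤-trans (*-monoˡ-< (x ^ L) {{ >-nonZero (m^n>0 x {{ >-nonZero hx }} L) }} squares) (doubling-power x (4 * m * suc b) hx)) }
      where
      open import Data.Nat.Properties using (*-monoˡ-<; *-mono-<)
      ρ p₀ K L β : ℕ
      ρ = 2 ^ b
      p₀ = 25 * (5 * ρ + 2)
      K = p₀ + 4 * ρ
      L = suc x * (4 * m * suc b)
      β = 5000 * (m * m * (suc L * suc K))
      ρ1 : 1 ≤ ρ
      ρ1 = m^n>0 2 b
      m≤β : m ≤ β
      m≤β = ≤-trans (≤-reflexive (ring-134 m)) (*-mono-≤ {1} {5000} (s≤s z≤n) (*-mono-≤ {m * 1} {m * m} (*-monoʳ-≤ m hm) (*-mono-≤ {1} {suc L} {1} {suc K} (s≤s z≤n) (s≤s z≤n))))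
      K≤ : suc K ≤ 180 * ρ
      K≤ = lin 0 (51 ⊗ ρ1) (ring-135 ρ)
      L≤ : suc L ≤ suc (suc x * (4 * m)) * suc b
      L≤ = ≤-trans (m≤m+n (suc L) b) (≤-reflexive (ring-136 x m b))
      β≤ : β ≤ 5000 * (m * m * (suc (suc x * (4 * m)) * 180)) * (suc b * ρ)
      β≤ = ≤-trans (*-monoʳ-≤ 5000 (*-monoʳ-≤ (m * m) (*-mono-≤ L≤ K≤))) (≤-reflexive (ring-137 m (suc (suc x * (4 * m))) (suc b) ρ))
      squares : n ^ m * n ^ m < 2 ^ (4 * m * suc b)
      squares = ≤-trans (*-mono-< pm pm) (≤-reflexive (trans (sym (^-distribˡ-+-* 4 (suc b * m) (suc b * m))) (trans (4^≡ (suc b * m + suc b * m)) (trans (sym (^-distribˡ-+-* 2 (suc b * m + suc b * m) _)) (cong (2 ^_) (ring-138 m b))))))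
        where
        open import Data.Nat.Properties using (^-monoˡ-<)
        pm : n ^ m < 4 ^ (suc b * m)
        pm = ≤-trans (^-monoˡ-< m {{ >-nonZero hm }} hi) (≤-reflexive (^-*-assoc 4 (suc b) m))

    exponent : ∀ C n → 4 ^ (C + C + 2) ≤ n → ∃ λ b → 4 ^ b ≤ n × n < 4 ^ suc b × C * suc b ≤ 2 ^ b
    exponent C n h = go (bracket n n (≤-trans (m^n>0 4 b₀) h) (n<4^n n))
      where
      b₀ : ℕ
      b₀ = C + C + 2
      go : (∃ λ b → 4 ^ b ≤ n × n < 4 ^ suc b) → ∃ λ b → 4 ^ b ≤ n × n < 4 ^ suc b × C * suc b ≤ 2 ^ b
      go (b , lo , hi) = b , lo , hi , subst (λ z → C * suc z ≤ 2 ^ z) (m+[n∸m]≡n {b₀} {b} (≮⇒≥ (λ p → 1+n≰n (≤-trans hi (≤-trans (^-monoʳ-≤ 4 p) h))))) (linear≤exponential C (b ∸ b₀))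

    scale : ∀ s m → 6000 ≤ s → 1 ≤ m → ∃ λ n₀ → ∀ n → n₀ ≤ n → Scale s m n
    scale s m hs hm = 4 ^ (C + C + 2) , λ n h → let b , lo , hi , small = exponent C n h in scale′ s m x b n (proj₁ hx) (proj₂ hx) hm lo hi small
      where
      x C : ℕ
      x = pred (2 * s)
      C = s * (4 * (2 * (5000 * (m * m * (suc (suc x * (4 * m)) * 180)))) * m)
      hx : 2 * s ≡ suc x × 1 ≤ x
      hx = pos s (≤-trans (≤ᵇ⇒≤ 2 6000 tt) hs)
        where
        pos : ∀ s → 2 ≤ s → 2 * s ≡ suc (pred (2 * s)) × 1 ≤ pred (2 * s)
        pos (suc zero) (s≤s ())
        pos (suc (suc s)) _ = refl , s≤s z≤n

module Hyper where

  open Base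
  open Arithmetic

  -- k = 2m with m = suc μ, and e S says that the vertices listed in S form an edge.
  -- The numbers s and β are the precision and the budget of the counting arguments:
  -- β vertices may be avoided everywhere at the cost of a relative error 1/s.
  -- κ, p₀ and K govern the cover of almost all vertices by at most 2K paths.
  -- L steps, each meeting a fraction 1/2s of the requests left, meet all of n^2m requests.
  record HG : Set where
    field
      n μ D s β L κ K p₀ τ : ℕ
      e         : List (Fin n) → Bool
      e-↭       : ∀ {xs ys} → xs ↭ ys → e xs ≡ true → e ys ≡ true
      e-unique  : ∀ {xs} → e xs ≡ true → Unique xs
      e-length  : ∀ {xs} → e xs ≡ true → length xs ≡ suc μ + suc μ
      codegree  : ∀ {S} → Unique S → suc (length S) ≡ suc μ + suc μ → D ≤ # (λ y → e (y ∷ S)) of allFin n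
      D-large   : n + 4 ≤ 2 * D + 4 * suc μ
      μ-large   : 2 ≤ μ
      s-large   : 6000 ≤ s
      n-large   : s * (4 * (suc μ + β) * suc μ) ≤ n
      n-parts   : n ≡ suc μ * τ
      κ-pos     : 1 ≤ κ
      p₀-large  : 25 * (5 * κ + 2) ≤ p₀
      K-large   : κ * p₀ + n ≤ κ * K
      β-large   : 5000 * (suc μ * suc μ * (suc L * suc K)) ≤ β
      L-large   : n ^ suc μ * n ^ suc μ * pred (2 * s) ^ L < (2 * s) ^ L

    open Vertices n public

    m : ℕ
    m = suc μ

    unit : ℕ
    unit = m * m * (suc L * suc K)

    abstract
      unit-pos : ∀ {a b c d} → a ≤ m → b ≤ m → c ≤ suc L → d ≤ suc K → a * b * (c * d) ≤ unit
      unit-pos h₁ h₂ h₃ h₄ = *-mono-≤ (*-mono-≤ h₁ h₂) (*-mono-≤ h₃ h₄)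

      1≤unit : 1 ≤ unit
      1≤unit = unit-pos {1} {1} {1} {1} (s≤s z≤n) (s≤s z≤n) (s≤s z≤n) (s≤s z≤n)

      m≤unit : m ≤ unit
      m≤unit = ≤-trans (≤-reflexive (ring-1 m)) (unit-pos {m} {1} {1} {1} ≤-refl (s≤s z≤n) (s≤s z≤n) (s≤s z≤n))

      mK≤unit : m * suc K ≤ unit
      mK≤unit = ≤-trans (≤-reflexive (ring-2 m (suc K))) (unit-pos {m} {1} {1} {suc K} ≤-refl (s≤s z≤n) (s≤s z≤n) ≤-refl)

      mmK≤unit : m * m * suc K ≤ unit
      mmK≤unit = ≤-trans (≤-reflexive (ring-3 m (suc K))) (unit-pos {m} {m} {1} {suc K} ≤-refl ≤-refl (s≤s z≤n) ≤-refl)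

      K≤unit : suc K ≤ unit
      K≤unit = ≤-trans (m≤m+n (suc K) (μ * suc K)) mK≤unit

      units≤β : ∀ j → j ≤ 5000 → j * unit ≤ β
      units≤β j h = ≤-trans (*-monoˡ-≤ unit h) β-large

      24β≤n : 24000 * β ≤ n
      24β≤n = ≤-trans (*-monoʳ-≤ 24000 (≤-trans (m≤n+m β m) (≤-trans (≤-reflexive (sym (*-identityʳ (m + β)))) (*-monoʳ-≤ (m + β) (s≤s z≤n)))))
        (≤-trans (≤-trans (≤-reflexive (ring-4 ((m + β) * m))) (*-monoˡ-≤ (4 * ((m + β) * m)) s-large)) (≤-trans (≤-reflexive (ring-5 s (m + β) m)) n-large))

    Part : Set
    Part = List V

    U : List Part
    U = tup m

    N : ℕ
    N = n ^ m

    abstract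
      adj : Part → Part → Bool
      adj A B with length A ≟ℕ m
      ... | yes _ = e (A ++ B)
      ... | no _ = false

      ~-edge : ∀ {A B} → adj A B ≡ true → e (A ++ B) ≡ true
      ~-edge {A} h with length A ≟ℕ m
      ... | yes _ = h

      ~-length : ∀ {A B} → adj A B ≡ true → length A ≡ m
      ~-length {A} h with length A ≟ℕ m
      ... | yes p = p

      edge-~ : ∀ {A B} → length A ≡ m → e (A ++ B) ≡ true → adj A B ≡ true
      edge-~ {A} p h with length A ≟ℕ m
      ... | yes _ = h
      ... | no q = ⊥-elim (q p)

    infix 4 _~_

    _~_ : Part → Part → Set
    A ~ B = adj A B ≡ true

    Proper : Part → Set
    Proper A = Unique A × length A ≡ m

    ~-lengthʳ : ∀ {A B} → A ~ B → length B ≡ m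
    ~-lengthʳ {A} {B} h = +-cancelˡ-≡ m (length B) m
      (trans (cong (_+ length B) (sym (~-length {A} {B} h))) (trans (sym (length-++ A)) (e-length (~-edge {A} {B} h))))

    ~-sym : ∀ {A B} → A ~ B → B ~ A
    ~-sym {A} {B} h = edge-~ {B} {A} (~-lengthʳ {A} {B} h) (e-↭ (++-comm A B) (~-edge {A} {B} h))

    ~-unique : ∀ {A B} → A ~ B → Unique (A ++ B)
    ~-unique {A} {B} h = e-unique (~-edge {A} {B} h)

    ~-properˡ : ∀ {A B} → A ~ B → Proper A
    ~-properˡ {A} {B} h = unique-ˡ A (~-unique {A} {B} h) , ~-length {A} {B} h

    ~-properʳ : ∀ {A B} → A ~ B → Proper B
    ~-properʳ {A} {B} h = unique-ʳ A (~-unique {A} {B} h) , ~-lengthʳ {A} {B} h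

    adj-sym : ∀ A B → adj A B ≡ adj B A
    adj-sym A B with bool-case (adj A B) | bool-case (adj B A)
    ... | inj₁ p | _ = trans p (sym (~-sym {A} {B} p))
    ... | _ | inj₁ q = trans (~-sym {B} {A} q) (sym q)
    ... | inj₂ p | inj₂ q = trans p (sym q)

    ~-↭ˡ : ∀ {A A′ B} → A ↭ A′ → A ~ B → A′ ~ B
    ~-↭ˡ {A} {A′} {B} p h = edge-~ {A′} {B} (trans (sym (↭-length p)) (~-length {A} {B} h)) (e-↭ (++⁺ʳ B p) (~-edge {A} {B} h))

    adj-↭ : ∀ {A A′} B → A ↭ A′ → adj A B ≡ adj A′ B
    adj-↭ {A} {A′} B p with bool-case (adj A B) | bool-case (adj A′ B)
    ... | inj₁ h | _ = trans h (sym (~-↭ˡ {A} {A′} {B} p h))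
    ... | _ | inj₁ h = trans (~-↭ˡ {A′} {A} {B} (↭-sym p) h) (sym h)
    ... | inj₂ h | inj₂ h′ = trans h (sym h′)

    n≤2D : n ≤ 2 * D + 4 * m
    n≤2D = ≤-trans (m≤m+n n 4) D-large

    links : ∀ j {S} → Unique S → length S + suc j ≡ m + m →
      n ^ suc j ≤ 2 * # (λ w → e (w ++ S)) of tup (suc j) + 4 * m * suc j * n ^ j
    links zero {S} u l = ≤-trans (≤-reflexive (*-identityʳ n)) (≤-trans n≤2D
        (≤-trans ((2 ⊗ codegree u (trans (+-comm 1 _) l)) ⊕ ≤-refl {4 * m})
          (≤-reflexive (cong₂ (λ a b → 2 * a + b) (sym single) (ring-7 (4 * m))))))
      where
      single : # (λ w → e (w ++ S)) of tup 1 ≡ # (λ y → e (y ∷ S)) of allFin n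
      single = trans (∑-tup 0 _) (∑-cong (allFin n) (λ v → ∑-tup₀ _))
    links (suc j) {S} u l = ≤-trans (≤-reflexive (sym (∑-V (n ^ suc j)))) (≤-trans (∑-mono (allFin n) per) total)
      where
      g : V → ℕ
      g v = # (λ w → e (v ∷ w ++ S)) of tup (suc j)
      c = 4 * m * suc j * n ^ j
      move : ∀ v w → ⟦ e (w ++ v ∷ S) ⟧ ≤ ⟦ e (v ∷ w ++ S) ⟧
      move v w = ⟦⟧-≤ (e (w ++ v ∷ S)) (λ h → ⟦⟧-true (e-↭ (shift v w S) h))
      per : ∀ v → n ^ suc j ≤ 2 * g v + c + ⟦ v ∈ᵇ S ⟧ * n ^ suc j
      per v with v ∈? S
      ... | yes _ = ≤-trans (≤-reflexive (sym (+-identityʳ _))) (m≤n+m _ (2 * g v + c))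
      ... | no p = ≤-trans (links j {v ∷ S} (unique-∷ p u) (trans (sym (+-suc _ _)) l))
                     (≤-trans (+-monoˡ-≤ c (2 ⊗ ∑-mono (tup (suc j)) (move v))) (m≤m+n _ _))
      S≤ : # (_∈ᵇ S) of allFin n ≤ 2 * m
      S≤ = ≤-trans (#-elem S) (≤-trans (m≤m+n _ _) (≤-reflexive (trans l (cong (m +_) (sym (+-identityʳ m))))))
      total : ∑ (allFin n) (λ v → 2 * g v + c + ⟦ v ∈ᵇ S ⟧ * n ^ suc j) ≤ 2 * # (λ w → e (w ++ S)) of tup (suc (suc j)) + 4 * m * suc (suc j) * n ^ suc j
      total = ≤-trans (≤-reflexive (trans (∑-+ (allFin n) _ _) (cong₂ _+_ (trans (∑-+ (allFin n) _ _) (cong₂ _+_ (trans (∑-* (allFin n) 2 g) (cong (2 *_) (sym (∑-tup (suc j) _)))) (∑-V c))) (∑-*ʳ (allFin n) (n ^ suc j) _))))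
        (≤-trans (+-monoʳ-≤ _ (*-monoˡ-≤ (n ^ suc j) S≤)) (≤-trans (m≤m+n _ (2 * m * (n * n ^ j))) (≤-reflexive (ring-8 (# (λ w → e (w ++ S)) of tup (suc (suc j))) n m j (n ^ j)))))

    off : List V → (List V → Bool) → List V → Bool
    off F p w = p w ∧ not (hits F w)

    off-count : ∀ F j p → # p of tup (suc j) ≤ # off F p of tup (suc j) + suc j * length F * n ^ j
    off-count F j p = ≤-trans (∑-mono (tup (suc j)) (λ w → cases (p w) (hits F w))) (≤-trans (≤-reflexive (∑-+ (tup (suc j)) _ _)) (+-monoʳ-≤ _ (hits-count F j)))
      where
      cases : ∀ a b → ⟦ a ⟧ ≤ ⟦ a ∧ not b ⟧ + ⟦ b ⟧
      cases true true = ≤-refl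
      cases true false = ≤-refl
      cases false b = z≤n

    links-off : ∀ j {S} F → j ≤ μ → length F ≤ β → Unique S → length S + suc j ≡ m + m →
      s * n ^ suc j ≤ 2 * s * # off F (λ w → e (w ++ S)) of tup (suc j) + n ^ suc j
    links-off j {S} F j≤ F≤ u l = lin 0 (s ⊗ links j u l ⊕ 2 * s ⊗ off-count F j (λ w → e (w ++ S)) ⊕ small ⊕ n^j ⊗ n-large′)
        (ring-9 s n n^j X Y (length F) j m β)
      where
      n^j = n ^ j
      X = # (λ w → e (w ++ S)) of tup (suc j)
      Y = # off F (λ w → e (w ++ S)) of tup (suc j)
      n-large′ : s * (4 * m * m + 2 * β * m) ≤ n
      n-large′ = ≤-trans (*-monoʳ-≤ s (≤-trans (m≤m+n _ (2 * β * m)) (≤-reflexive (ring-6 m β)))) n-large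
      small : s * n^j * (4 * m * suc j + 2 * suc j * length F) ≤ s * n^j * (4 * m * m + 2 * m * β)
      small = s * n^j ⊗ ((4 * m ⊗ s≤s j≤) ⊕ *-mono-≤ (2 ⊗ s≤s j≤) F≤)

    Pred : Set
    Pred = Part → Bool

    slot : Pred → Pred → Part → Part → Part → Part → Bool
    slot P Q A B C E = adj A C ∧ (adj C E ∧ (adj E B ∧ (Q C ∧ P E)))

    Frame : Pred → Pred → Set
    Frame P Q = ∀ {A B} → Proper A → Proper B → P A ≡ true → Q B ≡ true →
      N * N ≤ s * ∑₂ U U (λ C E → ⟦ slot P Q A B C E ⟧)

    slotᶠ : Pred → Pred → List V → Part → Part → Part → Part → Bool
    slotᶠ P Q F A B C E = slot P Q A B C E ∧ (not (hits F C) ∧ not (hits F E))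

    frame-off : ∀ {P Q} → Frame P Q → ∀ F → length F ≤ β → ∀ {A B} → Proper A → Proper B → P A ≡ true → Q B ≡ true →
      N * N ≤ 2 * s * ∑₂ U U (λ C E → ⟦ slotᶠ P Q F A B C E ⟧)
    frame-off {P} {Q} fr F F≤ {A} {B} pA pB PA QB =
        lin 0 (2 ⊗ fr pA pB PA QB ⊕ 2 * s ⊗ X≤ ⊕ 4 * s * N ⊗ H≤ ⊕ small ⊕ N * n ^ μ ⊗ n-large)
          (ring-10 s n N (n ^ μ) X Y H (length F) m β)
      where
      X = ∑₂ U U (λ C E → ⟦ slot P Q A B C E ⟧)
      Y = ∑₂ U U (λ C E → ⟦ slotᶠ P Q F A B C E ⟧)
      H = # (hits F) of U
      cases : ∀ a b c → ⟦ a ⟧ ≤ ⟦ a ∧ (not b ∧ not c) ⟧ + (⟦ b ⟧ + ⟦ c ⟧)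
      cases true true c = s≤s z≤n
      cases true false true = ≤-refl
      cases true false false = ≤-refl
      cases false b c = z≤n
      X≤ : X ≤ Y + (N * H + N * H)
      X≤ = ≤-trans (∑₂-mono U U (λ C E → cases (slot P Q A B C E) (hits F C) (hits F E)))
        (≤-reflexive (trans (∑₂-+ U U _ _) (cong (Y +_) (trans (∑₂-+ U U _ _) (cong₂ _+_
          (trans (∑₂-ˡ U U (λ C → ⟦ hits F C ⟧)) (cong (_* H) (length-tup m))) (trans (∑₂-ʳ U U (λ E → ⟦ hits F E ⟧)) (cong (_* H) (length-tup m))))))))
      H≤ : H ≤ m * length F * n ^ μ
      H≤ = hits-count F μ
      small : 4 * s * N * m * n ^ μ * length F ≤ 4 * s * N * m * n ^ μ * (β + m)
      small = 4 * s * N * m * n ^ μ ⊗ ≤-trans F≤ (m≤m+n β m)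

    n-pos : 1 ≤ n
    n-pos = ≤-trans (*-mono-≤ (≤-trans (s≤s z≤n) s-large) (*-mono-≤ {1} {4 * (m + β)} {1} {m} (≤-trans (s≤s z≤n) (4 ⊗ m≤m+n m β)) (s≤s z≤n))) n-large

    power-pos : ∀ j → 1 ≤ n ^ j
    power-pos zero = ≤-refl
    power-pos (suc j) = *-mono-≤ n-pos (power-pos j)

    freshSet : ∀ {F} j → Unique F → length F + j ≤ n → ∃ λ w → length w ≡ j × Unique (w ++ F)
    freshSet {F} j u h =
      let zs , p = rest u
          lz = trans (sym length-allFin) (↭-length p)
          as , bs , q , l = split j zs (+-cancelˡ-≤ (length F) j (length zs) (≤-trans h (≤-reflexive (trans lz (length-++ F)))))
      in as , l , Unique-↭ (++-comm F as) (unique-ˡ (F ++ as) (subst Unique (trans (cong (F ++_) q) (sym (++-assoc F as bs))) (Unique-↭ p (allFin-unique))))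

    record Slot (P Q : Pred) (F : List V) (A B : Part) : Set where
      constructor mkSlot
      field
        C E  : Part
        AC   : A ~ C
        CE   : C ~ E
        EB   : E ~ B
        QC   : Q C ≡ true
        PE   : P E ≡ true
        offC : Disj C F
        offE : Disj E F

    slotᶠ-sound : ∀ {P Q F A B C E} → slotᶠ P Q F A B C E ≡ true → Slot P Q F A B
    slotᶠ-sound {P} {Q} {F} {A} {B} {C} {E} h with ∧-elim {slot P Q A B C E} h
    ... | h₁ , h₂ with ∧-elim {adj A C} h₁ | ∧-elim {not (hits F C)} h₂
    ... | ac , h₃ | c , e′ with ∧-elim {adj C E} h₃
    ... | ce , h₄ with ∧-elim {adj E B} h₄
    ... | eb , h₅ with ∧-elim {Q C} h₅
    ... | qc , pe = mkSlot C E ac ce eb qc pe (hits-disj F C (not-true c)) (hits-disj F E (not-true e′))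

    frame-slot : ∀ {P Q} → Frame P Q → ∀ F → length F ≤ β → ∀ {A B} → Proper A → Proper B → P A ≡ true → Q B ≡ true → Slot P Q F A B
    frame-slot {P} {Q} fr F F≤ {A} {B} pA pB PA QB =
      let C , E , k = ∑₂-find U U {slotᶠ P Q F A B} (positive _ (≤-trans (*-mono-≤ (power-pos m) (power-pos m)) (frame-off fr F F≤ pA pB PA QB)))
      in slotᶠ-sound {P} {Q} {F} {A} {B} {C} {E} k
      where
      positive : ∀ y → 1 ≤ 2 * s * y → 1 ≤ y
      positive (suc y) _ = s≤s z≤n
      positive zero h = ⊥-elim (1+n≰n (≤-trans h (≤-reflexive (*-zeroʳ (2 * s)))))

module Tri where

  open Base
  open Arithmetic
  open Hyper

  module Forms (hg : HG) where
    open HG hg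

    deg : Part → ℕ
    deg A = # (adj A) of U

    degree-bound : ∀ {A} → Proper A → s * N ≤ 2 * s * deg A + N
    degree-bound {A} (u , l) = ≤-trans (links-off μ {A} [] ≤-refl z≤n u (cong (_+ m) l)) (+-monoˡ-≤ N (2 * s ⊗ ∑-mono U le))
      where
      le : ∀ w → ⟦ off [] (λ w → e (w ++ A)) w ⟧ ≤ ⟦ adj A w ⟧
      le w = ⟦⟧-≤ (off [] (λ w → e (w ++ A)) w) (λ h → ⟦⟧-true (edge-~ {A} {w} l (e-↭ (++-comm w A) (∧-fst {e (w ++ A)} h))))

    form form′ : Pred → Pred → ℕ
    form f g = ∑₂ U U (λ C E → ⟦ f C ⟧ * (⟦ g E ⟧ * ⟦ adj C E ⟧))
    form′ f g = ∑₂ U U (λ C E → ⟦ f C ⟧ * (⟦ g E ⟧ * ⟦ not (adj C E) ⟧))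

    _⊑_ : Pred → Pred → Set
    f ⊑ g = ∀ C → ⟦ f C ⟧ ≤ ⟦ g C ⟧

    all : Pred
    all _ = true

    size : Pred → ℕ
    size f = # f of U

    size≤N : ∀ f → size f ≤ N
    size≤N f = ≤-trans (#≤length U f) (≤-reflexive (length-tup m))

    form-mono : ∀ {f f′ g g′} → f ⊑ f′ → g ⊑ g′ → form f g ≤ form f′ g′
    form-mono h k = ∑₂-mono U U (λ C E → *-mono-≤ (h C) (*-mono-≤ (k E) ≤-refl))

    form′-mono : ∀ {f f′ g g′} → f ⊑ f′ → g ⊑ g′ → form′ f g ≤ form′ f′ g′
    form′-mono h k = ∑₂-mono U U (λ C E → *-mono-≤ (h C) (*-mono-≤ (k E) ≤-refl))

    form-total : ∀ f g → form f g + form′ f g ≡ size f * size g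
    form-total f g = trans (sym (∑₂-+ U U _ _)) (trans (∑-cong U (λ C → ∑-cong U (λ E → cases ⟦ f C ⟧ ⟦ g E ⟧ (adj C E)))) (∑₂-× U U _ _))
      where
      cases : ∀ a b c → a * (b * ⟦ c ⟧) + a * (b * ⟦ not c ⟧) ≡ a * b
      cases a b true = ring-26 a b
      cases a b false = ring-27 a b

    form-sym : ∀ f g → form f g ≡ form g f
    form-sym f g = trans (∑-swap U U _) (∑-cong U (λ E → ∑-cong U (λ C → trans (cong (λ z → ⟦ f C ⟧ * (⟦ g E ⟧ * ⟦ z ⟧)) (adj-sym C E)) (ring-16 ⟦ f C ⟧ ⟦ g E ⟧ ⟦ adj E C ⟧))))

    form-degree : ∀ f → (∀ C → f C ≡ true → Proper C) → s * (size f * N) ≤ 2 * s * form f all + size f * N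
    form-degree f pr = ≤-trans (≤-reflexive (trans (sym (*-assoc s _ N)) (trans (cong (_* N) (sym (∑-* U s _))) (sym (∑-*ʳ U N _)))))
        (≤-trans (∑-mono U per) (≤-reflexive (trans (∑-+ U _ _) (cong₂ _+_ (∑-* U (2 * s) _) (∑-*ʳ U N _)))))
      where
      t : ∀ C → ∑ U (λ E → 1 * (1 * ⟦ adj C E ⟧)) ≡ deg C
      t C = ∑-cong U (λ E → trans (+-identityʳ _) (+-identityʳ _))
      per : ∀ C → s * ⟦ f C ⟧ * N ≤ 2 * s * ∑ U (λ E → ⟦ f C ⟧ * (1 * ⟦ adj C E ⟧)) + ⟦ f C ⟧ * N
      per C with f C in eq
      ... | false = ≤-trans (≤-reflexive (cong (_* N) (*-zeroʳ s))) z≤n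
      ... | true = ≤-trans (≤-reflexive (cong (_* N) (*-identityʳ s))) (≤-trans (degree-bound (pr C eq)) (≤-reflexive (cong₂ _+_ (cong (2 * s *_) (sym (t C))) (sym (+-identityʳ N)))))

    form-split : ∀ f g h → (∀ C → 1 ≤ ⟦ g C ⟧ + ⟦ h C ⟧) → form f all ≤ form f g + form f h
    form-split f g h c = ≤-trans (∑₂-mono U U per) (≤-reflexive (∑₂-+ U U _ _))
      where
      per : ∀ C E → ⟦ f C ⟧ * (1 * ⟦ adj C E ⟧) ≤ ⟦ f C ⟧ * (⟦ g E ⟧ * ⟦ adj C E ⟧) + ⟦ f C ⟧ * (⟦ h E ⟧ * ⟦ adj C E ⟧)
      per C E = ≤-trans (*-monoʳ-≤ ⟦ f C ⟧ (*-monoˡ-≤ ⟦ adj C E ⟧ (c E))) (≤-reflexive (ring-28 ⟦ f C ⟧ ⟦ g E ⟧ ⟦ h E ⟧ ⟦ adj C E ⟧))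

    into : Pred → Part → ℕ
    into 𝒟 A = # (λ C → adj A C ∧ 𝒟 C) of U

    abstract
      rich : Pred → Pred
      rich 𝒟 A = does (N ≤? 5 * into 𝒟 A)

      rich-true : ∀ 𝒟 {A} → rich 𝒟 A ≡ true → N ≤ 5 * into 𝒟 A
      rich-true 𝒟 {A} = decided (N ≤? 5 * into 𝒟 A)

      rich-false : ∀ 𝒟 {A} → rich 𝒟 A ≡ false → 5 * into 𝒟 A ≤ N
      rich-false 𝒟 {A} h = ≤-trans (n≤1+n _) (≰⇒> (undecided (N ≤? 5 * into 𝒟 A) h))

      rich-↭ : ∀ 𝒟 {A A′} → A ↭ A′ → rich 𝒟 A ≡ rich 𝒟 A′
      rich-↭ 𝒟 {A} {A′} p = cong (λ z → does (N ≤? 5 * z)) (∑-cong U (λ C → cong (λ z → ⟦ z ∧ 𝒟 C ⟧) (adj-↭ C p)))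

      rich-proper : ∀ 𝒟 {A} → rich 𝒟 A ≡ true → Proper A
      rich-proper 𝒟 {A} h = let C , _ , k = #-find U (λ C → adj A C ∧ 𝒟 C) (pos (into 𝒟 A) (≤-trans (power-pos m) (rich-true 𝒟 {A} h))) in ~-properˡ {A} {C} (∧-fst {adj A C} k)
        where
        pos : ∀ z → 1 ≤ 5 * z → 1 ≤ z
        pos (suc z) _ = s≤s z≤n

    arith : ∀ s N a b X u v F → N ≤ 5 * b → N ≤ 5 * a → a * b ≤ X + F + (N * u + N * v) → N * u ≤ 5 * F → N * v ≤ 5 * F →
      s * F ≤ 3 * (N * N) → 6000 ≤ s → N * N ≤ s * X
    arith s N a b X u v F hb ha ab hu hv hF hs = *-cancelˡ-≤ 25
        (lin 0 (s * 5 * a ⊗ hb ⊕ s * N ⊗ ha ⊕ 25 * s ⊗ ab ⊕ 25 * s ⊗ hu ⊕ 25 * s ⊗ hv ⊕ 275 ⊗ hF ⊕ N * N ⊗ ≤-trans (≤ᵇ⇒≤ 850 6000 tt) hs) (ring-29 N a b s X u v F))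

    abstract
      arith-inhabited : ∀ s N z g u F → 2 * N ≤ 5 * z → z ≤ g + u → N * u ≤ 5 * F → s * F ≤ 3 * (N * N) → 6000 ≤ s → N * N ≤ 5 * s * N * g
      arith-inhabited s N z g u F hz sp hu hF hs =
        lin 0 (s * N ⊗ hz ⊕ 5 * s * N ⊗ sp ⊕ 5 * s ⊗ hu ⊕ 25 ⊗ hF ⊕ N * N ⊗ ≤-trans (≤-trans (≤ᵇ⇒≤ 76 6000 tt) hs) (m≤m+n s (s + 0))) (ring-13 s N z g u F)

      into-split : ∀ 𝒟 𝓔 A → deg A ≤ into 𝒟 A + into 𝓔 A + # (λ C → not (𝒟 C) ∧ not (𝓔 C)) of U
      into-split 𝒟 𝓔 A = ≤-trans (∑-mono U (λ C → cases (adj A C) (𝒟 C) (𝓔 C))) (≤-reflexive (trans (∑-+ U _ _) (cong (_+ _) (∑-+ U _ _))))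
        where
        cases : ∀ a b c → ⟦ a ⟧ ≤ ⟦ a ∧ b ⟧ + ⟦ a ∧ c ⟧ + ⟦ not b ∧ not c ⟧
        cases false b c = z≤n
        cases true true c = s≤s z≤n
        cases true false true = s≤s z≤n
        cases true false false = s≤s z≤n

      arith-covers : ∀ s N d a b R {C : Set} → s * N ≤ 2 * s * d + N → d ≤ a + b + R → 5 * a ≤ N → 5 * b ≤ N → s * R * 10 + N * 6 ≤ s * N → 1 ≤ N → C
      arith-covers s N d a b R hd sp ha hb hR hN =
        absurd 0 (5 ⊗ hd ⊕ 10 * s ⊗ sp ⊕ 2 * s ⊗ ha ⊕ 2 * s ⊗ hb ⊕ hR ⊕ hN) (ring-14 s N d a b R)

    abstract
      rich-covers : ∀ 𝒟 𝓔 → s * # (λ C → not (𝒟 C) ∧ not (𝓔 C)) of U * 10 + N * 6 ≤ s * N → ∀ {A} → Proper A → rich 𝒟 A ≡ true ⊎ rich 𝓔 A ≡ true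
      rich-covers 𝒟 𝓔 out {A} pA = go (bool-case (rich 𝒟 A)) (bool-case (rich 𝓔 A))
        where
        go : rich 𝒟 A ≡ true ⊎ rich 𝒟 A ≡ false → rich 𝓔 A ≡ true ⊎ rich 𝓔 A ≡ false → rich 𝒟 A ≡ true ⊎ rich 𝓔 A ≡ true
        go (inj₁ p) _ = inj₁ p
        go _ (inj₁ q) = inj₂ q
        go (inj₂ p) (inj₂ q) = arith-covers s N (deg A) (into 𝒟 A) (into 𝓔 A) _ (degree-bound pA) (into-split 𝒟 𝓔 A) (rich-false 𝒟 {A} p) (rich-false 𝓔 {A} q) out (power-pos m)

    module NearComplete (𝒟 𝓔 : Pred) (dense : s * form′ 𝒟 𝓔 ≤ 3 * (N * N)) (𝒟-large : 2 * N ≤ 5 * size 𝒟) (𝓔-large : 2 * N ≤ 5 * size 𝓔) where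

      P Q : Pred
      P = rich 𝒟
      Q = rich 𝓔

      poor𝒟 poor𝓔 : ℕ
      poor𝒟 = # (λ C → 𝒟 C ∧ not (Q C)) of U
      poor𝓔 = # (λ E → 𝓔 E ∧ not (P E)) of U

      half : ∀ (𝓔 : Pred) (C : Part) → size 𝓔 ≤ into 𝓔 C + ∑ U (λ E → ⟦ 𝓔 E ⟧ * ⟦ not (adj C E) ⟧)
      half 𝓔 C = ≤-trans (∑-mono U (λ E → cases (𝓔 E) (adj C E))) (≤-reflexive (∑-+ U _ _))
        where
        cases : ∀ a b → ⟦ a ⟧ ≤ ⟦ b ∧ a ⟧ + ⟦ a ⟧ * ⟦ not b ⟧
        cases true true = s≤s z≤n
        cases true false = s≤s z≤n
        cases false b = z≤n

      poor-per : ∀ (𝓔 : Pred) → 2 * N ≤ 5 * size 𝓔 → ∀ (𝒟 : Pred) (C : Part) → ⟦ 𝒟 C ∧ not (rich 𝓔 C) ⟧ * N ≤ 5 * ∑ U (λ E → ⟦ 𝒟 C ⟧ * (⟦ 𝓔 E ⟧ * ⟦ not (adj C E) ⟧))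
      poor-per 𝓔 large 𝒟 C with 𝒟 C | rich 𝓔 C in eq
      ... | false | _ = z≤n
      ... | true | true = z≤n
      ... | true | false = ≤-trans (lin 0 (large ⊕ 5 ⊗ half 𝓔 C ⊕ rich-false 𝓔 {C} eq) (ring-15 N (size 𝓔) (into 𝓔 C) S))
                (≤-reflexive (cong (5 *_) (∑-cong U (λ E → sym (+-identityʳ _)))))
        where
        S = ∑ U (λ E → ⟦ 𝓔 E ⟧ * ⟦ not (adj C E) ⟧)

      poor𝒟≤ : N * poor𝒟 ≤ 5 * form′ 𝒟 𝓔
      poor𝒟≤ = ≤-trans (≤-reflexive (trans (*-comm N poor𝒟) (sym (∑-*ʳ U N _)))) (≤-trans (∑-mono U (poor-per 𝓔 𝓔-large 𝒟)) (≤-reflexive (∑-* U 5 _)))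

      poor𝓔≤ : N * poor𝓔 ≤ 5 * form′ 𝒟 𝓔
      poor𝓔≤ = ≤-trans (≤-reflexive (trans (*-comm N poor𝓔) (sym (∑-*ʳ U N _)))) (≤-trans (∑-mono U (poor-per 𝒟 𝒟-large 𝓔)) (≤-reflexive (trans (∑-* U 5 _) (cong (5 *_) sw))))
        where
        sw : ∑ U (λ E → ∑ U (λ C → ⟦ 𝓔 E ⟧ * (⟦ 𝒟 C ⟧ * ⟦ not (adj E C) ⟧))) ≡ form′ 𝒟 𝓔
        sw = trans (∑-swap U U _) (∑-cong U (λ C → ∑-cong U (λ E → trans (cong (λ z → ⟦ 𝓔 E ⟧ * (⟦ 𝒟 C ⟧ * ⟦ not z ⟧)) (adj-sym E C)) (ring-16 ⟦ 𝓔 E ⟧ ⟦ 𝒟 C ⟧ ⟦ not (adj C E) ⟧))))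

      frame : Frame P Q
      frame {A} {B} pA pB PA QB = arith s N (into 𝒟 A) (into 𝓔 B) X poor𝒟 poor𝓔 (form′ 𝒟 𝓔)
          (rich-true 𝓔 {B} QB) (rich-true 𝒟 {A} PA) ab poor𝒟≤ poor𝓔≤ dense s-large
        where
        X = ∑₂ U U (λ C E → ⟦ slot P Q A B C E ⟧)
        cases : ∀ a a′ b b′ c p q → ⟦ a ∧ a′ ⟧ * ⟦ b ∧ b′ ⟧ ≤ ⟦ a ∧ (c ∧ (b ∧ (q ∧ p))) ⟧ + ⟦ a′ ⟧ * (⟦ b′ ⟧ * ⟦ not c ⟧) + (⟦ a′ ∧ not q ⟧ + ⟦ b′ ∧ not p ⟧)
        cases false a′ b b′ c p q = z≤n
        cases true false b b′ c p q = z≤n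
        cases true true false b′ c p q = z≤n
        cases true true true false c p q = z≤n
        cases true true true true false p q = s≤s z≤n
        cases true true true true true true true = s≤s z≤n
        cases true true true true true true false = s≤s z≤n
        cases true true true true true false true = s≤s z≤n
        cases true true true true true false false = s≤s z≤n
        per : ∀ C E → ⟦ adj A C ∧ 𝒟 C ⟧ * ⟦ adj B E ∧ 𝓔 E ⟧ ≤ ⟦ slot P Q A B C E ⟧ + ⟦ 𝒟 C ⟧ * (⟦ 𝓔 E ⟧ * ⟦ not (adj C E) ⟧) + (⟦ 𝒟 C ∧ not (Q C) ⟧ + ⟦ 𝓔 E ∧ not (P E) ⟧)
        per C E rewrite adj-sym B E = cases (adj A C) (𝒟 C) (adj E B) (𝓔 E) (adj C E) (P E) (Q C)
        ab : into 𝒟 A * into 𝓔 B ≤ X + form′ 𝒟 𝓔 + (N * poor𝒟 + N * poor𝓔)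
        ab = ≤-trans (≤-reflexive (sym (∑₂-× U U _ _))) (≤-trans (∑₂-mono U U per) (≤-reflexive
               (trans (∑₂-+ U U _ _) (cong₂ _+_ (∑₂-+ U U _ _) (trans (∑₂-+ U U _ _) (cong₂ _+_ (trans (∑₂-ˡ U U _) (cong (_* poor𝒟) (length-tup m))) (trans (∑₂-ʳ U U _) (cong (_* poor𝓔) (length-tup m)))))))))

      inhabited : ∃ λ C → 𝒟 C ≡ true × Q C ≡ true
      inhabited =
        let C , _ , h = #-find U (λ C → 𝒟 C ∧ Q C) (pos _ many)
        in C , ∧-elim {𝒟 C} h
        where
        good = # (λ C → 𝒟 C ∧ Q C) of U
        cases : ∀ a b → ⟦ a ⟧ ≤ ⟦ a ∧ b ⟧ + ⟦ a ∧ not b ⟧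
        cases true true = s≤s z≤n
        cases true false = s≤s z≤n
        cases false b = z≤n
        sp : size 𝒟 ≤ good + poor𝒟
        sp = ≤-trans (∑-mono U (λ C → cases (𝒟 C) (Q C))) (≤-reflexive (∑-+ U _ _))
        many : N * N ≤ 5 * s * N * good
        many = arith-inhabited s N (size 𝒟) good poor𝒟 (form′ 𝒟 𝓔) 𝒟-large sp poor𝒟≤ dense s-large
        pos : ∀ g → N * N ≤ 5 * s * N * g → 1 ≤ g
        pos zero h = ⊥-elim (1+n≰n (≤-trans (*-mono-≤ (power-pos m) (power-pos m)) (≤-trans h (≤-reflexive (*-zeroʳ (5 * s * N))))))
        pos (suc g) h = s≤s z≤n

      inhabited′ : ∃ λ C → 𝓔 C ≡ true × P C ≡ true
      inhabited′ =
        let C , _ , h = #-find U (λ C → 𝓔 C ∧ P C) (pos _ many)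
        in C , ∧-elim {𝓔 C} h
        where
        good = # (λ C → 𝓔 C ∧ P C) of U
        cases : ∀ a b → ⟦ a ⟧ ≤ ⟦ a ∧ b ⟧ + ⟦ a ∧ not b ⟧
        cases true true = s≤s z≤n
        cases true false = s≤s z≤n
        cases false b = z≤n
        sp : size 𝓔 ≤ good + poor𝓔
        sp = ≤-trans (∑-mono U (λ C → cases (𝓔 C) (P C))) (≤-reflexive (∑-+ U _ _))
        many : N * N ≤ 5 * s * N * good
        many = arith-inhabited s N (size 𝓔) good poor𝓔 (form′ 𝒟 𝓔) 𝓔-large sp poor𝓔≤ dense s-large
        pos : ∀ g → N * N ≤ 5 * s * N * g → 1 ≤ g
        pos zero h = ⊥-elim (1+n≰n (≤-trans (*-mono-≤ (power-pos m) (power-pos m)) (≤-trans h (≤-reflexive (*-zeroʳ (5 * s * N))))))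
        pos (suc g) h = s≤s z≤n

  record Same (hg : HG) : Set where
    open HG hg
    field
      X Y    : Pred
      XX     : Frame X X
      YY     : Frame Y Y
      XorY   : ∀ {A} → Proper A → X A ≡ true ⊎ Y A ≡ true
      X-↭    : ∀ {A A′} → A ↭ A′ → X A ≡ X A′
      Y-↭    : ∀ {A A′} → A ↭ A′ → Y A ≡ Y A′
      X-some : ∃ λ A → Proper A × X A ≡ true
      Y-some : ∃ λ A → Proper A × Y A ≡ true

  record Diff (hg : HG) : Set where
    open HG hg
    field
      P Q  : Pred
      PQ   : Frame P Q
      PorQ : ∀ {A} → Proper A → P A ≡ true ⊎ Q A ≡ true
      P-↭  : ∀ {A A′} → A ↭ A′ → P A ≡ P A′
      Q-↭  : ∀ {A A′} → A ↭ A′ → Q A ≡ Q A′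
      P-some : ∃ λ A → Proper A × P A ≡ true
      Q-some : ∃ λ A → Proper A × Q A ≡ true

  module Trichotomy (hg : HG) where
    open HG hg hiding (K)
    open Forms hg

    abstract
      arith-dense : ∀ s N x y c E1 Exy Exc F → s * N ≤ 2 * s * y + N → s * (x * N) ≤ 2 * s * E1 + x * N → E1 ≤ Exy + Exc →
        Exc + F ≤ x * c → c + y ≤ N → s * Exy ≤ N * N → x ≤ N → s * F ≤ 2 * (N * N)
      arith-dense s N x y c E1 Exy Exc F h1 h2 h3 h4 h5 h6 h7 = *-cancelˡ-≤ 2
        (lin 0 (x ⊗ h1 ⊕ h2 ⊕ 2 * s ⊗ h3 ⊕ 2 * s ⊗ h4 ⊕ 2 * s * x ⊗ h5 ⊕ 2 ⊗ h6 ⊕ 2 * N ⊗ h7) (ring-17 s N x y c E1 Exy Exc F))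

      arith-product : ∀ s N E F p → E + F ≡ p → s * E ≤ N * N → s * F ≤ 2 * (N * N) → s * p ≤ 3 * (N * N)
      arith-product s N E F p refl h k = lin 0 (h ⊕ k) (ring-18 s N E F)

      arith-large : ∀ s N i j → s * N ≤ 2 * s * (i + j) + N → 40 * i ≤ N → 6000 ≤ s → 2 * N ≤ 5 * j
      arith-large s N i j h k hs = cancel (8 * s) (≤-trans (≤ᵇ⇒≤ 1 6000 tt) (≤-trans hs (m≤m+n s (7 * s))))
        (lin (2 * s * N + 5980 * N) (20 ⊗ h ⊕ s ⊗ k ⊕ N ⊗ hs) (ring-19 s N i j))

      arith-outside : ∀ s N i j k r → s * N ≤ 2 * s * (i + j) + N → s * N ≤ 2 * s * (i + k) + N → 40 * i ≤ N → j + k + r ≤ N → 6000 ≤ s →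
        s * r * 10 + N * 6 ≤ s * N
      arith-outside s N i j k r hx hy hi hr hs = *-cancelˡ-≤ 2
        (lin (5968 * N) (10 ⊗ hx ⊕ 10 ⊗ hy ⊕ s ⊗ hi ⊕ N ⊗ hs ⊕ 20 * s ⊗ hr) (ring-20 s N i j k r))

      arith-small : ∀ s N i j → N ≤ 40 * i → s * (i * j) ≤ 3 * (N * N) → 1 ≤ N → s * j ≤ 120 * N
      arith-small s N i j hi hp hN = cancel N hN (lin 0 (s * j ⊗ hi ⊕ 40 ⊗ hp) (ring-21 s N i j))

      arith-outside′ : ∀ s N j k r → s * j ≤ 120 * N → s * k ≤ 120 * N → r ≤ j + k → 6000 ≤ s → s * r * 10 + N * 6 ≤ s * N
      arith-outside′ s N j k r hj hk hr hs = lin (3594 * N) (10 * s ⊗ hr ⊕ 10 ⊗ hj ⊕ 10 ⊗ hk ⊕ N ⊗ hs) (ring-22 s N j k r)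

      arith-I : ∀ s N i j → s * N ≤ 2 * s * (i + j) + N → s * j ≤ 120 * N → 6000 ≤ s → 2 * N ≤ 5 * i
      arith-I s N i j h hj hs = cancel (2 * s) (≤-trans (≤ᵇ⇒≤ 1 6000 tt) (≤-trans hs (m≤m+n s (1 * s))))
        (lin (4795 * N) (5 ⊗ h ⊕ 10 ⊗ hj ⊕ N ⊗ hs) (ring-23 s N i j))

      arith-O : ∀ s N i o ij ik E1 EI EJ EK EO → s * (i * N) ≤ 2 * s * E1 + i * N → E1 ≤ EI + (EJ + (EK + EO)) → s * EI ≤ N * N →
        EJ ≤ ij → s * ij ≤ 3 * (N * N) → EK ≤ ik → s * ik ≤ 3 * (N * N) → EO ≤ i * o → N ≤ 40 * i → 6000 ≤ s → 1 ≤ N → 2 * N ≤ 5 * o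
      arith-O s N i o ij ik E1 EI EJ EK EO h1 h2 h3 h4 h5 h6 h7 h8 h9 hs hN = cancel (2 * s * i)
        (*-mono-≤ {1} {2 * s} (≤-trans (≤ᵇ⇒≤ 1 6000 tt) (≤-trans hs (m≤m+n s (1 * s)))) (pos i (≤-trans hN h9)))
        (lin (3195 * i * N) (5 ⊗ h1 ⊕ 10 * s ⊗ h2 ⊕ 10 ⊗ h3 ⊕ 10 * s ⊗ h4 ⊕ 10 ⊗ h5 ⊕ 10 * s ⊗ h6 ⊕ 10 ⊗ h7 ⊕ 10 * s ⊗ h8 ⊕ 70 * N ⊗ h9 ⊕ i * N ⊗ hs)
          (ring-24 s N i o ij ik E1 EI EJ EK EO))
        where
        pos : ∀ i → 1 ≤ 40 * i → 1 ≤ i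
        pos (suc i) _ = s≤s z≤n

      form≤ : ∀ f g → form f g ≤ size f * size g
      form≤ f g = ≤-trans (m≤m+n _ _) (≤-reflexive (form-total f g))

    module Bad (A B : Part) (pA : Proper A) (pB : Proper B)
      (bad : s * ∑₂ U U (λ C E → ⟦ slot all all A B C E ⟧) ≤ N * N) where

      x y I J K O cx cy : Pred
      x C = adj A C
      y C = adj B C
      I C = x C ∧ y C
      J C = x C ∧ not (y C)
      K C = y C ∧ not (x C)
      O C = not (x C) ∧ not (y C)
      cx C = not (x C)
      cy C = not (y C)

      ∧-⊑ˡ : ∀ a b → ⟦ a ∧ b ⟧ ≤ ⟦ a ⟧
      ∧-⊑ˡ true b = ⟦⟧≤1 b
      ∧-⊑ˡ false b = z≤n
      ∧-⊑ʳ : ∀ a b → ⟦ a ∧ b ⟧ ≤ ⟦ b ⟧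
      ∧-⊑ʳ true b = ≤-refl
      ∧-⊑ʳ false b = z≤n
      I⊑x : I ⊑ x
      I⊑x C = ∧-⊑ˡ (x C) (y C)
      I⊑y : I ⊑ y
      I⊑y C = ∧-⊑ʳ (x C) (y C)
      J⊑x : J ⊑ x
      J⊑x C = ∧-⊑ˡ (x C) (cy C)
      J⊑cy : J ⊑ cy
      J⊑cy C = ∧-⊑ʳ (x C) (cy C)
      K⊑y : K ⊑ y
      K⊑y C = ∧-⊑ˡ (y C) (cx C)
      K⊑cx : K ⊑ cx
      K⊑cx C = ∧-⊑ʳ (y C) (cx C)
      O⊑cy : O ⊑ cy
      O⊑cy C = ∧-⊑ʳ (cx C) (cy C)

      abstract
        bad-xy : s * form x y ≤ N * N
        bad-xy = ≤-trans (*-monoʳ-≤ s (∑₂-mono U U per)) bad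
          where
          cases : ∀ a b c → ⟦ a ⟧ * (⟦ b ⟧ * ⟦ c ⟧) ≤ ⟦ a ∧ (c ∧ (b ∧ true)) ⟧
          cases true true true = s≤s z≤n
          cases true true false = z≤n
          cases true false c = z≤n
          cases false b c = z≤n
          per : ∀ C E → ⟦ x C ⟧ * (⟦ y E ⟧ * ⟦ adj C E ⟧) ≤ ⟦ slot all all A B C E ⟧
          per C E rewrite adj-sym B E = cases (adj A C) (adj E B) (adj C E)

        complement-size : ∀ f → size (λ C → not (f C)) + size f ≤ N
        complement-size f = ≤-reflexive (trans (sym (∑-+ U _ _)) (trans (∑-cong U (λ C → cases (f C))) (trans (∑-U m 1) (*-identityʳ N))))
          where
          cases : ∀ a → ⟦ not a ⟧ + ⟦ a ⟧ ≡ 1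
          cases true = refl
          cases false = refl

        either : ∀ (f : Pred) C → 1 ≤ ⟦ f C ⟧ + ⟦ not (f C) ⟧
        either f C = cases (f C)
          where
          cases : ∀ a → 1 ≤ ⟦ a ⟧ + ⟦ not a ⟧
          cases true = s≤s z≤n
          cases false = s≤s z≤n

        dense-x : s * form′ x cy ≤ 2 * (N * N)
        dense-x = arith-dense s N (size x) (size y) (size cy) (form x all) (form x y) (form x cy) (form′ x cy)
          (degree-bound pB) (form-degree x (λ C h → ~-properʳ {A} {C} h)) (form-split x y cy (either y)) (≤-reflexive (form-total x cy)) (complement-size y) bad-xy (size≤N x)

        dense-y : s * form′ y cx ≤ 2 * (N * N)
        dense-y = arith-dense s N (size y) (size x) (size cx) (form y all) (form y x) (form y cx) (form′ y cx)
          (degree-bound pA) (form-degree y (λ C h → ~-properʳ {B} {C} h)) (form-split y x cx (either x)) (≤-reflexive (form-total y cx)) (complement-size x)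
          (≤-trans (≤-reflexive (cong (s *_) (form-sym y x))) bad-xy) (size≤N y)

        bad-sub : ∀ {f g} → f ⊑ x → g ⊑ y → s * form f g ≤ N * N
        bad-sub h k = ≤-trans (*-monoʳ-≤ s (form-mono h k)) bad-xy

        dense-sub-x : ∀ {f g} → f ⊑ x → g ⊑ cy → s * form′ f g ≤ 2 * (N * N)
        dense-sub-x h k = ≤-trans (*-monoʳ-≤ s (form′-mono h k)) dense-x

        dense-sub-y : ∀ {f g} → f ⊑ y → g ⊑ cx → s * form′ f g ≤ 2 * (N * N)
        dense-sub-y h k = ≤-trans (*-monoʳ-≤ s (form′-mono h k)) dense-y

        2≤3 : ∀ {z} → z ≤ 2 * (N * N) → z ≤ 3 * (N * N)
        2≤3 h = ≤-trans h (*-monoˡ-≤ (N * N) (≤ᵇ⇒≤ 2 3 tt))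

        IJ-small : s * (size I * size J) ≤ 3 * (N * N)
        IJ-small = arith-product s N (form I J) (form′ I J) _ (form-total I J)
          (≤-trans (≤-reflexive (cong (s *_) (form-sym I J))) (bad-sub {J} {I} J⊑x I⊑y)) (dense-sub-x {I} {J} I⊑x J⊑cy)

        IK-small : s * (size I * size K) ≤ 3 * (N * N)
        IK-small = arith-product s N (form I K) (form′ I K) _ (form-total I K) (bad-sub {I} {K} I⊑x K⊑y) (dense-sub-y {I} {K} I⊑y K⊑cx)

        size-split : ∀ (f g : Pred) → size f ≤ size (λ C → f C ∧ g C) + size (λ C → f C ∧ not (g C))
        size-split f g = ≤-trans (∑-mono U (λ C → cases (f C) (g C))) (≤-reflexive (∑-+ U _ _))
          where
          cases : ∀ a b → ⟦ a ⟧ ≤ ⟦ a ∧ b ⟧ + ⟦ a ∧ not b ⟧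
          cases true true = s≤s z≤n
          cases true false = s≤s z≤n
          cases false b = z≤n

        hx : s * N ≤ 2 * s * (size I + size J) + N
        hx = ≤-trans (degree-bound pA) (+-monoˡ-≤ N (2 * s ⊗ size-split x y))

        hy : s * N ≤ 2 * s * (size I + size K) + N
        hy = ≤-trans (degree-bound pB) (+-monoˡ-≤ N (2 * s ⊗ ≤-trans (size-split y x) (+-monoˡ-≤ (size K) (∑-mono U (λ C → cases (y C) (x C))))))
          where
          cases : ∀ a b → ⟦ a ∧ b ⟧ ≤ ⟦ b ∧ a ⟧
          cases true true = ≤-refl
          cases true false = z≤n
          cases false b = z≤n

      module CaseE (small : 40 * size I ≤ N) where

        module JJ = NearComplete J J (2≤3 (dense-sub-x {J} {J} J⊑x J⊑cy)) (arith-large s N (size I) (size J) hx small s-large) (arith-large s N (size I) (size J) hx small s-large)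
        module KK = NearComplete K K (2≤3 (dense-sub-y {K} {K} K⊑y K⊑cx)) (arith-large s N (size I) (size K) hy small s-large) (arith-large s N (size I) (size K) hy small s-large)

        abstract
          out : s * # (λ C → not (J C) ∧ not (K C)) of U * 10 + N * 6 ≤ s * N
          out = arith-outside s N (size I) (size J) (size K) _ hx hy small
            (≤-reflexive (trans (cong (_+ # (λ C → not (J C) ∧ not (K C)) of U) (sym (∑-+ U _ _))) (trans (sym (∑-+ U _ _)) (trans (∑-cong U (λ C → cases (x C) (y C))) (trans (∑-U m 1) (*-identityʳ N)))))) s-large
            where
            cases : ∀ a b → ⟦ a ∧ not b ⟧ + ⟦ b ∧ not a ⟧ + ⟦ not (a ∧ not b) ∧ not (b ∧ not a) ⟧ ≡ 1
            cases true true = refl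
            cases true false = refl
            cases false true = refl
            cases false false = refl

          proper-K : ∀ C → K C ≡ true → Proper C
          proper-K C h = ~-properʳ {B} {C} (∧-fst {y C} h)

          proper-J : ∀ C → J C ≡ true → Proper C
          proper-J C h = ~-properʳ {A} {C} (∧-fst {x C} h)

        same : Same hg
        same = record
          { X = rich J ; Y = rich K ; XX = JJ.frame ; YY = KK.frame ; XorY = rich-covers J K out ; X-↭ = rich-↭ J ; Y-↭ = rich-↭ K
          ; X-some = let C , j , h = JJ.inhabited in C , proper-J C j , h
          ; Y-some = let C , k , h = KK.inhabited in C , proper-K C k , h }

      module CaseO (big : N ≤ 40 * size I) where

        abstract
          Nj : s * size J ≤ 120 * N
          Nj = arith-small s N (size I) (size J) big IJ-small (power-pos m)

          Nk : s * size K ≤ 120 * N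
          Nk = arith-small s N (size I) (size K) big IK-small (power-pos m)

          I-large : 2 * N ≤ 5 * size I
          I-large = arith-I s N (size I) (size J) hx Nj s-large

          O-large : 2 * N ≤ 5 * size O
          O-large = arith-O s N (size I) (size O) (size I * size J) (size I * size K) (form I all) (form I I) (form I J) (form I K) (form I O)
            (form-degree I (λ C h → ~-properʳ {A} {C} (∧-fst {x C} h))) splitting (bad-sub {I} {I} I⊑x I⊑y) (form≤ I J) IJ-small (form≤ I K) IK-small (form≤ I O) big s-large (power-pos m)
            where
            cases : ∀ a b → 1 ≤ ⟦ a ∧ b ⟧ + (⟦ a ∧ not b ⟧ + (⟦ b ∧ not a ⟧ + ⟦ not a ∧ not b ⟧))
            cases true true = s≤s z≤n
            cases true false = s≤s z≤n
            cases false true = s≤s z≤n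
            cases false false = s≤s z≤n
            per : ∀ C E → ⟦ I C ⟧ * (1 * ⟦ adj C E ⟧) ≤ ⟦ I C ⟧ * (⟦ I E ⟧ * ⟦ adj C E ⟧) + (⟦ I C ⟧ * (⟦ J E ⟧ * ⟦ adj C E ⟧) + (⟦ I C ⟧ * (⟦ K E ⟧ * ⟦ adj C E ⟧) + ⟦ I C ⟧ * (⟦ O E ⟧ * ⟦ adj C E ⟧)))
            per C E = ≤-trans (*-monoʳ-≤ ⟦ I C ⟧ (*-monoˡ-≤ ⟦ adj C E ⟧ (cases (x E) (y E)))) (≤-reflexive (ring-11 ⟦ I C ⟧ ⟦ I E ⟧ ⟦ J E ⟧ ⟦ K E ⟧ ⟦ O E ⟧ ⟦ adj C E ⟧))
            splitting : form I all ≤ form I I + (form I J + (form I K + form I O))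
            splitting = ≤-trans (∑₂-mono U U per) (≤-reflexive (trans (∑₂-+ U U _ _) (cong (form I I +_) (trans (∑₂-+ U U _ _) (cong (form I J +_) (∑₂-+ U U _ _))))))

        module IO = NearComplete I O (2≤3 (dense-sub-x {I} {O} I⊑x O⊑cy)) I-large O-large

        abstract
          out : s * # (λ C → not (I C) ∧ not (O C)) of U * 10 + N * 6 ≤ s * N
          out = arith-outside′ s N (size J) (size K) _ Nj Nk (≤-trans (∑-mono U (λ C → cases (x C) (y C))) (≤-reflexive (∑-+ U _ _))) s-large
            where
            cases : ∀ a b → ⟦ not (a ∧ b) ∧ not (not a ∧ not b) ⟧ ≤ ⟦ a ∧ not b ⟧ + ⟦ b ∧ not a ⟧
            cases true true = z≤n
            cases true false = s≤s z≤n
            cases false true = s≤s z≤n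
            cases false false = z≤n

        diff : Diff hg
        diff = record
          { P = rich I ; Q = rich O ; PQ = IO.frame ; PorQ = rich-covers I O out ; P-↭ = rich-↭ I ; Q-↭ = rich-↭ O
          ; P-some = go IO.inhabited′ ; Q-some = go′ IO.inhabited }
          where
          go : (∃ λ E → O E ≡ true × rich I E ≡ true) → ∃ λ A → Proper A × rich I A ≡ true
          go (E , _ , h) = E , rich-proper I h , h
          go′ : (∃ λ E → I E ≡ true × rich O E ≡ true) → ∃ λ A → Proper A × rich O A ≡ true
          go′ (E , _ , h) = E , rich-proper O h , h

      outcome : Same hg ⊎ Diff hg
      outcome = [ (λ h → inj₁ (CaseE.same h)) , (λ h → inj₂ (CaseO.diff h)) ]′ (≤-total (40 * size I) N)

    abstract
      anyProper : ∃ Proper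
      anyProper = let w , l , u = freshSet {[]} m [] (≤-trans (m≤m+n m β) (≤-trans (≤-trans (m≤m*1 (m + β)) (≤-trans (*-mono-≤ {1} {s * 4} {(m + β) * 1} {(m + β) * m} (≤-trans (≤ᵇ⇒≤ 1 6000 tt) (≤-trans s-large (m*4 s))) (*-monoʳ-≤ (m + β) (s≤s z≤n))) (≤-reflexive (ring-25 s (m + β) m)))) n-large))
                  in w , unique-ˡ w u , l
        where
        m≤m*1 : ∀ a → a ≤ 1 * (a * 1)
        m≤m*1 a = ≤-reflexive (ring-12 a)
        m*4 : ∀ a → a ≤ a * 4
        m*4 a = ≤-trans (≤-reflexive (sym (*-identityʳ a))) (*-monoʳ-≤ a (s≤s z≤n))

    sparse : Part → Part → Bool
    sparse A B = does (s * ∑₂ U U (λ C E → ⟦ slot all all A B C E ⟧) ≤? N * N) ∧ (does (unique? A) ∧ does (unique? B))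

    abstract
      sparse-case : ∀ {A B} → A ∈ U → B ∈ U → sparse A B ≡ true → Same hg ⊎ Diff hg
      sparse-case {A} {B} A∈ B∈ h with ∧-elim {does (s * ∑₂ U U (λ C E → ⟦ slot all all A B C E ⟧) ≤? N * N)} h
      ... | h₁ , h₂ with ∧-elim {does (unique? A)} h₂
      ... | uA , uB = Bad.outcome A B (decided (unique? A) uA , tup-length m A∈) (decided (unique? B) uB , tup-length m B∈) (decided (_ ≤? _) h₁)

      dense-frame : (∀ A → A ∈ U → ∀ B → B ∈ U → sparse A B ≡ false) → Frame all all
      dense-frame h {A} {B} (uA , lA) (uB , lB) _ _ = go (bool-case (does (X ≤? N * N)))
        where
        X : ℕ
        X = s * ∑₂ U U (λ C E → ⟦ slot all all A B C E ⟧)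
        go : does (X ≤? N * N) ≡ true ⊎ does (X ≤? N * N) ≡ false → N * N ≤ X
        go (inj₁ p) = true≢false (∧-intro p (∧-intro (decide (unique? A) uA) (decide (unique? B) uB))) (h A (∈-tup m A lA) B (∈-tup m B lB))
        go (inj₂ p) = ≤-trans (n≤1+n _) (≰⇒> (undecided (X ≤? N * N) p))

      trichotomy : Same hg ⊎ Diff hg
      trichotomy with search U (λ A → does (1 ≤? # (sparse A) of U))
      ... | inj₁ (A , A∈ , h) = let B , B∈ , k = #-find U (sparse A) (decided (1 ≤? _) h) in sparse-case A∈ B∈ k
      ... | inj₂ none = inj₁ (record
        { X = all ; Y = all ; XX = dense-frame clear ; YY = dense-frame clear ; XorY = λ _ → inj₁ refl ; X-↭ = λ _ → refl ; Y-↭ = λ _ → refl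
        ; X-some = let A , p = anyProper in A , p , refl ; Y-some = let A , p = anyProper in A , p , refl })
        where
        clear : ∀ A → A ∈ U → ∀ B → B ∈ U → sparse A B ≡ false
        clear A A∈ B B∈ = [ (λ p → true≢false (decide (1 ≤? _) (#-pos (sparse A) B∈ p)) (none A A∈)) , id ]′ (bool-case (sparse A B))

module Absorb where

  open Base
  open Arithmetic
  open Hyper

  module Trails (hg : HG) where
    open HG hg

    -- A path through parts from A to B that uses exactly the vertices W.
    data Trail : Part → Part → List V → Set where
      part : ∀ {A} → Proper A → Trail A A A
      join : ∀ {A B C D W W′} → Trail A B W → B ~ C → Trail C D W′ → Trail A D (W ++ W′)
      perm′ : ∀ {A B W W′} → W ↭ W′ → Trail A B W → Trail A B W′

    reverse : ∀ {A B W} → Trail A B W → Trail B A W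
    reverse (part p) = part p
    reverse (join {B = B} {C} {W = W} {W′} t h t′) = perm′ (++-comm W′ W) (join (reverse t′) (~-sym {B} {C} h) (reverse t))
    reverse (perm′ p t) = perm′ p (reverse t)

    first-proper : ∀ {A B W} → Trail A B W → Proper A
    first-proper (part p) = p
    first-proper (join t _ _) = first-proper t
    first-proper (perm′ _ t) = first-proper t

    last-proper : ∀ {A B W} → Trail A B W → Proper B
    last-proper t = first-proper (reverse t)

    Absorbs : (List V → Set) → ℕ → Part → Part → List V → Set
    Absorbs Item K A B W = ∀ Ws → All Item Ws → length Ws ≤ K → Trail A B (W ++ concat Ws)

    trail-length : ∀ {A B W} → Trail A B W → ∃ λ k → length W ≡ m * k
    trail-length (part (u , l)) = 1 , trans l (sym (*-identityʳ m))
    trail-length (join {W = W} t _ t′) = let k , h = trail-length t ; k′ , h′ = trail-length t′ in k + k′ , trans (length-++ W) (trans (cong₂ _+_ h h′) (sym (*-distribˡ-+ m k k′)))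
    trail-length (perm′ p t) = let k , h = trail-length t in k , trans (sym (↭-length p)) h

    Hamilton : Set
    Hamilton = ∃ λ A → ∃ λ B → ∃ λ W → Trail A B W × B ~ A × W ↭ allFin n

    absorbs-plain : ∀ {Item K A B W} → Absorbs Item K A B W → Trail A B W
    absorbs-plain {W = W} a = perm′ (↭-reflexive (++-identityʳ W)) (a [] [] z≤n)

    trail-absorbs : ∀ {Item A B W} → Trail A B W → Absorbs Item 0 A B W
    trail-absorbs {W = W} t [] _ _ = perm′ (↭-reflexive (sym (++-identityʳ W))) t

    absorbs-join : ∀ {Item K K′ A B C D W W′} → Absorbs Item K A B W → B ~ C → Absorbs Item K′ C D W′ → Absorbs Item (K + K′) A D (W ++ W′)
    absorbs-join {Item} {K} {K′} {W = W} {W′} a h a′ Ws is l = perm′ p (join (a (take K Ws) (All′.take⁺ K is) lt) h (a′ (drop K Ws) (All′.drop⁺ K is) ld))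
      where
      import Data.List.Relation.Unary.All.Properties as All′
      open import Data.Nat.Properties using (m⊓n≤m; ∸-monoˡ-≤; m+n∸m≡n)
      lt : length (take K Ws) ≤ K
      lt = ≤-trans (≤-reflexive (length-take K Ws)) (m⊓n≤m K (length Ws))
      ld : length (drop K Ws) ≤ K′
      ld = ≤-trans (≤-reflexive (length-drop K Ws)) (≤-trans (∸-monoˡ-≤ K l) (≤-reflexive (m+n∸m≡n K K′)))
      p : (W ++ concat (take K Ws)) ++ (W′ ++ concat (drop K Ws)) ↭ (W ++ W′) ++ concat Ws
      p = ↭-trans (perm 4 (λ a b c d → (a ∙ b) ∙ (c ∙ d) ⊜ (a ∙ c) ∙ (b ∙ d)) ↭-refl W (concat (take K Ws)) W′ (concat (drop K Ws)))
            (++⁺ˡ (W ++ W′) (↭-reflexive (trans (sym (concat-++ (take K Ws) (drop K Ws))) (cong concat (take++drop≡id K Ws)))))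

    record Gap (F G A B : Part) (W : List V) : Set where
      constructor mkGap
      field
        {C E}   : Part
        {W₁ W₂} : List V
        front   : Trail F C W₁
        back    : Trail E G W₂
        CA      : C ~ A
        EB      : E ~ B
        whole   : W₁ ++ W₂ ↭ W

    fill : ∀ {F G A B W W′} → Gap F G A B W → Trail A B W′ → Trail F G (W ++ W′)
    fill {A = A} {B} {W} {W′} (mkGap {C} {E} {W₁} {W₂} front back CA EB whole) t =
      perm′ (↭-trans (perm 3 (λ a b c → a ∙ (c ∙ b) ⊜ (a ∙ b) ∙ c) ↭-refl W₁ W₂ W′) (++⁺ʳ W′ whole))
        (join front CA (join t (~-sym {E} {B} EB) back))

    gap-left : ∀ {F G F′ G′ A B W W′} → Trail F′ G′ W′ → G′ ~ F → Gap F G A B W → Gap F′ G A B (W′ ++ W)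
    gap-left {W′ = W′} t h (mkGap {W₁ = W₁} {W₂} front back CA EB whole) =
      mkGap (join t h front) back CA EB (↭-trans (↭-reflexive (++-assoc W′ W₁ W₂)) (++⁺ˡ W′ whole))

    module Framed {P Q : Pred} (frame : Frame P Q) where

      PQItem PairItem Item : List V → Set
      PQItem W = ∃ λ A → ∃ λ B → Trail A B W × P A ≡ true × Q B ≡ true
      PairItem W = ∃ λ W₁ → ∃ λ W₂ → W₁ ++ W₂ ↭ W × (∃ λ A → ∃ λ A′ → Trail A A′ W₁ × P A ≡ true × P A′ ≡ true) × (∃ λ B → ∃ λ B′ → Trail B B′ W₂ × Q B ≡ true × Q B′ ≡ true)
      Item W = PQItem W ⊎ PairItem W

      slot-unique : ∀ {F A B} (sl : Slot P Q F A B) → Unique F → Unique ((Slot.C sl ++ Slot.E sl) ++ F)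
      slot-unique (mkSlot C E AC CE EB QC PE offC offE) u = unique-++ (~-unique {C} {E} CE) u (λ i j → [ (λ k → offC k j) , (λ k → offE k j) ]′ (∈-++⁻ C i))

      slot-length : ∀ {F A B} (sl : Slot P Q F A B) → length (Slot.C sl ++ Slot.E sl) ≡ 2 * m
      slot-length (mkSlot C E AC CE EB QC PE offC offE) = trans (length-++ C) (cong₂ _+_ (~-length {C} {E} CE) (trans (~-lengthʳ {C} {E} CE) (sym (+-identityʳ m))))

      slot-trail : ∀ {F A B} (sl : Slot P Q F A B) → Trail (Slot.C sl) (Slot.E sl) (Slot.C sl ++ Slot.E sl)
      slot-trail (mkSlot C E AC CE EB QC PE offC offE) = join (part (~-properˡ {C} {E} CE)) CE (part (~-properʳ {C} {E} CE))

      record Round (Serves : Part → Part → Set) (F : List V) (c : ℕ) : Set where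
        constructor mkRound
        field
          {first last} : Part
          {W}    : List V
          Qfirst : Q first ≡ true
          Plast  : P last ≡ true
          trail  : Trail first last W
          serve  : ∀ {A B} → Serves A B → Gap first last A B W
          fresh  : Unique (W ++ F)
          short  : length W ≤ c

      Request : Set
      Request = Part × Part

      Valid : Request → Set
      Valid (A , B) = (Proper A × P A ≡ true) × (Proper B × Q B ≡ true)

      sift : (Request → Bool) → List Request → List Request
      sift p [] = []
      sift p (r ∷ rs) = if p r then sift p rs else r ∷ sift p rs

      sift-length : ∀ p rs → length (sift p rs) + # p of rs ≡ length rs
      sift-length p [] = refl
      sift-length p (r ∷ rs) with p r
      ... | true = trans (+-suc _ _) (cong suc (sift-length p rs))
      ... | false = cong suc (sift-length p rs)

      sift-∈ : ∀ p {rs r} → r ∈ rs → p r ≡ false → r ∈ sift p rs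
      sift-∈ p {r ∷ rs} (here refl) h rewrite h = here refl
      sift-∈ p {r ∷ rs} (there i) h with p r
      ... | true = sift-∈ p i h
      ... | false = there (sift-∈ p i h)

      ∈-sift : ∀ p {rs r} → r ∈ sift p rs → r ∈ rs × p r ≡ false
      ∈-sift p {r ∷ rs} i with p r in eq
      ∈-sift p {r ∷ rs} i | true = let j , h = ∈-sift p i in there j , h
      ∈-sift p {r ∷ rs} (here refl) | false = here refl , eq
      ∈-sift p {r ∷ rs} (there i) | false = let j , h = ∈-sift p i in there j , h

      meets : List V → Part → Part → Request → Bool
      meets F C E (A , B) = slotᶠ P Q F A B C E

      abstract
        good-slot : ∀ F → length F ≤ β → ∀ rs → (∀ {r} → r ∈ rs → Valid r) → ∃ λ C → ∃ λ E → length rs ≤ 2 * s * # (meets F C E) of rs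
        good-slot F F≤ rs valid =
          let C , _ , h = ∑-find U {λ _ → ∑ U (λ _ → length rs)} {λ C → ∑ U (λ E → g C E + 1)} total
              E , _ , k = ∑-find U {λ _ → length rs} {λ E → g C E + 1} h
          in C , E , ≤-pred (≤-trans k (≤-reflexive (+-comm _ 1)))
          where
          g : Part → Part → ℕ
          g C E = 2 * s * # (meets F C E) of rs
          each : ∀ r → r ∈ rs → N * N ≤ 2 * s * ∑₂ U U (λ C E → ⟦ meets F C E r ⟧)
          each (A , B) i = let (pA , PA) , (pB , QB) = valid i in frame-off frame F F≤ pA pB PA QB
          swapped : ∑ rs (λ r → ∑₂ U U (λ C E → ⟦ meets F C E r ⟧)) ≡ ∑₂ U U (λ C E → # (meets F C E) of rs)
          swapped = trans (∑-swap rs U _) (∑-cong U (λ C → ∑-swap rs U _))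
          size : ∀ c → ∑₂ U U (λ _ _ → c) ≡ N * (N * c)
          size c = trans (∑-cong U (λ _ → ∑-U m c)) (∑-U m (N * c))
          enough : ∑₂ U U (λ _ _ → length rs) ≤ ∑₂ U U g
          enough = ≤-trans (≤-reflexive (trans (size (length rs)) (trans (ring-37 N N (length rs)) (sym (∑-const rs (N * N)))))) (≤-trans (∑-mono∈ rs each)
            (≤-reflexive (trans (∑-* rs (2 * s) _) (trans (cong (2 * s *_) swapped) (trans (sym (∑-* U (2 * s) _)) (∑-cong U (λ C → sym (∑-* U (2 * s) _))))))))
          total : ∑₂ U U (λ _ _ → length rs) < ∑₂ U U (λ C E → g C E + 1)
          total = ≤-trans (s≤s enough) (≤-trans (≤-trans (≤-reflexive (+-comm 1 _)) (+-monoʳ-≤ (∑₂ U U g) (≤-trans (*-mono-≤ (power-pos m) (*-mono-≤ (power-pos m) (≤-refl {1}))) (≤-reflexive (sym (size 1)))))) (≤-reflexive (sym (∑₂-+ U U g (λ _ _ → 1)))))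

      q : ℕ
      q = pred (2 * s)

      abstract
        2s≡ : 2 * s ≡ suc q
        2s≡ = pos s (≤-trans (≤ᵇ⇒≤ 1 6000 tt) s-large)
          where
          pos : ∀ s → 1 ≤ s → 2 * s ≡ suc (pred (2 * s))
          pos (suc s) _ = refl

        decay : ∀ L len g rest → rest + g ≡ len → len ≤ 2 * s * g → len * q ^ suc L < (2 * s) ^ suc L → rest * q ^ L < (2 * s) ^ L
        decay L len g rest refl h k = *-cancelˡ-< (suc q) (rest * q ^ L) ((2 * s) ^ L)
            (≤-trans (s≤s (≤-trans step (≤-reflexive (ring-39 (rest + g) q (q ^ L))))) (≤-trans k (≤-reflexive (cong (_* (2 * s) ^ L) 2s≡))))
          where
          open import Data.Nat.Properties using (*-cancelˡ-<)
          h′ : rest + g ≤ suc q * g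
          h′ = subst (λ z → rest + g ≤ z * g) 2s≡ h
          less : suc q * rest ≤ q * (rest + g)
          less = lin {suc q * rest} {q * (rest + g)} 0 h′ (ring-38 rest g q)
          step : suc q * (rest * q ^ L) ≤ q * (rest + g) * q ^ L
          step = ≤-trans (≤-reflexive (sym (*-assoc (suc q) rest (q ^ L)))) (*-monoˡ-≤ (q ^ L) less)

      module Start {A₀ B₀ : Part} (pA₀ : Proper A₀) (PA₀ : P A₀ ≡ true) (pB₀ : Proper B₀) (QB₀ : Q B₀ ≡ true) where

        relax : ∀ {R : Part → Part → Set} {F c c′} → c ≤ c′ → Round R F c → Round R F c′
        relax l (mkRound Qf Pl t sv f sh) = mkRound Qf Pl t sv f (≤-trans sh l)

        startRound : ∀ F → length F ≤ β → Unique F → ∀ {R : Part → Part → Set} → (∀ {A B} → ¬ R A B) → Round R F (2 * m)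
        startRound F F≤ u none = let sl = frame-slot frame F F≤ pA₀ pB₀ PA₀ QB₀ in
          mkRound (Slot.QC sl) (Slot.PE sl) (slot-trail sl) (λ r → ⊥-elim (none r)) (slot-unique sl u) (≤-reflexive (slot-length sl))

        module AddSlot {F c} {C E : Part} (QC : Q C ≡ true) (PE : P E ≡ true) (CE : C ~ E) (u : Unique ((C ++ E) ++ F))
          {R R′ : Part → Part → Set} (rd : Round R ((C ++ E) ++ F) c) (small : 2 * m + c + length F ≤ β)
          (cover : ∀ {A B} → R′ A B → (A ~ C × E ~ B) ⊎ R A B) where
          open Round rd

          lCE : length (C ++ E) ≡ 2 * m
          lCE = trans (length-++ C) (cong₂ _+_ (~-length {C} {E} CE) (trans (~-lengthʳ {C} {E} CE) (sym (+-identityʳ m))))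

          used : List V
          used = W ++ ((C ++ E) ++ F)

          used≤ : length used ≤ β
          used≤ = ≤-trans (≤-reflexive (trans (length-++ W) (cong (length W +_) (trans (length-++ (C ++ E)) (cong (_+ length F) lCE)))))
                    (≤-trans (+-monoˡ-≤ _ short) (≤-trans (≤-reflexive (ring-31 m c (length F))) small))

          module Linked (sl : Slot P Q used E first) where
            X Y : Part
            X = Slot.C sl
            Y = Slot.E sl

            before : Trail C Y ((C ++ E) ++ (X ++ Y))
            before = join (join (part (~-properˡ {C} {E} CE)) CE (part (~-properʳ {C} {E} CE))) (Slot.AC sl) (slot-trail sl)

            after : Trail E last (E ++ ((X ++ Y) ++ W))
            after = join (part (~-properʳ {C} {E} CE)) (Slot.AC sl) (join (slot-trail sl) (Slot.EB sl) trail)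

            W′ : List V
            W′ = ((C ++ E) ++ (X ++ Y)) ++ W

            abstract
              fresh′ : Unique (W′ ++ F)
              fresh′ = Unique-↭ (perm 4 (λ x w ce f → x ∙ (w ∙ (ce ∙ f)) ⊜ ((ce ∙ x) ∙ w) ∙ f) ↭-refl (X ++ Y) W (C ++ E) F) (slot-unique sl fresh)

              short′ : length W′ ≤ 4 * m + c
              short′ = ≤-trans (≤-reflexive (trans (length-++ ((C ++ E) ++ (X ++ Y))) (cong (_+ length W) (trans (length-++ (C ++ E)) (cong₂ _+_ lCE (slot-length sl))))))
                 (≤-trans (+-monoʳ-≤ (2 * m + 2 * m) short) (≤-reflexive (ring-30 m c)))

              rearrange : C ++ (E ++ ((X ++ Y) ++ W)) ↭ W′
              rearrange = perm 4 (λ c e x w → c ∙ (e ∙ (x ∙ w)) ⊜ ((c ∙ e) ∙ x) ∙ w) ↭-refl C E (X ++ Y) W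

            serve′ : ∀ {A B} → R′ A B → Gap C last A B W′
            serve′ {A} {B} r = [ (λ h → mkGap (part (~-properˡ {C} {E} CE)) after (~-sym {A} {C} (proj₁ h)) (proj₂ h) rearrange)
                               , (λ h → gap-left before (Slot.EB sl) (serve h)) ]′ (cover r)

            result : Round R′ F (4 * m + c)
            result = mkRound {W = W′} QC Plast (join before (Slot.EB sl) trail) serve′ fresh′ short′

          abstract
            added : Round R′ F (4 * m + c)
            added = Linked.result (frame-slot frame used used≤ (~-properʳ {C} {E} CE) (first-proper trail) PE Qfirst)

        cost : ℕ → ℕ
        cost zero = 2 * m
        cost (suc L) = 4 * m + cost L

        serveAll : ∀ L rs → (∀ {r} → r ∈ rs → Valid r) → length rs * q ^ L < (2 * s) ^ L → ∀ F → Unique F → cost L + length F ≤ β → Round (λ A B → (A , B) ∈ rs) F (cost L)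
        serveAll L [] valid h F u small = relax (low L) (startRound F (≤-trans (m≤n+m _ (cost L)) small) u (λ ()))
          where
          low : ∀ L → 2 * m ≤ cost L
          low zero = ≤-refl
          low (suc L) = ≤-trans (low L) (m≤n+m (cost L) (4 * m))
        serveAll zero (r ∷ rs) valid (s≤s ()) F u small
        serveAll (suc L) rs@(_ ∷ _) valid h F u small = build (good-slot F (≤-trans (m≤n+m _ (cost (suc L))) small) rs valid)
          where
          build : (∃ λ C → ∃ λ E → length rs ≤ 2 * s * # (meets F C E) of rs) → Round (λ A B → (A , B) ∈ rs) F (cost (suc L))
          build (C , E , g) = finish (#-find rs p (positive (# p of rs) g))
            where
            p = meets F C E
            positive : ∀ k → length rs ≤ 2 * s * k → 1 ≤ k
            positive (suc k) _ = s≤s z≤n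
            positive zero h = ⊥-elim (1+n≰n (≤-trans (s≤s z≤n) (≤-trans h (≤-reflexive (*-zeroʳ (2 * s))))))
            finish : (∃ λ r → r ∈ rs × p r ≡ true) → Round (λ A B → (A , B) ∈ rs) F (cost (suc L))
            finish ((A , B) , i , pr) = AddSlot.added (∧-parts₁ pr) (∧-parts₂ pr) (∧-parts₃ pr) u′
                (serveAll L (sift p rs) (λ i → valid (proj₁ (∈-sift p i))) (decay L (length rs) (# p of rs) (length (sift p rs)) (sift-length p rs) g h) ((C ++ E) ++ F) u′
                  (≤-trans (≤-reflexive (cong (cost L +_) (trans (length-++ (C ++ E)) (cong (_+ length F) lCE)))) (≤-trans (≤-reflexive (ring-31 m (cost L) (length F))) small′)))
                small′ cases
              where
              slotOf : ∀ {A B} → p (A , B) ≡ true → (A ~ C × E ~ B) × (C ~ E × Q C ≡ true × P E ≡ true × Disj C F × Disj E F)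
              slotOf {A} {B} h with ∧-elim {slot P Q A B C E} h
              ... | h₁ , h₂ with ∧-elim {adj A C} h₁ | ∧-elim {not (hits F C)} h₂
              ... | ac , h₃ | c , e′ with ∧-elim {adj C E} h₃
              ... | ce , h₄ with ∧-elim {adj E B} h₄
              ... | eb , h₅ with ∧-elim {Q C} h₅
              ... | qc , pe = (ac , eb) , (ce , qc , pe , hits-disj F C (not-true c) , hits-disj F E (not-true e′))
              ∧-parts₁ : p (A , B) ≡ true → Q C ≡ true
              ∧-parts₁ h = proj₁ (proj₂ (proj₂ (slotOf h)))
              ∧-parts₂ : p (A , B) ≡ true → P E ≡ true
              ∧-parts₂ h = proj₁ (proj₂ (proj₂ (proj₂ (slotOf h))))
              ∧-parts₃ : p (A , B) ≡ true → C ~ E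
              ∧-parts₃ h = proj₁ (proj₂ (slotOf h))
              lCE : length (C ++ E) ≡ 2 * m
              lCE = trans (length-++ C) (cong₂ _+_ (~-length {C} {E} (∧-parts₃ pr)) (trans (~-lengthʳ {C} {E} (∧-parts₃ pr)) (sym (+-identityʳ m))))
              u′ : Unique ((C ++ E) ++ F)
              u′ with slotOf pr
              ... | _ , (ce , _ , _ , dc , de) = unique-++ (~-unique {C} {E} ce) u (λ i j → [ (λ k → dc k j) , (λ k → de k j) ]′ (∈-++⁻ C i))
              small′ : 2 * m + cost L + length F ≤ β
              small′ = ≤-trans (+-monoˡ-≤ (length F) (+-monoˡ-≤ (cost L) (*-monoˡ-≤ m {2} {4} (s≤s (s≤s z≤n))))) small
              cases : ∀ {A B} → (A , B) ∈ rs → (A ~ C × E ~ B) ⊎ ((A , B) ∈ sift p rs)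
              cases {A} {B} i = [ (λ h → inj₁ (proj₁ (slotOf h))) , (λ h → inj₂ (sift-∈ p i h)) ]′ (bool-case (p (A , B)))

        cost≡ : ∀ L → cost L ≡ 4 * m * L + 2 * m
        cost≡ zero = cong (_+ 2 * m) (sym (*-zeroʳ (4 * m)))
        cost≡ (suc L) = trans (cong (4 * m +_) (cost≡ L)) (ring-40 m L)

        Good : Part → Part → Set
        Good A B = Valid (A , B)

        round : ∀ F → Unique F → cost L + length F ≤ β → Round Good F (cost L)
        round F u small = record { Qfirst = Qfirst ; Plast = Plast ; trail = trail ; fresh = fresh ; short = short
            ; serve = λ {A} {B} v → serve (sift-∈ invalid (∈-cartesianProduct⁺ (∈-tup m A (proj₂ (proj₁ (proj₁ v)))) (∈-tup m B (proj₂ (proj₁ (proj₂ v))))) (valid→ v)) }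
          where
          open import Data.List.Base using (cartesianProduct)
          open import Data.List.Membership.Propositional.Properties using (∈-cartesianProduct⁺)
          length-product : ∀ (xs ys : List Part) → length (cartesianProduct xs ys) ≡ length xs * length ys
          length-product [] ys = refl
          length-product (x ∷ xs) ys = trans (length-++ (map (x ,_) ys)) (cong₂ _+_ (length-map (x ,_) ys) (length-product xs ys))
          proper? : Part → Bool
          proper? A = does (unique? A) ∧ does (length A ≟ℕ m)
          invalid : Request → Bool
          invalid (A , B) = not ((proper? A ∧ P A) ∧ (proper? B ∧ Q B))
          proper→ : ∀ {A} → Proper A → proper? A ≡ true
          proper→ {A} (u , l) = ∧-intro (decide (unique? A) u) (decide (length A ≟ℕ m) l)
          proper← : ∀ {A} → proper? A ≡ true → Proper A
          proper← {A} h = let a , b = ∧-elim {does (unique? A)} h in decided (unique? A) a , decided (length A ≟ℕ m) b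
          valid→ : ∀ {A B} → Valid (A , B) → invalid (A , B) ≡ false
          valid→ ((pA , PA) , (pB , QB)) rewrite ∧-intro (∧-intro (proper→ pA) PA) (∧-intro (proper→ pB) QB) = refl
          valid← : ∀ {A B} → invalid (A , B) ≡ false → Valid (A , B)
          valid← {A} {B} h = let a , b = ∧-elim {proper? A ∧ P A} (notf _ h) ; c , d = ∧-elim {proper? A} a ; e , f = ∧-elim {proper? B} b in (proper← c , d) , (proper← e , f)
            where
            notf : ∀ b → not b ≡ false → b ≡ true
            notf true _ = refl
          rs = sift invalid (cartesianProduct U U)
          len : length rs ≤ N * N
          len = ≤-trans (m≤m+n _ _) (≤-reflexive (trans (sift-length invalid (cartesianProduct U U)) (trans (length-product U U) (cong₂ _*_ (length-tup m) (length-tup m)))))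
          r = serveAll L rs (λ i → valid← (proj₂ (∈-sift invalid {cartesianProduct U U} i))) (≤-trans (s≤s (*-monoˡ-≤ (q ^ L) len)) L-large) F u small
          open Round r

        record Absorber (K : ℕ) (F : List V) (c : ℕ) : Set where
          constructor mkAbsorber
          field
            {first last} : Part
            {W}     : List V
            Qfirst  : Q first ≡ true
            Plast   : P last ≡ true
            absorbs : Absorbs Item K first last W
            fresh   : Unique (W ++ F)
            short   : length W ≤ c

        plain : ∀ {K F c} (a : Absorber K F c) → Trail (Absorber.first a) (Absorber.last a) (Absorber.W a)
        plain a = absorbs-plain (Absorber.absorbs a)

        module TwoRounds {F c} (r : Round Good F c) (r′ : Round Good (Round.W r ++ F) c)
          (sl : Slot P Q (Round.W r′ ++ (Round.W r ++ F)) (Round.last r) (Round.first r′)) where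
          private
            module R = Round r
            module R′ = Round r′

          X Y : Part
          X = Slot.C sl
          Y = Slot.E sl

          total : List V
          total = (R.W ++ (X ++ Y)) ++ R′.W

          abstract
            fresh₂ : Unique (total ++ F)
            fresh₂ = Unique-↭ (perm 4 (λ x r r′ f → x ∙ (r′ ∙ (r ∙ f)) ⊜ ((r ∙ x) ∙ r′) ∙ f) ↭-refl (X ++ Y) R.W R′.W F) (slot-unique sl R′.fresh)

            short₂ : length total ≤ 2 * c + 2 * m
            short₂ = ≤-trans (≤-reflexive (trans (length-++ (R.W ++ (X ++ Y))) (cong (_+ length R′.W) (trans (length-++ R.W) (cong (length R.W +_) (slot-length sl))))))
              (≤-trans (+-monoˡ-≤ (2 * m) R.short ⊕ R′.short) (≤-reflexive (ring-32 m c)))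

          first-half : Trail R.first Y (R.W ++ (X ++ Y))
          first-half = join R.trail (Slot.AC sl) (slot-trail sl)
          whole : Trail R.first R′.last ((R.W ++ (X ++ Y)) ++ R′.W)
          whole = join first-half (Slot.EB sl) R′.trail
          one : ∀ W → Item W → Trail R.first R′.last (total ++ W)
          one W (inj₁ (A , B , t , PA , QB)) = perm′ (perm 4 (λ r x r′ w → (r ∙ w) ∙ (x ∙ r′) ⊜ ((r ∙ x) ∙ r′) ∙ w) ↭-refl R.W (X ++ Y) R′.W W)
            (join (fill (R.serve ((first-proper t , PA) , (last-proper t , QB))) t) (Slot.AC sl) (join (slot-trail sl) (Slot.EB sl) R′.trail))
          one W (inj₂ (V₁ , V₂ , split , (A , A′ , t , PA , PA′) , (B , B′ , t′ , QB , QB′))) =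
              perm′ (↭-trans rearr (++⁺ˡ total split))
                (join G.front G.CA (join t (~-sym {G′.C} {A′} G′.CA) (join (reverse middle) G.EB (join t′ (~-sym {G′.E} {B′} G′.EB) G′.back))))
            where
            -- Reversing the stretch between the two gaps turns a P–P path and a Q–Q path into one path.
            module G = Gap (R.serve ((first-proper t , PA) , (first-proper t′ , QB)))
            module G′ = Gap (R′.serve ((last-proper t , PA′) , (last-proper t′ , QB′)))
            middle : Trail G.E G′.C (G.W₂ ++ ((X ++ Y) ++ G′.W₁))
            middle = join G.back (Slot.AC sl) (join (slot-trail sl) (Slot.EB sl) G′.front)
            rearr : G.W₁ ++ (V₁ ++ ((G.W₂ ++ ((X ++ Y) ++ G′.W₁)) ++ (V₂ ++ G′.W₂))) ↭ total ++ (V₁ ++ V₂)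
            rearr = ↭-trans (perm 7 (λ a v b x c w d → a ∙ (v ∙ ((b ∙ (x ∙ c)) ∙ (w ∙ d))) ⊜ (((a ∙ b) ∙ x) ∙ (c ∙ d)) ∙ (v ∙ w)) ↭-refl G.W₁ V₁ G.W₂ (X ++ Y) G′.W₁ V₂ G′.W₂)
              (++⁺ʳ (V₁ ++ V₂) (++⁺ (++⁺ʳ (X ++ Y) G.whole) G′.whole))
          absorb : Absorbs Item 1 R.first R′.last total
          absorb [] _ _ = perm′ (↭-reflexive (sym (++-identityʳ total))) whole
          absorb (W ∷ []) (i ∷ []) _ = perm′ (++⁺ˡ total (↭-reflexive (sym (++-identityʳ W)))) (one W i)
          absorb (_ ∷ _ ∷ _) _ (s≤s ())

          result : Absorber 1 F (2 * c + 2 * m)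
          result = mkAbsorber {W = total} R.Qfirst R′.Plast absorb fresh₂ short₂

        abstract
          twoRounds : ∀ F → Unique F → 2 * cost L + length F ≤ β → Absorber 1 F (2 * cost L + 2 * m)
          twoRounds F u small = step (round F u (≤-trans (+-monoˡ-≤ (length F) (m≤m+n c (c + 0))) small))
            where
            c : ℕ
            c = cost L
            step : Round Good F c → Absorber 1 F (2 * c + 2 * m)
            step r = step₂ (round (Round.W r ++ F) (Round.fresh r) used≤)
              where
              used≤ : c + length (Round.W r ++ F) ≤ β
              used≤ = ≤-trans (+-monoʳ-≤ c (≤-trans (≤-reflexive (length-++ (Round.W r))) (+-monoˡ-≤ (length F) (Round.short r)))) (≤-trans (≤-reflexive (ring-33 c (length F))) small)
              step₂ : Round Good (Round.W r ++ F) c → Absorber 1 F (2 * c + 2 * m)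
              step₂ r′ = TwoRounds.result r r′ (frame-slot frame _ (≤-trans (≤-reflexive (length-++ (Round.W r′))) (≤-trans (+-monoˡ-≤ _ (Round.short r′)) used≤))
                (last-proper (Round.trail r)) (first-proper (Round.trail r′)) (Round.Plast r) (Round.Qfirst r′))

        perItem : ℕ
        perItem = 2 * cost L + 4 * m

        module Chain {K F c c′} (a : Absorber 1 F c) (a′ : Absorber K (Absorber.W a ++ F) c′)
          (sl : Slot P Q (Absorber.W a′ ++ (Absorber.W a ++ F)) (Absorber.last a) (Absorber.first a′)) where
          private
            module A = Absorber a
            module A′ = Absorber a′

          X Y : Part
          X = Slot.C sl
          Y = Slot.E sl

          total : List V
          total = A.W ++ ((X ++ Y) ++ A′.W)

          abstract
            fresh₂ : Unique (total ++ F)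
            fresh₂ = Unique-↭ (perm 4 (λ x r r′ f → x ∙ (r′ ∙ (r ∙ f)) ⊜ (r ∙ (x ∙ r′)) ∙ f) ↭-refl (X ++ Y) A.W A′.W F) (slot-unique sl A′.fresh)

            short₂ : length total ≤ c + 2 * m + c′
            short₂ = ≤-trans (≤-reflexive (trans (length-++ A.W) (trans (cong (length A.W +_) (trans (length-++ (X ++ Y)) (cong (_+ length A′.W) (slot-length sl)))) (sym (+-assoc (length A.W) (2 * m) _)))))
              (+-monoˡ-≤ (2 * m) A.short ⊕ A′.short)

          result : Absorber (suc K) F (c + 2 * m + c′)
          result = mkAbsorber {W = total} A.Qfirst A′.Plast (absorbs-join A.absorbs (Slot.AC sl) (absorbs-join {K = 0} (trail-absorbs (slot-trail sl)) (Slot.EB sl) A′.absorbs)) fresh₂ short₂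

        abstract
          weaken : ∀ {K K′ F c c′} → K′ ≤ K → c ≤ c′ → Absorber K F c → Absorber K′ F c′
          weaken k l a = mkAbsorber Qfirst Plast (λ Ws is h → absorbs Ws is (≤-trans h k)) fresh (≤-trans short l)
            where open Absorber a

          absorber : ∀ K F → Unique F → suc K * perItem + length F ≤ β → Absorber K F (suc K * perItem)
          absorber zero F u small = weaken z≤n (≤-trans (+-monoʳ-≤ (2 * cost L) (*-monoˡ-≤ m {2} {4} (s≤s (s≤s z≤n)))) (m≤m+n perItem 0))
            (twoRounds F u (≤-trans (+-monoˡ-≤ (length F) (≤-trans (m≤m+n (2 * cost L) (4 * m)) (m≤m+n perItem 0))) small))
          absorber (suc K) F u small = step (twoRounds F u (≤-trans (+-monoˡ-≤ (length F) (≤-trans (m≤m+n (2 * cost L) (4 * m)) (m≤m+n perItem _))) small))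
            where
            step : Absorber 1 F (2 * cost L + 2 * m) → Absorber (suc K) F (suc (suc K) * perItem)
            step a = step₂ (absorber K (A.W ++ F) A.fresh used≤)
              where
              module A = Absorber a
              used≤ : suc K * perItem + length (A.W ++ F) ≤ β
              used≤ = ≤-trans (+-monoʳ-≤ (suc K * perItem) (≤-trans (≤-reflexive (length-++ A.W)) (+-monoˡ-≤ (length F) A.short)))
                (≤-trans (m≤m+n _ (2 * m)) (≤-trans (≤-reflexive (ring-35 m (cost L) (suc K * perItem) (length F))) small))
              step₂ : Absorber K (A.W ++ F) (suc K * perItem) → Absorber (suc K) F (suc (suc K) * perItem)
              step₂ a′ = weaken ≤-refl (≤-reflexive (ring-34 m (cost L) (suc K * perItem))) (Chain.result a a′
                (frame-slot frame _ (≤-trans (≤-reflexive (length-++ (Absorber.W a′))) (≤-trans (+-monoˡ-≤ _ (Absorber.short a′)) used≤))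
                  (last-proper (plain a)) (first-proper (plain a′)) A.Plast (Absorber.Qfirst a′)))

          abs-length : ∀ j J → suc J ≤ j * (m * suc K) → suc J * perItem ≤ 8 * j * unit
          abs-length j J h = ≤-trans (*-monoˡ-≤ perItem h) (≤-reflexive (trans (cong (λ z → j * (m * suc K) * (2 * z + 4 * m)) (cost≡ L)) (ring-36 j m L K)))

          makeAbsorber : ∀ j J F → suc J ≤ j * (m * suc K) → Unique F → 8 * j * unit + length F ≤ β → Absorber J F (8 * j * unit)
          makeAbsorber j J F h u small = weaken ≤-refl (abs-length j J h) (absorber J F u (≤-trans (+-monoˡ-≤ (length F) (abs-length j J h)) small))

module Cover where

  open Base
  open Arithmetic
  open Hyper
  open Absorb

  module _ {A : Set} where

    takeTrue : ∀ (p : A → Bool) k xs → k ≤ # p of xs → ∃ λ ys → ∃ λ zs → xs ↭ ys ++ zs × length ys ≡ k × (∀ {y} → y ∈ ys → p y ≡ true)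
    takeTrue p zero xs h = [] , xs , ↭-refl , refl , λ ()
    takeTrue p (suc k) (x ∷ xs) h with p x in eq
    ... | false = let ys , zs , q , l , t = takeTrue p (suc k) xs h in ys , x ∷ zs , ↭-trans (prep x q) (↭-sym (shift x ys zs)) , l , t
    ... | true = let ys , zs , q , l , t = takeTrue p k xs (≤-pred h) in x ∷ ys , zs , prep x q , cong suc l , λ { (here refl) → eq ; (there i) → t i }

    concatMap-↭ : ∀ {B : Set} (f : A → List B) {xs ys} → xs ↭ ys → concatMap f xs ↭ concatMap f ys
    concatMap-↭ f p = concat-↭ (map⁺ f p)

    concatMap-++ : ∀ {B : Set} (f : A → List B) xs ys → concatMap f (xs ++ ys) ≡ concatMap f xs ++ concatMap f ys
    concatMap-++ f [] ys = refl
    concatMap-++ f (x ∷ xs) ys = trans (cong (f x ++_) (concatMap-++ f xs ys)) (sym (++-assoc (f x) (concatMap f xs) (concatMap f ys)))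

    length-concatMap : ∀ {B : Set} (f : A → List B) xs → length (concatMap f xs) ≡ ∑ xs (λ x → length (f x))
    length-concatMap f [] = refl
    length-concatMap f (x ∷ xs) = trans (length-++ (f x)) (cong (length (f x) +_) (length-concatMap f xs))

    concatMap-∙ : ∀ {B : Set} (f g : A → List B) xs → concatMap (λ x → f x ++ g x) xs ↭ concatMap f xs ++ concatMap g xs
    concatMap-∙ f g [] = ↭-refl
    concatMap-∙ f g (x ∷ xs) = ↭-trans (++⁺ˡ (f x ++ g x) (concatMap-∙ f g xs)) (perm 4 (λ a b c d → (a ∙ b) ∙ (c ∙ d) ⊜ (a ∙ c) ∙ (b ∙ d)) ↭-refl (f x) (g x) (concatMap f xs) (concatMap g xs))

    all-∈ : ∀ {P : A → Set} {xs x} → All P xs → x ∈ xs → P x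
    all-∈ (p ∷ _) (here refl) = p
    all-∈ (_ ∷ ps) (there i) = all-∈ ps i

    all-++ : ∀ {P : A → Set} {xs ys} → All P xs → All P ys → All P (xs ++ ys)
    all-++ [] q = q
    all-++ (p ∷ ps) q = p ∷ all-++ ps q

  module Covering (hg : HG) where
    open HG hg renaming (κ to c; κ-pos to c-pos)
    open Trails hg

    Path : Set
    Path = Part × List Part

    Chain : Part → List Part → Set
    Chain A [] = Proper A
    Chain A (B ∷ ps) = A ~ B × Chain B ps

    IsPath : Path → Set
    IsPath (A , ps) = Chain A ps

    verts : Path → List V
    verts (A , ps) = A ++ concat ps

    parts : Path → ℕ
    parts (A , ps) = suc (length ps)

    chain-head : ∀ A ps → Chain A ps → Proper A
    chain-head A [] p = p
    chain-head A (B ∷ ps) (h , _) = ~-properˡ {A} {B} h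

    chain-prefix : ∀ A xs {ys} → Chain A (xs ++ ys) → Chain A xs
    chain-prefix A [] {ys} c = chain-head A ys c
    chain-prefix A (B ∷ xs) (h , c) = h , chain-prefix B xs c

    chain-suffix : ∀ A xs {B ys} → Chain A (xs ++ B ∷ ys) → Chain B ys
    chain-suffix A [] (h , c) = c
    chain-suffix A (C ∷ xs) (h , c) = chain-suffix C xs c

    chain-length : ∀ A ps → Chain A ps → length (A ++ concat ps) ≡ m * suc (length ps)
    chain-length A [] (u , l) = trans (cong length (++-identityʳ A)) (trans l (sym (*-identityʳ m)))
    chain-length A (B ∷ ps) (h , c) = trans (length-++ A) (trans (cong₂ _+_ (~-length {A} {B} h) (chain-length B ps c)) (sym (*-suc m (suc (length ps)))))

    Rig : Set
    Rig = Path × List V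

    rigVerts : Rig → List V
    rigVerts (π , T) = verts π ++ T

    IsRig : Rig → Set
    IsRig (π , T) = IsPath π × length T ≡ μ

    hit : Rig → V → Bool
    hit ((A , ps) , T) y = e (y ∷ T ++ A)

    extend : Rig → V → Path
    extend ((A , ps) , T) y = y ∷ T , A ∷ ps

    extend-path : ∀ r y → IsRig r → hit r y ≡ true → IsPath (extend r y)
    extend-path ((A , ps) , T) y (c , l) h = edge-~ {y ∷ T} {A} (cong suc l) h , c

    extend-verts : ∀ r y → verts (extend r y) ↭ y ∷ rigVerts r
    extend-verts ((A , ps) , T) y = prep y (++-comm T (A ++ concat ps))

    removeAt : ∀ {r : Rig} {os} → r ∈ os → ∃ λ os′ → os ↭ r ∷ os′
    removeAt i with ∈-∃++ i
    ... | a , b , refl = a ++ b , shift _ a b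

    partsSum : List Rig → ℕ
    partsSum os = ∑ os (λ r → parts (proj₁ r))

    all-↭ : ∀ {A : Set} {P : A → Set} {xs ys : List A} → xs ↭ ys → All P xs → All P ys
    all-↭ = All-resp-↭
      where open import Data.List.Relation.Binary.Permutation.Propositional.Properties using (All-resp-↭)

    record Distributed (ys : List V) (os : List Rig) : Set where
      field
        news   : List Path
        olds   : List Rig
        paths  : All IsPath news
        rigs   : All IsRig olds
        count  : length news + length olds ≡ length os
        weight : ∑ news parts + partsSum olds ≡ partsSum os + length ys
        whole  : concatMap verts news ++ concatMap rigVerts olds ↭ ys ++ concatMap rigVerts os

    abstract
      distribute : ∀ ys os → All IsRig os → (∀ {y} → y ∈ ys → length ys ≤ # (λ r → hit r y) of os) → Distributed ys os
      distribute [] os rigs h = record { news = [] ; olds = os ; paths = [] ; rigs = rigs ; count = refl ; weight = sym (+-identityʳ _) ; whole = ↭-refl }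
      distribute (y ∷ ys) os rigs h = chosen (#-find os (λ r → hit r y) (≤-trans (s≤s z≤n) (h (here refl))))
        where
        chosen : (∃ λ r → r ∈ os × hit r y ≡ true) → Distributed (y ∷ ys) os
        chosen (r , i , hr) = go (removeAt i)
          where
          go : (∃ λ os′ → os ↭ r ∷ os′) → Distributed (y ∷ ys) os
          go (os′ , p) = combine (all-↭ p rigs)
            where
            enough : ∀ {z} → z ∈ ys → length ys ≤ # (λ r → hit r z) of os′
            enough {z} j = ≤-pred (≤-trans (h (there j)) (≤-trans (≤-reflexive (∑-↭ _ p)) (+-monoˡ-≤ _ (⟦⟧≤1 (hit r z)))))
            combine : All IsRig (r ∷ os′) → Distributed (y ∷ ys) os
            combine (rig ∷ rigs′) = record
              { news = extend r y ∷ news ; olds = olds ; paths = extend-path r y rig hr ∷ paths ; rigs = D.rigs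
              ; count = trans (cong suc count) (sym (↭-length p))
              ; weight = trans (cong suc (trans (+-assoc (parts (proj₁ r)) (∑ news parts) _) (cong (parts (proj₁ r) +_) weight)))
                  (trans (ring-41 (parts (proj₁ r)) (partsSum os′) (length ys)) (cong (_+ suc (length ys)) (sym (∑-↭ (λ r → parts (proj₁ r)) p))))
              ; whole = ↭-trans (↭-reflexive (++-assoc (verts (extend r y)) (concatMap verts news) _)) (↭-trans (++⁺ (extend-verts r y) whole)
                  (prep y (↭-trans (shifts (rigVerts r) ys) (++⁺ˡ ys (↭-sym (concatMap-↭ rigVerts p)))))) }
              where
              module D = Distributed (distribute ys os′ rigs′ enough)
              open D

    module Improve {F Xs : List V} (F≤β : length F ≤ β) (all≡ : allFin n ↭ F ++ Xs) where

      R : ℕ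
      R = 5 * c + 2

      K≤β : K ≤ β
      K≤β = ≤-trans (n≤1+n K) (≤-trans K≤unit (≤-trans (≤-reflexive (sym (+-identityʳ unit))) (units≤β 1 (≤ᵇ⇒≤ 1 5000 tt))))

      record State : Set where
        constructor mkState
        field
          πs    : List Path
          left  : List V
          paths : All IsPath πs
          whole : concatMap verts πs ++ left ↭ Xs

        count weight : ℕ
        count = length πs
        weight = ∑ πs parts

      module _ (good : V → Bool) where

        goods : List Part → ℕ
        goods ps = # good of concat ps

        -- A stretch of at most 4c parts that is worth dissolving: its good vertices pay for
        -- the parts lost and, unless it is an end of its path, for the extra path.
        data Stretch : List Part → Set where
          end    : ∀ pre chunk → length chunk ≤ 4 * c → length chunk < goods chunk → Stretch (pre ++ chunk ++ [])
          middle : ∀ pre chunk B post → length chunk ≤ 4 * c → length chunk + c < goods chunk → Stretch (pre ++ chunk ++ B ∷ post)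

        extendˡ : ∀ xs {ps} → Stretch ps → Stretch (xs ++ ps)
        extendˡ xs (end pre chunk l g) = subst Stretch (++-assoc xs pre (chunk ++ [])) (end (xs ++ pre) chunk l g)
        extendˡ xs (middle pre chunk B post l g) = subst Stretch (++-assoc xs pre (chunk ++ B ∷ post)) (middle (xs ++ pre) chunk B post l g)

        abstract
          goods-++ : ∀ xs ys → goods (xs ++ ys) ≡ goods xs + goods ys
          goods-++ xs ys = trans (cong (# good of_) (concat-++ xs ys)) (#-++ (concat xs) (concat ys) good)

          stretch : ∀ fuel ps → length ps ≤ fuel → Stretch ps ⊎ 4 * goods ps ≤ 5 * length ps
          stretch fuel [] h = inj₂ z≤n
          stretch (suc fuel) ps@(P ∷ ps′) h with length ps ≤? 4 * c
          ... | yes short with length ps <? goods ps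
          ... | yes g = inj₁ (subst Stretch (++-identityʳ ps) (end [] ps short g))
          ... | no g = inj₂ (≤-trans (4 ⊗ ≮⇒≥ g) (*-monoˡ-≤ (length ps) {4} {5} (n≤1+n 4)))
          stretch (suc fuel) ps@(P ∷ ps′) h | no long with split (4 * c) ps (≤-trans (n≤1+n _) (≰⇒> long))
          ... | chunk , [] , eq , l = ⊥-elim (long (≤-reflexive (trans (cong length eq) (trans (cong length (++-identityʳ chunk)) l))))
          ... | chunk , B ∷ post , eq , l with length chunk + c <? goods chunk
          ... | yes g = inj₁ (subst Stretch (sym eq) (middle [] chunk B post (≤-reflexive l) g))
          ... | no g with stretch fuel (B ∷ post) (≤-pred (≤-trans (≤-trans (+-monoˡ-≤ (length (B ∷ post)) (≤-trans (*-mono-≤ {1} {4} (s≤s z≤n) c-pos) (≤-reflexive (sym l)))) (≤-reflexive (trans (sym (length-++ chunk)) (cong length (sym eq))))) h))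
          ... | inj₁ st = inj₁ (subst Stretch (sym eq) (extendˡ chunk st))
          ... | inj₂ k = inj₂ (subst (λ z → 4 * goods z ≤ 5 * length z) (sym eq)
                  (subst₂ (λ a b → 4 * a ≤ 5 * b) (sym (goods-++ chunk (B ∷ post))) (sym (length-++ chunk))
                    (arith (goods chunk) (goods (B ∷ post)) (length chunk) (length (B ∷ post)) c l (≮⇒≥ g) k)))
            where
            arith : ∀ g g′ x x′ c → x ≡ 4 * c → g ≤ x + c → 4 * g′ ≤ 5 * x′ → 4 * (g + g′) ≤ 5 * (x + x′)
            arith g g′ x x′ c refl h k = lin 0 (4 ⊗ h ⊕ k) (ring-42 g g′ x′ c)

        body : Rig → List Part
        body ((A , ps) , T) = ps

        data Found : List Rig → Set where
          found : ∀ a r b → Stretch (body r) → Found (a ++ r ∷ b)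

        found-∷ : ∀ r {es} → Found es → Found (r ∷ es)
        found-∷ r (found a r′ b st) = found (r ∷ a) r′ b st

        abstract
          findStretch : ∀ es → Found es ⊎ 4 * ∑ es (λ r → goods (body r)) ≤ 5 * ∑ es (λ r → length (body r))
          findStretch [] = inj₂ z≤n
          findStretch (r ∷ es) with stretch (length (body r)) (body r) ≤-refl | findStretch es
          ... | inj₁ st | _ = inj₁ (found [] r es st)
          ... | inj₂ _ | inj₁ f = inj₁ (found-∷ r f)
          ... | inj₂ h | inj₂ k = inj₂ (subst₂ _≤_ (sym (*-distribˡ-+ 4 (goods (body r)) _)) (sym (*-distribˡ-+ 5 (length (body r)) _)) (h ⊕ k))

      record Rigged (πs : List Path) (left : List V) : Set where
        field
          es    : List Rig
          spare : List V
          rigs  : All IsRig es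
          same  : map proj₁ es ≡ πs
          whole : concatMap proj₂ es ++ spare ≡ left

      abstract
        rig : ∀ πs left → All IsPath πs → length πs * μ ≤ length left → Rigged πs left
        rig [] left [] h = record { es = [] ; spare = left ; rigs = [] ; same = refl ; whole = refl }
        rig (π ∷ πs) left (p ∷ ps) h with split μ left (≤-trans (m≤m+n μ _) h)
        ... | T , left′ , refl , l = record
            { es = (π , T) ∷ es ; spare = spare ; rigs = (p , l) ∷ rigs ; same = cong (π ∷_) same
            ; whole = trans (++-assoc T (concatMap proj₂ es) spare) (cong (T ++_) whole) }
          where
          open Rigged (rig πs left′ ps (+-cancelˡ-≤ μ _ _ (≤-trans h (≤-reflexive (trans (length-++ T) (cong (_+ length left′) l))))))

        rig-verts : ∀ es → concatMap rigVerts es ↭ concatMap verts (map proj₁ es) ++ concatMap proj₂ es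
        rig-verts es = ↭-trans (concatMap-∙ (λ r → verts (proj₁ r)) proj₂ es) (++⁺ʳ _ (↭-reflexive (lemma es)))
          where
          lemma : ∀ (es : List Rig) → concatMap (λ r → verts (proj₁ r)) es ≡ concatMap verts (map proj₁ es)
          lemma [] = refl
          lemma (r ∷ es) = cong (verts (proj₁ r) ++_) (lemma es)

        paths-of : ∀ es → All IsRig es → All IsPath (map proj₁ es)
        paths-of [] [] = []
        paths-of (r ∷ es) ((p , _) ∷ ps) = p ∷ paths-of es ps

        weight-of : ∀ (es : List Rig) → ∑ (map proj₁ es) parts ≡ partsSum es
        weight-of es = ∑-map proj₁ es parts

        unrig : ∀ (news : List Path) (olds : List Rig) rest → concatMap verts (news ++ map proj₁ olds) ++ (concatMap proj₂ olds ++ rest) ↭ (concatMap verts news ++ concatMap rigVerts olds) ++ rest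
        unrig news olds rest = ↭-trans (++⁺ʳ _ (↭-reflexive (concatMap-++ verts news (map proj₁ olds))))
          (↭-trans (perm 4 (λ a b c d → (a ∙ b) ∙ (c ∙ d) ⊜ (a ∙ (b ∙ c)) ∙ d) ↭-refl (concatMap verts news) (concatMap verts (map proj₁ olds)) (concatMap proj₂ olds) rest)
            (++⁺ʳ rest (++⁺ˡ (concatMap verts news) (↭-sym (rig-verts olds)))))

      Better : State → State → Set
      Better S S′ = suc (c * State.count S′ + State.weight S) ≤ c * State.count S + State.weight S′ × State.count S ≤ State.count S′

      module Step (S : State) (u : Unique Xs) (p≤K : State.count S ≤ K) (p≥ : 25 * R ≤ State.count S)
        (rigged : Rigged (State.πs S) (State.left S)) where
        open State S
        open Rigged rigged renaming (whole to whole′)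

        p : ℕ
        p = count

        abstract
          es-length : length es ≡ p
          es-length = trans (sym (length-map proj₁ es)) (cong length same)

          es-whole : concatMap rigVerts es ++ spare ↭ Xs
          es-whole = ↭-trans (++⁺ʳ spare (rig-verts es)) (↭-trans (↭-reflexive (trans (++-assoc (concatMap verts (map proj₁ es)) (concatMap proj₂ es) spare) (cong₂ _++_ (cong (concatMap verts) same) whole′))) whole)

          es-weight : partsSum es ≡ weight
          es-weight = trans (sym (weight-of es)) (cong (λ z → ∑ z parts) same)

          build : ∀ {a b : List Rig} {r : Rig} (ys : List V) → es ↭ r ∷ a → (d : Distributed ys a) → (new : List Path) → (rest : List V) → All IsPath new →
            (concatMap verts new ++ rest) ++ ys ↭ rigVerts r ++ spare →
            suc (c * length new + parts (proj₁ r)) ≤ c + ∑ new parts + length ys → 1 ≤ length new → ∃ (Better S)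
          build {a} {r = r} ys q d new rest newp eq gain one = mkState (new ++ (news ++ map proj₁ olds)) (concatMap proj₂ olds ++ rest)
              (all-++ newp (all-++ D.paths (paths-of olds rigs′))) wh , be , more
            where
            module D = Distributed d
            open D using (news; olds) renaming (rigs to rigs′)
            wh : concatMap verts (new ++ (news ++ map proj₁ olds)) ++ (concatMap proj₂ olds ++ rest) ↭ Xs
            wh = ↭-trans (++⁺ʳ _ (↭-reflexive (concatMap-++ verts new _))) (↭-trans (↭-reflexive (++-assoc (concatMap verts new) _ _))
              (↭-trans (++⁺ˡ (concatMap verts new) (↭-trans (unrig news olds rest) (++⁺ʳ rest D.whole)))
                (↭-trans (perm 4 (λ n y a r → n ∙ ((y ∙ a) ∙ r) ⊜ a ∙ ((n ∙ r) ∙ y)) ↭-refl (concatMap verts new) ys (concatMap rigVerts a) rest)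
                  (↭-trans (++⁺ˡ (concatMap rigVerts a) eq) (↭-trans (perm 3 (λ a r s → a ∙ (r ∙ s) ⊜ (r ∙ a) ∙ s) ↭-refl (concatMap rigVerts a) (rigVerts r) spare)
                    (↭-trans (++⁺ʳ spare (concatMap-↭ rigVerts (↭-sym q))) es-whole))))))
            cnt : length (new ++ (news ++ map proj₁ olds)) ≡ length new + length a
            cnt = trans (length-++ new) (cong (length new +_) (trans (length-++ news) (trans (cong (length news +_) (length-map proj₁ olds)) D.count)))
            p≡ : p ≡ suc (length a)
            p≡ = trans (sym es-length) (↭-length q)
            wt : ∑ (new ++ (news ++ map proj₁ olds)) parts ≡ ∑ new parts + (partsSum a + length ys)
            wt = trans (∑-++ new _ parts) (cong (∑ new parts +_) (trans (∑-++ news _ parts) (trans (cong (∑ news parts +_) (weight-of olds)) D.weight)))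
            w≡ : weight ≡ parts (proj₁ r) + partsSum a
            w≡ = trans (sym es-weight) (∑-↭ (λ r → parts (proj₁ r)) q)
            arith : ∀ c k x a w s y → suc (c * k + x) ≤ c + s + y → suc (c * (k + a) + (x + w)) ≤ c * suc a + (s + (w + y))
            arith c k x a w s y h = ≤-trans (≤-reflexive (ring-43 c k x a w)) (≤-trans (+-monoˡ-≤ (c * a + w) h) (≤-reflexive (ring-44 c a w s y)))
            be : suc (c * length (new ++ (news ++ map proj₁ olds)) + weight) ≤ c * count + ∑ (new ++ (news ++ map proj₁ olds)) parts
            be = subst₂ _≤_ (sym (cong₂ (λ i j → suc (c * i + j)) cnt w≡)) (sym (cong₂ (λ i j → c * i + j) p≡ wt))
              (arith c (length new) (parts (proj₁ r)) (length a) (partsSum a) (∑ new parts) (length ys) gain)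
            more : count ≤ length (new ++ (news ++ map proj₁ olds))
            more = ≤-trans (≤-reflexive p≡) (≤-trans (+-monoˡ-≤ (length a) one) (≤-reflexive (sym cnt)))

          case-spare : ∀ {r y} → r ∈ es → y ∈ spare → hit r y ≡ true → ∃ (Better S)
          case-spare {r} {y} i j h with removeAt i | ∈-∃++ j
          ... | a , q | s₁ , s₂ , eq = build {b = []} [] q (distribute [] a (tailAll (all-↭ q rigs)) λ ()) (extend r y ∷ []) (s₁ ++ s₂) (extend-path r y (all-∈ rigs i) h ∷ [])
              (↭-trans (↭-reflexive (++-identityʳ _)) (↭-trans (++⁺ʳ (s₁ ++ s₂) (↭-trans (↭-reflexive (++-identityʳ _)) (extend-verts r y)))
                (↭-trans (↭-sym (shift y (rigVerts r) (s₁ ++ s₂))) (++⁺ˡ (rigVerts r) (↭-trans (↭-sym (shift y s₁ s₂)) (↭-reflexive (sym eq)))))))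
              (≤-reflexive (ring-51 c (parts (proj₁ r)))) (s≤s z≤n)
            where
            tailAll : ∀ {A : Set} {P : A → Set} {x xs} → All P (x ∷ xs) → All P xs
            tailAll (_ ∷ ps) = ps

        hits-of : V → ℕ
        hits-of y = # (λ r → hit r y) of es

        good : V → Bool
        good y = does (R ≤? hits-of y)

        abstract
          case-stretch : Found good es → ∃ (Better S)
          case-stretch f = go es refl f
            where
            tailAll : ∀ {A : Set} {P : A → Set} {x xs} → All P (x ∷ xs) → All P xs
            tailAll (_ ∷ ps) = ps
            distributed : ∀ {r a ys} → es ↭ r ∷ a → length ys ≤ 5 * c + 1 → (∀ {y} → y ∈ ys → good y ≡ true) → Distributed ys a
            distributed {r} {a} {ys} q l g = distribute ys a (tailAll (all-↭ q rigs)) λ {y} i →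
              ≤-pred (≤-trans (s≤s l) (≤-trans (≤-reflexive (sym (+-suc (5 * c) 1))) (≤-trans (decided (R ≤? hits-of y) (g i)) (≤-trans (≤-reflexive (∑-↭ _ q)) (+-monoˡ-≤ _ (⟦⟧≤1 (hit r y)))))))
            go : ∀ es′ → es ≡ es′ → Found good es′ → ∃ (Better S)
            go .(a ++ ((A , _) , T) ∷ b) eq (found a ((A , _) , T) b (end pre chunk l g)) with takeTrue good (suc (length chunk)) (concat chunk) g
            ... | ys , zs , py , ly , ty = build {b = []} ys q (distributed q (≤-trans (≤-reflexive ly) (≤-trans (s≤s (≤-trans l (≤-trans (m≤n+m (4 * c) c) (≤-reflexive (ring-45 c))))) (≤-reflexive (+-comm 1 (5 * c))))) ty)
                ((A , pre) ∷ []) ((zs ++ T) ++ spare) (chain-prefix A pre (proj₁ (all-∈ (all-↭ q rigs) (here refl))) ∷ [])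
                (↭-trans (++⁺ʳ ys (++⁺ʳ ((zs ++ T) ++ spare) (↭-reflexive (++-identityʳ (A ++ concat pre)))))
                (↭-trans (perm 6 (λ a p z t s y → ((a ∙ p) ∙ ((z ∙ t) ∙ s)) ∙ y ⊜ ((a ∙ (p ∙ (y ∙ z))) ∙ t) ∙ s) ↭-refl A (concat pre) zs T spare ys)
                  (++⁺ʳ spare (++⁺ʳ T (++⁺ˡ A (↭-trans (++⁺ˡ (concat pre) (↭-sym py)) (↭-reflexive (trans (sym (concat-++ pre chunk)) (cong (λ z → concat (pre ++ z)) (sym (++-identityʳ chunk)))))))))))
                (≤-reflexive (trans (cong (λ z → suc (c * 1 + suc z)) (trans (length-++ pre) (cong (length pre +_) (trans (length-++ chunk) (+-identityʳ _))))) (trans (ring-46 c (length pre) (length chunk)) (cong (c + (suc (length pre) + 0) +_) (sym ly)))))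
                (s≤s z≤n)
              where
              q : es ↭ ((A , pre ++ chunk ++ []) , T) ∷ (a ++ b)
              q = ↭-trans (↭-reflexive eq) (shift _ a b)
            go .(a ++ ((A , _) , T) ∷ b) eq (found a ((A , _) , T) b (middle pre chunk B post l g)) with takeTrue good (suc (length chunk + c)) (concat chunk) g
            ... | ys , zs , py , ly , ty = build {b = []} ys q (distributed q (≤-trans (≤-reflexive ly) (≤-trans (s≤s (+-monoˡ-≤ c l)) (≤-reflexive (ring-47 c)))) ty)
                ((A , pre) ∷ (B , post) ∷ []) ((zs ++ T) ++ spare) (chain-prefix A pre ch ∷ chain-suffix A (pre ++ chunk) (subst (Chain A) (sym (++-assoc pre chunk (B ∷ post))) ch) ∷ [])
                (↭-trans (++⁺ʳ ys (++⁺ʳ ((zs ++ T) ++ spare) (++⁺ˡ (A ++ concat pre) (↭-reflexive (++-identityʳ (B ++ concat post))))))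
                (↭-trans (perm 7 (λ a p b z t s y → (((a ∙ p) ∙ b) ∙ ((z ∙ t) ∙ s)) ∙ y ⊜ ((a ∙ (p ∙ ((y ∙ z) ∙ b))) ∙ t) ∙ s) ↭-refl A (concat pre) (B ++ concat post) zs T spare ys)
                  (++⁺ʳ spare (++⁺ʳ T (++⁺ˡ A (↭-trans (++⁺ˡ (concat pre) (++⁺ʳ (B ++ concat post) (↭-sym py))) (↭-reflexive (trans (cong (concat pre ++_) (sym (concat-++ chunk (B ∷ post)))) (sym (concat-++ pre (chunk ++ B ∷ post)))))))))))
                (≤-reflexive (trans (cong (λ z → suc (c * 2 + suc z)) (trans (length-++ pre) (cong (length pre +_) (length-++ chunk)))) (trans (ring-48 c (length pre) (length chunk) (length post)) (cong (c + (suc (length pre) + (suc (length post) + 0)) +_) (sym ly)))))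
                (s≤s z≤n)
              where
              q : es ↭ ((A , pre ++ chunk ++ B ∷ post) , T) ∷ (a ++ b)
              q = ↭-trans (↭-reflexive eq) (shift _ a b)
              ch : Chain A (pre ++ chunk ++ B ∷ post)
              ch = proj₁ (all-∈ (all-↭ q rigs) (here refl))

          unique-sub : ∀ {r rs} → r ∈ rs → Unique (concatMap rigVerts rs) → Unique (rigVerts r)
          unique-sub {r} (here refl) u = unique-ˡ (rigVerts r) u
          unique-sub {rs = r′ ∷ rs} (there i) u = unique-sub i (unique-ʳ (rigVerts r′) u)

          core rest′ : Rig → List V
          core ((A , ps) , T) = A ++ T
          rest′ ((A , ps) , T) = concat ps

          core-length : ∀ rs → All IsRig rs → length (concatMap core rs) ≤ 2 * m * length rs
          core-length [] [] = z≤n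
          core-length (((A , ps) , T) ∷ rs) ((ch , l) ∷ h) = ≤-trans (≤-reflexive (trans (length-++ (A ++ T)) (cong (_+ _) (trans (length-++ A) (cong₂ _+_ (proj₂ (chain-head A ps ch)) l)))))
            (≤-trans (+-monoʳ-≤ (m + μ) (core-length rs h)) (≤-trans (m≤n+m _ 1) (≤-reflexive (ring-52 μ (length rs)))))

          whole-list : allFin n ↭ (F ++ concatMap core es) ++ (spare ++ concatMap rest′ es)
          whole-list = ↭-trans all≡ (↭-trans (++⁺ˡ F (↭-trans (↭-sym es-whole) (++⁺ʳ spare (regroup es))))
            (perm 4 (λ f a b s → f ∙ ((a ∙ b) ∙ s) ⊜ (f ∙ a) ∙ (s ∙ b)) ↭-refl F (concatMap core es) (concatMap rest′ es) spare))
            where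
            regroup : ∀ rs → concatMap rigVerts rs ↭ concatMap core rs ++ concatMap rest′ rs
            regroup rs = ↭-trans (pointwise rs) (concatMap-∙ core rest′ rs)
              where
              pointwise : ∀ rs → concatMap rigVerts rs ↭ concatMap (λ r → core r ++ rest′ r) rs
              pointwise [] = ↭-refl
              pointwise (((A , ps) , T) ∷ rs) = ++⁺ (perm 3 (λ a p t → (a ∙ p) ∙ t ⊜ (a ∙ t) ∙ p) ↭-refl A (concat ps) T) (pointwise rs)

          bodies : List V
          bodies = concatMap rest′ es

          degree-r : ∀ {r} → r ∈ es → (∀ y → y ∈ spare → hit r y ≡ false) → D ≤ β + 2 * m * p + # (hit r) of bodies
          degree-r {r@((A , ps) , T)} i none = ≤-trans (codegree uTA lTA) (≤-trans (≤-reflexive (trans (∑-↭ _ whole-list) (trans (#-++ (F ++ concatMap core es) (spare ++ bodies) (hit r)) (cong (# hit r of (F ++ concatMap core es) +_) (#-++ spare bodies (hit r))))))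
            (≤-trans (≤-trans (#≤length (F ++ concatMap core es) (hit r)) (≤-trans (≤-reflexive (length-++ F)) (F≤β ⊕ ≤-trans (core-length es rigs) (≤-reflexive (cong (2 * m *_) es-length))))
               ⊕ (≤-trans (∑-mono∈ spare (λ y j → ≤-reflexive (cong ⟦_⟧ (none y j)))) (≤-reflexive (∑-zero spare)) ⊕ ≤-refl)) ≤-refl))
            where
            ch : Chain A ps
            ch = proj₁ (all-∈ rigs i)
            lT : length T ≡ μ
            lT = proj₂ (all-∈ rigs i)
            uTA : Unique (T ++ A)
            uTA = unique-ˡ (T ++ A) (Unique-↭ (perm 3 (λ a p t → (a ∙ p) ∙ t ⊜ (t ∙ a) ∙ p) ↭-refl A (concat ps) T) (unique-sub i (unique-ˡ (concatMap rigVerts es) (Unique-↭ (↭-sym es-whole) u))))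
            lTA : suc (length (T ++ A)) ≡ m + m
            lTA = cong suc (trans (length-++ T) (cong₂ _+_ lT (proj₂ (chain-head A ps ch))))

          arith : ∀ n m β p R D ρ b g → 1 ≤ p → 1 ≤ n → p ≤ β → 25 * R ≤ p → n ≤ 2 * D + 4 * m → p * D ≤ p * (β + 2 * m * p) + (b * R + p * ρ) → b ≤ n →
            4 * ρ ≤ 5 * g → 3 * g ≤ n → 1200 * ((m + β) * m) ≤ n → 1 ≤ m → ⊥
          arith n m β p R D ρ b g p1 n1 pβ hR hD hp hb hρ hg hn hm = absurd (11 * (p * n) + 600 * p * m * m + 300 * p * β * m)
            (150 * p ⊗ hD ⊕ 300 ⊗ hp ⊕ 300 * R ⊗ hb ⊕ 12 * n ⊗ hR ⊕ 75 * p ⊗ hρ ⊕ 125 * p ⊗ hg ⊕ 600 * p * m ⊗ pβ ⊕ 300 * p * β ⊗ hm ⊕ 600 * p * m ⊗ hm ⊕ p ⊗ hn ⊕ *-mono-≤ p1 n1)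
            (ring-53 n m β p R D ρ b g)

          bodies-length : length bodies ≡ m * ∑ es (λ r → length (body good r))
          bodies-length = trans (length-concatMap rest′ es) (trans (lemma es rigs) (∑-* es m _))
            where
            concat-length : ∀ A ps → Chain A ps → length (concat ps) ≡ m * length ps
            concat-length A ps ch = +-cancelˡ-≡ m _ _ (trans (cong (_+ length (concat ps)) (sym (proj₂ (chain-head A ps ch)))) (trans (sym (length-++ A)) (trans (chain-length A ps ch) (*-suc m (length ps)))))
            lemma : ∀ rs → All IsRig rs → ∑ rs (λ r → length (rest′ r)) ≡ ∑ rs (λ r → m * length (body good r))
            lemma [] [] = refl
            lemma (((A , ps) , T) ∷ rs) ((ch , _) ∷ h) = cong₂ _+_ (concat-length A ps ch) (lemma rs h)

          bodies≤n : length bodies ≤ n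
          bodies≤n = ≤-trans (≤-trans (m≤n+m _ (length spare)) (≤-reflexive (sym (length-++ spare)))) (≤-trans (m≤n+m _ (length (F ++ concatMap core es)))
            (≤-reflexive (trans (sym (length-++ (F ++ concatMap core es))) (trans (sym (↭-length whole-list)) length-allFin))))

          goods-sum : ∑ es (λ r → goods good (body good r)) ≡ # good of bodies
          goods-sum = sym (∑-concatMap rest′ es _)

          degrees : (∀ r → r ∈ es → ∀ y → y ∈ spare → hit r y ≡ false) → p * D ≤ p * (β + 2 * m * p) + (length bodies * R + p * # good of bodies)
          degrees none = ≤-trans (≤-reflexive (trans (cong (_* D) (sym es-length)) (sym (∑-const es D)))) (≤-trans (∑-mono∈ es (λ r i → degree-r i (none r i)))
              (≤-trans (≤-reflexive (trans (∑-+ es _ _) (cong₂ _+_ (trans (∑-const es _) (cong (_* (β + 2 * m * p)) es-length)) (∑-swap es bodies (λ r y → ⟦ hit r y ⟧)))))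
                (+-monoʳ-≤ (p * (β + 2 * m * p)) (≤-trans (∑-mono bodies per) (≤-reflexive (trans (∑-+ bodies _ _) (cong₂ _+_ (∑-const bodies R) (∑-* bodies p _))))))))
            where
            per : ∀ y → hits-of y ≤ R + p * ⟦ good y ⟧
            per y = go (bool-case (good y))
              where
              go : good y ≡ true ⊎ good y ≡ false → hits-of y ≤ R + p * ⟦ good y ⟧
              go (inj₁ h) = ≤-trans (#≤length es _) (≤-trans (≤-reflexive es-length) (≤-trans (≤-reflexive (sym (*-identityʳ p))) (≤-trans (*-monoʳ-≤ p (⟦⟧-true h)) (m≤n+m _ R))))
              go (inj₂ h) = ≤-trans (n≤1+n _) (≤-trans (≰⇒> (undecided (R ≤? hits-of y) h)) (m≤m+n R _))

          1200-large : 1200 * ((m + β) * m) ≤ n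
          1200-large = ≤-trans (*-monoˡ-≤ ((m + β) * m) (≤-trans (≤ᵇ⇒≤ 1200 24000 tt) (4 ⊗ s-large))) (≤-trans (≤-reflexive (ring-54 s (m + β) m)) n-large)

          improve : ∃ (Better S)
          improve = first (search es (λ r → does (1 ≤? # (hit r) of spare)))
            where
            second : (∀ r → r ∈ es → ∀ y → y ∈ spare → hit r y ≡ false) → Found good es ⊎ 4 * ∑ es (λ r → goods good (body good r)) ≤ 5 * ∑ es (λ r → length (body good r)) → ∃ (Better S)
            second none (inj₁ f) = case-stretch f
            second none (inj₂ h) = ⊥-elim (arith n m β p R D (# good of bodies) (length bodies) (∑ es (λ r → length (body good r)))
              (≤-trans (≤-trans (≤ᵇ⇒≤ 1 50 tt) (25 ⊗ m≤n+m 2 (5 * c))) p≥) n-pos (≤-trans p≤K K≤β) p≥ n≤2D (degrees none) bodies≤n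
              (subst (λ z → 4 * z ≤ 5 * ∑ es (λ r → length (body good r))) goods-sum h)
              (≤-trans (*-monoˡ-≤ (∑ es (λ r → length (body good r))) (s≤s μ-large)) (≤-trans (≤-reflexive (sym bodies-length)) bodies≤n)) 1200-large (s≤s z≤n))
            first : (∃ λ r → r ∈ es × does (1 ≤? # (hit r) of spare) ≡ true) ⊎ (∀ r → r ∈ es → does (1 ≤? # (hit r) of spare) ≡ false) → ∃ (Better S)
            first (inj₁ (r , i , h)) = let y , j , k = #-find spare (hit r) (decided (1 ≤? _) h) in case-spare i j k
            first (inj₂ none) = second (λ r i y j → [ (λ h → true≢false (decide (1 ≤? _) (#-pos (hit r) j h)) (none r i)) , id ]′ (bool-case (hit r y))) (findStretch good es)

      chop : ∀ t (xs : List V) → length xs ≡ m * t → Unique xs → ∃ λ πs → All IsPath πs × concatMap verts πs ≡ xs × length πs ≡ t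
      chop zero [] _ _ = [] , [] , refl , refl
      chop zero (x ∷ xs) h _ = ⊥-elim (1+n≰n (≤-trans (s≤s z≤n) (≤-reflexive (trans h (*-zeroʳ m)))))
      chop (suc t) xs h u with split m xs (≤-trans (m≤m+n m (m * t)) (≤-reflexive (sym (trans h (*-suc m t)))))
      ... | A , ys , refl , l with chop t ys (+-cancelˡ-≡ m _ _ (trans (cong (_+ length ys) (sym l)) (trans (sym (length-++ A)) (trans h (*-suc m t))))) (unique-ʳ A u)
      ... | πs , ps , eq , k = (A , []) ∷ πs , (unique-ˡ A u , l) ∷ ps , cong₂ _++_ (++-identityʳ A) eq , cong suc k

      paths-length : ∀ πs → All IsPath πs → length (concatMap verts πs) ≡ m * ∑ πs parts
      paths-length [] [] = sym (*-zeroʳ m)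
      paths-length ((A , ps) ∷ πs) (p ∷ h) = trans (length-++ (A ++ concat ps)) (trans (cong₂ _+_ (chain-length A ps p) (paths-length πs h)) (sym (*-distribˡ-+ m (suc (length ps)) (∑ πs parts))))

      Xs≤n : length Xs ≤ n
      Xs≤n = ≤-trans (m≤n+m _ (length F)) (≤-reflexive (trans (sym (length-++ F)) (trans (sym (↭-length all≡)) length-allFin)))

      abstract
        weight≤n : ∀ S → State.weight S ≤ n
        weight≤n S = ≤-trans (m≤m+n _ (μ * State.weight S)) (≤-trans (≤-reflexive (sym (paths-length (State.πs S) (State.paths S)))) (≤-trans (≤-trans (m≤m+n _ _) (≤-reflexive (trans (sym (length-++ (concatMap verts (State.πs S)))) (↭-length (State.whole S))))) Xs≤n))

        iterate : Unique Xs → ∀ fuel S → c * State.count S + n ≤ fuel + State.weight S → fuel ≤ c * K → 25 * R ≤ State.count S →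
          ∃ λ S′ → State.count S′ ≤ K × length (State.left S′) ≤ m * K
        iterate u fuel S h hK hR = go (m * State.count S ≤? length (State.left S)) fuel h hK
          where
          count≤K : ∀ fuel → c * State.count S + n ≤ fuel + State.weight S → fuel ≤ c * K → State.count S ≤ K
          count≤K fuel h hK = cancel c c-pos (≤-trans (+-cancelʳ-≤ n _ _ (≤-trans h (+-monoʳ-≤ fuel (weight≤n S)))) hK)
          go : Dec (m * State.count S ≤ length (State.left S)) → ∀ fuel → c * State.count S + n ≤ fuel + State.weight S → fuel ≤ c * K →
            ∃ λ S′ → State.count S′ ≤ K × length (State.left S′) ≤ m * K
          go (no small) fuel h hK = S , count≤K fuel h hK , ≤-trans (n≤1+n _) (≤-trans (≰⇒> small) (*-monoʳ-≤ m (count≤K fuel h hK)))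
          go (yes room) zero h hK = ⊥-elim (1+n≰n (≤-trans (*-mono-≤ c-pos (≤-trans (≤-trans (≤ᵇ⇒≤ 1 50 tt) (25 ⊗ m≤n+m 2 (5 * c))) hR)) (+-cancelʳ-≤ n _ 0 (≤-trans h (weight≤n S)))))
          go (yes room) (suc fuel) h hK = next (Step.improve S u (count≤K (suc fuel) h hK) hR (rig (State.πs S) (State.left S) (State.paths S) (≤-trans (*-monoʳ-≤ (State.count S) (n≤1+n μ)) (≤-trans (≤-reflexive (*-comm (State.count S) m)) room))))
            where
            arith : ∀ a n f w a′ w′ → a + n ≤ suc f + w → suc (a′ + w) ≤ a + w′ → a′ + n ≤ f + w′
            arith a n f w a′ w′ h k = +-cancelˡ-≤ (1 + a + w) (a′ + n) (f + w′) (subst₂ _≤_ (ring-49 a n a′ w) (ring-50 a f w w′) (h ⊕ k))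
            next : ∃ (Better S) → ∃ λ S′ → State.count S′ ≤ K × length (State.left S′) ≤ m * K
            next (S′ , b , more) = iterate u fuel S′ (arith (c * State.count S) n fuel (State.weight S) (c * State.count S′) (State.weight S′) h b) (≤-trans (n≤1+n fuel) hK) (≤-trans hR more)

        -- p₀ single parts are a legal starting position.
        cover : ∀ t → Unique Xs → length Xs ≡ m * t → p₀ ≤ t →
          ∃ λ πs → All IsPath πs × concatMap verts πs ↭ Xs × length πs ≤ 2 * K
        cover t u l h = start (split (m * p₀) Xs (≤-trans (*-monoʳ-≤ m h) (≤-reflexive (sym l))))
          where
          finish : (∃ λ S′ → State.count S′ ≤ K × length (State.left S′) ≤ m * K) → ∃ λ πs → All IsPath πs × concatMap verts πs ↭ Xs × length πs ≤ 2 * K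
          finish (mkState πs left paths whole , cK , lK) = assemble (chop d left left≡ (unique-ʳ (concatMap verts πs) (Unique-↭ (↭-sym whole) u)))
            where
            w : ℕ
            w = ∑ πs parts
            w≤t : w ≤ t
            w≤t = cancel m (s≤s z≤n) (≤-trans (≤-reflexive (sym (paths-length πs paths))) (≤-trans (m≤m+n _ (length left)) (≤-reflexive (trans (sym (length-++ (concatMap verts πs))) (trans (↭-length whole) l)))))
            d : ℕ
            d = t ∸ w
            left≡ : length left ≡ m * d
            left≡ = +-cancelˡ-≡ (m * w) _ _ (trans (cong (_+ length left) (sym (paths-length πs paths))) (trans (sym (length-++ (concatMap verts πs))) (trans (↭-length whole) (trans l (trans (cong (m *_) (sym (m+[n∸m]≡n w≤t))) (*-distribˡ-+ m w d))))))
            assemble : (∃ λ ρs → All IsPath ρs × concatMap verts ρs ≡ left × length ρs ≡ d) → ∃ λ πs → All IsPath πs × concatMap verts πs ↭ Xs × length πs ≤ 2 * K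
            assemble (ρs , ρp , ρe , ρl) = πs ++ ρs , all-++ paths ρp , ↭-trans (↭-reflexive (trans (concatMap-++ verts πs ρs) (cong (concatMap verts πs ++_) ρe))) whole
              , ≤-trans (≤-reflexive (length-++ πs)) (≤-trans (cK ⊕ ≤-trans (≤-reflexive ρl) (cancel m (s≤s z≤n) (≤-trans (≤-reflexive (sym left≡)) lK))) (≤-reflexive (cong (K +_) (sym (+-identityʳ K)))))
          start : (∃ λ as → ∃ λ bs → Xs ≡ as ++ bs × length as ≡ m * p₀) → ∃ λ πs → All IsPath πs × concatMap verts πs ↭ Xs × length πs ≤ 2 * K
          start (as , bs , eq , la) = begin (chop p₀ as la (unique-ˡ as (subst Unique eq u)))
            where
            begin : (∃ λ πs → All IsPath πs × concatMap verts πs ≡ as × length πs ≡ p₀) → ∃ λ πs → All IsPath πs × concatMap verts πs ↭ Xs × length πs ≤ 2 * K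
            begin (πs , ps , pe , pl) = finish (iterate u (c * p₀ + n) (mkState πs bs ps (↭-reflexive (trans (cong (_++ bs) pe) (sym eq))))
              (≤-trans (≤-reflexive (cong (λ z → c * z + n) pl)) (m≤m+n _ _)) K-large (≤-trans p₀-large (≤-reflexive (sym pl))))

    lastPart : Part → List Part → Part
    lastPart A [] = A
    lastPart A (B ∷ ps) = lastPart B ps

    chain-trail : ∀ A ps → Chain A ps → Trail A (lastPart A ps) (A ++ concat ps)
    chain-trail A [] p = perm′ (↭-reflexive (sym (++-identityʳ A))) (part p)
    chain-trail A (B ∷ ps) (h , c) = join (part (~-properˡ {A} {B} h)) h (chain-trail B ps c)

    record Covered (F : List V) : Set where
      field
        Xs    : List V
        rest≡ : allFin n ↭ F ++ Xs
        πs    : List Path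
        paths : All IsPath πs
        whole : concatMap verts πs ↭ Xs
        few   : length πs ≤ 2 * K

    abstract
      coverRest : ∀ F f → Unique F → length F ≤ β → length F ≡ m * f → Covered F
      coverRest F f u h l = go (rest u)
        where
        go : (∃ λ Xs → allFin n ↭ F ++ Xs) → Covered F
        go (Xs , p) = finish (Improve.cover h p (τ ∸ f) (unique-ʳ F (Unique-↭ p allFin-unique)) Xs≡ p₀≤)
          where
          f≤τ : f ≤ τ
          f≤τ = cancel m (s≤s z≤n) (≤-trans (≤-reflexive (sym l)) (≤-trans (m≤m+n _ (length Xs)) (≤-reflexive (trans (sym (length-++ F)) (trans (sym (↭-length p)) (trans length-allFin n-parts))))))
          Xs≡ : length Xs ≡ m * (τ ∸ f)
          Xs≡ = +-cancelˡ-≡ (length F) _ _ (trans (sym (length-++ F)) (trans (sym (↭-length p)) (trans length-allFin (trans n-parts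
            (trans (cong (m *_) (sym (m+[n∸m]≡n f≤τ))) (trans (*-distribˡ-+ m f (τ ∸ f)) (cong (_+ m * (τ ∸ f)) (sym l))))))))
          p₀≤K : p₀ ≤ K
          p₀≤K = cancel c c-pos (≤-trans (m≤m+n _ n) K-large)
          mp₀ : length F + m * p₀ ≤ n
          mp₀ = ≤-trans (h ⊕ ≤-trans (*-monoʳ-≤ m (≤-trans p₀≤K (n≤1+n K))) (≤-trans mK≤unit (≤-trans (≤-reflexive (sym (+-identityʳ unit))) (units≤β 1 (≤ᵇ⇒≤ 1 5000 tt)))))
            (≤-trans (≤-trans (≤-reflexive (cong (β +_) (sym (+-identityʳ β)))) (*-monoˡ-≤ β (≤ᵇ⇒≤ 2 24000 tt))) 24β≤n)
          p₀≤ : p₀ ≤ τ ∸ f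
          p₀≤ = cancel m (s≤s z≤n) (≤-trans (+-cancelˡ-≤ (length F) _ _ (≤-trans mp₀ (≤-reflexive (trans (trans (sym length-allFin) (↭-length p)) (length-++ F))))) (≤-reflexive Xs≡))
          finish : (∃ λ πs → All IsPath πs × concatMap verts πs ↭ Xs × length πs ≤ 2 * K) → Covered F
          finish (πs , ps , w , k) = record { Xs = Xs ; rest≡ = p ; πs = πs ; paths = ps ; whole = w ; few = k }

module Interface where

  open Base
  open Hyper
  open Absorb
  open Cover
  open import Defs
  open import Data.Nat using (_/_; _%_)
  open import Data.Nat.DivMod using (_mod_; m<n⇒m%n≡m; [m+n]%n≡m%n)
  open import Data.Fin using (fromℕ<)
  open import Data.Fin.Properties using (toℕ-fromℕ<; toℕ<n)
  open import Data.Fin.Subset using (Subset; ∣_∣; ⁅_⁆; _∪_; inside; outside) renaming (⊥ to ∅; _∈_ to _∈ˢ_; _⊆_ to _⊆ˢ_)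
  open import Data.Fin.Subset.Properties using (_⊆?_; ∪-assoc; ∪-comm; ∉⊥; x∈⁅x⁆; x∈⁅y⁆⇒x≡y; x∈p∪q⁻; x∈p∪q⁺; ⊆-antisym; p⊆q⇒∣p∣≤∣q∣; p⊂q⇒∣p∣<∣q∣; ∣⊥∣≡0; drop-∷-⊆)
    renaming (_∈?_ to _∈ˢ?_)
  open import Data.Fin.Permutation using (Permutation′; permutation; _⟨$⟩ʳ_)
  open import Data.List.Base using (applyUpTo; upTo; filter; lookup)
  open import Data.Maybe.Base using (Maybe; just; nothing)
  open import Data.Bool.Properties using () renaming (_≟_ to _≟ᵇ_)
  import Data.Vec as Vec
  import Data.Vec.Properties as Vec′
  import Data.List.Relation.Unary.Any as Any
  import Data.List.Relation.Unary.Any.Properties as Any′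

  module _ {n : ℕ} where

    toSubset : List (Fin n) → Subset n
    toSubset = foldr (λ v acc → ⁅ v ⁆ ∪ acc) ∅

    abstract
      toSubset-↭ : ∀ {xs ys} → xs ↭ ys → toSubset xs ≡ toSubset ys
      toSubset-↭ _↭_.refl = refl
      toSubset-↭ (prep x p) = cong (⁅ x ⁆ ∪_) (toSubset-↭ p)
      toSubset-↭ (swap {xs} {ys} x y p) = trans (cong (λ z → ⁅ x ⁆ ∪ (⁅ y ⁆ ∪ z)) (toSubset-↭ p)) (trans (sym (∪-assoc ⁅ x ⁆ ⁅ y ⁆ _)) (trans (cong (_∪ toSubset ys) (∪-comm ⁅ x ⁆ ⁅ y ⁆)) (∪-assoc ⁅ y ⁆ ⁅ x ⁆ _)))
      toSubset-↭ (_↭_.trans p q) = trans (toSubset-↭ p) (toSubset-↭ q)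

      ∈-toSubset⁺ : ∀ {v xs} → v ∈ xs → v ∈ˢ toSubset xs
      ∈-toSubset⁺ (here refl) = x∈p∪q⁺ (inj₁ (x∈⁅x⁆ _))
      ∈-toSubset⁺ (there i) = x∈p∪q⁺ (inj₂ (∈-toSubset⁺ i))

      ∈-toSubset⁻ : ∀ {v} xs → v ∈ˢ toSubset xs → v ∈ xs
      ∈-toSubset⁻ [] i = ⊥-elim (∉⊥ i)
      ∈-toSubset⁻ (x ∷ xs) i = [ (λ j → here (x∈⁅y⁆⇒x≡y x j)) , (λ j → there (∈-toSubset⁻ xs j)) ]′ (x∈p∪q⁻ ⁅ x ⁆ (toSubset xs) i)

      toSubset-⊆ : ∀ {xs S} → (∀ {v} → v ∈ xs → v ∈ˢ S) → toSubset xs ⊆ˢ S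
      toSubset-⊆ {xs} h i = h (∈-toSubset⁻ xs i)

    ∣∪⁅⁆∣ : ∀ {m} (v : Fin m) (S : Subset m) → ∣ ⁅ v ⁆ ∪ S ∣ ≤ suc ∣ S ∣
    ∣∪⁅⁆∣ Fin.zero (inside Vec.∷ S) = ≤-trans (≤-reflexive (cong (λ z → suc ∣ z ∣) (∅∪ S))) (n≤1+n _)
      where
      ∅∪ : ∀ {m} (S : Subset m) → ∅ ∪ S ≡ S
      ∅∪ Vec.[] = refl
      ∅∪ (x Vec.∷ S) = cong (x Vec.∷_) (∅∪ S)
    ∣∪⁅⁆∣ Fin.zero (outside Vec.∷ S) = ≤-reflexive (cong (λ z → suc ∣ z ∣) (∅∪ S))
      where
      ∅∪ : ∀ {m} (S : Subset m) → ∅ ∪ S ≡ S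
      ∅∪ Vec.[] = refl
      ∅∪ (x Vec.∷ S) = cong (x Vec.∷_) (∅∪ S)
    ∣∪⁅⁆∣ (Fin.suc v) (inside Vec.∷ S) = s≤s (∣∪⁅⁆∣ v S)
    ∣∪⁅⁆∣ (Fin.suc v) (outside Vec.∷ S) = ∣∪⁅⁆∣ v S

    abstract
      size-toSubset : ∀ xs → Unique xs → ∣ toSubset xs ∣ ≡ length xs
      size-toSubset [] u = ∣⊥∣≡0 n
      size-toSubset (x ∷ xs) u = ≤-antisym (≤-trans (∣∪⁅⁆∣ x (toSubset xs)) (s≤s (≤-reflexive (size-toSubset xs (unique-tail u)))))
        (≤-trans (s≤s (≤-reflexive (sym (size-toSubset xs (unique-tail u))))) (p⊂q⇒∣p∣<∣q∣ ((λ i → x∈p∪q⁺ (inj₂ i)) , x , x∈p∪q⁺ (inj₁ (x∈⁅x⁆ x)) , λ i → unique-head u (∈-toSubset⁻ xs i))))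

      -- An edge containing the (k − 1)-set S is S together with one further vertex.
      extension : ∀ S (E : Subset n) → Unique S → ∣ E ∣ ≡ suc (length S) → toSubset S ⊆ˢ E → ∃ λ y → y ∉ S × E ≡ toSubset (y ∷ S)
      extension S E u l sub = go (search (allFin n) (λ y → does (y ∈ˢ? E) ∧ not (does (Vertices._∈?_ n y S))))
        where
        test : Fin n → Bool
        test y = does (y ∈ˢ? E) ∧ not (does (Vertices._∈?_ n y S))
        go : (∃ λ y → y ∈ allFin n × test y ≡ true) ⊎ (∀ y → y ∈ allFin n → test y ≡ false) → ∃ λ y → y ∉ S × E ≡ toSubset (y ∷ S)
        go (inj₂ none) = ⊥-elim (1+n≰n (≤-trans (≤-reflexive (sym l)) (≤-trans (p⊆q⇒∣p∣≤∣q∣ E⊆) (≤-reflexive (size-toSubset S u)))))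
          where
          E⊆ : E ⊆ˢ toSubset S
          E⊆ {y} i = ∈-toSubset⁺ {xs = S} (case Vertices._∈?_ n y S of λ { (yes j) → j ; (no j) → true≢false (∧-intro (decide (y ∈ˢ? E) i) (cong not (refute (Vertices._∈?_ n y S) j))) (none y (∈-allFin y)) })
            where
            refute : ∀ {P : Set} (d : Dec P) → ¬ P → does d ≡ false
            refute (yes p) k = ⊥-elim (k p)
            refute (no _) _ = refl
        go (inj₁ (y , _ , h)) = y , y∉ , ⊆-antisym E⊆ yS⊆
          where
          y∈ : y ∈ˢ E
          y∈ = decided (y ∈ˢ? E) (∧-fst {does (y ∈ˢ? E)} h)
          y∉ : y ∉ S
          y∉ = undecided (Vertices._∈?_ n y S) (not-true (∧-snd {does (y ∈ˢ? E)} h))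
          yS⊆ : toSubset (y ∷ S) ⊆ˢ E
          yS⊆ = toSubset-⊆ {xs = y ∷ S} λ { (here refl) → y∈ ; (there i) → sub (∈-toSubset⁺ {xs = S} i) }
          E⊆ : E ⊆ˢ toSubset (y ∷ S)
          E⊆ {z} i = case z ∈ˢ? toSubset (y ∷ S) of λ { (yes j) → j
            ; (no j) → ⊥-elim (1+n≰n (≤-trans (≤-trans (s≤s (≤-reflexive (sym (size-toSubset (y ∷ S) (unique-∷ y∉ u))))) (p⊂q⇒∣p∣<∣q∣ (yS⊆ , z , i , j))) (≤-reflexive l))) }

  abstract
    allSubsets-once : ∀ {m} (X : Subset m) → # (λ E → does (Vec′.≡-dec _≟ᵇ_ E X)) of allSubsets m ≤ 1
    allSubsets-once Vec.[] = ≤-refl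
    allSubsets-once {suc m} (b Vec.∷ X) = ≤-trans (≤-reflexive (trans (#-++ (map (outside Vec.∷_) (allSubsets m)) (map (inside Vec.∷_) (allSubsets m)) (λ E → does (Vec′.≡-dec _≟ᵇ_ E (b Vec.∷ X)))) (cong₂ _+_ (∑-map (outside Vec.∷_) (allSubsets m) (λ E → ⟦ does (Vec′.≡-dec _≟ᵇ_ E (b Vec.∷ X)) ⟧)) (∑-map (inside Vec.∷_) (allSubsets m) (λ E → ⟦ does (Vec′.≡-dec _≟ᵇ_ E (b Vec.∷ X)) ⟧))))) (go b)
      where
      is : ∀ c b (E : Subset m) → ⟦ does (Vec′.≡-dec _≟ᵇ_ (c Vec.∷ E) (b Vec.∷ X)) ⟧ ≤ ⟦ does (c ≟ᵇ b) ⟧ * ⟦ does (Vec′.≡-dec _≟ᵇ_ E X) ⟧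
      is c b E = ⟦⟧-≤ _ λ h → case decided (Vec′.≡-dec _≟ᵇ_ (c Vec.∷ E) (b Vec.∷ X)) h of λ { refl → *-mono-≤ (⟦⟧-true (decide (c ≟ᵇ c) refl)) (⟦⟧-true (decide (Vec′.≡-dec _≟ᵇ_ E E) refl)) }
      sum : ∀ c b → ∑ (allSubsets m) (λ E → ⟦ does (Vec′.≡-dec _≟ᵇ_ (c Vec.∷ E) (b Vec.∷ X)) ⟧) ≤ ⟦ does (c ≟ᵇ b) ⟧ * 1
      sum c b = ≤-trans (∑-mono (allSubsets m) (is c b)) (≤-trans (≤-reflexive (∑-* (allSubsets m) ⟦ does (c ≟ᵇ b) ⟧ (λ E → ⟦ does (Vec′.≡-dec _≟ᵇ_ E X) ⟧))) (*-monoʳ-≤ ⟦ does (c ≟ᵇ b) ⟧ (allSubsets-once X)))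
      go : ∀ b → ∑ (allSubsets m) (λ E → ⟦ does (Vec′.≡-dec _≟ᵇ_ (outside Vec.∷ E) (b Vec.∷ X)) ⟧) + ∑ (allSubsets m) (λ E → ⟦ does (Vec′.≡-dec _≟ᵇ_ (inside Vec.∷ E) (b Vec.∷ X)) ⟧) ≤ 1
      go true = sum outside true ⊕ sum inside true
      go false = sum outside false ⊕ sum inside false

    length-filter : ∀ {A : Set} {P : A → Set} (P? : ∀ x → Dec (P x)) xs → length (filter P? xs) ≡ # (λ x → does (P? x)) of xs
    length-filter P? [] = refl
    length-filter P? (x ∷ xs) with does (P? x)
    ... | true = cong suc (length-filter P? xs)
    ... | false = length-filter P? xs

  module Translate {k n : ℕ} (H : Hypergraph k n) where

    e : List (Fin n) → Bool
    e W = (does (Vertices.unique? n W) ∧ does (length W ≟ℕ k)) ∧ edge H (toSubset W)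

    abstract
      e-elim : ∀ {W} → e W ≡ true → Unique W × length W ≡ k × edge H (toSubset W) ≡ true
      e-elim {W} h = let a , b = ∧-elim {does (Vertices.unique? n W) ∧ does (length W ≟ℕ k)} h ; c , d = ∧-elim {does (Vertices.unique? n W)} a
                     in decided (Vertices.unique? n W) c , decided (length W ≟ℕ k) d , b

      e-intro : ∀ {W} → Unique W → length W ≡ k → edge H (toSubset W) ≡ true → e W ≡ true
      e-intro {W} u l h = ∧-intro (∧-intro (decide (Vertices.unique? n W) u) (decide (length W ≟ℕ k) l)) h

      e-↭ : ∀ {xs ys} → xs ↭ ys → e xs ≡ true → e ys ≡ true
      e-↭ p h = let u , l , g = e-elim h in e-intro (Unique-↭ p u) (trans (sym (↭-length p)) l) (trans (cong (edge H) (sym (toSubset-↭ p))) g)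

      codegree : ∀ S → Unique S → suc (length S) ≡ k → degree H (toSubset S) ≤ # (λ y → e (y ∷ S)) of allFin n
      codegree S u l = ≤-trans (≤-reflexive (length-filter {P = IsEdgeContaining H (toSubset S)} (isEdgeContaining? H (toSubset S)) (allSubsets n))) (≤-trans (∑-mono (allSubsets n) per)
          (≤-trans (≤-reflexive (∑-swap (allSubsets n) (allFin n) (λ E y → ⟦ e (y ∷ S) ⟧ * ⟦ does (Vec′.≡-dec _≟ᵇ_ E (toSubset (y ∷ S))) ⟧))) (∑-mono (allFin n) λ y → ≤-trans (≤-reflexive (∑-* (allSubsets n) ⟦ e (y ∷ S) ⟧ (λ E → ⟦ does (Vec′.≡-dec _≟ᵇ_ E (toSubset (y ∷ S))) ⟧))) (≤-trans (*-monoʳ-≤ ⟦ e (y ∷ S) ⟧ (allSubsets-once (toSubset (y ∷ S)))) (≤-reflexive (*-identityʳ ⟦ e (y ∷ S) ⟧))))))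
        where
        per : ∀ E → ⟦ does (isEdgeContaining? H (toSubset S) E) ⟧ ≤ ∑ (allFin n) (λ y → ⟦ e (y ∷ S) ⟧ * ⟦ does (Vec′.≡-dec _≟ᵇ_ E (toSubset (y ∷ S))) ⟧)
        per E = ⟦⟧-≤ _ λ h → found (decided (isEdgeContaining? H (toSubset S) E) h)
          where
          found : IsEdgeContaining H (toSubset S) E → 1 ≤ ∑ (allFin n) (λ y → ⟦ e (y ∷ S) ⟧ * ⟦ does (Vec′.≡-dec _≟ᵇ_ E (toSubset (y ∷ S))) ⟧)
          found (ed , sub) = go (extension S E u (trans (uniform H E ed) (sym l)) sub)
            where
            go : (∃ λ y → y ∉ S × E ≡ toSubset (y ∷ S)) → 1 ≤ ∑ (allFin n) (λ y → ⟦ e (y ∷ S) ⟧ * ⟦ does (Vec′.≡-dec _≟ᵇ_ E (toSubset (y ∷ S))) ⟧)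
            go (y , y∉ , eq) = ≤-trans (#-pos (λ y → e (y ∷ S) ∧ does (Vec′.≡-dec _≟ᵇ_ E (toSubset (y ∷ S)))) (∈-allFin y)
                (∧-intro {e (y ∷ S)} (e-intro {y ∷ S} (unique-∷ y∉ u) l (trans (cong (edge H) (sym eq)) ed)) (decide (Vec′.≡-dec _≟ᵇ_ E (toSubset (y ∷ S))) eq))) (≤-reflexive (∑-cong (allFin n) (λ y → ⟦∧⟧ (e (y ∷ S)) (does (Vec′.≡-dec _≟ᵇ_ E (toSubset (y ∷ S)))))))

  module _ {A : Set} where

    at : List A → ℕ → Maybe A
    at [] _ = nothing
    at (x ∷ xs) zero = just x
    at (x ∷ xs) (suc i) = at xs i

    at-++ˡ : ∀ xs {ys} i → i < length xs → at (xs ++ ys) i ≡ at xs i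
    at-++ˡ (x ∷ xs) zero h = refl
    at-++ˡ (x ∷ xs) (suc i) (s≤s h) = at-++ˡ xs i h

    at-++ʳ : ∀ xs {ys} i → at (xs ++ ys) (length xs + i) ≡ at ys i
    at-++ʳ [] i = refl
    at-++ʳ (x ∷ xs) i = at-++ʳ xs i

    at-lookup : ∀ (xs : List A) (i : Fin (length xs)) → at xs (toℕ i) ≡ just (lookup xs i)
    at-lookup (x ∷ xs) Fin.zero = refl
    at-lookup (x ∷ xs) (Fin.suc i) = at-lookup xs i

    lookup-∈ : ∀ (xs : List A) (i : Fin (length xs)) → lookup xs i ∈ xs
    lookup-∈ (x ∷ xs) Fin.zero = here refl
    lookup-∈ (x ∷ xs) (Fin.suc i) = there (lookup-∈ xs i)

    lookup-injective : ∀ {xs : List A} → Unique xs → ∀ i j → lookup xs i ≡ lookup xs j → i ≡ j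
    lookup-injective {x ∷ xs} u Fin.zero Fin.zero h = refl
    lookup-injective {x ∷ xs} u Fin.zero (Fin.suc j) h = ⊥-elim (unique-head u (subst (_∈ xs) (sym h) (lookup-∈ xs j)))
    lookup-injective {x ∷ xs} u (Fin.suc i) Fin.zero h = ⊥-elim (unique-head u (subst (_∈ xs) h (lookup-∈ xs i)))
    lookup-injective {x ∷ xs} u (Fin.suc i) (Fin.suc j) h = cong Fin.suc (lookup-injective (unique-tail u) i j h)

    applyUpTo-≡ : ∀ k (g : ℕ → A) mid post → length mid ≡ k → (∀ j → j < k → at (mid ++ post) j ≡ just (g j)) → applyUpTo g k ≡ mid
    applyUpTo-≡ zero g [] post l h = refl
    applyUpTo-≡ (suc k) g (x ∷ mid) post l h = cong₂ _∷_ (sym (just-injective (h 0 (s≤s z≤n)))) (applyUpTo-≡ k (λ j → g (suc j)) mid post (suc-injective l) (λ j p → h (suc j) (s≤s p)))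
      where
      just-injective : ∀ {a b : A} → just a ≡ just b → a ≡ b
      just-injective refl = refl

  window-≡ : ∀ {n} (h : ℕ → Fin n) (f : ℕ → ℕ) k → foldr (λ j acc → ⁅ h j ⁆ ∪ acc) ∅ (applyUpTo f k) ≡ toSubset (applyUpTo (λ j → h (f j)) k)
  window-≡ h f zero = refl
  window-≡ h f (suc k) = cong (⁅ h (f 0) ⁆ ∪_) (window-≡ h (λ j → f (suc j)) k)

  module Ordering {n′ : ℕ} (vs : List (Fin (suc n′))) (p : vs ↭ allFin (suc n′)) where

    private
      n : ℕ
      n = suc n′

    abstract
      len : length vs ≡ n
      len = trans (↭-length p) (Vertices.length-allFin n)

      uniq : Unique vs
      uniq = Unique-↭ (↭-sym p) (Vertices.allFin-unique n)

    f : Fin n → Fin n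
    f i = lookup vs (subst Fin (sym len) i)

    g : Fin n → Fin n
    g v = subst Fin len (Any.index (∈-resp-↭ (↭-sym p) (∈-allFin v)))

    abstract
      f-g : ∀ v → f (g v) ≡ v
      f-g v = trans (cong (lookup vs) (undo len _)) (sym (Any′.lookup-index (∈-resp-↭ (↭-sym p) (∈-allFin v))))
        where
        undo : ∀ {a b : ℕ} (q : a ≡ b) (i : Fin a) → subst Fin (sym q) (subst Fin q i) ≡ i
        undo refl i = refl

      f-injective : ∀ i j → f i ≡ f j → i ≡ j
      f-injective i j h = subst-inj (sym len) (lookup-injective uniq _ _ h)
        where
        subst-inj : ∀ {a b : ℕ} (q : a ≡ b) {i j : Fin a} → subst Fin q i ≡ subst Fin q j → i ≡ j
        subst-inj refl h = h

    σ : Permutation′ n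
    σ = permutation f g f-g (λ i → f-injective _ _ (f-g (f i)))

    abstract
      at-f : ∀ i → at vs (toℕ i) ≡ just (f i)
      at-f i = trans (cong (at vs) (sym (toℕ-subst (sym len) i))) (at-lookup vs _)
        where
        toℕ-subst : ∀ {a b : ℕ} (q : a ≡ b) (i : Fin a) → toℕ (subst Fin q i) ≡ toℕ i
        toℕ-subst refl i = refl

      at-mod : ∀ x → x < n → at vs x ≡ just (σ ⟨$⟩ʳ (x mod n))
      at-mod x h = trans (cong (at vs) (sym (trans (toℕ-fromℕ< _) (m<n⇒m%n≡m h)))) (at-f (x mod n))

      -- Positions past the end wrap around into the first part A.
      at-cyclic : ∀ A rest → vs ≡ A ++ rest → ∀ x → x < n + length A → at (vs ++ A) x ≡ just (σ ⟨$⟩ʳ (x mod n))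
      at-cyclic A rest eq x h with x <? n
      ... | yes q = trans (at-++ˡ vs x (≤-trans q (≤-reflexive (sym len)))) (at-mod x q)
      ... | no q = trans (cong (at (vs ++ A)) (sym x≡)) (trans (trans (cong (λ z → at (vs ++ A) (z + (x ∸ n))) (sym len)) (at-++ʳ vs (x ∸ n))) (trans (sym (trans (cong (λ z → at z (x ∸ n)) eq) (at-++ˡ A (x ∸ n) y<))) (trans (at-mod (x ∸ n) y<n) (cong (λ z → just (σ ⟨$⟩ʳ z)) same))))
        where
        x≡ : n + (x ∸ n) ≡ x
        x≡ = m+[n∸m]≡n (≮⇒≥ q)
        y< : x ∸ n < length A
        y< = +-cancelˡ-≤ n _ _ (≤-trans (≤-reflexive (trans (+-suc n (x ∸ n)) (cong suc x≡))) h)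
        y<n : x ∸ n < n
        y<n = ≤-trans y< (≤-trans (m≤m+n (length A) (length rest)) (≤-reflexive (trans (sym (length-++ A)) (trans (cong length (sym eq)) len))))
        same : (x ∸ n) mod n ≡ x mod n
        same = fromℕ<-cong {x ∸ n} {x} (trans (sym ([m+n]%n≡m%n (x ∸ n) n)) (cong (_% n) (trans (+-comm (x ∸ n) n) x≡)))
          where
          open import Data.Fin.Properties using (toℕ-injective)
          fromℕ<-cong : ∀ {a b : ℕ} → a % n ≡ b % n → a mod n ≡ b mod n
          fromℕ<-cong q = toℕ-injective (trans (toℕ-fromℕ< _) (trans q (sym (toℕ-fromℕ< _))))

      window-parts : ∀ A rest → vs ≡ A ++ rest → ∀ a k pre mid post → vs ++ A ≡ pre ++ (mid ++ post) → length pre ≡ a → length mid ≡ k → window σ a k ≡ toSubset mid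
      window-parts A rest eq a k pre mid post split la lk = trans (window-≡ (λ j → σ ⟨$⟩ʳ ((a + j) mod n)) id k) (cong toSubset (applyUpTo-≡ k (λ j → σ ⟨$⟩ʳ ((a + j) mod n)) mid post lk λ j h →
          trans (sym (at-++ʳ pre j)) (trans (cong₂ at (sym split) (cong (_+ j) la)) (at-cyclic A rest eq (a + j) (bound j h)))))
        where
        bound : ∀ j → j < k → a + j < n + length A
        bound j h = ≤-trans (≤-reflexive (sym (+-suc a j))) (≤-trans (+-monoʳ-≤ a h) (≤-trans (≤-reflexive (sym (trans (length-++ pre) (cong₂ _+_ la (trans (length-++ mid) (cong (_+ length post) lk))))) ⊣ (m≤m+n (a + k) (length post))) (≤-reflexive (trans (cong length (sym split)) (trans (length-++ vs) (cong (_+ length A) len))))))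
          where
          _⊣_ : ∀ {z : ℕ} → a + (k + length post) ≤ z → a + k ≤ a + k + length post → a + k ≤ z
          p ⊣ q = ≤-trans q (≤-trans (≤-reflexive (+-assoc a k (length post))) p)

  module Cyclic (hg : HG) where
    open HG hg
    open Trails hg
    open Covering hg

    record Sequence (A B : Part) (W : List V) : Set where
      constructor mkSequence
      field
        ps    : List Part
        chain : Chain A ps
        last≡ : lastPart A ps ≡ B
        all≡  : A ++ concat ps ↭ W

    chain-++ : ∀ A ps {C} qs → Chain A ps → lastPart A ps ~ C → Chain C qs → Chain A (ps ++ C ∷ qs)
    chain-++ A [] qs c h d = h , d
    chain-++ A (B ∷ ps) qs (a , c) h d = a , chain-++ B ps qs c h d

    last-++ : ∀ A ps {C} qs → lastPart A (ps ++ C ∷ qs) ≡ lastPart C qs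
    last-++ A [] qs = refl
    last-++ A (B ∷ ps) qs = last-++ B ps qs

    sequence : ∀ {A B W} → Trail A B W → Sequence A B W
    sequence {A} (part p) = mkSequence [] p refl (↭-reflexive (++-identityʳ A))
    sequence (perm′ w t) = let mkSequence ps c l p = sequence t in mkSequence ps c l (↭-trans p w)
    sequence (join {A} {B} {C} t h t′) with sequence t | sequence t′
    ... | mkSequence ps c refl p | mkSequence qs d l q = mkSequence (ps ++ C ∷ qs) (chain-++ A ps qs c h d) (trans (last-++ A ps qs) l)
        (↭-trans (↭-reflexive (trans (cong (A ++_) (concat-++ ps (C ∷ qs))) (sym (++-assoc A (concat ps) (C ++ concat qs))))) (++⁺ p q))

    consecutive : ∀ A ps Z → Chain A ps → lastPart A ps ~ Z → ∀ i → i ≤ length ps → ∃ λ pre → ∃ λ X → ∃ λ Y → ∃ λ post → A ∷ ps ++ [ Z ] ≡ pre ++ X ∷ Y ∷ post × length (concat pre) ≡ i * m × X ~ Y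
    consecutive A [] Z c h zero _ = [] , A , Z , [] , refl , refl , h
    consecutive A (B ∷ ps) Z (a , c) h zero _ = [] , A , B , ps ++ [ Z ] , refl , refl , a
    consecutive A (B ∷ ps) Z (a , c) h (suc i) (s≤s l) with consecutive B ps Z c h i l
    ... | pre , X , Y , post , eq , len , xy = A ∷ pre , X , Y , post , cong (A ∷_) eq , trans (length-++ A) (cong₂ _+_ (~-length {A} {B} a) len) , xy

    module Close {A ps} (c : Chain A ps) (h : lastPart A ps ~ A) where

      vs : List V
      vs = A ++ concat ps

      abstract
        pieces : ∀ i → i ≤ length ps → ∃ λ pre → ∃ λ mid → ∃ λ post → vs ++ A ≡ pre ++ (mid ++ post) × length pre ≡ i * m × length mid ≡ m + m × e mid ≡ true
        pieces i l with consecutive A ps A c h i l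
        ... | pre , X , Y , post , eq , len , xy = concat pre , X ++ Y , concat post ,
            trans (trans (++-assoc A (concat ps) A) (trans (cong (λ z → A ++ (concat ps ++ z)) (sym (++-identityʳ A))) (cong (A ++_) (sym (concat-++ ps [ A ]))))) (trans (cong concat eq) (trans (concat-++ pre (X ∷ Y ∷ post)) (cong (concat pre ++_) (sym (++-assoc X Y (concat post)))))) ,
            len , trans (length-++ X) (cong₂ _+_ (~-length {X} {Y} xy) (~-lengthʳ {X} {Y} xy)) , ~-edge {X} {Y} xy

  cyclic-order : ∀ {n k} (H : Hypergraph k n) (vs : List (Fin n)) → vs ↭ allFin n → 1 ≤ n → ∀ A rest → vs ≡ A ++ rest → ∀ m t → t * m ≡ n →
    (∀ i → i < t → ∃ λ pre → ∃ λ mid → ∃ λ post → vs ++ A ≡ pre ++ (mid ++ post) × length pre ≡ i * m × length mid ≡ k × edge H (toSubset mid) ≡ true) →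
    ∀ ℓ → k ∸ ℓ ≡ m → HasHamiltonCycle H ℓ
  cyclic-order {suc n′} {k} H vs p _ A rest eq _ t tm pieces ℓ refl = σ , t , tm , λ i h → edges i (pieces i h)
    where
    open Ordering vs p
    edges : ∀ i → (∃ λ pre → ∃ λ mid → ∃ λ post → vs ++ A ≡ pre ++ (mid ++ post) × length pre ≡ i * (k ∸ ℓ) × length mid ≡ k × edge H (toSubset mid) ≡ true) →
      edge H (window σ (i * (k ∸ ℓ)) k) ≡ true
    edges i (pre , mid , post , split , la , lk , h) = trans (cong (edge H) (window-parts A rest eq (i * (k ∸ ℓ)) k pre mid post split la lk)) h

  module _ (hg : HG) where
    open HG hg
    open Trails hg
    open Covering hg
    open Cyclic hg

    abstract
      hamilton-cycle : ∀ {k} (H : Hypergraph k n) → k ≡ m + m → (∀ W → e W ≡ true → edge H (toSubset W) ≡ true) → Hamilton → HasHamiltonCycle H m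
      hamilton-cycle {k} H k≡ edges (A , B , W , trail , B~A , all) = go (sequence trail)
        where
        go : Sequence A B W → HasHamiltonCycle H m
        go (mkSequence ps chain last≡ all≡) = cyclic-order H vs all′ (≤-trans (s≤s z≤n) (≤-reflexive size)) A (concat ps) refl m (suc (length ps)) (trans (*-comm (suc (length ps)) m) size)
            (λ i h → piece i (pieces i (≤-pred h))) m (trans (cong (_∸ m) k≡) (m+n∸n≡m m m))
          where
          open Close {A} {ps} chain (subst (_~ A) (sym last≡) B~A)
          open import Data.Nat.Properties using (m+n∸n≡m)
          all′ : vs ↭ allFin n
          all′ = ↭-trans all≡ all
          size : m * suc (length ps) ≡ n
          size = trans (sym (chain-length A ps chain)) (trans (↭-length all′) length-allFin)
          piece : ∀ i → (∃ λ pre → ∃ λ mid → ∃ λ post → vs ++ A ≡ pre ++ (mid ++ post) × length pre ≡ i * m × length mid ≡ m + m × e mid ≡ true) →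
            ∃ λ pre → ∃ λ mid → ∃ λ post → vs ++ A ≡ pre ++ (mid ++ post) × length pre ≡ i * m × length mid ≡ k × edge H (toSubset mid) ≡ true
          piece i (pre , mid , post , split , la , lm , h) = pre , mid , post , split , la , trans lm (sym k≡) , edges mid h

module Parity where

  open Base
  open Arithmetic
  open Xor
  open Hyper
  open Absorb
  open Cover

  not≢ : ∀ {a : Bool} {C : Set} → a ≡ not a → C
  not≢ {true} ()
  not≢ {false} ()

  module _ {A : Set} (χ : A → Bool) where

    parity : List A → Bool
    parity [] = false
    parity (v ∷ vs) = χ v xor parity vs

    parity-++ : ∀ xs ys → parity (xs ++ ys) ≡ parity xs xor parity ys
    parity-++ [] ys = refl
    parity-++ (x ∷ xs) ys = trans (cong (χ x xor_) (parity-++ xs ys)) (sym (xor-assoc (χ x) (parity xs) (parity ys)))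

    parity-↭ : ∀ {xs ys} → xs ↭ ys → parity xs ≡ parity ys
    parity-↭ _↭_.refl = refl
    parity-↭ (prep x p) = cong (χ x xor_) (parity-↭ p)
    parity-↭ (swap x y p) = trans (cong (λ z → χ x xor (χ y xor z)) (parity-↭ p)) (xor-swap (χ x) (χ y) _)
    parity-↭ (_↭_.trans p q) = trans (parity-↭ p) (parity-↭ q)

    parity-const : ∀ b xs ys → (∀ {v} → v ∈ xs → χ v ≡ b) → (∀ {v} → v ∈ ys → χ v ≡ b) → length xs ≡ length ys → parity xs ≡ parity ys
    parity-const b [] [] hx hy l = refl
    parity-const b (x ∷ xs) (y ∷ ys) hx hy l = cong₂ _xor_ (trans (hx (here refl)) (sym (hy (here refl)))) (parity-const b xs ys (λ i → hx (there i)) (λ i → hy (there i)) (suc-injective l))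

  module Counting (hg : HG) where
    open HG hg

    abstract
      neighbour : ∀ F S → length F ≤ 100 * β → Unique S → suc (length S) ≡ m + m → ∃ λ y → y ∉ F × e (y ∷ S) ≡ true
      neighbour F S F≤ u l = let y , _ , h = #-find (allFin n) p many in y , (λ i → true≢false (∧-snd {e (y ∷ S)} h) (cong not (decide (y ∈? F) i))) , ∧-fst {e (y ∷ S)} h
        where
        p : V → Bool
        p y = e (y ∷ S) ∧ not (y ∈ᵇ F)
        cases : ∀ a b → ⟦ a ⟧ ≤ ⟦ a ∧ not b ⟧ + ⟦ b ⟧
        cases true true = s≤s z≤n
        cases true false = s≤s z≤n
        cases false b = z≤n
        D≤ : D ≤ # p of allFin n + length F
        D≤ = ≤-trans (codegree u l) (≤-trans (∑-mono (allFin n) (λ y → cases (e (y ∷ S)) (y ∈ᵇ F))) (≤-trans (≤-reflexive (∑-+ (allFin n) _ _)) (+-monoʳ-≤ (# p of allFin n) (#-elem F))))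
        arith : ∀ n D k f β m → n ≤ 2 * D + 4 * m → D ≤ k + f → f ≤ 100 * β → m ≤ β → 24000 * β ≤ n → 1 ≤ n → 1 ≤ k
        arith n D zero f β m h₁ h₂ h₃ h₄ h₅ h₆ = absurd (23592 * β) (2 ⊗ h₁ ⊕ 4 ⊗ h₂ ⊕ 4 ⊗ h₃ ⊕ 8 ⊗ h₄ ⊕ h₅ ⊕ h₆) (ring-60 n D f β m)
        arith n D (suc k) f β m _ _ _ _ _ _ = s≤s z≤n
        many : 1 ≤ # p of allFin n
        many = arith n D (# p of allFin n) (length F) β m n≤2D D≤ F≤ (≤-trans m≤unit (≤-trans (≤-reflexive (sym (+-identityʳ unit))) (units≤β 1 (≤ᵇ⇒≤ 1 5000 tt)))) 24β≤n n-pos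

      -- Three disjoint families, each containing almost half of all tuples.
      threeHalves : ∀ j (f g h : List V → Bool) → (∀ w → f w ≡ true → g w ≡ true → ⊥) → (∀ w → f w ≡ true → h w ≡ true → ⊥) → (∀ w → g w ≡ true → h w ≡ true → ⊥) →
        s * n ^ suc j ≤ 2 * s * # f of tup (suc j) + n ^ suc j → s * n ^ suc j ≤ 2 * s * # g of tup (suc j) + n ^ suc j → s * n ^ suc j ≤ 2 * s * # h of tup (suc j) + n ^ suc j → ⊥
      threeHalves j f g h fg fh gh hf hg hh = arith s (n ^ suc j) (# f of tup (suc j)) (# g of tup (suc j)) (# h of tup (suc j)) hf hg hh total (power-pos (suc j)) s-large
        where
        cases : ∀ a b c → (a ≡ true → b ≡ true → ⊥) → (a ≡ true → c ≡ true → ⊥) → (b ≡ true → c ≡ true → ⊥) → ⟦ a ⟧ + ⟦ b ⟧ + ⟦ c ⟧ ≤ 1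
        cases true true c p q r = ⊥-elim (p refl refl)
        cases true false true p q r = ⊥-elim (q refl refl)
        cases true false false p q r = s≤s z≤n
        cases false true true p q r = ⊥-elim (r refl refl)
        cases false true false p q r = s≤s z≤n
        cases false false true p q r = s≤s z≤n
        cases false false false p q r = z≤n
        total : # f of tup (suc j) + # g of tup (suc j) + # h of tup (suc j) ≤ n ^ suc j
        total = ≤-trans (≤-reflexive (sym (trans (∑-+ (tup (suc j)) _ _) (cong (_+ # h of tup (suc j)) (∑-+ (tup (suc j)) _ _))))) (≤-trans (∑-mono (tup (suc j)) (λ w → cases (f w) (g w) (h w) (fg w) (fh w) (gh w))) (≤-reflexive (trans (∑-U (suc j) 1) (*-identityʳ _))))
        arith : ∀ s M a b c → s * M ≤ 2 * s * a + M → s * M ≤ 2 * s * b + M → s * M ≤ 2 * s * c + M → a + b + c ≤ M → 1 ≤ M → 6000 ≤ s → ⊥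
        arith s M a b c ha hb hc ht hM hs = absurd (5996 * M) (ha ⊕ hb ⊕ hc ⊕ 2 * s ⊗ ht ⊕ hM ⊕ M ⊗ hs) (ring-61 s M a b c)

  record Exact (hg : HG) : Set where
    open HG hg
    field
      Z        : List V
      Z-unique : Unique Z
      Z-few    : length Z ≤ 30 * (m * suc K)
      col      : Pred
      col-↭    : ∀ {A A′} → A ↭ A′ → col A ≡ col A′
      δ        : Bool
      edge-col : ∀ {A B} → A ~ B → Disj A Z → Disj B Z → col A xor col B ≡ δ
      rainbow  : ∀ F → length F + 30 * unit ≤ β → ∀ c → ∃ λ A → Proper A × Disj A F × col A ≡ c

    Z-small : length Z ≤ 30 * unit
    Z-small = ≤-trans Z-few (*-monoʳ-≤ 30 mK≤unit)

  record Chi (hg : HG) (ex : Exact hg) : Set where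
    open HG hg
    open Exact ex
    field
      Zs        : List V
      Zs-unique : Unique Zs
      Zs-few    : length Zs ≤ 33 * (m * suc K)
      Zs-some   : ∃ λ z → z ∈ Zs
      χ         : V → Bool
      c₀        : Bool
      Z⊆        : ∀ {v} → v ∈ Z → v ∈ Zs
      col-par   : ∀ {A} → Proper A → Disj A Zs → col A ≡ c₀ xor parity χ A
      edge-par  : ∀ {S} → e S ≡ true → Disj S Zs → parity χ S ≡ δ
      pick      : ∀ F → length F + 66 * unit ≤ β → ∀ b → ∃ λ v → v ∉ F × v ∉ Zs × χ v ≡ b

    Zs-small : length Zs ≤ 33 * unit
    Zs-small = ≤-trans Zs-few (*-monoʳ-≤ 33 mK≤unit)

  module Colouring (hg : HG) (ex : Exact hg) where
    open HG hg
    open Exact ex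
    open Counting hg

    ν : ℕ
    ν = pred μ

    abstract
      μ≡ : μ ≡ suc ν
      μ≡ = pos μ μ-large
        where
        pos : ∀ k → 2 ≤ k → k ≡ suc (pred k)
        pos (suc k) _ = refl

      many-links : ∀ F S → length F ≤ β → Unique S → length S ≡ suc m → s * n ^ suc ν ≤ 2 * s * # off F (λ w → e (w ++ S)) of tup (suc ν) + n ^ suc ν
      many-links F S h u l = links-off ν F (≤-trans (n≤1+n ν) (≤-reflexive (sym μ≡))) h u (trans (cong₂ _+_ l (sym μ≡)) (cong suc (sym (+-suc μ μ))))

      off-elim : ∀ F p w → off F p w ≡ true → p w ≡ true × Disj w F
      off-elim F p w h = let a , b = ∧-elim {p w} h in a , hits-disj F w (not-true b)

      1unit : ∀ j → j ≤ 5000 → ∀ {x} → x ≤ j * unit → x ≤ β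
      1unit j h k = ≤-trans k (units≤β j h)

      edge-cols : ∀ {u v T w} → length T ≡ μ → v ∉ Z → Disj (u ∷ T) Z → e (w ++ (u ∷ v ∷ T)) ≡ true → Disj w Z → col (v ∷ w) ≡ col (u ∷ T) xor δ
      edge-cols {u} {v} {T} {w} l v∉ dT h dw = trans (sym (xor-undoˡ (col (u ∷ T)) (col (v ∷ w)))) (cong (col (u ∷ T) xor_) (edge-col {u ∷ T} {v ∷ w} (edge-~ {u ∷ T} {v ∷ w} (cong suc l) (e-↭ p h)) dT (disj-∷ v∉ dw)))
        where
        p : w ++ (u ∷ v ∷ T) ↭ (u ∷ T) ++ (v ∷ w)
        p = perm 4 (λ w u v t → w ∙ (u ∙ (v ∙ t)) ⊜ (u ∙ t) ∙ (v ∙ w)) ↭-refl w [ u ] [ v ] T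

      core : ∀ u v T T′ → length T ≡ μ → length T′ ≡ μ → Unique (u ∷ v ∷ T) → Unique (u ∷ v ∷ T′) → Disj (u ∷ v ∷ T) Z → Disj (u ∷ v ∷ T′) Z →
        col (v ∷ T) ≡ col (v ∷ T′) → col (u ∷ T) ≡ col (u ∷ T′)
      core u v T T′ l l′ U U′ d d′ same = [ id , (λ differ → ⊥-elim (clash differ)) ]′ (bool-≟ (col (u ∷ T)) (col (u ∷ T′)))
        where
        u∉ : u ∉ Z
        u∉ = d (here refl)
        v∉ : v ∉ Z
        v∉ = d (there (here refl))
        dT : ∀ {T} → Disj (u ∷ v ∷ T) Z → ∀ x → x ∉ Z → Disj (x ∷ T) Z
        dT d x x∉ (here refl) j = x∉ j
        dT d x x∉ (there i) j = d (there (there i)) j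
        Z≤ : length Z ≤ β
        Z≤ = 1unit 30 (≤ᵇ⇒≤ 30 5000 tt) Z-small
        wit : ∃ λ A → Proper A × Disj A (u ∷ Z) × col A ≡ not (col (v ∷ T))
        wit = rainbow (u ∷ Z) (1unit 61 (≤ᵇ⇒≤ 61 5000 tt) (≤-trans (+-monoˡ-≤ (30 * unit) (1≤unit ⊕ Z-small)) (≤-reflexive (sym (*-distribʳ-+ unit 31 30))))) (not (col (v ∷ T)))
        A : Part
        A = proj₁ wit
        pA : Proper A
        pA = proj₁ (proj₂ wit)
        dA : Disj A (u ∷ Z)
        dA = proj₁ (proj₂ (proj₂ wit))
        f g h : List V → Bool
        f = off Z (λ w → e (w ++ (u ∷ v ∷ T)))
        g = off Z (λ w → e (w ++ (u ∷ v ∷ T′)))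
        h = off Z (λ w → e (w ++ (u ∷ A)))
        u∉A : u ∉ A
        u∉A i = dA i (here refl)
        fu : ∀ w → f w ≡ true → col (u ∷ w) ≡ col (v ∷ T) xor δ
        fu w k = let a , b = off-elim Z (λ w → e (w ++ (u ∷ v ∷ T))) w k in edge-cols {v} {u} {T} {w} l u∉ (dT d v v∉) (e-↭ (++⁺ˡ w (swap u v ↭-refl)) a) b
        fv : ∀ w → f w ≡ true → col (v ∷ w) ≡ col (u ∷ T) xor δ
        fv w k = let a , b = off-elim Z (λ w → e (w ++ (u ∷ v ∷ T))) w k in edge-cols {u} {v} {T} {w} l v∉ (dT d u u∉) a b
        gu : ∀ w → g w ≡ true → col (u ∷ w) ≡ col (v ∷ T′) xor δ
        gu w k = let a , b = off-elim Z (λ w → e (w ++ (u ∷ v ∷ T′))) w k in edge-cols {v} {u} {T′} {w} l′ u∉ (dT d′ v v∉) (e-↭ (++⁺ˡ w (swap u v ↭-refl)) a) b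
        gv : ∀ w → g w ≡ true → col (v ∷ w) ≡ col (u ∷ T′) xor δ
        gv w k = let a , b = off-elim Z (λ w → e (w ++ (u ∷ v ∷ T′))) w k in edge-cols {u} {v} {T′} {w} l′ v∉ (dT d′ u u∉) a b
        hu : ∀ w → h w ≡ true → col (u ∷ w) ≡ not (col (v ∷ T)) xor δ
        hu w k = let a , b = off-elim Z (λ w → e (w ++ (u ∷ A))) w k in
          trans (sym (xor-undoˡ (col A) (col (u ∷ w)))) (trans (cong (col A xor_) (edge-col {A} {u ∷ w} (edge-~ {A} {u ∷ w} (proj₂ pA) (e-↭ (perm 3 (λ w u a → w ∙ (u ∙ a) ⊜ a ∙ (u ∙ w)) ↭-refl w [ u ] A) a)) (λ i j → dA i (there j)) (disj-∷ u∉ b))) (cong (_xor δ) (proj₂ (proj₂ (proj₂ wit)))))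
        bad : ∀ a {x : Bool} → x ≡ a xor δ → x ≡ not a xor δ → ⊥
        bad a p q = not≢ {a} (xor-cancel δ a (not a) (trans (xor-comm δ a) (trans (trans (sym p) q) (xor-comm (not a) δ))))
        clash : col (u ∷ T) ≡ not (col (u ∷ T′)) → ⊥
        clash differ = threeHalves ν f g h
          (λ w a b → bad (col (u ∷ T′)) (gv w b) (trans (fv w a) (cong (_xor δ) differ)))
          (λ w a b → bad (col (v ∷ T)) (fu w a) (hu w b))
          (λ w a b → bad (col (v ∷ T)) (trans (gu w a) (cong (_xor δ) (sym same))) (hu w b))
          (many-links Z (u ∷ v ∷ T) Z≤ U (cong (2 +_) l)) (many-links Z (u ∷ v ∷ T′) Z≤ U′ (cong (2 +_) l′)) (many-links Z (u ∷ A) Z≤ (unique-∷ u∉A (proj₁ pA)) (cong suc (proj₂ pA)))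

      swap-col : ∀ u v T T′ → length T ≡ μ → length T′ ≡ μ → Unique (u ∷ v ∷ T) → Unique (u ∷ v ∷ T′) → Disj (u ∷ v ∷ T) Z → Disj (u ∷ v ∷ T′) Z →
        col (u ∷ T) xor col (v ∷ T) ≡ col (u ∷ T′) xor col (v ∷ T′)
      swap-col u v T T′ l l′ U U′ d d′ = xor-agree (col (u ∷ T)) (col (v ∷ T)) (col (u ∷ T′)) (col (v ∷ T′)) (core u v T T′ l l′ U U′ d d′)
          (core v u T T′ l l′ (Unique-↭ (swap u v ↭-refl) U) (Unique-↭ (swap u v ↭-refl) U′) (λ i → d (∈-resp-↭ (swap v u ↭-refl) i)) (λ i → d′ (∈-resp-↭ (swap v u ↭-refl) i)))

    module Based (T₀ C₀ : List V) (lT₀ : length T₀ ≡ μ) (lC₀ : length C₀ ≡ m) (fresh : Unique (C₀ ++ (T₀ ++ Z))) where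

      Zs : List V
      Zs = C₀ ++ (T₀ ++ Z)

      χ : V → Bool
      χ v = col (v ∷ T₀)

      Φ : List V → Bool
      Φ A = col A xor parity χ A

      abstract
        Φ-↭ : ∀ {A B} → A ↭ B → Φ A ≡ Φ B
        Φ-↭ p = cong₂ _xor_ (col-↭ p) (parity-↭ χ p)

        Φ-swap : ∀ u v T → length T ≡ μ → Unique (u ∷ v ∷ T) → Disj (u ∷ v ∷ T) (T₀ ++ Z) → Φ (u ∷ T) ≡ Φ (v ∷ T)
        Φ-swap u v T l U d = xor-exchange (col (u ∷ T)) (col (v ∷ T)) (χ u) (χ v) (parity χ T)
            (swap-col u v T T₀ l lT₀ U (Unique-↭ (perm 3 (λ t u v → t ∙ (u ∙ v) ⊜ u ∙ (v ∙ t)) ↭-refl T₀ [ u ] [ v ]) (unique-++ (unique-ˡ T₀ (unique-ʳ C₀ fresh)) uv (λ i j → d (widen j) (∈-++⁺ˡ i))))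
              (λ i j → d i (∈-++⁺ʳ T₀ j)) dT₀)
          where
          uv : Unique (u ∷ v ∷ [])
          uv = unique-ˡ (u ∷ v ∷ []) U
          widen : ∀ {x} → x ∈ (u ∷ v ∷ []) → x ∈ u ∷ v ∷ T
          widen (here p) = here p
          widen (there (here p)) = there (here p)
          dT₀ : Disj (u ∷ v ∷ T₀) Z
          dT₀ (here refl) j = d (here refl) (∈-++⁺ʳ T₀ j)
          dT₀ (there (here refl)) j = d (there (here refl)) (∈-++⁺ʳ T₀ j)
          dT₀ (there (there i)) j = unique-disj T₀ (unique-ʳ C₀ fresh) i j

        walk : ∀ xs ys zs → length xs ≡ length zs → length (xs ++ ys) ≡ m → Unique (xs ++ (ys ++ zs)) → Disj (xs ++ (ys ++ zs)) (T₀ ++ Z) → Φ (xs ++ ys) ≡ Φ (ys ++ zs)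
        walk [] ys [] _ _ _ _ = Φ-↭ (↭-reflexive (sym (++-identityʳ ys)))
        walk (a ∷ xs) ys (z ∷ zs) l lm U d = trans (Φ-swap a z (xs ++ ys) (suc-injective lm) Uaz (λ i → d (∈-resp-↭ q (∈-++⁺ˡ i))))
            (trans (Φ-↭ (↭-sym (shift z xs ys))) (trans (walk xs (z ∷ ys) zs (suc-injective l) (trans (trans (length-++ xs) (+-suc (length xs) (length ys))) (trans (cong suc (sym (length-++ xs))) lm))
              (Unique-↭ (++⁺ˡ xs (shift z ys zs)) (unique-tail U)) (λ i → d (there (∈-resp-↭ (++⁺ˡ xs (↭-sym (shift z ys zs))) i)))) (Φ-↭ (↭-sym (shift z ys zs)))))
          where
          q : (a ∷ z ∷ (xs ++ ys)) ++ zs ↭ (a ∷ xs) ++ (ys ++ (z ∷ zs))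
          q = perm 5 (λ a z x y w → (a ∙ (z ∙ (x ∙ y))) ∙ w ⊜ (a ∙ x) ∙ (y ∙ (z ∙ w))) ↭-refl [ a ] [ z ] xs ys zs
          Uaz : Unique (a ∷ z ∷ (xs ++ ys))
          Uaz = unique-ˡ (a ∷ z ∷ (xs ++ ys)) (Unique-↭ (↭-sym q) U)

        Φ-const : ∀ {A} → Proper A → Disj A Zs → Φ A ≡ Φ C₀
        Φ-const {A} (u , l) d = trans (Φ-↭ (↭-reflexive (sym (++-identityʳ A)))) (walk A [] C₀ (trans l (sym lC₀)) (trans (cong length (++-identityʳ A)) l)
            (unique-++ u (unique-ˡ C₀ fresh) (λ i j → d i (∈-++⁺ˡ j))) (λ i j → [ (λ k → d k (∈-++⁺ʳ C₀ j)) , (λ k → unique-disj C₀ fresh k j) ]′ (∈-++⁻ A i)))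

        c₀ : Bool
        c₀ = Φ C₀

        col-par : ∀ {A} → Proper A → Disj A Zs → col A ≡ c₀ xor parity χ A
        col-par {A} p d = trans (sym (xor-undoʳ (col A) (parity χ A))) (cong (_xor parity χ A) (Φ-const p d))

        edge-par : ∀ {S} → e S ≡ true → Disj S Zs → parity χ S ≡ δ
        edge-par {S} h d = go (split m S (≤-trans (m≤m+n m m) (≤-reflexive (sym (e-length h)))))
          where
          go : (∃ λ A → ∃ λ B → S ≡ A ++ B × length A ≡ m) → parity χ S ≡ δ
          go (A , B , refl , l) = trans (parity-++ χ A B) (trans (sym (xor-common c₀ (parity χ A) (parity χ B))) (trans (sym (cong₂ _xor_ (col-par pA dA) (col-par pB dB)))
              (edge-col {A} {B} a (λ i j → dA i (∈-++⁺ʳ C₀ (∈-++⁺ʳ T₀ j))) (λ i j → dB i (∈-++⁺ʳ C₀ (∈-++⁺ʳ T₀ j))))))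
            where
            a : A ~ B
            a = edge-~ {A} {B} l h
            pA : Proper A
            pA = ~-properˡ {A} {B} a
            pB : Proper B
            pB = ~-properʳ {A} {B} a
            dA : Disj A Zs
            dA i = d (∈-++⁺ˡ i)
            dB : Disj B Zs
            dB i = d (∈-++⁺ʳ A i)

        Zs-few : length Zs ≤ 33 * (m * suc K)
        Zs-few = ≤-trans (≤-reflexive (trans (length-++ C₀) (cong₂ _+_ lC₀ (trans (length-++ T₀) (cong (_+ length Z) lT₀))))) (≤-trans (m≤ ⊕ (≤-trans (n≤1+n μ) m≤ ⊕ Z-few)) (≤-trans (m≤n+m _ v) (≤-reflexive (ring-62 v))))
          where
          v : ℕ
          v = m * suc K
          m≤ : m ≤ v
          m≤ = ≤-trans (≤-reflexive (sym (*-identityʳ m))) (*-monoʳ-≤ m (s≤s z≤n))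

        Zs-small : length Zs ≤ 33 * unit
        Zs-small = ≤-trans Zs-few (*-monoʳ-≤ 33 mK≤unit)

        Zs-some : ∃ λ z → z ∈ Zs
        Zs-some = go C₀ lC₀
          where
          go : ∀ C → length C ≡ m → ∃ λ z → z ∈ C ++ (T₀ ++ Z)
          go (z ∷ C) _ = z , here refl

        -- A colour that occurs in neither of two parts of different colour would make their parities equal.
        pick : ∀ F → length F + 66 * unit ≤ β → ∀ b → ∃ λ v → v ∉ F × v ∉ Zs × χ v ≡ b
        pick F h b = go (rainbow (F ++ Zs) F≤ true) (rainbow (F ++ Zs) F≤ false)
          where
          F≤ : length (F ++ Zs) + 30 * unit ≤ β
          F≤ = ≤-trans (+-monoˡ-≤ (30 * unit) (≤-trans (≤-reflexive (length-++ F)) (+-monoʳ-≤ (length F) Zs-small))) (≤-trans (≤-reflexive (+-assoc (length F) (33 * unit) (30 * unit))) (≤-trans (+-monoʳ-≤ (length F) (≤-trans (≤-reflexive (sym (*-distribʳ-+ unit 33 30))) (*-monoˡ-≤ unit (≤ᵇ⇒≤ 63 66 tt)))) h))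
          is : V → Bool
          is v = not (χ v xor b)
          is-true : ∀ x → not (x xor b) ≡ true → x ≡ b
          is-true x h = [ id , (λ k → true≢false h (lem x b k)) ]′ (bool-≟ x b)
            where
            lem : ∀ x b → x ≡ not b → not (x xor b) ≡ false
            lem _ true refl = refl
            lem _ false refl = refl
          is-false : ∀ x → not (x xor b) ≡ false → x ≡ not b
          is-false x h = [ (λ k → true≢false (lem x b k) h) , id ]′ (bool-≟ x b)
            where
            lem : ∀ x b → x ≡ b → not (x xor b) ≡ true
            lem _ true refl = refl
            lem _ false refl = refl
          go : (∃ λ A → Proper A × Disj A (F ++ Zs) × col A ≡ true) → (∃ λ A → Proper A × Disj A (F ++ Zs) × col A ≡ false) → ∃ λ v → v ∉ F × v ∉ Zs × χ v ≡ b
          go (A , pA , dA , cA) (B , pB , dB , cB) = found (search (A ++ B) is)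
            where
            found : (∃ λ v → v ∈ A ++ B × is v ≡ true) ⊎ (∀ v → v ∈ A ++ B → is v ≡ false) → ∃ λ v → v ∉ F × v ∉ Zs × χ v ≡ b
            found (inj₁ (v , i , p)) = v , (λ j → off′ (∈-++⁺ˡ j)) , (λ j → off′ (∈-++⁺ʳ F j)) , is-true (χ v) p
              where
              off′ : v ∈ F ++ Zs → ⊥
              off′ j = [ (λ k → dA k j) , (λ k → dB k j) ]′ (∈-++⁻ A i)
            found (inj₂ none) = true≢false (trans (trans (cong (c₀ xor_) (parity-const χ (not b) B A (λ i → is-false _ (none _ (∈-++⁺ʳ A i))) (λ i → is-false _ (none _ (∈-++⁺ˡ i))) (trans (proj₂ pB) (sym (proj₂ pA)))))
                (sym (col-par pA (λ i j → dA i (∈-++⁺ʳ F j))))) cA) (trans (sym (col-par pB (λ i j → dB i (∈-++⁺ʳ F j)))) cB)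

      chi : Chi hg ex
      chi = record { Zs = Zs ; Zs-unique = fresh ; Zs-few = Zs-few ; Zs-some = Zs-some ; χ = χ ; c₀ = c₀ ; Z⊆ = λ i → ∈-++⁺ʳ C₀ (∈-++⁺ʳ T₀ i) ; col-par = col-par ; edge-par = edge-par ; pick = pick }

    abstract
      β≤n : ∀ j → j ≤ 5000 → ∀ {x} → x ≤ j * unit → x ≤ n
      β≤n j h k = ≤-trans (1unit j h k) (≤-trans (≤-trans (≤-reflexive (sym (+-identityʳ β))) (*-monoˡ-≤ β (≤ᵇ⇒≤ 1 24000 tt))) 24β≤n)

      chi : Chi hg ex
      chi = go (freshSet μ Z-unique (β≤n 31 (≤ᵇ⇒≤ 31 5000 tt) (≤-trans (≤-reflexive (+-comm (length Z) μ)) (≤-trans (n≤1+n μ) m≤unit ⊕ Z-small))))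
        where
        go : (∃ λ T → length T ≡ μ × Unique (T ++ Z)) → Chi hg ex
        go (T₀ , l , u) = go′ (freshSet m u (β≤n 32 (≤ᵇ⇒≤ 32 5000 tt) (≤-trans (≤-reflexive (trans (+-comm (length (T₀ ++ Z)) m) (cong (m +_) (trans (length-++ T₀) (cong (_+ length Z) l))))) (m≤unit ⊕ (≤-trans (n≤1+n μ) m≤unit ⊕ Z-small)))))
          where
          go′ : (∃ λ C → length C ≡ m × Unique (C ++ (T₀ ++ Z))) → Chi hg ex
          go′ (C₀ , l′ , u′) = Based.chi T₀ C₀ l l′ u′

  parity-odd : ∀ {A : Set} (χ : A → Bool) b j xs → length xs ≡ suc (j + j) → (∀ {v} → v ∈ xs → χ v ≡ b) → parity χ xs ≡ b
  parity-odd χ b zero (x ∷ []) l h = trans (xor-comm (χ x) false) (h (here refl))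
  parity-odd χ b (suc j) (x ∷ y ∷ xs) l h = trans (sym (xor-assoc (χ x) (χ y) _)) (trans (cong₂ (λ p q → (p xor q) xor parity χ xs) (h (here refl)) (h (there (here refl))))
    (trans (cong (_xor parity χ xs) (xor-self b)) (parity-odd χ b j xs (suc-injective (suc-injective (trans l (cong (λ z → suc (suc z)) (+-suc j j))))) (λ i → h (there (there i))))))
  parity-odd χ b (suc j) (x ∷ []) l h = ⊥-elim (impossible (trans (suc-injective l) (cong suc (+-suc j j))))
    where
    impossible : ∀ {k} → 0 ≡ suc k → ⊥
    impossible ()

module Mixed where

  open Base
  open Arithmetic
  open Xor
  open Hyper
  open Absorb
  open Cover
  open Parity

  same : Bool → Bool → Bool
  same b x = not (x xor b)

  abstract
    same-true : ∀ b x → same b x ≡ true → x ≡ b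
    same-true true true _ = refl
    same-true false false _ = refl

    same-intro : ∀ b x → x ≡ b → same b x ≡ true
    same-intro true _ refl = refl
    same-intro false _ refl = refl

    same-split : ∀ b x → ⟦ same b x ⟧ + ⟦ same (not b) x ⟧ ≡ 1
    same-split true true = refl
    same-split true false = refl
    same-split false true = refl
    same-split false false = refl

  module Fresh (hg : HG) (ex : Exact hg) (chi : Chi hg ex) where
    open HG hg
    open Exact ex
    open Chi chi

    record FreshSet (k : ℕ) (p : Bool) (F : List V) : Set where
      constructor mkFresh
      field
        w      : List V
        unique : Unique w
        size   : length w ≡ k
        off-F  : Disj w F
        off-Zs : Disj w Zs
        par    : parity χ w ≡ p

    abstract
      add : ∀ {k p F} b (x : FreshSet k p F) → k + length F + 66 * unit ≤ β → ∃ λ v → χ v ≡ b × Σ (FreshSet (suc k) (b xor p) F) λ y → FreshSet.w y ≡ v ∷ FreshSet.w x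
      add {k} {p} {F} b (mkFresh w u l dF dZ q) h =
        let v , v∉ , v∉Z , c = pick (w ++ F) (≤-trans (≤-reflexive (cong (_+ 66 * unit) (trans (length-++ w) (cong (_+ length F) l)))) h) b
        in v , c , mkFresh (v ∷ w) (unique-∷ (λ i → v∉ (∈-++⁺ˡ i)) u) (cong suc l)
             (λ { (here refl) j → v∉ (∈-++⁺ʳ w j) ; (there i) j → dF i j }) (λ { (here refl) j → v∉Z j ; (there i) j → dZ i j }) (cong₂ _xor_ c q) , refl

      freshSome : ∀ k F → k + length F + 66 * unit ≤ β → ∃ λ p → FreshSet k p F
      freshSome zero F h = false , mkFresh [] [] refl (λ ()) (λ ()) refl
      freshSome (suc k) F h = let p , x = freshSome k F (≤-trans (n≤1+n _) h) ; _ , _ , y , _ = add true x (≤-trans (n≤1+n _) h) in true xor p , y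

      freshPar : ∀ k p F → suc k + length F + 66 * unit ≤ β → FreshSet (suc k) p F
      freshPar k p F h = let q , x = freshSome k F (≤-trans (n≤1+n _) h) ; _ , _ , y , _ = add (p xor q) x (≤-trans (n≤1+n _) h) in cast (xor-undoʳ p q) y
        where
        cast : ∀ {k a b F} → a ≡ b → FreshSet k a F → FreshSet k b F
        cast refl x = x

      -- A monochromatic list with one vertex of the other class on top.
      freshMono : ∀ k b F → k + length F + 66 * unit ≤ β → ∃ λ p → Σ (FreshSet k p F) λ x → ∀ {v} → v ∈ FreshSet.w x → χ v ≡ b
      freshMono zero b F h = false , mkFresh [] [] refl (λ ()) (λ ()) refl , λ ()
      freshMono (suc k) b F h with freshMono k b F (≤-trans (n≤1+n _) h)
      ... | p , x , all with add b x (≤-trans (n≤1+n _) h)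
      ... | v , c , y , eq = b xor p , y , λ {v′} i → [ (λ { refl → c }) , all ]′ (split′ (subst (v′ ∈_) eq i))
        where
        split′ : ∀ {v′} → v′ ∈ v ∷ FreshSet.w x → v′ ≡ v ⊎ v′ ∈ FreshSet.w x
        split′ (here e) = inj₁ e
        split′ (there i) = inj₂ i

  module Mixing (hg : HG) (ex : Exact hg) (chi : Chi hg ex) (adm : List (Fin (HG.n hg)) → Bool) where
    open HG hg
    open Exact ex
    open Chi chi
    open Counting hg

    record Edge (F : List V) (z : V) (b : Bool) : Set where
      constructor mkEdge
      field
        S     : List V
        isE   : e (z ∷ S) ≡ true
        off-F : Disj S F
        isAdm : adm S ≡ true
        par   : parity χ S ≡ b

    Mixed : List V → V → Set
    Mixed F z = Edge F z true × Edge F z false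

    Single : List V → V → Bool → Set
    Single F z r = ∀ S → e (z ∷ S) ≡ true → Disj S F → adm S ≡ true → parity χ S ≡ r

    abstract
      edge? : ∀ F z b → Edge F z b ⊎ Single F z (not b)
      edge? F z b = go (search (tup (μ + m)) test)
        where
        test : List V → Bool
        test S = (e (z ∷ S) ∧ not (hits F S)) ∧ (adm S ∧ same b (parity χ S))
        go : (∃ λ S → S ∈ tup (μ + m) × test S ≡ true) ⊎ (∀ S → S ∈ tup (μ + m) → test S ≡ false) → Edge F z b ⊎ Single F z (not b)
        go (inj₁ (S , _ , h)) = let h₁ , h₂ = ∧-elim {e (z ∷ S) ∧ not (hits F S)} h ; a , c = ∧-elim {e (z ∷ S)} h₁ ; d , p = ∧-elim {adm S} h₂
                                in inj₁ (mkEdge S a (hits-disj F S (not-true c)) d (same-true b _ p))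
        go (inj₂ none) = inj₂ λ S a d g → [ (λ p → true≢false (∧-intro (∧-intro a (not-false (disj-hits F S d))) (∧-intro g (same-intro b _ p))) (none S (∈-tup (μ + m) S (suc-injective (e-length a))))) , id ]′ (bool-≟ (parity χ S) b)

      mixed? : ∀ F z → Mixed F z ⊎ ∃ (Single F z)
      mixed? F z = go (edge? F z true) (edge? F z false)
        where
        go : Edge F z true ⊎ Single F z false → Edge F z false ⊎ Single F z true → Mixed F z ⊎ ∃ (Single F z)
        go (inj₁ a) (inj₁ b) = inj₁ (a , b)
        go (inj₂ h) _ = inj₂ (false , h)
        go _ (inj₂ h) = inj₂ (true , h)

      findMixed : ∀ F zs → (∃ λ z → z ∈ zs × Mixed F z) ⊎ (∀ {z} → z ∈ zs → ∃ (Single F z))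
      findMixed F [] = inj₂ λ ()
      findMixed F (z ∷ zs) = go (mixed? F z) (findMixed F zs)
        where
        go : Mixed F z ⊎ ∃ (Single F z) → (∃ λ z → z ∈ zs × Mixed F z) ⊎ (∀ {z} → z ∈ zs → ∃ (Single F z)) → (∃ λ z′ → z′ ∈ z ∷ zs × Mixed F z′) ⊎ (∀ {z′} → z′ ∈ z ∷ zs → ∃ (Single F z′))
        go (inj₁ m) _ = inj₁ (z , here refl , m)
        go _ (inj₁ (z′ , i , m)) = inj₁ (z′ , there i , m)
        go (inj₂ s) (inj₂ f) = inj₂ λ { (here refl) → s ; (there i) → f i }

    record Gadget (Ok : List V → Set) (F : List V) (z : V) : Set where
      constructor mkGadget
      field
        A T C  : List V
        AT     : A ~ (z ∷ T)
        TC     : (z ∷ T) ~ C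
        unique : Unique (A ++ ((z ∷ T) ++ C))
        offA   : Disj A F
        offT   : Disj T F
        offC   : Disj C F
        differ : parity χ A xor parity χ C ≡ true
        ok     : Ok T

    verticesOf : ∀ {Ok F z} → Gadget Ok F z → List V
    verticesOf {z = z} g = Gadget.A g ++ ((z ∷ Gadget.T g) ++ Gadget.C g)

    abstract
      gadget-∈ : ∀ {Ok F z} (g : Gadget Ok F z) {v} → v ∈ verticesOf g → v ∈ F → v ≡ z
      gadget-∈ {F = F} {z} g {v} i f = [ (λ k → ⊥-elim (Gadget.offA g k f)) , (λ k → [ inner , (λ k′ → ⊥-elim (Gadget.offC g k′ f)) ]′ (∈-++⁻ (z ∷ Gadget.T g) k)) ]′ (∈-++⁻ (Gadget.A g) i)
        where
        inner : v ∈ z ∷ Gadget.T g → v ≡ z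
        inner (here e) = e
        inner (there j) = ⊥-elim (Gadget.offT g j f)

      gadget-off : ∀ {Ok F z} (g : Gadget Ok F z) {G} → z ∉ G → (∀ {v} → v ∈ G → v ∈ F) → Disj (verticesOf g) G
      gadget-off g z∉ G⊆F i j = z∉ (subst (_∈ _) (gadget-∈ g i (G⊆F j)) j)

    module Build (Ok : List V → Set) (F : List V) (F≤ : length F ≤ 2000 * unit)
      (splitS : ∀ S → adm S ≡ true → suc (length S) ≡ m + m → ∃ λ T → ∃ λ B → S ↭ T ++ B × length T ≡ μ × Ok T)
      (freshT : ∀ G → length G ≤ 2100 * unit → ∃ λ T → Unique T × length T ≡ μ × Disj T G × Ok T)
      (z : V) (z∈F : z ∈ F) where

      record Half : Set where
        constructor mkHalf
        field
          T B  : List V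
          edge : (z ∷ T) ~ B
          lT   : length T ≡ μ
          offT : Disj T F
          offB : Disj B F
          okT  : Ok T

      value : Half → Bool
      value h = parity χ (Half.T h) xor parity χ (Half.B h)

      Next : Half → List V → List V → Set
      Next h T′ G = ∃ λ y → y ∉ G × y ∉ F × (z ∷ T′) ~ (y ∷ Half.T h) × (parity χ T′ xor parity χ (y ∷ Half.T h) ≡ value h)

      abstract
        unique₃ : ∀ {A M C : List V} → A ~ M → M ~ C → Disj A C → Unique (A ++ (M ++ C))
        unique₃ {A} {M} {C} h k d = unique-++ (unique-ˡ A (~-unique {A} {M} h)) (~-unique {M} {C} k) (λ i j → [ unique-disj A (~-unique {A} {M} h) i , d i ]′ (∈-++⁻ M j))

        step : ∀ h T′ G → Unique T′ → length T′ ≡ μ → Ok T′ → Disj T′ (Half.T h ++ (Half.B h ++ F)) → length G ≤ 100 * unit → Gadget Ok F z ⊎ Next h T′ G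
        step (mkHalf T B edge lT offT offB okT) T′ G uT′ lT′ okT′ d G≤ = go (neighbour (B ++ (G ++ F)) (z ∷ (T ++ T′)) small uS lS)
          where
          uzT : Unique (z ∷ T)
          uzT = unique-ˡ (z ∷ T) (~-unique {z ∷ T} {B} edge)
          uS : Unique (z ∷ (T ++ T′))
          uS = unique-++ uzT uT′ λ { (here refl) j → d j (∈-++⁺ʳ T (∈-++⁺ʳ B z∈F)) ; (there i) j → d j (∈-++⁺ˡ i) }
          lS : suc (length (z ∷ (T ++ T′))) ≡ m + m
          lS = cong suc (trans (cong suc (trans (length-++ T) (cong₂ _+_ lT lT′))) (sym (+-suc μ μ)))
          small : length (B ++ (G ++ F)) ≤ 100 * β
          small = ≤-trans (≤-reflexive (trans (length-++ B) (cong₂ _+_ (~-lengthʳ {z ∷ T} {B} edge) (length-++ G)))) (≤-trans (m≤unit ⊕ (G≤ ⊕ F≤))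
            (≤-trans (≤-reflexive (ring-63 unit)) (≤-trans (units≤β 2101 (≤ᵇ⇒≤ 2101 5000 tt)) (m≤m+n β (99 * β)))))
          go : (∃ λ y → y ∉ B ++ (G ++ F) × e (y ∷ z ∷ (T ++ T′)) ≡ true) → Gadget Ok F z ⊎ Next (mkHalf T B edge lT offT offB okT) T′ G
          go (y , y∉ , h) = [ (λ eq → inj₂ (y , (λ i → y∉ (∈-++⁺ʳ B (∈-++⁺ˡ i))) , (λ i → y∉ (∈-++⁺ʳ B (∈-++⁺ʳ G i))) , T′T , trans (lem₁ (parity χ T′) (χ y) (parity χ T)) (cong (parity χ T xor_) eq)))
                          , (λ ne → inj₁ (mkGadget B T (y ∷ T′) (~-sym {z ∷ T} {B} edge) TT′ (unique₃ (~-sym {z ∷ T} {B} edge) TT′ dB) offB offT dyT′ (lem₂ _ _ ne) okT)) ]′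
                          (bool-≟ (parity χ (y ∷ T′)) (parity χ B))
            where
            T′T : (z ∷ T′) ~ (y ∷ T)
            T′T = edge-~ {z ∷ T′} {y ∷ T} (cong suc lT′) (e-↭ (perm 4 (λ y z t t′ → y ∙ (z ∙ (t ∙ t′)) ⊜ (z ∙ t′) ∙ (y ∙ t)) ↭-refl [ y ] [ z ] T T′) h)
            TT′ : (z ∷ T) ~ (y ∷ T′)
            TT′ = edge-~ {z ∷ T} {y ∷ T′} (cong suc lT) (e-↭ (perm 4 (λ y z t t′ → y ∙ (z ∙ (t ∙ t′)) ⊜ (z ∙ t) ∙ (y ∙ t′)) ↭-refl [ y ] [ z ] T T′) h)
            dB : Disj B (y ∷ T′)
            dB i (here refl) = y∉ (∈-++⁺ˡ i)
            dB i (there j) = d j (∈-++⁺ʳ T (∈-++⁺ˡ i))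
            dyT′ : Disj (y ∷ T′) F
            dyT′ (here refl) j = y∉ (∈-++⁺ʳ B (∈-++⁺ʳ G j))
            dyT′ (there i) j = d i (∈-++⁺ʳ T (∈-++⁺ʳ B j))
            lem₁ : ∀ a b c → a xor (b xor c) ≡ c xor (b xor a)
            lem₁ a b c = trans (sym (xor-assoc a b c)) (trans (xor-comm (a xor b) c) (cong (c xor_) (xor-comm a b)))
            lem₂ : ∀ a b → a ≡ not b → b xor a ≡ true
            lem₂ _ true refl = refl
            lem₂ _ false refl = refl

        fromEdge : ∀ {b} (E : Edge F z b) → Σ Half λ h → value h ≡ b × Edge.S E ↭ Half.T h ++ Half.B h
        fromEdge (mkEdge S isE off isAdm par) with splitS S isAdm (e-length isE)
        ... | T , B , p , l , ok = mkHalf T B (edge-~ {z ∷ T} {B} (cong suc l) (e-↭ (prep z p) isE)) l (λ i → off (∈-resp-↭ (↭-sym p) (∈-++⁺ˡ i))) (λ i → off (∈-resp-↭ (↭-sym p) (∈-++⁺ʳ T i))) ok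
            , trans (sym (parity-++ χ T B)) (trans (sym (parity-↭ χ p)) par) , p

        half-small : ∀ h → length (Half.T h ++ Half.B h) ≤ 2 * unit
        half-small (mkHalf T B edge lT _ _ _) = ≤-trans (≤-reflexive (trans (length-++ T) (cong₂ _+_ lT (~-lengthʳ {z ∷ T} {B} edge)))) (≤-trans (≤-trans (n≤1+n μ) m≤unit ⊕ m≤unit) (≤-reflexive (cong (unit +_) (sym (+-identityʳ unit)))))

        -- Move both edges to fresh parts, where their far ends are disjoint.
        gadget : Mixed F z → Gadget Ok F z
        gadget (E₁ , E₂) = go (fromEdge E₁) (fromEdge E₂)
          where
          go : (Σ Half λ h → value h ≡ true × Edge.S E₁ ↭ Half.T h ++ Half.B h) → (Σ Half λ h → value h ≡ false × Edge.S E₂ ↭ Half.T h ++ Half.B h) → Gadget Ok F z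
          go (h₁ , v₁ , _) (h₂ , v₂ , _) = first (freshT (S₁ ++ (S₂ ++ F)) (≤-trans (≤-reflexive (trans (length-++ S₁) (cong (length S₁ +_) (length-++ S₂)))) (≤-trans (half-small h₁ ⊕ (half-small h₂ ⊕ F≤)) (≤-trans (≤-reflexive (ring-64 unit)) (*-monoˡ-≤ unit (≤ᵇ⇒≤ 2004 2100 tt))))))
            where
            S₁ S₂ : List V
            S₁ = Half.T h₁ ++ Half.B h₁
            S₂ = Half.T h₂ ++ Half.B h₂
            S₂≤ : length S₂ ≤ 100 * unit
            S₂≤ = ≤-trans (half-small h₂) (*-monoˡ-≤ unit (≤ᵇ⇒≤ 2 100 tt))
            first : (∃ λ T → Unique T × length T ≡ μ × Disj T (S₁ ++ (S₂ ++ F)) × Ok T) → Gadget Ok F z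
            first (T₃ , u₃ , l₃ , d₃ , ok₃) = [ id , second ]′ (step h₁ T₃ S₂ u₃ l₃ ok₃ (λ i j → [ (λ k → d₃ i (∈-++⁺ˡ (∈-++⁺ˡ k))) , (λ k → [ (λ x → d₃ i (∈-++⁺ˡ (∈-++⁺ʳ (Half.T h₁) x))) , (λ x → d₃ i (∈-++⁺ʳ S₁ (∈-++⁺ʳ S₂ x))) ]′ (∈-++⁻ (Half.B h₁) k)) ]′ (∈-++⁻ (Half.T h₁) j)) S₂≤)
              where
              second : Next h₁ T₃ S₂ → Gadget Ok F z
              second (y , y∉ , y∉F , edge , val) = third (freshT (W ++ (S₂ ++ F)) (≤-trans (≤-reflexive (trans (length-++ W) (cong (length W +_) (length-++ S₂)))) (≤-trans (half-small h₃ ⊕ (half-small h₂ ⊕ F≤)) (≤-trans (≤-reflexive (ring-64 unit)) (*-monoˡ-≤ unit (≤ᵇ⇒≤ 2004 2100 tt))))))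
                where
                h₃ : Half
                h₃ = mkHalf T₃ (y ∷ Half.T h₁) edge l₃ (λ i j → d₃ i (∈-++⁺ʳ S₁ (∈-++⁺ʳ S₂ j))) (λ { (here refl) j → y∉F j ; (there i) j → Half.offT h₁ i j }) ok₃
                W : List V
                W = Half.T h₃ ++ Half.B h₃
                third : (∃ λ T → Unique T × length T ≡ μ × Disj T (W ++ (S₂ ++ F)) × Ok T) → Gadget Ok F z
                third (T₄ , u₄ , l₄ , d₄ , ok₄) = [ id , fourth ]′ (step h₃ T₄ S₂ u₄ l₄ ok₄ (λ i j → [ (λ k → d₄ i (∈-++⁺ˡ (∈-++⁺ˡ k))) , (λ k → [ (λ x → d₄ i (∈-++⁺ˡ (∈-++⁺ʳ T₃ x))) , (λ x → d₄ i (∈-++⁺ʳ W (∈-++⁺ʳ S₂ x))) ]′ (∈-++⁻ (y ∷ Half.T h₁) k)) ]′ (∈-++⁻ T₃ j)) S₂≤)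
                  where
                  fourth : Next h₃ T₄ S₂ → Gadget Ok F z
                  fourth (y₄ , y₄∉ , y₄∉F , edge₄ , val₄) = [ id , fifth ]′ (step h₂ T₄ (y₄ ∷ T₃) u₄ l₄ ok₄
                      (λ i j → [ (λ k → d₄ i (∈-++⁺ʳ W (∈-++⁺ˡ (∈-++⁺ˡ k)))) , (λ k → [ (λ x → d₄ i (∈-++⁺ʳ W (∈-++⁺ˡ (∈-++⁺ʳ (Half.T h₂) x)))) , (λ x → d₄ i (∈-++⁺ʳ W (∈-++⁺ʳ S₂ x))) ]′ (∈-++⁻ (Half.B h₂) k)) ]′ (∈-++⁻ (Half.T h₂) j))
                      (≤-trans (≤-reflexive (cong suc l₃)) (≤-trans m≤unit (m≤m+n unit (99 * unit)))))
                    where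
                    fifth : Next h₂ T₄ (y₄ ∷ T₃) → Gadget Ok F z
                    fifth (y₅ , y₅∉ , y₅∉F , edge₅ , val₅) = mkGadget (y₄ ∷ T₃) T₄ (y₅ ∷ Half.T h₂) (~-sym {z ∷ T₄} {y₄ ∷ T₃} edge₄) edge₅ (unique₃ (~-sym {z ∷ T₄} {y₄ ∷ T₃} edge₄) edge₅ dis)
                        (λ { (here refl) j → y₄∉F j ; (there i) j → d₃ i (∈-++⁺ʳ S₁ (∈-++⁺ʳ S₂ j)) }) (λ i j → d₄ i (∈-++⁺ʳ W (∈-++⁺ʳ S₂ j)))
                        (λ { (here refl) j → y₅∉F j ; (there i) j → Half.offT h₂ i j }) (xor-differ (parity χ T₄) _ _ (trans val₄ (trans val v₁)) (trans val₅ v₂)) ok₄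
                      where
                      dis : Disj (y₄ ∷ T₃) (y₅ ∷ Half.T h₂)
                      dis i (here refl) = y₅∉ i
                      dis (here refl) (there j) = y₄∉ (∈-++⁺ˡ j)
                      dis (there i) (there j) = d₃ i (∈-++⁺ʳ S₁ (∈-++⁺ˡ (∈-++⁺ˡ j)))

    abstract
      -- The degree of S: its neighbours in R all lie in the class of χ* that the parity of S prescribes.
      census : ∀ (F J R : List V) (χ* : V → Bool) → (∀ {v} → v ∈ Zs → v ∈ F) → (∀ {v} → v ∈ J → v ∈ Zs) → allFin n ↭ J ++ R → (∀ {v} → v ∉ Zs → χ* v ≡ χ v) →
        (∀ {v} → v ∈ Zs → v ∉ J → ∀ S → e (v ∷ S) ≡ true → Disj S F → adm S ≡ true → χ* v ≡ δ xor parity χ S) →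
        ∀ S → Unique S → suc (length S) ≡ m + m → Disj S F → adm S ≡ true →
        D + # (λ v → same (δ xor parity χ S) (χ v)) of S ≤ # (λ v → same (δ xor parity χ S) (χ* v)) of R + # (λ y → e (y ∷ S)) of J
      census F J R χ* Zs⊆F J⊆Zs all≡ normal role S u l d a =
          ≤-trans (+-monoˡ-≤ _ (≤-trans (codegree u l) (≤-reflexive (trans (∑-↭ _ all≡) (#-++ J R _)))))
          (≤-trans (≤-reflexive (ring-67 nJ nR sS)) (+-monoˡ-≤ nJ inner))
        where
        b : Bool
        b = δ xor parity χ S
        nR sS nJ : ℕ
        nJ = # (λ y → e (y ∷ S)) of J
        nR = # (λ y → e (y ∷ S)) of R
        sS = # (λ v → same b (χ v)) of S
        J⊎R : Unique (J ++ R)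
        J⊎R = Unique-↭ all≡ allFin-unique
        S⊆R : ∀ {v} → v ∈ S → v ∈ R
        S⊆R {v} i = [ (λ j → ⊥-elim (d i (Zs⊆F (J⊆Zs j)))) , id ]′ (∈-++⁻ J (∈-resp-↭ all≡ (∈-allFin v)))
        class : ∀ {y} → y ∈ R → e (y ∷ S) ≡ true → χ* y ≡ b
        class {y} i h = go (y ∈? Zs)
          where
          go : Dec (y ∈ Zs) → χ* y ≡ b
          go (yes z) = role z (λ j → unique-disj J J⊎R j i) S h d a
          go (no z) = trans (normal z) (xor-transpose (χ y) (parity χ S) (edge-par h (λ { (here refl) j → z j ; (there k) j → d k (Zs⊆F j) })))
        per : ∀ y → y ∈ R → ⟦ e (y ∷ S) ⟧ + ⟦ y ∈ᵇ S ∧ same b (χ* y) ⟧ ≤ ⟦ same b (χ* y) ⟧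
        per y i = cases (e (y ∷ S)) (y ∈ᵇ S) (same b (χ* y)) (λ h → same-intro b _ (class i h)) (λ h k → unique-head (e-unique h) (decided (y ∈? S) k))
          where
          cases : ∀ p q r → (p ≡ true → r ≡ true) → (p ≡ true → q ≡ true → ⊥) → ⟦ p ⟧ + ⟦ q ∧ r ⟧ ≤ ⟦ r ⟧
          cases true true r f g = ⊥-elim (g refl refl)
          cases true false r f g = ⟦⟧-true (f refl)
          cases false true r f g = ≤-refl
          cases false false r f g = z≤n
        inside : sS ≤ # (λ y → y ∈ᵇ S ∧ same b (χ* y)) of R
        inside = go (complement u S⊆R)
          where
          go : (∃ λ R′ → R ↭ S ++ R′) → sS ≤ # (λ y → y ∈ᵇ S ∧ same b (χ* y)) of R
          go (R′ , p) = ≤-trans (∑-mono∈ S (λ y i → ⟦⟧-≤ (same b (χ y)) (λ h → ⟦⟧-true (∧-intro (decide (y ∈? S) i) (same-intro b _ (trans (normal (λ j → d i (Zs⊆F j))) (same-true b _ h)))))))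
            (≤-trans (m≤m+n _ _) (≤-reflexive (sym (trans (∑-↭ _ p) (#-++ S R′ _)))))
        inner : nR + sS ≤ # (λ v → same b (χ* v)) of R
        inner = ≤-trans (+-monoʳ-≤ nR inside) (≤-trans (≤-reflexive (sym (∑-+ R _ _))) (∑-mono∈ R per))

    module Extend (F J : List V) (roles : ∀ {v} → v ∈ Zs → v ∉ J → ∃ (Single F v)) where

      abstract
        χ* : V → Bool
        χ* v = choose (v ∈? Zs) (v ∈? J)
          where
          choose : Dec (v ∈ Zs) → Dec (v ∈ J) → Bool
          choose (yes i) (no j) = δ xor proj₁ (roles i j)
          choose _ _ = χ v

        normal : ∀ {v} → v ∉ Zs → χ* v ≡ χ v
        normal {v} h with v ∈? Zs | v ∈? J
        ... | yes i | _ = ⊥-elim (h i)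
        ... | no _ | yes _ = refl
        ... | no _ | no _ = refl

        role : ∀ {v} → v ∈ Zs → v ∉ J → ∀ S → e (v ∷ S) ≡ true → Disj S F → adm S ≡ true → χ* v ≡ δ xor parity χ S
        role {v} i j S h d a with v ∈? Zs | v ∈? J
        ... | yes i′ | no j′ = cong (δ xor_) (sym (proj₂ (roles i′ j′) S h d a))
        ... | yes _ | yes j′ = ⊥-elim (j j′)
        ... | no i′ | _ = ⊥-elim (i′ i)

module Bags where

  open Base
  open Arithmetic
  open Xor
  open Hyper
  open Tri
  open Absorb
  open Cover

  module Bagging (hg : HG) (df : Diff hg) where
    open HG hg
    open Diff df
    open Trails hg
    open Covering hg
    open Framed PQ

    Between : Pred → Pred → List V → Set
    Between f g W = ∃ λ A → ∃ λ B → Trail A B W × f A ≡ true × g B ≡ true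

    -- x paths from P to P, y paths from Q to Q and r paths from P to Q, with vertices W altogether.
    record Bag (x y r : ℕ) (W : List V) : Set where
      constructor mkBag
      field
        pps qqs pqs : List (List V)
        PPs : All (Between P P) pps
        QQs : All (Between Q Q) qqs
        PQs : All (Between P Q) pqs
        lx  : length pps ≡ x
        ly  : length qqs ≡ y
        lr  : length pqs ≡ r
        all≡ : concat pps ++ (concat qqs ++ concat pqs) ↭ W

    emptyBag : Bag 0 0 0 []
    emptyBag = mkBag [] [] [] [] [] [] refl refl refl ↭-refl

    permBag : ∀ {x y r W W′} → W ↭ W′ → Bag x y r W → Bag x y r W′
    permBag p (mkBag a b c d e f g h i q) = mkBag a b c d e f g h i (↭-trans q p)

    abstract
      bag-++ : ∀ {x y r W x′ y′ r′ W′} → Bag x y r W → Bag x′ y′ r′ W′ → Bag (x + x′) (y + y′) (r + r′) (W ++ W′)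
      bag-++ (mkBag a b c pa pb pc refl refl refl q) (mkBag a′ b′ c′ pa′ pb′ pc′ refl refl refl q′) =
        mkBag (a ++ a′) (b ++ b′) (c ++ c′) (all-++ pa pa′) (all-++ pb pb′) (all-++ pc pc′) (length-++ a) (length-++ b) (length-++ c)
          (↭-trans (++⁺ (↭-reflexive (concat-++ a a′)) (++⁺ (↭-reflexive (concat-++ b b′)) (↭-reflexive (concat-++ c c′))))
            (↭-trans (perm 6 (λ a a′ b b′ c c′ → (a ∙ a′) ∙ ((b ∙ b′) ∙ (c ∙ c′)) ⊜ (a ∙ (b ∙ c)) ∙ (a′ ∙ (b′ ∙ c′))) ↭-refl (concat a) (concat a′) (concat b) (concat b′) (concat c) (concat c′)) (++⁺ q q′)))

      bagPP : ∀ {W} → Between P P W → Bag 1 0 0 W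
      bagPP {W} h = mkBag (W ∷ []) [] [] (h ∷ []) [] [] refl refl refl (↭-reflexive (trans (++-identityʳ (W ++ [])) (++-identityʳ W)))

      bagQQ : ∀ {W} → Between Q Q W → Bag 0 1 0 W
      bagQQ {W} h = mkBag [] (W ∷ []) [] [] (h ∷ []) [] refl refl refl (↭-reflexive (trans (++-identityʳ (W ++ [])) (++-identityʳ W)))

      bagPQ : ∀ {W} → Between P Q W → Bag 0 0 1 W
      bagPQ {W} h = mkBag [] [] (W ∷ []) [] [] (h ∷ []) refl refl refl (↭-reflexive (++-identityʳ W))

    record SomeBag (k : ℕ) (W : List V) : Set where
      constructor someBag
      field
        {x y r} : ℕ
        bag     : Bag x y r W
        total   : x + y + r ≡ k

    abstract
      trailBag : ∀ {A B W} → Trail A B W → SomeBag 1 W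
      trailBag {A} {B} {W} t = go (PorQ (first-proper t)) (PorQ (last-proper t))
        where
        go : P A ≡ true ⊎ Q A ≡ true → P B ≡ true ⊎ Q B ≡ true → SomeBag 1 W
        go (inj₁ a) (inj₁ b) = someBag (bagPP (A , B , t , a , b)) refl
        go (inj₁ a) (inj₂ b) = someBag (bagPQ (A , B , t , a , b)) refl
        go (inj₂ a) (inj₁ b) = someBag (bagPQ (B , A , reverse t , b , a)) refl
        go (inj₂ a) (inj₂ b) = someBag (bagQQ (A , B , t , a , b)) refl


      pathsBag : ∀ πs → All IsPath πs → SomeBag (length πs) (concatMap verts πs)
      pathsBag [] [] = someBag emptyBag refl
      pathsBag ((A , ps) ∷ πs) (c ∷ cs) = go (trailBag (chain-trail A ps c)) (pathsBag πs cs)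
        where
        go : ∀ {W W′ k} → SomeBag 1 W → SomeBag k W′ → SomeBag (suc k) (W ++ W′)
        go (someBag {x} {y} {r} b e₁) (someBag {x′} {y′} {r′} b′ e₂) = someBag (bag-++ b b′) (trans (ring-83 x y r x′ y′ r′) (cong₂ _+_ e₁ e₂))

      pairUp : ∀ {W₁ W₂} (as bs : List (List V)) → All (Between P P) as → All (Between Q Q) bs → length as ≡ length bs → concat as ↭ W₁ → concat bs ↭ W₂ →
        ∃ λ Ws → All Item Ws × length Ws ≡ length as × concat Ws ↭ W₁ ++ W₂
      pairUp [] [] [] [] _ p q = [] , [] , refl , ++⁺ p q
      pairUp (a ∷ as) (b ∷ bs) (pa ∷ pas) (pb ∷ pbs) l p q =
        let Ws , its , k , w = pairUp as bs pas pbs (suc-injective l) ↭-refl ↭-refl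
        in (a ++ b) ∷ Ws , inj₂ (a , b , ↭-refl , pa , pb) ∷ its , cong suc k ,
           ↭-trans (++⁺ˡ (a ++ b) w) (↭-trans (perm 4 (λ a b c d → (a ∙ b) ∙ (c ∙ d) ⊜ (a ∙ c) ∙ (b ∙ d)) ↭-refl a b (concat as) (concat bs)) (++⁺ p q))

      balancedItems : ∀ {z r W} → Bag z z r W → ∃ λ Ws → All Item Ws × length Ws ≡ z + r × concat Ws ↭ W
      balancedItems (mkBag a b c pa pb pc refl ly refl q) =
        let Ws , its , k , w = pairUp a b pa pb (sym ly) ↭-refl ↭-refl
        in Ws ++ c , all-++ its (singles pc) , trans (length-++ Ws) (cong (_+ length c) k) ,
           ↭-trans (↭-reflexive (concat-++ Ws c)) (↭-trans (++⁺ʳ (concat c) w) (↭-trans (↭-reflexive (++-assoc (concat a) (concat b) (concat c))) q))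
        where
        singles : ∀ {c} → All (Between P Q) c → All Item c
        singles [] = []
        singles (h ∷ hs) = inj₁ h ∷ singles hs

      bag-length : ∀ {x y r W} → Bag x y r W → ∃ λ f → length W ≡ m * f
      bag-length (mkBag a b c pa pb pc _ _ _ q) =
        let f , h = lengths a pa ; g , h′ = lengths b pb ; k , h″ = lengths c pc
        in f + (g + k) , trans (sym (↭-length q)) (trans (length-++ (concat a)) (trans (cong₂ _+_ h (trans (length-++ (concat b)) (cong₂ _+_ h′ h″))) (ring-77 m f g k)))
        where
        lengths : ∀ {f g} ws → All (Between f g) ws → ∃ λ k → length (concat ws) ≡ m * k
        lengths [] [] = 0 , sym (*-zeroʳ m)
        lengths (w ∷ ws) ((_ , _ , t , _) ∷ hs) = let k , h = trail-length t ; k′ , h′ = lengths ws hs in k + k′ , trans (length-++ w) (trans (cong₂ _+_ h h′) (sym (*-distribˡ-+ m k k′)))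

    Arrangement : List V → ℕ → Set
    Arrangement R J = ∀ {W Xs x y r A B} → Trail A B W → Q A ≡ true → P B ≡ true → Bag x y r Xs → x + y + r ≤ 2 * K → allFin n ↭ (W ++ R) ++ Xs →
      ∃ λ z → ∃ λ r′ → Bag z z r′ (R ++ Xs) × z + r′ ≤ J

    module Start′ = Start (proj₁ (proj₂ P-some)) (proj₂ (proj₂ P-some)) (proj₁ (proj₂ Q-some)) (proj₂ (proj₂ Q-some))
    open Start′ using (Absorber; makeAbsorber; plain)

    module Closing {R : List V} {J c : ℕ} (arr : Arrangement R J) (mR : ∃ λ f → length R ≡ m * f) (R≤ : length R ≤ 2000 * unit) (c≤ : c ≤ 2400 * unit)
      (a : Absorber J R c) (sl : Slot P Q (Absorber.W a ++ R) (Absorber.last a) (Absorber.first a)) where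
      module A = Absorber a

      S : List V
      S = Slot.C sl ++ Slot.E sl

      abstract
        cycle : Hamilton
        cycle = go (coverRest ((S ++ A.W) ++ R) (proj₁ lens) (Unique-↭ (↭-reflexive (sym (++-assoc S A.W R))) (slot-unique sl A.fresh)) small (proj₂ lens))
          where
          ring : Trail A.first (Slot.E sl) (A.W ++ S)
          ring = join (plain a) (Slot.AC sl) (slot-trail sl)
          lens : ∃ λ f → length ((S ++ A.W) ++ R) ≡ m * f
          lens = let f , h = mR ; g , h′ = trail-length ring in g + f , trans (length-++ (S ++ A.W)) (trans (cong₂ _+_ (trans (↭-length (++-comm S A.W)) h′) h) (sym (*-distribˡ-+ m g f)))
          small : length ((S ++ A.W) ++ R) ≤ β
          small = ≤-trans (≤-reflexive (trans (length-++ (S ++ A.W)) (cong (_+ length R) (trans (length-++ S) (cong (_+ length A.W) (slot-length sl))))))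
            (≤-trans ((*-monoʳ-≤ 2 m≤unit ⊕ ≤-trans A.short c≤) ⊕ R≤) (≤-trans (≤-reflexive (ring-73 unit)) (units≤β 4402 (≤ᵇ⇒≤ 4402 5000 tt))))
          go : Covered ((S ++ A.W) ++ R) → Hamilton
          go cov = balance (pathsBag πs paths)
            where
            open Covered cov
            balance : SomeBag (length πs) (concatMap verts πs) → Hamilton
            balance (someBag b tot) = close (arr ring A.Qfirst (Slot.PE sl) (permBag whole b) (≤-trans (≤-reflexive tot) few) (↭-trans rest≡ (++⁺ʳ Xs (++⁺ʳ R (++-comm S A.W)))))
              where
              close : (∃ λ z → ∃ λ r′ → Bag z z r′ (R ++ Xs) × z + r′ ≤ J) → Hamilton
              close (z , r′ , bag , l) = end (balancedItems bag)
                where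
                end : (∃ λ Ws → All Item Ws × length Ws ≡ z + r′ × concat Ws ↭ R ++ Xs) → Hamilton
                end (Ws , its , k , w) = A.first , Slot.E sl , _ , join (A.absorbs Ws its (≤-trans (≤-reflexive k) l)) (Slot.AC sl) (slot-trail sl) , Slot.EB sl
                  , ↭-trans (perm 3 (λ a w s → (a ∙ w) ∙ s ⊜ (s ∙ a) ∙ w) ↭-refl A.W (concat Ws) S) (↭-trans (++⁺ˡ (S ++ A.W) w) (↭-trans (↭-reflexive (sym (++-assoc (S ++ A.W) R Xs))) (↭-sym rest≡)))

    abstract
      assemble : ∀ R J → Unique R → (∃ λ f → length R ≡ m * f) → length R ≤ 2000 * unit → suc J ≤ 300 * (m * suc K) → Arrangement R J → Hamilton
      assemble R J u mR R≤ hJ arr = go (makeAbsorber 300 J R hJ u (≤-trans (+-monoʳ-≤ (2400 * unit) R≤) (≤-trans (≤-reflexive (sym (*-distribʳ-+ unit 2400 2000))) (units≤β 4400 (≤ᵇ⇒≤ 4400 5000 tt)))))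
        where
        go : Absorber J R (8 * 300 * unit) → Hamilton
        go a = Closing.cycle arr mR R≤ ≤-refl a (frame-slot PQ _ (≤-trans (≤-reflexive (length-++ (Absorber.W a))) (≤-trans (Absorber.short a ⊕ R≤) (≤-trans (≤-reflexive (sym (*-distribʳ-+ unit 2400 2000))) (units≤β 4400 (≤ᵇ⇒≤ 4400 5000 tt)))))
          (last-proper (plain a)) (first-proper (plain a)) (Absorber.Plast a) (Absorber.Qfirst a))

    record Toggler (g : ℕ) (W : List V) : Set where
      constructor mkToggler
      field
        {x y r x′ y′ r′} : ℕ
        low  : Bag x y r W
        high : Bag x′ y′ r′ W
        gap  : x′ + y ≡ g + (x + y′)
        low≤ : x + y + r ≤ 2
        high≤ : x′ + y′ + r′ ≤ 2

    -- A reserve whose surplus of P–P over Q–Q paths can be raised by g up to k times.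
    record Flex (g k : ℕ) (W : List V) : Set where
      field
        X Y   : ℕ
        raise : ∀ j → j ≤ k → ∃ λ x → ∃ λ y → ∃ λ r → Bag x y r W × x + Y ≡ g * j + (X + y) × x + y + r ≤ 2 * k
        X≤    : X ≤ 2 * k
        Y≤    : Y ≤ 2 * k

    abstract
      flex-[] : ∀ {g} → Flex g 0 []
      flex-[] {g} = record { X = 0 ; Y = 0 ; raise = λ { zero _ → 0 , 0 , 0 , emptyBag , cong (_+ 0) (sym (*-zeroʳ g)) , z≤n } ; X≤ = z≤n ; Y≤ = z≤n }

      flex-∷ : ∀ {g k W W′} → Toggler g W → Flex g k W′ → Flex g (suc k) (W ++ W′)
      flex-∷ {g} {k} {W} {W′} (mkToggler {x} {y} {r} {x′} {y′} {r′} low high gap low≤ high≤) fl = record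
          { X = x + X ; Y = y + Y ; raise = up
          ; X≤ = ≤-trans (≤-trans (≤-trans (m≤m+n x y) (m≤m+n (x + y) r)) low≤ ⊕ X≤) (≤-reflexive (ring-78 k))
          ; Y≤ = ≤-trans (≤-trans (≤-trans (m≤n+m y x) (m≤m+n (x + y) r)) low≤ ⊕ Y≤) (≤-reflexive (ring-78 k)) }
        where
        open Flex fl
        t₁ : ∀ x a y Y g j X b → a + Y ≡ g * j + (X + b) → x + a + (y + Y) ≡ g * j + (x + X + (y + b))
        t₁ x a y Y g j X b h = trans (ring-74 x a y Y) (trans (cong (x + y +_) h) (ring-75 x y g j X b))
        t₂ : ∀ x′ a y Y g k X b x y′ → x′ + y ≡ g + (x + y′) → a + Y ≡ g * k + (X + b) → x′ + a + (y + Y) ≡ g * suc k + (x + X + (y′ + b))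
        t₂ x′ a y Y g k X b x y′ h h′ = trans (ring-74 x′ a y Y) (trans (cong₂ _+_ h h′) (ring-76 x y′ g k X b))
        up : ∀ j → j ≤ suc k → ∃ λ a → ∃ λ b → ∃ λ c → Bag a b c (W ++ W′) × a + (y + Y) ≡ g * j + (x + X + b) × a + b + c ≤ 2 * suc k
        up j h with j ≤? k
        ... | yes j≤k with raise j j≤k
        ... | a , b , c , bag , eq , tot = x + a , y + b , r + c , bag-++ low bag , t₁ x a y Y g j X b eq , ≤-trans (≤-reflexive (ring-83 x y r a b c)) (≤-trans (low≤ ⊕ tot) (≤-reflexive (ring-78 k)))
        up j h | no j≰k with ≤-antisym h (≰⇒> j≰k)
        ... | refl with raise k ≤-refl
        ... | a , b , c , bag , eq , tot = x′ + a , y′ + b , r′ + c , bag-++ high bag , t₂ x′ a y Y g k X b x y′ gap eq , ≤-trans (≤-reflexive (ring-83 x′ y′ r′ a b c)) (≤-trans (high≤ ⊕ tot) (≤-reflexive (ring-78 k)))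

      flex-X : ∀ {g k W W′} (t : Toggler g W) (fl : Flex g k W′) → Flex.X (flex-∷ t fl) ≡ Toggler.x t + Flex.X fl
      flex-X (mkToggler _ _ _ _ _) fl = refl

      flex-Y : ∀ {g k W W′} (t : Toggler g W) (fl : Flex g k W′) → Flex.Y (flex-∷ t fl) ≡ Toggler.y t + Flex.Y fl
      flex-Y (mkToggler _ _ _ _ _) fl = refl

      flex-X₀ : ∀ {g} → Flex.X (flex-[] {g}) ≡ 0
      flex-X₀ = refl

      flex-Y₀ : ∀ {g} → Flex.Y (flex-[] {g}) ≡ 0
      flex-Y₀ = refl

      -- Fixed paths plus a flexible reserve plus the cover, with j raises making both surpluses equal.
      balance : ∀ {g k W₁ W₂ Xs x₁ y₁ r₁ x y r} → Bag x₁ y₁ r₁ W₁ → (fl : Flex g k W₂) → Bag x y r Xs → ∀ j → j ≤ k → g * j + (x₁ + x + Flex.X fl) ≡ y₁ + y + Flex.Y fl →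
        ∃ λ z → ∃ λ r′ → Bag z z r′ ((W₁ ++ W₂) ++ Xs) × z + r′ ≤ x₁ + y₁ + r₁ + (2 * k + (x + y + r))
      balance {g} {k} {W₁} {W₂} {Xs} {x₁} {y₁} {r₁} {x} {y} {r} b₁ fl b j h eq with Flex.raise fl j h
      ... | a , c , d , bf , e′ , tot = x₁ + a + x , r₁ + d + r , subst (λ z → Bag (x₁ + a + x) z (r₁ + d + r) ((W₁ ++ W₂) ++ Xs)) (sym same) (bag-++ (bag-++ b₁ bf) b)
          , ≤-trans (m≤m+n _ (y₁ + c + y)) (≤-trans (≤-reflexive (ring-82 x₁ a x r₁ d r y₁ c y)) (+-monoʳ-≤ (x₁ + y₁ + r₁) (+-monoˡ-≤ (x + y + r) tot)))
        where
        X Y : ℕ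
        X = Flex.X fl
        Y = Flex.Y fl
        same : x₁ + a + x ≡ y₁ + c + y
        same = +-cancelʳ-≡ Y _ _ (trans (ring-79 x₁ a x Y) (trans (cong (x₁ + x +_) e′) (trans (ring-80 g j x₁ x X c) (trans (cong (_+ c) eq) (ring-81 y₁ y Y c)))))

module Many where

  open Base
  open Arithmetic
  open Xor
  open Hyper
  open Tri
  open Absorb
  open Cover
  open Parity
  open Bags

  module Togglers (hg : HG) (df : Diff hg) where
    open HG hg
    open Diff df
    open Trails hg
    open Framed PQ
    open Bagging hg df

    Clear : List V → Set
    Clear F = (∀ {A} → Proper A → Disj A F → P A ≡ true → Q A ≡ true → ⊥) × (∀ {A B} → A ~ B → Disj A F → Disj B F → P A ≡ true → P B ≡ true → ⊥)
      × (∀ {A B} → A ~ B → Disj A F → Disj B F → Q A ≡ true → Q B ≡ true → ⊥)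

    record NewToggler (F : List V) : Set where
      constructor mkNew
      field
        {W}     : List V
        toggler : Toggler 1 W
        fresh   : Unique (W ++ F)
        short   : length W ≤ 2 * m

    abstract
      single : ∀ {A} → Proper A → Trail A A A
      single = part

      edgeTrail : ∀ {A B} → A ~ B → Trail A B (A ++ B)
      edgeTrail {A} {B} a = join (part (~-properˡ {A} {B} a)) a (part (~-properʳ {A} {B} a))

      edge-fresh : ∀ {A B F} → A ~ B → Unique F → Disj A F → Disj B F → Unique ((A ++ B) ++ F)
      edge-fresh {A} {B} a u dA dB = unique-++ (~-unique {A} {B} a) u (λ x y → [ (λ z → dA z y) , (λ z → dB z y) ]′ (∈-++⁻ A x))

      edge-short : ∀ {A B} → A ~ B → length (A ++ B) ≤ 2 * m
      edge-short {A} {B} a = ≤-reflexive (trans (length-++ A) (cong₂ _+_ (~-length {A} {B} a) (trans (~-lengthʳ {A} {B} a) (sym (+-identityʳ m)))))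

      togglerBoth : ∀ {A} → Proper A → P A ≡ true → Q A ≡ true → Toggler 1 A
      togglerBoth {A} pA p q = mkToggler (bagPQ (A , A , part pA , p , q)) (bagPP (A , A , part pA , p , p)) refl (s≤s z≤n) (s≤s z≤n)

      togglerPP : ∀ {A B} → A ~ B → P A ≡ true → P B ≡ true → Toggler 1 (A ++ B)
      togglerPP {A} {B} a p q = mkToggler (bagPP (A , B , edgeTrail {A} {B} a , p , q)) (bag-++ (bagPP (A , A , part (~-properˡ {A} {B} a) , p , p)) (bagPP (B , B , part (~-properʳ {A} {B} a) , q , q))) refl (s≤s z≤n) (s≤s (s≤s z≤n))

      togglerQQ : ∀ {A B} → A ~ B → Q A ≡ true → Q B ≡ true → Toggler 1 (A ++ B)
      togglerQQ {A} {B} a p q = mkToggler (bag-++ (bagQQ (A , A , part (~-properˡ {A} {B} a) , p , p)) (bagQQ (B , B , part (~-properʳ {A} {B} a) , q , q))) (bagQQ (A , B , edgeTrail {A} {B} a , p , q)) refl (s≤s (s≤s z≤n)) (s≤s z≤n)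

      findEdge : ∀ (f g : Pred) F → (∃ λ A → ∃ λ B → A ~ B × Disj A F × Disj B F × f A ≡ true × g B ≡ true) ⊎ (∀ {A B} → A ~ B → Disj A F → Disj B F → f A ≡ true → g B ≡ true → ⊥)
      findEdge f g F = go (search U (λ A → does (1 ≤? # (test A) of U)))
        where
        test : Part → Part → Bool
        test A B = (adj A B ∧ (not (hits F A) ∧ not (hits F B))) ∧ (f A ∧ g B)
        Res : Set
        Res = (∃ λ A → ∃ λ B → A ~ B × Disj A F × Disj B F × f A ≡ true × g B ≡ true) ⊎ (∀ {A B} → A ~ B → Disj A F → Disj B F → f A ≡ true → g B ≡ true → ⊥)
        go : (∃ λ A → A ∈ U × does (1 ≤? # (test A) of U) ≡ true) ⊎ (∀ A → A ∈ U → does (1 ≤? # (test A) of U) ≡ false) → Res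
        go (inj₂ none) = inj₂ (λ {A} {B} a dA dB x y → true≢false (decide (1 ≤? _) (#-pos (test A) (∈-tup m B (~-lengthʳ {A} {B} a)) (∧-intro (∧-intro a (∧-intro (not-false (disj-hits F A dA)) (not-false (disj-hits F B dB)))) (∧-intro x y)))) (none A (∈-tup m A (~-length {A} {B} a))))
        go (inj₁ (A , i , h)) = edge (#-find U (test A) (decided (1 ≤? _) h))
          where
          edge : (∃ λ B → B ∈ U × test A B ≡ true) → Res
          edge (B , j , k) with ∧-elim {adj A B ∧ (not (hits F A) ∧ not (hits F B))} k
          ... | k₁ , k₂ with ∧-elim {adj A B} k₁ | ∧-elim {f A} k₂
          ... | a , k₃ | c , d with ∧-elim {not (hits F A)} k₃
          ... | oA , oB = inj₁ (A , B , a , hits-disj F A (not-true oA) , hits-disj F B (not-true oB) , c , d)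

      findBoth : ∀ F → (∃ λ A → Proper A × Disj A F × P A ≡ true × Q A ≡ true) ⊎ (∀ {A} → Proper A → Disj A F → P A ≡ true → Q A ≡ true → ⊥)
      findBoth F = go (search U test)
        where
        test : Part → Bool
        test A = (does (unique? A) ∧ not (hits F A)) ∧ (P A ∧ Q A)
        go : (∃ λ A → A ∈ U × test A ≡ true) ⊎ (∀ A → A ∈ U → test A ≡ false) → (∃ λ A → Proper A × Disj A F × P A ≡ true × Q A ≡ true) ⊎ (∀ {A} → Proper A → Disj A F → P A ≡ true → Q A ≡ true → ⊥)
        go (inj₂ none) = inj₂ λ {A} p d x y → true≢false (∧-intro (∧-intro (decide (unique? A) (proj₁ p)) (not-false (disj-hits F A d))) (∧-intro x y)) (none A (∈-tup m A (proj₂ p)))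
        go (inj₁ (A , i , h)) with ∧-elim {does (unique? A) ∧ not (hits F A)} h
        ... | h₁ , h₂ with ∧-elim {does (unique? A)} h₁ | ∧-elim {P A} h₂
        ... | a , b | c , d = inj₁ (A , (decided (unique? A) a , tup-length m i) , hits-disj F A (not-true b) , c , d)

      findToggler : ∀ F → Unique F → NewToggler F ⊎ Clear F
      findToggler F u = go (findBoth F) (findEdge P P F) (findEdge Q Q F)
        where
        go : (∃ λ A → Proper A × Disj A F × P A ≡ true × Q A ≡ true) ⊎ (∀ {A} → Proper A → Disj A F → P A ≡ true → Q A ≡ true → ⊥) →
          (∃ λ A → ∃ λ B → A ~ B × Disj A F × Disj B F × P A ≡ true × P B ≡ true) ⊎ (∀ {A B} → A ~ B → Disj A F → Disj B F → P A ≡ true → P B ≡ true → ⊥) →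
          (∃ λ A → ∃ λ B → A ~ B × Disj A F × Disj B F × Q A ≡ true × Q B ≡ true) ⊎ (∀ {A B} → A ~ B → Disj A F → Disj B F → Q A ≡ true → Q B ≡ true → ⊥) → NewToggler F ⊎ Clear F
        go (inj₁ (A , pA , d , p , q)) _ _ = inj₁ (mkNew (togglerBoth pA p q) (unique-++ (proj₁ pA) u d) (≤-trans (≤-reflexive (proj₂ pA)) (m≤m+n m _)))
        go _ (inj₁ (A , B , a , dA , dB , p , q)) _ = inj₁ (mkNew (togglerPP {A} {B} a p q) (edge-fresh {A} {B} a u dA dB) (edge-short {A} {B} a))
        go _ _ (inj₁ (A , B , a , dA , dB , p , q)) = inj₁ (mkNew (togglerQQ {A} {B} a p q) (edge-fresh {A} {B} a u dA dB) (edge-short {A} {B} a))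
        go (inj₂ a) (inj₂ b) (inj₂ c) = inj₂ (a , (λ {A} {B} → b {A} {B}) , λ {A} {B} → c {A} {B})

    record Collected (k : ℕ) : Set where
      field
        W     : List V
        flex  : Flex 1 k W
        uniq  : Unique W
        short : length W ≤ 2 * m * k

    record Cleared : Set where
      field
        Z     : List V
        uniq  : Unique Z
        few   : length Z ≤ 8 * (m * suc K)
        clear : Clear Z

    abstract
      collect : ∀ k → k ≤ 4 * K → Collected k ⊎ Cleared
      collect zero h = inj₁ (record { W = [] ; flex = flex-[] ; uniq = [] ; short = z≤n })
      collect (suc k) h = go (collect k (≤-trans (n≤1+n k) h))
        where
        go : Collected k ⊎ Cleared → Collected (suc k) ⊎ Cleared
        go (inj₂ c) = inj₂ c
        go (inj₁ c) = go′ (findToggler (Collected.W c) (Collected.uniq c))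
          where
          open Collected c
          go′ : NewToggler W ⊎ Clear W → Collected (suc k) ⊎ Cleared
          go′ (inj₁ (mkNew {W′} t f s)) = inj₁ (record { W = W′ ++ W ; flex = flex-∷ t flex ; uniq = f ; short = ≤-trans (≤-reflexive (length-++ W′)) (≤-trans (s ⊕ short) (≤-reflexive (sym (*-suc (2 * m) k)))) })
          go′ (inj₂ cl) = inj₂ (record { Z = W ; uniq = uniq ; clear = cl ; few = ≤-trans short (≤-trans (*-monoʳ-≤ (2 * m) (≤-trans (n≤1+n k) (≤-trans h (*-monoʳ-≤ 4 (n≤1+n K))))) (≤-reflexive (ring-89 m (suc K)))) })

      singles : ∀ (b : Bool) k F → Unique F → length F + 2 * m * k ≤ β → ∃ λ W → Bag (if b then k else 0) (if b then 0 else k) 0 W × Unique (W ++ F) × length W ≡ m * k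
      singles true zero F u h = [] , emptyBag , u , sym (*-zeroʳ m)
      singles false zero F u h = [] , emptyBag , u , sym (*-zeroʳ m)
      singles b (suc k) F u h = go b (singles b k F u (≤-trans (+-monoʳ-≤ (length F) (*-monoʳ-≤ (2 * m) (n≤1+n k))) h))
        where
        arith : ∀ m k f → m * k + f + 2 * m ≤ f + 2 * m * suc k
        arith m k f = ≤-trans (m≤m+n _ (m * k)) (≤-reflexive (ring-91 m k f))
        go : ∀ b → (∃ λ W → Bag (if b then k else 0) (if b then 0 else k) 0 W × Unique (W ++ F) × length W ≡ m * k) →
          ∃ λ W → Bag (if b then suc k else 0) (if b then 0 else suc k) 0 W × Unique (W ++ F) × length W ≡ m * suc k
        go b (W , bag , uw , l) = pickSlot b bag (frame-slot PQ (W ++ F) (≤-trans (≤-reflexive (trans (length-++ W) (cong (_+ length F) l))) (≤-trans (m≤m+n _ (2 * m)) (≤-trans (arith m k (length F)) h)))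
            (proj₁ (proj₂ P-some)) (proj₁ (proj₂ Q-some)) (proj₂ (proj₂ P-some)) (proj₂ (proj₂ Q-some)))
          where
          pickSlot : ∀ b → Bag (if b then k else 0) (if b then 0 else k) 0 W → Slot P Q (W ++ F) (proj₁ P-some) (proj₁ Q-some) → ∃ λ W → Bag (if b then suc k else 0) (if b then 0 else suc k) 0 W × Unique (W ++ F) × length W ≡ m * suc k
          pickSlot true bag (mkSlot C E AC CE EB QC PE offC offE) = E ++ W , bag-++ (bagPP (E , E , part (~-properʳ {C} {E} CE) , PE , PE)) bag
            , subst Unique (sym (++-assoc E W F)) (unique-++ (proj₁ (~-properʳ {C} {E} CE)) uw offE) , trans (length-++ E) (trans (cong₂ _+_ (~-lengthʳ {C} {E} CE) l) (sym (*-suc m k)))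
          pickSlot false bag (mkSlot C E AC CE EB QC PE offC offE) = C ++ W , bag-++ (bagQQ (C , C , part (~-properˡ {C} {E} CE) , QC , QC)) bag
            , subst Unique (sym (++-assoc C W F)) (unique-++ (proj₁ (~-properˡ {C} {E} CE)) uw offC) , trans (length-++ C) (trans (cong₂ _+_ (~-length {C} {E} CE) l) (sym (*-suc m k)))

    module ManyTogglers (c : Collected (4 * K)) where
      open Collected c
      open Flex flex

      Centred : Set
      Centred = ∃ λ x₁ → ∃ λ y₁ → ∃ λ S → Bag x₁ y₁ 0 S × Unique (S ++ W) × length S ≤ 10 * unit × y₁ + Y ≡ x₁ + X + 2 * K × x₁ + y₁ ≤ 10 * suc K

      abstract
        W≤ : length W ≤ 8 * unit
        W≤ = ≤-trans short (≤-trans (*-monoʳ-≤ (2 * m) (*-monoʳ-≤ 4 (n≤1+n K))) (≤-trans (≤-reflexive (ring-89 m (suc K))) (*-monoʳ-≤ 8 mK≤unit)))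

        sing : ∀ b k → k ≤ 10 * suc K → ∃ λ S → Bag (if b then k else 0) (if b then 0 else k) 0 S × Unique (S ++ W) × length S ≤ 10 * unit
        sing b k h = go (singles b k W uniq (≤-trans (W≤ ⊕ ≤-trans (*-monoʳ-≤ (2 * m) h) (≤-trans (≤-reflexive (ring-92 m (suc K))) (*-monoʳ-≤ 20 mK≤unit))) (≤-trans (≤-reflexive (sym (*-distribʳ-+ unit 8 20))) (units≤β 28 (≤ᵇ⇒≤ 28 5000 tt)))))
          where
          go : (∃ λ S → Bag (if b then k else 0) (if b then 0 else k) 0 S × Unique (S ++ W) × length S ≡ m * k) → ∃ λ S → Bag (if b then k else 0) (if b then 0 else k) 0 S × Unique (S ++ W) × length S ≤ 10 * unit
          go (S , bag , u , l) = S , bag , u , ≤-trans (≤-reflexive l) (≤-trans (*-monoʳ-≤ m h) (≤-trans (≤-reflexive (ring-93 m (suc K))) (*-monoʳ-≤ 10 mK≤unit)))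

        bound : ∀ z w → z ≤ 2 * (4 * K) → w ≤ z + 2 * K → w ≤ 10 * suc K
        bound z w h k = ≤-trans k (≤-trans (+-monoˡ-≤ (2 * K) h) (≤-trans (≤-reflexive (ring-94 K)) (*-monoʳ-≤ 10 (n≤1+n K))))

        centred : Centred
        centred = go (≤-total Y (X + 2 * K))
          where
          go : Y ≤ X + 2 * K ⊎ X + 2 * K ≤ Y → Centred
          go (inj₁ h) = go′ (sing false k k≤)
            where
            k : ℕ
            k = X + 2 * K ∸ Y
            eq : Y + k ≡ X + 2 * K
            eq = m+[n∸m]≡n h
            k≤ : k ≤ 10 * suc K
            k≤ = bound X k X≤ (≤-trans (m≤n+m k Y) (≤-reflexive eq))
            go′ : (∃ λ S → Bag 0 k 0 S × Unique (S ++ W) × length S ≤ 10 * unit) → Centred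
            go′ (S , bag , u , l) = 0 , k , S , bag , u , l , trans (+-comm k Y) eq , k≤
          go (inj₂ h) = go′ (sing true k k≤)
            where
            k : ℕ
            k = Y ∸ (X + 2 * K)
            eq : X + 2 * K + k ≡ Y
            eq = m+[n∸m]≡n h
            k≤ : k ≤ 10 * suc K
            k≤ = bound Y k Y≤ (≤-trans (≤-trans (m≤n+m k (X + 2 * K)) (≤-reflexive eq)) (m≤m+n Y (2 * K)))
            go′ : (∃ λ S → Bag k 0 0 S × Unique (S ++ W) × length S ≤ 10 * unit) → Centred
            go′ (S , bag , u , l) = k , 0 , S , bag , u , l , trans (sym eq) (ring-90 X k (2 * K)) , ≤-trans (≤-reflexive (+-identityʳ k)) k≤

        cycle : Hamilton
        cycle = go centred
          where
          go : Centred → Hamilton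
          go (x₁ , y₁ , S , bag , u , l , eq , few) = assemble (S ++ W) (18 * suc K + 2 * K) u (lens (bag-length bag) (Flex.raise flex 0 z≤n))
              (≤-trans (≤-reflexive (length-++ S)) (≤-trans (l ⊕ W≤) (≤-trans (≤-reflexive (sym (*-distribʳ-+ unit 10 8))) (*-monoˡ-≤ unit (≤ᵇ⇒≤ 18 2000 tt)))))
              count arrange
            where
            lens : (∃ λ f → length S ≡ m * f) → (∃ λ x → ∃ λ y → ∃ λ r → Bag x y r W × x + Y ≡ 1 * 0 + (X + y) × x + y + r ≤ 2 * (4 * K)) → ∃ λ f → length (S ++ W) ≡ m * f
            lens (f , h) (_ , _ , _ , b , _) = let g , h′ = bag-length b in f + g , trans (length-++ S) (trans (cong₂ _+_ h h′) (sym (*-distribˡ-+ m f g)))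
            count : suc (18 * suc K + 2 * K) ≤ 300 * (m * suc K)
            count = ≤-trans (m≤m+n _ 1) (≤-trans (≤-reflexive (ring-88 K)) (≤-trans (*-monoˡ-≤ (suc K) (≤ᵇ⇒≤ 20 300 tt)) (*-monoʳ-≤ 300 (m≤m+n (suc K) (μ * suc K)))))
            arrange : Arrangement (S ++ W) (18 * suc K + 2 * K)
            arrange {x = x} {y} {r} _ _ _ b h _ = fin (balance bag flex b (y + 2 * K ∸ x) j≤ jeq)
              where
              x≤ : x ≤ 2 * K
              x≤ = ≤-trans (≤-trans (m≤m+n x y) (m≤m+n (x + y) r)) h
              y≤ : y ≤ 2 * K
              y≤ = ≤-trans (≤-trans (m≤n+m y x) (m≤m+n (x + y) r)) h
              j-eq : x + (y + 2 * K ∸ x) ≡ y + 2 * K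
              j-eq = m+[n∸m]≡n (≤-trans x≤ (m≤n+m (2 * K) y))
              j≤ : y + 2 * K ∸ x ≤ 4 * K
              j≤ = ≤-trans (m≤n+m _ x) (≤-trans (≤-reflexive j-eq) (≤-trans (+-monoˡ-≤ (2 * K) y≤) (≤-reflexive (sym (*-distribʳ-+ K 2 2)))))
              jeq : 1 * (y + 2 * K ∸ x) + (x₁ + x + X) ≡ y₁ + y + Y
              jeq = trans (ring-84 (y + 2 * K ∸ x) x₁ x X) (trans (cong (_+ (x₁ + X)) j-eq) (trans (ring-85 y (2 * K) x₁ X) (trans (cong (y +_) (sym eq)) (ring-86 y y₁ Y))))
              fin : ∀ {Xs} → (∃ λ z → ∃ λ r′ → Bag z z r′ ((S ++ W) ++ Xs) × z + r′ ≤ x₁ + y₁ + 0 + (2 * (4 * K) + (x + y + r))) → ∃ λ z → ∃ λ r′ → Bag z z r′ ((S ++ W) ++ Xs) × z + r′ ≤ 18 * suc K + 2 * K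
              fin (z , r′ , bg , t) = z , r′ , bg , ≤-trans t (≤-trans (≤-trans (≤-reflexive (+-identityʳ (x₁ + y₁))) few ⊕ (*-monoʳ-≤ 2 (*-monoʳ-≤ 4 (n≤1+n K)) ⊕ h)) (≤-reflexive (ring-87 K)))

    module FewTogglers (cl : Cleared) where
      open Cleared cl

      abstract
        ex-edge : ∀ {A B} → A ~ B → Disj A Z → Disj B Z → P A xor P B ≡ true
        ex-edge {A} {B} a dA dB = go (bool-case (P A)) (bool-case (P B))
          where
          not-P : ∀ {A} → Proper A → P A ≡ false → Q A ≡ true
          not-P p h = [ (λ k → true≢false k h) , id ]′ (PorQ p)
          go : P A ≡ true ⊎ P A ≡ false → P B ≡ true ⊎ P B ≡ false → P A xor P B ≡ true
          go (inj₁ p) (inj₁ q) = ⊥-elim (proj₁ (proj₂ clear) {A} {B} a dA dB p q)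
          go (inj₂ p) (inj₂ q) = ⊥-elim (proj₂ (proj₂ clear) {A} {B} a dA dB (not-P (~-properˡ {A} {B} a) p) (not-P (~-properʳ {A} {B} a) q))
          go (inj₁ p) (inj₂ q) = cong₂ _xor_ p q
          go (inj₂ p) (inj₁ q) = cong₂ _xor_ p q

        ex-rainbow : ∀ F → length F + 30 * unit ≤ β → ∀ c → ∃ λ A → Proper A × Disj A F × P A ≡ c
        ex-rainbow F h c = go (frame-slot PQ (F ++ Z) (≤-trans (≤-reflexive (length-++ F)) (≤-trans (+-monoʳ-≤ (length F) (≤-trans few (≤-trans (*-monoʳ-≤ 8 mK≤unit) (*-monoˡ-≤ unit (≤ᵇ⇒≤ 8 30 tt))))) h))
            (proj₁ (proj₂ P-some)) (proj₁ (proj₂ Q-some)) (proj₂ (proj₂ P-some)) (proj₂ (proj₂ Q-some))) c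
          where
          go : Slot P Q (F ++ Z) (proj₁ P-some) (proj₁ Q-some) → ∀ c → ∃ λ A → Proper A × Disj A F × P A ≡ c
          go (mkSlot C E AC CE EB QC PE offC offE) true = E , ~-properʳ {C} {E} CE , (λ i j → offE i (∈-++⁺ˡ j)) , PE
          go (mkSlot C E AC CE EB QC PE offC offE) false = C , ~-properˡ {C} {E} CE , (λ i j → offC i (∈-++⁺ˡ j))
            , [ (λ p → ⊥-elim (proj₁ clear (~-properˡ {C} {E} CE) (λ i j → offC i (∈-++⁺ʳ F j)) p QC)) , id ]′ (bool-case (P C))

      exact : Exact hg
      exact = record { Z = Z ; Z-unique = uniq ; Z-few = ≤-trans few (*-monoˡ-≤ (m * suc K) (≤ᵇ⇒≤ 8 30 tt)) ; col = P ; col-↭ = P-↭ ; δ = true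
                     ; edge-col = λ {A} {B} → ex-edge {A} {B} ; rainbow = ex-rainbow }

module Few where

  open Base
  open Arithmetic
  open Xor
  open Hyper
  open Tri
  open Absorb
  open Cover
  open Parity
  open Mixed
  open Bags
  open Many

  odd : ℕ → Bool
  odd zero = false
  odd (suc k) = not (odd k)

  abstract
    odd-+ : ∀ a b → odd (a + b) ≡ odd a xor odd b
    odd-+ zero b = refl
    odd-+ (suc a) b = trans (cong not (odd-+ a b)) (sym (not-xor (odd a) (odd b)))

    odd-double : ∀ k → odd (k + k) ≡ false
    odd-double k = trans (odd-+ k k) (xor-self (odd k))

    same-parity : ∀ d → odd d ≡ false → ∃ λ j → d ≡ j + j
    same-parity zero _ = 0 , refl
    same-parity (suc (suc d)) h = let j , e = same-parity d (trans (sym (not-involutive (odd d))) h) in suc j , cong suc (trans (cong suc e) (sym (+-suc j j)))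

  module FewBase (hg : HG) (df : Diff hg) (cl : Togglers.Cleared hg df) (chi : Chi hg (Togglers.FewTogglers.exact hg df cl)) where
    open HG hg
    open Diff df
    open Trails hg
    open Bagging hg df
    open Togglers hg df
    open FewTogglers cl using (exact; ex-edge)
    open Cleared cl using (Z; clear)
    open Chi chi
    open Fresh hg exact chi

    π : ℕ → ℕ → Bool
    π p q = (odd p ∧ not c₀) xor (odd q ∧ c₀)

    abstract
      π-+ : ∀ p q p′ q′ → π (p + p′) (q + q′) ≡ π p q xor π p′ q′
      π-+ p q p′ q′ = trans (cong₂ (λ a b → (a ∧ not c₀) xor (b ∧ c₀)) (odd-+ p p′) (odd-+ q q′)) (select-+ (odd p) (odd q) (odd p′) (odd q′) c₀)

      -- With p + q fixed, π p q determines the parity of p.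
      π-odd : ∀ p q p′ q′ → p + q ≡ p′ + q′ → π p q ≡ π p′ q′ → odd p ≡ odd p′
      π-odd p q p′ q′ e h = select-injective (odd p) (odd q) (odd p′) (odd q′) c₀ (trans (sym (odd-+ p q)) (trans (cong odd e) (odd-+ p′ q′))) h

    Counted : List V → ℕ → ℕ → Set
    Counted W p q = length W ≡ m * (p + q) × parity χ W ≡ π p q

    Disj-↭ : ∀ {W W′ : List V} → W ↭ W′ → Disj W′ Zs → Disj W Zs
    Disj-↭ p d i = d (∈-resp-↭ p i)

    abstract
      counted-[] : Counted [] 0 0
      counted-[] = sym (*-zeroʳ m) , refl

      counted-++ : ∀ {W W′ p q p′ q′} → Counted W p q → Counted W′ p′ q′ → Counted (W ++ W′) (p + p′) (q + q′)
      counted-++ {W} {W′} {p} {q} {p′} {q′} (l , h) (l′ , h′) = trans (length-++ W) (trans (cong₂ _+_ l l′) (ring-110 m p q p′ q′)) , trans (parity-++ χ W W′) (trans (cong₂ _xor_ h h′) (sym (π-+ p q p′ q′)))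

      counted-↭ : ∀ {W W′ p q} → W ↭ W′ → Counted W p q → Counted W′ p q
      counted-↭ w (l , h) = trans (sym (↭-length w)) l , trans (sym (parity-↭ χ w)) h

      first-⊆ : ∀ {A B W} → Trail A B W → ∀ {v} → v ∈ A → v ∈ W
      first-⊆ (part _) i = i
      first-⊆ (join t _ _) i = ∈-++⁺ˡ (first-⊆ t i)
      first-⊆ (perm′ p t) i = ∈-resp-↭ p (first-⊆ t i)

      last-⊆ : ∀ {A B W} → Trail A B W → ∀ {v} → v ∈ B → v ∈ W
      last-⊆ t = first-⊆ (reverse t)

      off-Z : ∀ {A : Part} → Disj A Zs → Disj A Z
      off-Z d i j = d i (Z⊆ j)

      par-P : ∀ {A} → Proper A → Disj A Zs → parity χ A ≡ c₀ xor P A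
      par-P {A} pA d = trans (sym (xor-undoˡ c₀ (parity χ A))) (cong (c₀ xor_) (sym (col-par pA d)))

      Q-notP : ∀ {A} → Proper A → Disj A Zs → Q A ≡ true → P A ≡ false
      Q-notP {A} pA d q = [ (λ p → ⊥-elim (proj₁ clear pA (off-Z d) p q)) , id ]′ (bool-case (P A))

      notP-Q : ∀ {A} → Proper A → P A ≡ false → Q A ≡ true
      notP-Q pA h = [ (λ p → true≢false p h) , id ]′ (PorQ pA)

      countPart : ∀ {A} → Proper A → parity χ A ≡ c₀ xor P A → ∃ λ p → ∃ λ q → Counted A p q × p + 1 ≡ q + (⟦ P A ⟧ + ⟦ P A ⟧)
      countPart {A} pA h = go (bool-case (P A))
        where
        lem₁ : ∀ c → c xor true ≡ not c xor false
        lem₁ true = refl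
        lem₁ false = refl
        lem₂ : ∀ c → c xor false ≡ c
        lem₂ c = xor-comm c false
        go : P A ≡ true ⊎ P A ≡ false → ∃ λ p → ∃ λ q → Counted A p q × p + 1 ≡ q + (⟦ P A ⟧ + ⟦ P A ⟧)
        go (inj₁ e) = 1 , 0 , (trans (proj₂ pA) (sym (*-identityʳ m)) , trans h (trans (cong (c₀ xor_) e) (lem₁ c₀))) , sym (cong (λ b → ⟦ b ⟧ + ⟦ b ⟧) e)
        go (inj₂ e) = 0 , 1 , (trans (proj₂ pA) (sym (*-identityʳ m)) , trans h (trans (cong (c₀ xor_) e) (lem₂ c₀))) , sym (cong (λ b → 1 + (⟦ b ⟧ + ⟦ b ⟧)) e)

      -- Along a path the two kinds of parts alternate.
      countTrail : ∀ {A B W} → Trail A B W → Disj W Zs → ∃ λ p → ∃ λ q → Counted W p q × p + 1 ≡ q + (⟦ P A ⟧ + ⟦ P B ⟧)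
      countTrail (part pA) d = countPart pA (par-P pA d)
      countTrail (perm′ w t) d with countTrail t (Disj-↭ w d)
      ... | p , q , c , e = p , q , counted-↭ {p = p} {q} w c , e
      countTrail (join {A} {B} {C} {E} {W} {W′} t h t′) d with countTrail t (λ i → d (∈-++⁺ˡ i)) | countTrail t′ (λ i → d (∈-++⁺ʳ W i))
      ... | p , q , c , e | p′ , q′ , c′ , e′ = p + p′ , q + q′ , counted-++ {W} {W′} {p} {q} {p′} {q′} c c′ ,
          arith p q p′ q′ ⟦ P A ⟧ ⟦ P B ⟧ ⟦ P C ⟧ ⟦ P E ⟧ e e′ (xor-alternate (P B) (P C) (ex-edge {B} {C} h (off-Z (λ i → d (∈-++⁺ˡ (last-⊆ t i)))) (off-Z (λ i → d (∈-++⁺ʳ W (first-⊆ t′ i))))))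
        where
        arith : ∀ p q p′ q′ a b c d → p + 1 ≡ q + (a + b) → p′ + 1 ≡ q′ + (c + d) → b + c ≡ 1 → p + p′ + 1 ≡ q + q′ + (a + d)
        arith p q p′ q′ a b c d h h′ k = +-cancelʳ-≡ 1 _ _ (trans (ring-105 p p′) (trans (cong₂ _+_ h h′) (trans (ring-106 q q′ a b c d) (cong (q + q′ + (a + d) +_) k))))

      countList : ∀ {f g : Pred} (a b : ℕ) → (∀ {A B W} → Trail A B W → Disj W Zs → f A ≡ true → g B ≡ true → ∀ p q → p + 1 ≡ q + (⟦ P A ⟧ + ⟦ P B ⟧) → p + a ≡ q + b) →
        ∀ ws → All (Between f g) ws → Disj (concat ws) Zs → ∃ λ p → ∃ λ q → Counted (concat ws) p q × p + length ws * a ≡ q + length ws * b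
      countList a b key [] [] d = 0 , 0 , counted-[] , refl
      countList a b key (w ∷ ws) ((A , B , t , fA , gB) ∷ hs) d with countTrail t (λ i → d (∈-++⁺ˡ i)) | countList a b key ws hs (λ i → d (∈-++⁺ʳ w i))
      ... | p , q , c , e | p′ , q′ , c′ , e′ = p + p′ , q + q′ , counted-++ {w} {concat ws} {p} {q} {p′} {q′} c c′ , arith p q p′ q′ (length ws * a) (length ws * b) (key t (λ i → d (∈-++⁺ˡ i)) fA gB p q e) e′
        where
        arith : ∀ p q p′ q′ x y → p + a ≡ q + b → p′ + x ≡ q′ + y → p + p′ + (a + x) ≡ q + q′ + (b + y)
        arith p q p′ q′ x y h h′ = trans (ring-74 p p′ a x) (trans (cong₂ _+_ h h′) (sym (ring-74 q q′ b y)))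

      countBag : ∀ {x y r W} → Bag x y r W → Disj W Zs → ∃ λ p → ∃ λ q → Counted W p q × p + y ≡ q + x
      countBag {x} {y} {r} (mkBag as bs cs pa pb pc refl refl refl w) d
        with countList {P} {P} 0 1 (λ _ _ a b p q h → keyPP p q a b h) as pa (λ i → d (∈-resp-↭ w (∈-++⁺ˡ i)))
           | countList {Q} {Q} 1 0 (λ t dt a b p q h → keyQQ p q (Q-notP (first-proper t) (λ i → dt (first-⊆ t i)) a) (Q-notP (last-proper t) (λ i → dt (last-⊆ t i)) b) h) bs pb (λ i → d (∈-resp-↭ w (∈-++⁺ʳ (concat as) (∈-++⁺ˡ i))))
           | countList {P} {Q} 0 0 (λ t dt a b p q h → keyPQ p q a (Q-notP (last-proper t) (λ i → dt (last-⊆ t i)) b) h) cs pc (λ i → d (∈-resp-↭ w (∈-++⁺ʳ (concat as) (∈-++⁺ʳ (concat bs) i))))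
        where
        keyPP : ∀ p q {a b} → a ≡ true → b ≡ true → p + 1 ≡ q + (⟦ a ⟧ + ⟦ b ⟧) → p + 0 ≡ q + 1
        keyPP p q refl refl h = +-cancelʳ-≡ 1 _ _ (trans (cong (_+ 1) (+-identityʳ p)) (trans h (sym (+-assoc q 1 1))))
        keyQQ : ∀ p q {a b} → a ≡ false → b ≡ false → p + 1 ≡ q + (⟦ a ⟧ + ⟦ b ⟧) → p + 1 ≡ q + 0
        keyQQ p q refl refl h = h
        keyPQ : ∀ p q {a b} → a ≡ true → b ≡ false → p + 1 ≡ q + (⟦ a ⟧ + ⟦ b ⟧) → p + 0 ≡ q + 0
        keyPQ p q refl refl h = +-cancelʳ-≡ 1 _ _ (trans (cong (_+ 1) (+-identityʳ p)) (trans h (cong (_+ 1) (sym (+-identityʳ q)))))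
      ... | p₁ , q₁ , c₁ , e₁ | p₂ , q₂ , c₂ , e₂ | p₃ , q₃ , c₃ , e₃ = p₁ + (p₂ + p₃) , q₁ + (q₂ + q₃) ,
          counted-↭ {p = p₁ + (p₂ + p₃)} {q₁ + (q₂ + q₃)} w (counted-++ {concat as} {concat bs ++ concat cs} {p₁} {q₁} {p₂ + p₃} {q₂ + q₃} c₁ (counted-++ {concat bs} {concat cs} {p₂} {q₂} {p₃} {q₃} c₂ c₃)) ,
          arith p₁ q₁ p₂ q₂ p₃ q₃ (length as) (length bs) (length cs) e₁ e₂ e₃
        where
        arith : ∀ p₁ q₁ p₂ q₂ p₃ q₃ x y r → p₁ + x * 0 ≡ q₁ + x * 1 → p₂ + y * 1 ≡ q₂ + y * 0 → p₃ + r * 0 ≡ q₃ + r * 0 → p₁ + (p₂ + p₃) + y ≡ q₁ + (q₂ + q₃) + x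
        arith p₁ q₁ p₂ q₂ p₃ q₃ x y r h₁ h₂ h₃ = trans (ring-107 p₁ p₂ p₃ x y r) (trans (cong₂ _+_ h₁ (cong₂ _+_ h₂ h₃)) (ring-108 q₁ q₂ q₃ x y r))

    record Pair (F : List V) : Set where
      constructor mkPair
      field
        {W}     : List V
        toggler : Toggler 4 W
        x≡      : Toggler.x toggler ≡ 0
        y≡      : Toggler.y toggler ≡ 2
        uniq    : Unique W
        offF    : Disj W F
        offZs   : Disj W Zs
        size    : length W ≡ 2 * m

    abstract
      singleP : ∀ {A} → Proper A → Disj A Zs → parity χ A ≡ not c₀ → Bag 1 0 0 A
      singleP {A} pA d h = bagPP (A , A , part pA , p , p)
        where
        p : P A ≡ true
        p = trans (col-par pA d) (trans (cong (c₀ xor_) h) (xor-not c₀))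

      singleQ : ∀ {A} → Proper A → Disj A Zs → parity χ A ≡ c₀ → Bag 0 1 0 A
      singleQ {A} pA d h = bagQQ (A , A , part pA , q , q)
        where
        q : Q A ≡ true
        q = notP-Q pA (trans (col-par pA d) (trans (cong (c₀ xor_) h) (xor-self c₀)))

      private-arith : ∀ u f → f ≤ 1000 * u → 3 * u + f + 66 * u ≤ 1069 * u
      private-arith u f h = ≤-trans (+-monoˡ-≤ (66 * u) (+-monoʳ-≤ (3 * u) h)) (≤-reflexive (ring-111 u))

      budget : ∀ k f → k ≤ 3 * unit → f ≤ 1000 * unit → k + f + 66 * unit ≤ β
      budget k f h g = ≤-trans (+-monoˡ-≤ (66 * unit) (+-monoˡ-≤ f h)) (≤-trans (private-arith unit f g) (units≤β 1069 (≤ᵇ⇒≤ 1069 5000 tt)))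

      -- Exchanging t and f between the parts t ∷ R₁ and f ∷ R₂ changes the type of both.
      pair : ∀ F → length F ≤ 900 * unit → Pair F
      pair F h = go (freshPar ν c₀ F (room F (≤-trans h (*-monoˡ-≤ unit (≤ᵇ⇒≤ 900 1000 tt)))))
        where
        open Colouring hg exact using (ν; μ≡)
        sν : suc ν ≤ 3 * unit
        sν = ≤-trans (≤-reflexive (sym μ≡)) (≤-trans (n≤1+n μ) (≤-trans m≤unit (m≤m+n unit _)))
        room : ∀ (G : List V) → length G ≤ 1000 * unit → suc ν + length G + 66 * unit ≤ β
        room G g = budget (suc ν) (length G) sν g
        go : FreshSet (suc ν) c₀ F → Pair F
        go (mkFresh R₁ u₁ l₁ d₁ z₁ p₁) = go₂ (freshPar ν (not c₀) (R₁ ++ F) (room (R₁ ++ F) (≤-trans (≤-reflexive (trans (length-++ R₁) (cong (_+ length F) l₁))) (≤-trans (sν ⊕ h) (≤-trans (≤-reflexive (sym (*-distribʳ-+ unit 3 900))) (*-monoˡ-≤ unit (≤ᵇ⇒≤ 903 1000 tt)))))))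
          where
          go₂ : FreshSet (suc ν) (not c₀) (R₁ ++ F) → Pair F
          go₂ (mkFresh R₂ u₂ l₂ d₂ z₂ p₂) = go₃ (freshPar 0 true G₂ (budget 1 _ (≤-trans 1≤unit (m≤m+n unit _)) G₂≤))
            where
            G₂ : List V
            G₂ = R₂ ++ (R₁ ++ F)
            G₂≤₆ : length G₂ ≤ 906 * unit
            G₂≤₆ = ≤-trans (≤-reflexive (trans (length-++ R₂) (cong₂ _+_ l₂ (trans (length-++ R₁) (cong (_+ length F) l₁))))) (≤-trans (sν ⊕ (sν ⊕ h)) (≤-reflexive (ring-96 unit)))
            G₂≤ : length G₂ ≤ 1000 * unit
            G₂≤ = ≤-trans G₂≤₆ (*-monoˡ-≤ unit (≤ᵇ⇒≤ 906 1000 tt))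
            go₃ : FreshSet 1 true G₂ → Pair F
            go₃ (mkFresh (t ∷ []) u₃ refl d₃ z₃ p₃) = go₄ (freshPar 0 false (t ∷ G₂) (budget 1 _ (≤-trans 1≤unit (m≤m+n unit _)) (≤-trans (1≤unit ⊕ G₂≤₆) (*-monoˡ-≤ unit (≤ᵇ⇒≤ 907 1000 tt)))))
              where
              go₄ : FreshSet 1 false (t ∷ G₂) → Pair F
              go₄ (mkFresh (f ∷ []) u₄ refl d₄ z₄ p₄) = mkPair {W = (f ∷ R₁) ++ (t ∷ R₂)}
                  (mkToggler (bag-++ (singleQ fR₁ (offs (disj-∷ f∉Z z₁)) parfR₁) (singleQ tR₂ (offs (disj-∷ t∉Z z₂)) partR₂)) (permBag sw (bag-++ (singleP tR₁ (offs (disj-∷ t∉Z z₁)) partR₁) (singleP fR₂ (offs (disj-∷ f∉Z z₂)) parfR₂))) refl ≤-refl ≤-refl)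
                  refl refl uW dW zW (trans (cong suc (length-++ R₁)) (trans (cong₂ (λ a b → suc (a + suc b)) (trans l₁ (sym μ≡)) (trans l₂ (sym μ≡))) (cong (m +_) (sym (+-identityʳ m)))))
                where
                t∉ : t ∉ G₂
                t∉ = d₃ (here refl)
                f∉ : f ∉ t ∷ G₂
                f∉ = d₄ (here refl)
                t∉Z : t ∉ Zs
                t∉Z = z₃ (here refl)
                f∉Z : f ∉ Zs
                f∉Z = z₄ (here refl)
                χt : χ t ≡ true
                χt = trans (sym (xor-comm (χ t) false)) p₃
                χf : χ f ≡ false
                χf = trans (sym (xor-comm (χ f) false)) p₄
                offs : ∀ {A : Part} → Disj A Zs → Disj A Zs
                offs d = d
                proper : ∀ v R → v ∉ R → Unique R → length R ≡ suc ν → Proper (v ∷ R)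
                proper v R h u l = unique-∷ h u , cong suc (trans l (sym μ≡))
                fR₁ : Proper (f ∷ R₁)
                fR₁ = proper f R₁ (λ i → f∉ (there (∈-++⁺ʳ R₂ (∈-++⁺ˡ i)))) u₁ l₁
                fR₂ : Proper (f ∷ R₂)
                fR₂ = proper f R₂ (λ i → f∉ (there (∈-++⁺ˡ i))) u₂ l₂
                tR₁ : Proper (t ∷ R₁)
                tR₁ = proper t R₁ (λ i → t∉ (∈-++⁺ʳ R₂ (∈-++⁺ˡ i))) u₁ l₁
                tR₂ : Proper (t ∷ R₂)
                tR₂ = proper t R₂ (λ i → t∉ (∈-++⁺ˡ i)) u₂ l₂
                nn : ∀ c → true xor (not c) ≡ c
                nn true = refl
                nn false = refl
                parfR₁ : parity χ (f ∷ R₁) ≡ c₀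
                parfR₁ = cong₂ _xor_ χf p₁
                parfR₂ : parity χ (f ∷ R₂) ≡ not c₀
                parfR₂ = cong₂ _xor_ χf p₂
                partR₁ : parity χ (t ∷ R₁) ≡ not c₀
                partR₁ = cong₂ _xor_ χt p₁
                partR₂ : parity χ (t ∷ R₂) ≡ c₀
                partR₂ = trans (cong₂ _xor_ χt p₂) (nn c₀)
                sw : (t ∷ R₁) ++ (f ∷ R₂) ↭ (f ∷ R₁) ++ (t ∷ R₂)
                sw = perm 4 (λ t r f s → (t ∙ r) ∙ (f ∙ s) ⊜ (f ∙ r) ∙ (t ∙ s)) ↭-refl [ t ] R₁ [ f ] R₂
                uW : Unique ((f ∷ R₁) ++ (t ∷ R₂))
                uW = unique-++ (proj₁ fR₁) (proj₁ tR₂) dis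
                  where
                  dis : Disj (f ∷ R₁) (t ∷ R₂)
                  dis (here refl) (here e) = f∉ (here e)
                  dis (here refl) (there j) = f∉ (there (∈-++⁺ˡ j))
                  dis (there i) (here refl) = t∉ (∈-++⁺ʳ R₂ (∈-++⁺ˡ i))
                  dis (there i) (there j) = d₂ j (∈-++⁺ˡ i)
                dW : Disj ((f ∷ R₁) ++ (t ∷ R₂)) F
                dW i j = [ (λ { (here refl) → f∉ (there (∈-++⁺ʳ R₂ (∈-++⁺ʳ R₁ j))) ; (there k) → d₁ k j }) , (λ { (here refl) → t∉ (∈-++⁺ʳ R₂ (∈-++⁺ʳ R₁ j)) ; (there k) → d₂ k (∈-++⁺ʳ R₁ j) }) ]′ (∈-++⁻ (f ∷ R₁) i)
                zW : Disj ((f ∷ R₁) ++ (t ∷ R₂)) Zs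
                zW i j = [ (λ k → disj-∷ f∉Z z₁ k j) , (λ k → disj-∷ t∉Z z₂ k j) ]′ (∈-++⁻ (f ∷ R₁) i)

    record Pairs (k : ℕ) (F : List V) : Set where
      field
        W     : List V
        flex  : Flex 4 k W
        X≡    : Flex.X flex ≡ 0
        Y≡    : Flex.Y flex ≡ 2 * k
        uniq  : Unique W
        offF  : Disj W F
        offZs : Disj W Zs
        size  : length W ≡ 2 * m * k

    abstract
      pairs : ∀ k F → k ≤ 200 * (m * suc K) → length F ≤ 400 * unit → Pairs k F
      pairs zero F _ _ = record { W = [] ; flex = flex-[] ; X≡ = flex-X₀ ; Y≡ = flex-Y₀ ; uniq = [] ; offF = λ () ; offZs = λ () ; size = sym (*-zeroʳ (2 * m)) }
      pairs (suc k) F hk hF = go (pairs k F (≤-trans (n≤1+n k) hk) hF)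
        where
        go : Pairs k F → Pairs (suc k) F
        go ps = go₂ (pair (W ++ F) (≤-trans (≤-reflexive (trans (length-++ W) (cong (_+ length F) size))) (≤-trans (≤-trans (*-monoʳ-≤ (2 * m) (≤-trans (n≤1+n k) hk)) (≤-trans (≤-reflexive (ring-109 m (suc K))) (*-monoʳ-≤ 400 mmK≤unit)) ⊕ hF)
            (≤-trans (≤-reflexive (sym (*-distribʳ-+ unit 400 400))) (*-monoˡ-≤ unit (≤ᵇ⇒≤ 800 900 tt))))))
          where
          open Pairs ps
          go₂ : Pair (W ++ F) → Pairs (suc k) F
          go₂ (mkPair {W′} t x y u dF dZ l) = record
            { W = W′ ++ W ; flex = flex-∷ t flex ; X≡ = trans (flex-X t flex) (cong₂ _+_ x X≡) ; Y≡ = trans (flex-Y t flex) (trans (cong₂ _+_ y Y≡) (sym (*-suc 2 k)))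
            ; uniq = unique-++ u uniq (λ i j → dF i (∈-++⁺ˡ j)) ; offF = λ i j → [ (λ z → dF z (∈-++⁺ʳ W j)) , (λ z → offF z j) ]′ (∈-++⁻ W′ i)
            ; offZs = λ i j → [ (λ z → dZ z j) , (λ z → offZs z j) ]′ (∈-++⁻ W′ i) ; size = trans (length-++ W′) (trans (cong₂ _+_ l size) (sym (*-suc (2 * m) k))) }

    -- A fixed part G containing Zs, such that the rest can be split into p parts of type P and q of type Q.
    record Layout : Set where
      field
        {x₁ y₁ r₁ p q} : ℕ
        G     : List V
        bag   : Bag x₁ y₁ r₁ G
        uniq  : Unique G
        Zs⊆G  : ∀ {v} → v ∈ Zs → v ∈ G
        short : length G ≤ 400 * unit
        few   : x₁ + y₁ + r₁ ≤ 50 * (m * suc K)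
        even  : p + x₁ ≡ q + y₁
        counted : ∀ W → allFin n ↭ G ++ W → Counted W p q

    module Finishing (lay : Layout) where
      open Layout lay renaming (p to p₀′; q to q₀′)

      k : ℕ
      k = 60 * (m * suc K)

      module _ (ps : Pairs k G) where
        open Pairs ps renaming (W to W₂; uniq to uniq₂; size to size₂)
        open Flex flex

        K≤mK : 2 * K ≤ 2 * (m * suc K)
        K≤mK = *-monoʳ-≤ 2 (≤-trans (n≤1+n K) (m≤m+n (suc K) (μ * suc K)))

        abstract
          arith : ∀ M p q p′ q′ x₁ y₁ x y j → p + q ≡ p′ + q′ → p + x₁ ≡ q + y₁ → p′ + y + 2 * (60 * M) ≡ q′ + x → p ≡ p′ + (j + j) → 4 * j + (x₁ + x + 0) ≡ y₁ + y + 2 * (60 * M)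
          arith M p q p′ q′ x₁ y₁ x y j h₁ h₂ h₃ refl = +-cancelˡ-≡ (p′ + p′ + q′ + q) _ _ (trans (ring-99 p′ q′ q j x₁ x) (trans (cong₂ _+_ (cong₂ _+_ h₂ (sym h₃)) h₁) (ring-100 p′ q′ q y₁ y M)))

          below : ∀ M p q p′ q′ x₁ y₁ r₁ x y → p + q ≡ p′ + q′ → p + x₁ ≡ q + y₁ → p′ + y + 2 * (60 * M) ≡ q′ + x → x₁ + y₁ + r₁ ≤ 50 * M → x ≤ 2 * M → p′ ≤ p
          below M p q p′ q′ x₁ y₁ r₁ x y h₁ h₂ h₃ h₄ h₅ = *-cancelˡ-≤ 2 (lin (2 * y₁ + y + 68 * M + r₁) (eq≥ h₁ ⊕ eq≥ h₂ ⊕ eq≤ h₃ ⊕ h₄ ⊕ h₅) (ring-101 M p q p′ q′ x₁ y₁ r₁ x y))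

          j-small : ∀ M j x₁ y₁ r₁ x y → 4 * j + (x₁ + x + 0) ≡ y₁ + y + 2 * (60 * M) → x₁ + y₁ + r₁ ≤ 50 * M → y ≤ 2 * M → j ≤ 60 * M
          j-small M j x₁ y₁ r₁ x y h h₄ h₅ = *-cancelˡ-≤ 4 (lin (2 * x₁ + x + r₁ + 68 * M) (eq≤ h ⊕ h₄ ⊕ h₅) (ring-102 M j x₁ y₁ r₁ x y))

          shares : ∀ pr qr p₂ q₂ px qx x y k a b → pr + 1 ≡ qr + 1 → p₂ + b ≡ q₂ + a → a + k ≡ b → px + y ≡ qx + x → pr + (p₂ + px) + y + k ≡ qr + (q₂ + qx) + x
          shares pr qr p₂ q₂ px qx x y k a .(a + k) h₁ h₂ refl h₃ = +-cancelʳ-≡ (1 + a) _ _ (trans (ring-103 pr p₂ px y k a) (trans (cong₂ _+_ h₁ (cong₂ _+_ h₂ h₃)) (ring-104 qr q₂ qx x a)))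

        M : ℕ
        M = m * suc K

        module Arrange {W Xs x y r A B} (t : Trail A B W) (QA : Q A ≡ true) (PB : P B ≡ true) (b : Bag x y r Xs) (tot : x + y + r ≤ 2 * K) (all≡ : allFin n ↭ (W ++ (G ++ W₂)) ++ Xs) where

          Counts : Set
          Counts = ∃ λ p′ → ∃ λ q′ → p₀′ + q₀′ ≡ p′ + q′ × π p₀′ q₀′ ≡ π p′ q′ × p′ + y + 2 * (60 * M) ≡ q′ + x

          Balanced : Set
          Balanced = ∃ λ z → ∃ λ r′ → Bag z z r′ ((G ++ W₂) ++ Xs) × z + r′ ≤ 172 * M

          abstract
            order : allFin n ↭ G ++ (W ++ (W₂ ++ Xs))
            order = ↭-trans all≡ (perm 4 (λ w g v x → (w ∙ (g ∙ v)) ∙ x ⊜ g ∙ (w ∙ (v ∙ x))) ↭-refl W G W₂ Xs)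

            outside : ∀ {v} → v ∈ W ++ (W₂ ++ Xs) → v ∈ Zs → ⊥
            outside i j = unique-disj G (Unique-↭ order allFin-unique) (Zs⊆G j) i

            counts : Counts
            counts = go (countTrail t (λ i → outside (∈-++⁺ˡ i))) (raise 0 z≤n) (countBag b (λ i → outside (∈-++⁺ʳ W (∈-++⁺ʳ W₂ i))))
              where
              notPA : P A ≡ false
              notPA = Q-notP (first-proper t) (λ i j → outside (∈-++⁺ˡ (first-⊆ t i)) j) QA
              cw : Counted (W ++ (W₂ ++ Xs)) p₀′ q₀′
              cw = counted (W ++ (W₂ ++ Xs)) order
              go : (∃ λ pr → ∃ λ qr → Counted W pr qr × pr + 1 ≡ qr + (⟦ P A ⟧ + ⟦ P B ⟧)) → (∃ λ a → ∃ λ c → ∃ λ d → Bag a c d W₂ × a + Y ≡ 4 * 0 + (X + c) × a + c + d ≤ 2 * k) →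
                (∃ λ px → ∃ λ qx → Counted Xs px qx × px + y ≡ qx + x) → Counts
              go (pr , qr , cr , er) (a , c , d , low , eq , _) (px , qx , cx , ex) = go₂ (countBag low offZs)
                where
                eq′ : a + 2 * (60 * M) ≡ c
                eq′ = trans (cong (a +_) (sym Y≡)) (trans eq (cong (_+ c) X≡))
                go₂ : (∃ λ p₂ → ∃ λ q₂ → Counted W₂ p₂ q₂ × p₂ + c ≡ q₂ + a) → Counts
                go₂ (p₂ , q₂ , c₂ , e₂) = pr + (p₂ + px) , qr + (q₂ + qx) ,
                    *-cancelˡ-≡ _ _ m (trans (sym (proj₁ cw)) (proj₁ cc)) , trans (sym (proj₂ cw)) (proj₂ cc) ,
                    shares pr qr p₂ q₂ px qx x y (2 * (60 * M)) a c (trans er (cong₂ (λ f g → qr + (⟦ f ⟧ + ⟦ g ⟧)) notPA PB)) e₂ eq′ ex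
                  where
                  cc : Counted (W ++ (W₂ ++ Xs)) (pr + (p₂ + px)) (qr + (q₂ + qx))
                  cc = counted-++ {W} {W₂ ++ Xs} {pr} {qr} {p₂ + px} {q₂ + qx} cr (counted-++ {W₂} {Xs} {p₂} {q₂} {px} {qx} c₂ cx)

            main-step : ∀ p′ q′ → p₀′ + q₀′ ≡ p′ + q′ → π p₀′ q₀′ ≡ π p′ q′ → p′ + y + 2 * (60 * M) ≡ q′ + x → Balanced
            main-step p′ q′ e₁ e₂ e₃ = go (same-parity (p₀′ ∸ p′) evenGap)
              where
              x≤ : x ≤ 2 * M
              x≤ = ≤-trans (≤-trans (≤-trans (m≤m+n x y) (m≤m+n (x + y) r)) tot) K≤mK
              y≤ : y ≤ 2 * M
              y≤ = ≤-trans (≤-trans (≤-trans (m≤n+m y x) (m≤m+n (x + y) r)) tot) K≤mK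
              p′≤ : p′ ≤ p₀′
              p′≤ = below M p₀′ q₀′ p′ q′ x₁ y₁ r₁ x y e₁ even e₃ few x≤
              gap : p′ + (p₀′ ∸ p′) ≡ p₀′
              gap = m+[n∸m]≡n p′≤
              evenGap : odd (p₀′ ∸ p′) ≡ false
              evenGap = xor-cancel (odd p′) _ false (trans (sym (odd-+ p′ (p₀′ ∸ p′))) (trans (cong odd gap) (trans (π-odd p₀′ q₀′ p′ q′ e₁ e₂) (xor-comm false (odd p′)))))
              go : (∃ λ j → p₀′ ∸ p′ ≡ j + j) → Balanced
              go (j , ej) = fin (balance bag flex b j (j-small M j x₁ y₁ r₁ x y main few y≤) (trans (cong (λ z → 4 * j + (x₁ + x + z)) X≡) (trans main (cong (y₁ + y +_) (sym Y≡)))))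
                where
                main : 4 * j + (x₁ + x + 0) ≡ y₁ + y + 2 * (60 * M)
                main = arith M p₀′ q₀′ p′ q′ x₁ y₁ x y j e₁ even e₃ (trans (sym gap) (cong (p′ +_) ej))
                fin : (∃ λ z → ∃ λ r′ → Bag z z r′ ((G ++ W₂) ++ Xs) × z + r′ ≤ x₁ + y₁ + r₁ + (2 * k + (x + y + r))) → Balanced
                fin (z , r′ , bg , l) = z , r′ , bg , ≤-trans l (≤-trans (few ⊕ (≤-refl {2 * k} ⊕ ≤-trans tot K≤mK)) (≤-reflexive (ring-95 M)))

            result : Balanced
            result = let p′ , q′ , e₁ , e₂ , e₃ = counts in main-step p′ q′ e₁ e₂ e₃

        abstract
          finish : Hamilton
          finish = assemble (G ++ W₂) (172 * M) (unique-++ uniq uniq₂ (λ i j → offF j i)) lens short′ count (λ t QA PB b tot all≡ → Arrange.result t QA PB b tot all≡)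
            where
            lens : ∃ λ f → length (G ++ W₂) ≡ m * f
            lens = let f , h = bag-length bag in f + 2 * k , trans (length-++ G) (trans (cong₂ _+_ h (trans size₂ (ring-97 m k))) (sym (*-distribˡ-+ m f (2 * k))))
            short′ : length (G ++ W₂) ≤ 2000 * unit
            short′ = ≤-trans (≤-reflexive (length-++ G)) (≤-trans (short ⊕ ≤-trans (≤-reflexive (trans size₂ (ring-98 m (suc K)))) (*-monoʳ-≤ 120 mmK≤unit)) (≤-trans (≤-reflexive (sym (*-distribʳ-+ unit 400 120))) (*-monoˡ-≤ unit (≤ᵇ⇒≤ 520 2000 tt))))
            count : suc (172 * M) ≤ 300 * (m * suc K)
            count = ≤-trans (+-monoˡ-≤ (172 * M) (*-mono-≤ {1} {m} {1} {suc K} (s≤s z≤n) (s≤s z≤n))) (*-monoˡ-≤ M (≤ᵇ⇒≤ 173 300 tt))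

      abstract
        cycle : Hamilton
        cycle = finish (pairs k G (*-monoˡ-≤ (m * suc K) (≤ᵇ⇒≤ 60 200 tt)) short)

module Layouts where

  open Base
  open Arithmetic
  open Xor
  open Hyper
  open Tri
  open Absorb
  open Cover
  open Parity
  open Mixed
  open Bags
  open Many
  open Few

  module _ {A : Set} (χ : A → Bool) where

    parity-even : ∀ b j xs → length xs ≡ j + j → (∀ {v} → v ∈ xs → χ v ≡ b) → parity χ xs ≡ false
    parity-even b zero [] l h = refl
    parity-even b (suc j) (x ∷ []) l h = ⊥-elim (impossible (trans (suc-injective l) (+-suc j j)))
      where
      impossible : ∀ {k} → 0 ≡ suc k → ⊥
      impossible ()
    parity-even b (suc j) (x ∷ y ∷ xs) l h = trans (sym (xor-assoc (χ x) (χ y) _)) (trans (cong₂ (λ p q → (p xor q) xor parity χ xs) (h (here refl)) (h (there (here refl))))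
      (trans (cong (_xor parity χ xs) (xor-self b)) (parity-even b j xs (suc-injective (trans (suc-injective l) (+-suc j j))) (λ i → h (there (there i))))))

    parity-odd-# : ∀ xs → parity χ xs ≡ odd (# χ of xs)
    parity-odd-# [] = refl
    parity-odd-# (x ∷ xs) with χ x
    ... | true = cong not (parity-odd-# xs)
    ... | false = parity-odd-# xs

  parity-cong : ∀ {A : Set} (f g : A → Bool) xs → (∀ {v} → v ∈ xs → f v ≡ g v) → parity f xs ≡ parity g xs
  parity-cong f g [] h = refl
  parity-cong f g (x ∷ xs) h = cong₂ _xor_ (h (here refl)) (parity-cong f g xs (λ i → h (there i)))

  module Laying (hg : HG) (df : Diff hg) (cl : Togglers.Cleared hg df) (chi : Chi hg (Togglers.FewTogglers.exact hg df cl)) where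
    open HG hg
    open Diff df
    open Trails hg
    open Bagging hg df
    open Togglers hg df
    open FewTogglers cl using (exact; ex-edge)
    open Chi chi
    open Fresh hg exact chi
    open FewBase hg df cl chi

    Has : Bool → List V → Set
    Has b S = ∃ λ v → v ∈ S × χ v ≡ b

    adm : List V → Bool
    adm S = does (1 ≤? # χ of S) ∧ does (1 ≤? # (λ v → not (χ v)) of S)

    open Mixing hg exact chi adm

    abstract
      adm-intro : ∀ {S} → Has true S → Has false S → adm S ≡ true
      adm-intro {S} (v , i , h) (w , j , k) = ∧-intro (decide (1 ≤? # χ of S) (#-pos χ i h)) (decide (1 ≤? # (λ v → not (χ v)) of S) (#-pos (λ v → not (χ v)) j (cong not k)))

      adm-elim : ∀ {S} → adm S ≡ true → Has true S × Has false S
      adm-elim {S} h = let a , b = ∧-elim {does (1 ≤? # χ of S)} h in #-find S χ (decided (1 ≤? _) a) , (let v , i , k = #-find S (λ v → not (χ v)) (decided (1 ≤? _) b) in v , i , not-true k)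

      has-bool : ∀ b {S} → Has b S → Has (not b) S → adm S ≡ true
      has-bool true h k = adm-intro h k
      has-bool false h k = adm-intro k h

    ν : ℕ
    ν = Colouring.ν hg exact

    μ≡ : μ ≡ suc ν
    μ≡ = Colouring.μ≡ hg exact

    abstract
      -- A bichromatic edge can be split with a first half of any parity: exchange t and f.
      splitS : ∀ p (S : List V) → adm S ≡ true → suc (length S) ≡ m + m → ∃ λ T → ∃ λ B → S ↭ T ++ B × length T ≡ μ × parity χ T ≡ p
      splitS p S a l = go (adm-elim a)
        where
        Res : Set
        Res = ∃ λ T → ∃ λ B → S ↭ T ++ B × length T ≡ μ × parity χ T ≡ p
        go : Has true S × Has false S → Res
        go ((t , i , χt) , (f , j , χf)) = go₂ (∈-∃++ i)
          where
          go₂ : (∃ λ as → ∃ λ bs → S ≡ as ++ t ∷ bs) → Res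
          go₂ (as , bs , eq) = go₃ (∈-∃++ (f∈ (∈-resp-↭ q j)))
            where
            q : S ↭ t ∷ (as ++ bs)
            q = ↭-trans (↭-reflexive eq) (shift t as bs)
            f∈ : f ∈ t ∷ (as ++ bs) → f ∈ as ++ bs
            f∈ (here e) = ⊥-elim (true≢false (trans (cong χ e) χt) χf)
            f∈ (there k) = k
            go₃ : (∃ λ cs → ∃ λ ds → as ++ bs ≡ cs ++ f ∷ ds) → Res
            go₃ (cs , ds , eq₂) = go₄ (split ν (cs ++ ds) (≤-trans (m≤m+n ν μ) (≤-reflexive (sym lR))))
              where
              q₂ : S ↭ t ∷ f ∷ (cs ++ ds)
              q₂ = ↭-trans q (prep t (↭-trans (↭-reflexive eq₂) (shift f cs ds)))
              lR : length (cs ++ ds) ≡ ν + μ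
              lR = suc-injective (suc-injective (trans (sym (↭-length q₂)) (suc-injective (trans l (cong suc (trans (cong₂ _+_ μ≡ refl) (cong suc (+-suc ν μ))))))))
              go₄ : (∃ λ R₁ → ∃ λ R₂ → cs ++ ds ≡ R₁ ++ R₂ × length R₁ ≡ ν) → Res
              go₄ (R₁ , R₂ , eq₃ , l₁) = go₅ (bool-≟ (parity χ R₁) p)
                where
                go₅ : parity χ R₁ ≡ p ⊎ parity χ R₁ ≡ not p → Res
                go₅ (inj₁ h) = f ∷ R₁ , t ∷ R₂ , ↭-trans q₂ (↭-trans (prep t (prep f (↭-reflexive eq₃))) (perm 4 (λ t f r s → t ∙ (f ∙ (r ∙ s)) ⊜ (f ∙ r) ∙ (t ∙ s)) ↭-refl [ t ] [ f ] R₁ R₂))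
                  , trans (cong suc l₁) (sym μ≡) , cong₂ _xor_ χf h
                go₅ (inj₂ h) = t ∷ R₁ , f ∷ R₂ , ↭-trans q₂ (↭-trans (prep t (prep f (↭-reflexive eq₃))) (perm 4 (λ t f r s → t ∙ (f ∙ (r ∙ s)) ⊜ (t ∙ r) ∙ (f ∙ s)) ↭-refl [ t ] [ f ] R₁ R₂))
                  , trans (cong suc l₁) (sym μ≡) , trans (cong₂ _xor_ χt h) (nn p)
                  where
                  nn : ∀ p → true xor not p ≡ p
                  nn true = refl
                  nn false = refl

      room : ∀ k (G : List V) → k ≤ 2 * m → length G ≤ 2100 * unit → k + length G + 66 * unit ≤ β
      room k G h g = ≤-trans (+-monoˡ-≤ (66 * unit) (≤-trans h (*-monoʳ-≤ 2 m≤unit) ⊕ g)) (≤-trans (≤-reflexive (ring-72 unit)) (units≤β 2168 (≤ᵇ⇒≤ 2168 5000 tt)))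

      μ≤2m : μ ≤ 2 * m
      μ≤2m = ≤-trans (n≤1+n μ) (m≤m+n m _)

      freshT : ∀ p (G : List V) → length G ≤ 2100 * unit → ∃ λ T → Unique T × length T ≡ μ × Disj T G × parity χ T ≡ p
      freshT p G h = go (freshPar ν p G (room (suc ν) G (≤-trans (≤-reflexive (sym μ≡)) μ≤2m) h))
        where
        go : FreshSet (suc ν) p G → ∃ λ T → Unique T × length T ≡ μ × Disj T G × parity χ T ≡ p
        go (mkFresh w u l d _ q) = w , u , trans l (sym μ≡) , d , q

      gadgetOf : ∀ p F → length F ≤ 2000 * unit → ∀ z → z ∈ F → Mixed F z → Gadget (λ T → parity χ T ≡ p) F z
      gadgetOf p F F≤ z z∈ mx = Build.gadget (λ T → parity χ T ≡ p) F F≤ (splitS p) (freshT p) z z∈ mx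

    record Bichromatic (F : List V) : Set where
      constructor mkBi
      field
        T      : List V
        uniq   : Unique T
        size   : length T ≡ μ
        off-F  : Disj T F
        off-Zs : Disj T Zs
        hasT   : Has true T
        hasF   : Has false T

    -- The majority class b on top of one vertex of the other class.
    record Special (k : ℕ) (b : Bool) (F : List V) : Set where
      constructor mkSpecial
      field
        v      : V
        w      : List V
        uniq   : Unique (v ∷ w)
        size   : length w ≡ k
        off-F  : Disj (v ∷ w) F
        off-Zs : Disj (v ∷ w) Zs
        χv     : χ v ≡ not b
        χw     : ∀ {x} → x ∈ w → χ x ≡ b

    abstract
      special : ∀ k b F → suc k ≤ 2 * m → length F ≤ 2100 * unit → Special k b F
      special k b F h hF = go (freshMono k b F (room k F (≤-trans (n≤1+n k) h) hF))
        where
        go : (∃ λ p → Σ (FreshSet k p F) λ x → ∀ {v} → v ∈ FreshSet.w x → χ v ≡ b) → Special k b F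
        go (p , mkFresh w u l d z q , all) = go₂ (add (not b) (mkFresh w u l d z q) (room k F (≤-trans (n≤1+n k) h) hF))
          where
          go₂ : (∃ λ v → χ v ≡ not b × Σ (FreshSet (suc k) (not b xor p) F) λ y → FreshSet.w y ≡ v ∷ w) → Special k b F
          go₂ (v , c , mkFresh .(v ∷ w) u′ l′ d′ z′ q′ , refl) = mkSpecial v w u′ l d′ z′ c all

      bichromatic : ∀ F → length F ≤ 2100 * unit → Bichromatic F
      bichromatic F h = go (special ν true F (≤-trans (≤-reflexive (sym μ≡)) μ≤2m) h) (two ν (≤-pred (≤-trans μ-large (≤-reflexive μ≡))))
        where
        two : ∀ k → 1 ≤ k → ∃ λ j → k ≡ suc j
        two (suc k) _ = k , refl
        go : Special ν true F → (∃ λ j → ν ≡ suc j) → Bichromatic F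
        go (mkSpecial v [] u l d z c a) (j , eq) = ⊥-elim (impossible (trans l eq))
          where
          impossible : ∀ {k} → 0 ≡ suc k → ⊥
          impossible ()
        go (mkSpecial v (x ∷ w) u l d z c a) _ = mkBi (v ∷ x ∷ w) u (trans (cong suc l) (sym μ≡)) d z (x , there (here refl) , a (here refl)) (v , here refl , c)

    Role : (V → Bool) → List V → V → Set
    Role f F z = ∀ S → e (z ∷ S) ≡ true → Disj S F → adm S ≡ true → f z ≡ true xor parity χ S

    Normal : (V → Bool) → Set
    Normal f = ∀ {v} → v ∉ Zs → f v ≡ χ v

    -- Each z ∈ zs in a part of its own; in any extension of χ that respects the roles
    -- these parts have the parity of their type.
    record Singles (zs F : List V) : Set where
      constructor mkSingles
      field
        {x y}  : ℕ
        W      : List V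
        bag    : Bag x y 0 W
        uniq   : Unique W
        cover  : ∀ {v} → v ∈ zs → v ∈ W
        where′ : ∀ {v} → v ∈ W → v ∈ zs ⊎ (v ∉ F × v ∉ Zs)
        total  : x + y ≡ length zs
        size   : length W ≡ m * length zs
        par    : ∀ f → Normal f → (∀ {z} → z ∈ zs → Role f F z) → parity f W ≡ π x y

    module OneSingle (F : List V) (F≤ : length F ≤ 1900 * unit) (Zs⊆F : ∀ {v} → v ∈ Zs → v ∈ F) (z : V) (z∈Zs : z ∈ Zs) (bi : Bichromatic F) where
      open Bichromatic bi

      abstract
        proper : Proper (z ∷ T)
        proper = unique-∷ (λ i → off-Zs i z∈Zs) uniq , cong suc size

        F≤β : length F ≤ β
        F≤β = ≤-trans F≤ (units≤β 1900 (≤ᵇ⇒≤ 1900 5000 tt))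

        parity-of : ∀ {B} → (z ∷ T) ~ B → Disj B F → ∀ f → Normal f → Role f F z → parity f (z ∷ T) ≡ true xor parity χ B
        parity-of {B} h d f nf rf = trans (cong₂ _xor_ (rf (T ++ B) (~-edge {z ∷ T} {B} h) (λ i j → [ (λ k → off-F k j) , (λ k → d k j) ]′ (∈-++⁻ T i)) admTB) (parity-cong f χ T (λ i → nf (off-Zs i))))
            (trans (cong (λ w → (true xor w) xor parity χ T) (parity-++ χ T B)) (xor-commonʳ (parity χ T) (parity χ B)))
          where
          widen : ∀ {b} → Has b T → Has b (T ++ B)
          widen (v , i , h) = v , ∈-++⁺ˡ i , h
          admTB : adm (T ++ B) ≡ true
          admTB = adm-intro (widen hasT) (widen hasF)

      OneBag : Set
      OneBag = ∃ λ x → ∃ λ y → Bag x y 0 (z ∷ T) × x + y ≡ 1 × (∀ f → Normal f → Role f F z → parity f (z ∷ T) ≡ π x y)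

      abstract
        one : OneBag
        one = go (PorQ proper)
          where
          go : P (z ∷ T) ≡ true ⊎ Q (z ∷ T) ≡ true → OneBag
          go (inj₁ p) = 1 , 0 , bagPP (z ∷ T , z ∷ T , part proper , p , p) , refl , fin (frame-slot PQ F F≤β proper (proj₁ (proj₂ Q-some)) p (proj₂ (proj₂ Q-some)))
            where
            fin : Slot P Q F (z ∷ T) (proj₁ Q-some) → ∀ f → Normal f → Role f F z → parity f (z ∷ T) ≡ π 1 0
            fin (mkSlot C E AC CE EB QC PE offC offE) f nf rf = trans (parity-of {C} AC offC f nf rf) (trans (cong (true xor_) (trans (par-P pC (λ i j → offC i (Zs⊆F j))) (cong (c₀ xor_) (Q-notP pC (λ i j → offC i (Zs⊆F j)) QC)))) (not-xor-false c₀))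
              where
              pC : Proper C
              pC = ~-properʳ {z ∷ T} {C} AC
          go (inj₂ q) = 0 , 1 , bagQQ (z ∷ T , z ∷ T , part proper , q , q) , refl , fin (frame-slot PQ F F≤β (proj₁ (proj₂ P-some)) proper (proj₂ (proj₂ P-some)) q)
            where
            fin : Slot P Q F (proj₁ P-some) (z ∷ T) → ∀ f → Normal f → Role f F z → parity f (z ∷ T) ≡ π 0 1
            fin (mkSlot C E AC CE EB QC PE offC offE) f nf rf = trans (parity-of {E} (~-sym {E} {z ∷ T} EB) offE f nf rf) (trans (cong (true xor_) (trans (par-P pE (λ i j → offE i (Zs⊆F j))) (cong (c₀ xor_) PE))) (not-xor-true c₀))
              where
              pE : Proper E
              pE = ~-properˡ {E} {z ∷ T} EB

    abstract
      singlesOf : ∀ F → length F ≤ 1800 * unit → (∀ {v} → v ∈ Zs → v ∈ F) → ∀ zs → Unique zs → (∀ {v} → v ∈ zs → v ∈ Zs) → m * length zs ≤ 33 * unit → Singles zs F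
      singlesOf F F≤ Zs⊆F [] u s h = mkSingles [] emptyBag [] (λ ()) (λ ()) refl (sym (*-zeroʳ m)) (λ _ _ _ → refl)
      singlesOf F F≤ Zs⊆F (z ∷ zs) u s h = go (singlesOf F F≤ Zs⊆F zs (unique-tail u) (λ i → s (there i)) h′)
        where
        h′ : m * length zs ≤ 33 * unit
        h′ = ≤-trans (*-monoʳ-≤ m (n≤1+n (length zs))) h
        go : Singles zs F → Singles (z ∷ zs) F
        go (mkSingles {x} {y} W bag uW cW wW tot sz pr) = go₂ (bichromatic (W ++ F) WF≤)
          where
          W≤ : length W ≤ 33 * unit
          W≤ = ≤-trans (≤-reflexive sz) h′
          WF≤ : length (W ++ F) ≤ 2100 * unit
          WF≤ = ≤-trans (≤-reflexive (length-++ W)) (≤-trans (W≤ ⊕ F≤) (≤-trans (≤-reflexive (sym (*-distribʳ-+ unit 33 1800))) (*-monoˡ-≤ unit (≤ᵇ⇒≤ 1833 2100 tt))))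
          go₂ : Bichromatic (W ++ F) → Singles (z ∷ zs) F
          go₂ (mkBi T uT lT dT zT hT hF) = go₃ (OneSingle.one F (≤-trans F≤ (*-monoˡ-≤ unit (≤ᵇ⇒≤ 1800 1900 tt))) Zs⊆F z (s (here refl)) (mkBi T uT lT (λ i j → dT i (∈-++⁺ʳ W j)) zT hT hF))
            where
            z∉T : z ∉ T
            z∉T i = zT i (s (here refl))
            z∉W : z ∉ W
            z∉W i = [ (λ j → unique-head u j) , (λ j → proj₂ j (s (here refl))) ]′ (wW i)
            go₃ : (∃ λ x → ∃ λ y → Bag x y 0 (z ∷ T) × x + y ≡ 1 × (∀ f → Normal f → Role f F z → parity f (z ∷ T) ≡ π x y)) → Singles (z ∷ zs) F
            go₃ (x′ , y′ , b′ , t′ , p′) = mkSingles ((z ∷ T) ++ W) (bag-++ b′ bag) (unique-++ (unique-∷ z∉T uT) uW dis) (λ { (here refl) → here refl ; (there i) → ∈-++⁺ʳ (z ∷ T) (cW i) }) wh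
                (trans (ring-74 x′ x y′ y) (cong₂ _+_ t′ tot)) (trans (cong suc (length-++ T)) (trans (cong₂ (λ a b → suc (a + b)) lT sz) (sym (*-suc m (length zs)))))
                (λ f nf rf → trans (parity-++ f (z ∷ T) W) (trans (cong₂ _xor_ (p′ f nf (rf (here refl))) (pr f nf (λ i → rf (there i)))) (sym (π-+ x′ y′ x y))))
              where
              dis : Disj (z ∷ T) W
              dis (here refl) j = z∉W j
              dis (there i) j = dT i (∈-++⁺ˡ j)
              wh : ∀ {v} → v ∈ (z ∷ T) ++ W → v ∈ z ∷ zs ⊎ (v ∉ F × v ∉ Zs)
              wh (here refl) = inj₁ (here refl)
              wh (there i) = [ (λ k → inj₂ ((λ j → dT k (∈-++⁺ʳ W j)) , zT k)) , (λ k → [ (λ j → inj₁ (there j)) , inj₂ ]′ (wW k)) ]′ (∈-++⁻ T i)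

    -- A fixed part consisting of paths WG through the vertices Js and of singles through the other vertices of Zs.
    record Core (zs F : List V) : Set where
      field
        Js WG       : List V
        {a b r w}   : ℕ
        bag         : Bag a b r WG
        uniq        : Unique WG
        Zs≡         : Zs ↭ Js ++ zs
        Js⊆         : ∀ {v} → v ∈ Js → v ∈ WG
        WG⊆         : ∀ {v} → v ∈ WG → v ∈ Js ⊎ v ∈ F
        zs-off      : ∀ {v} → v ∈ zs → v ∉ WG
        size        : length WG ≡ m * w
        w≤          : w ≤ 6
        few         : a + b + r ≤ 2

    module FromCore {zs F : List V} (core : Core zs F) (si : Singles zs F) where
      open Core core
      open Singles si renaming (W to WS; bag to bagS; uniq to uniqS; size to sizeS)

      G : List V
      G = WG ++ WS

      abstract
        len-zs : length zs ≤ 33 * (m * suc K)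
        len-zs = ≤-trans (≤-trans (m≤n+m _ (length Js)) (≤-reflexive (trans (sym (length-++ Js)) (sym (↭-length Zs≡))))) Zs-few

        G-size : length G ≡ m * (w + length zs)
        G-size = trans (length-++ WG) (trans (cong₂ _+_ size sizeS) (sym (*-distribˡ-+ m w (length zs))))

        layout : ∀ p q → p + (a + x) ≡ q + (b + y) → p + q + (w + length zs) ≡ τ → (∀ W → allFin n ↭ G ++ W → parity χ W ≡ π p q) → Layout
        layout p q ev tot parW = record
          { p = p ; q = q ; G = G ; bag = bag-++ bag bagS ; uniq = unique-++ uniq uniqS dis
          ; Zs⊆G = λ i → [ (λ j → ∈-++⁺ˡ (Js⊆ j)) , (λ j → ∈-++⁺ʳ WG (cover j)) ]′ (∈-++⁻ Js (∈-resp-↭ Zs≡ i))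
          ; short = ≤-trans (≤-reflexive (length-++ WG)) (≤-trans (≤-trans (≤-reflexive size) (≤-trans (*-monoʳ-≤ m w≤) (≤-trans (≤-reflexive (*-comm m 6)) (*-monoʳ-≤ 6 m≤unit))) ⊕ ≤-trans (≤-reflexive sizeS) (≤-trans (*-monoʳ-≤ m len-zs) (≤-trans (≤-reflexive (ring-120 m (suc K))) (*-monoʳ-≤ 33 mmK≤unit))))
              (≤-trans (≤-reflexive (sym (*-distribʳ-+ unit 6 33))) (*-monoˡ-≤ unit (≤ᵇ⇒≤ 39 400 tt))))
          ; few = ≤-trans (≤-reflexive (ring-121 a x b y r)) (≤-trans (few ⊕ ≤-trans (≤-reflexive total) len-zs) (≤-trans (+-monoˡ-≤ (33 * (m * suc K)) (*-monoʳ-≤ 2 (*-mono-≤ {1} {m} {1} {suc K} (s≤s z≤n) (s≤s z≤n)))) (≤-trans (≤-reflexive (sym (*-distribʳ-+ (m * suc K) 2 33))) (*-monoˡ-≤ (m * suc K) (≤ᵇ⇒≤ 35 50 tt)))))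
          ; even = ev
          ; counted = λ W all≡ → +-cancelˡ-≡ (length G) _ _ (trans (sym (length-++ G)) (trans (sym (↭-length all≡)) (trans length-allFin (trans n-parts (trans (cong (m *_) (sym tot)) (trans (ring-122 m (p + q) (w + length zs)) (cong (_+ m * (p + q)) (sym G-size)))))))) , parW W all≡ }
          where
          dis : Disj WG WS
          dis i j = [ (λ k → zs-off k i) , (λ k → [ (λ i′ → proj₂ k (∈-resp-↭ (↭-sym Zs≡) (∈-++⁺ˡ i′))) , proj₁ k ]′ (WG⊆ i)) ]′ (where′ j)

    abstract
      zs-big : ∀ (zs : List V) → length zs ≤ 33 * (m * suc K) → 2 * length zs + 6 ≤ τ
      zs-big zs l = cancel m (s≤s z≤n) (≤-trans big (≤-reflexive n-parts))
        where
        big : m * (2 * length zs + 6) ≤ n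
        big = ≤-trans (*-monoʳ-≤ m (+-monoˡ-≤ 6 (*-monoʳ-≤ 2 l))) (≤-trans (≤-reflexive (ring-126 m (suc K))) (≤-trans (*-monoʳ-≤ 66 mmK≤unit ⊕ *-monoʳ-≤ 6 m≤unit)
          (Colouring.β≤n hg exact 72 (≤ᵇ⇒≤ 72 5000 tt) (≤-reflexive (sym (*-distribʳ-+ unit 66 6))))))

      zs-bound : ∀ (zs : List V) h w → length zs ≤ 33 * (m * suc K) → h + h + w ≡ τ → w ≤ 6 → length zs ≤ h
      zs-bound zs h w l e w≤ = arith (length zs) h w (≤-trans (zs-big zs l) (≤-reflexive (sym e))) w≤
        where
        arith : ∀ z h w → 2 * z + 6 ≤ h + h + w → w ≤ 6 → z ≤ h
        arith z h w k k′ = *-cancelˡ-≤ 2 (lin 0 (k ⊕ k′) (ring-123 z h w))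

    module Plain {zs F : List V} (core : Core zs F) (si : Singles zs F) (h : ℕ) (τ≡ : h + h + Core.w core ≡ τ) (a0 : Core.a core ≡ 0) (b0 : Core.b core ≡ 0) where
      open Singles si
      open Core core using (WG; w; w≤)

      abstract
        len : length zs ≤ h
        len = zs-bound zs h w (FromCore.len-zs core si) τ≡ w≤

        x≤h : x ≤ h
        x≤h = ≤-trans (m≤m+n x y) (≤-trans (≤-reflexive total) len)

        y≤h : y ≤ h
        y≤h = ≤-trans (m≤n+m y x) (≤-trans (≤-reflexive total) len)

        fits : h ∸ x + (h ∸ y) + (w + length zs) ≡ τ
        fits = trans (cong (λ z → h ∸ x + (h ∸ y) + (w + z)) (sym total)) (trans (ring-124 (h ∸ x) (h ∸ y) w x y) (trans (cong₂ (λ u v → u + v + w) (m+[n∸m]≡n x≤h) (m+[n∸m]≡n y≤h)) τ≡))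

        even′ : h ∸ x + (Core.a core + x) ≡ h ∸ y + (Core.b core + y)
        even′ = trans (cong (λ z → h ∸ x + (z + x)) a0) (trans (trans (+-comm (h ∸ x) x) (m+[n∸m]≡n x≤h)) (sym (trans (cong (λ z → h ∸ y + (z + y)) b0) (trans (+-comm (h ∸ y) y) (m+[n∸m]≡n y≤h)))))

        finishM : parity χ (allFin n) ≡ (parity χ WG xor parity χ W) xor π (h ∸ x) (h ∸ y) → Hamilton
        finishM cond = Finishing.cycle (FromCore.layout core si (h ∸ x) (h ∸ y) even′ fits λ R all≡ →
            xor-cancel (parity χ WG xor parity χ W) (parity χ R) (π (h ∸ x) (h ∸ y)) (trans (cong (_xor parity χ R) (sym (parity-++ χ WG W))) (trans (sym (parity-++ χ (WG ++ W) R)) (trans (sym (parity-↭ χ all≡)) cond))))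

    abstract
      -- The two versions of the first gadget have different parities, so one of them fits.
      chooseM : ∀ {zs F} (c₁ c₂ : Core zs F) (si : Singles zs F) h → h + h + Core.w c₁ ≡ τ → h + h + Core.w c₂ ≡ τ → Core.a c₁ ≡ 0 → Core.b c₁ ≡ 0 → Core.a c₂ ≡ 0 → Core.b c₂ ≡ 0 →
        parity χ (Core.WG c₁) ≡ not (parity χ (Core.WG c₂)) → Hamilton
      chooseM c₁ c₂ si h e₁ e₂ a₁ b₁ a₂ b₂ ne = [ Plain.finishM c₁ si h e₁ a₁ b₁ , (λ k → Plain.finishM c₂ si h e₂ a₂ b₂ (trans k (not-xor₂ (parity χ (Core.WG c₁)) _ _ _ ne))) ]′ (bool-≟ (parity χ (allFin n)) _)

      gadgetBag : ∀ {Ok F z} (g : Gadget Ok F z) → (∀ {v} → v ∈ Zs → v ∈ F) → Bag 0 0 1 (verticesOf g)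
      gadgetBag {z = z} g Zs⊆F = go (bool-case (P A)) (bool-case (P C))
        where
        open Gadget g
        pA : Proper A
        pA = ~-properˡ {A} {z ∷ T} AT
        pC : Proper C
        pC = ~-properʳ {z ∷ T} {C} TC
        t : Trail A C (A ++ ((z ∷ T) ++ C))
        t = join (part pA) AT (join (part (~-properʳ {A} {z ∷ T} AT)) TC (part pC))
        ne : P A xor P C ≡ true
        ne = trans (cong₂ _xor_ (col-par pA (λ i j → offA i (Zs⊆F j))) (col-par pC (λ i j → offC i (Zs⊆F j)))) (trans (xor-common c₀ _ _) differ)
        go : P A ≡ true ⊎ P A ≡ false → P C ≡ true ⊎ P C ≡ false → Bag 0 0 1 (A ++ ((z ∷ T) ++ C))
        go (inj₁ p) (inj₁ q) = true≢false ne (cong₂ _xor_ p q)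
        go (inj₂ p) (inj₂ q) = true≢false ne (cong₂ _xor_ p q)
        go (inj₁ p) (inj₂ q) = bagPQ (A , C , t , p , notP-Q pC q)
        go (inj₂ p) (inj₁ q) = bagPQ (C , A , reverse t , q , notP-Q pA p)

      gadget-size : ∀ {Ok F z} (g : Gadget Ok F z) → length (verticesOf g) ≡ m * 3
      gadget-size {z = z} g = trans (length-++ A) (trans (cong₂ _+_ (~-length {A} {z ∷ T} AT) (trans (length-++ (z ∷ T)) (cong₂ _+_ (~-length {z ∷ T} {C} TC) (~-lengthʳ {z ∷ T} {C} TC)))) (ring-117 m))
        where
        open Gadget g

      gadget-parity : ∀ {p F z} (g : Gadget (λ T → parity χ T ≡ p) F z) → parity χ (verticesOf g) ≡ not (χ z xor p)
      gadget-parity {p} {z = z} g = trans (parity-++ χ A ((z ∷ T) ++ C)) (trans (cong (parity χ A xor_) (parity-++ χ (z ∷ T) C)) (trans (cong (λ w → parity χ A xor ((χ z xor w) xor parity χ C)) ok) (xor-between (parity χ A) (χ z xor p) (parity χ C) differ)))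
        where
        open Gadget g

    open Gadget using () renaming (unique to g-unique)

    OkP : Bool → List V → Set
    OkP p T = parity χ T ≡ p

    core₁ : ∀ {p z zs F} (g : Gadget (OkP p) Zs z) → Zs ↭ z ∷ zs → (∀ {v} → v ∈ verticesOf g → v ∈ F) → Core zs F
    core₁ {z = z} {zs} g Z≡ sub = record
      { Js = z ∷ [] ; WG = verticesOf g ; bag = gadgetBag g id ; uniq = g-unique g ; Zs≡ = Z≡ ; Js⊆ = λ { (here refl) → ∈-++⁺ʳ (Gadget.A g) (here refl) }
      ; WG⊆ = λ i → inj₂ (sub i) ; zs-off = λ i j → unique-head (Unique-↭ Z≡ Zs-unique) (subst (_∈ zs) (gadget-∈ g j (∈-resp-↭ (↭-sym Z≡) (there i))) i)
      ; size = gadget-size g ; w≤ = ≤ᵇ⇒≤ 3 6 tt ; few = s≤s z≤n }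

    core₂ : ∀ {p p′ z z′ zs F F′} (g : Gadget (OkP p) Zs z) (g′ : Gadget (OkP p′) F′ z′) → Zs ↭ z ∷ z′ ∷ zs → (∀ {v} → v ∈ Zs → v ∈ F′) → (∀ {v} → v ∈ verticesOf g → v ∈ F′) →
      (∀ {v} → v ∈ verticesOf g → v ∈ F) → (∀ {v} → v ∈ verticesOf g′ → v ∈ F) → Core zs F
    core₂ {z = z} {z′} {zs} g g′ Z≡ ZF′ gF′ gF g′F = record
      { Js = z ∷ z′ ∷ [] ; WG = verticesOf g ++ verticesOf g′ ; bag = bag-++ (gadgetBag g id) (gadgetBag g′ ZF′)
      ; uniq = unique-++ (g-unique g) (g-unique g′) (λ i j → gadget-off g′ z′∉g gF′ j i)
      ; Zs≡ = Z≡ ; Js⊆ = λ { (here refl) → ∈-++⁺ˡ (∈-++⁺ʳ (Gadget.A g) (here refl)) ; (there (here refl)) → ∈-++⁺ʳ (verticesOf g) (∈-++⁺ʳ (Gadget.A g′) (here refl)) }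
      ; WG⊆ = λ i → inj₂ ([ gF , g′F ]′ (∈-++⁻ (verticesOf g) i))
      ; zs-off = λ i j → [ (λ k → unique-head uz (subst (_∈ z′ ∷ zs) (gadget-∈ g k (back (there (there i)))) (there i))) , (λ k → unique-head (unique-tail uz) (subst (_∈ zs) (gadget-∈ g′ k (ZF′ (back (there (there i))))) i)) ]′ (∈-++⁻ (verticesOf g) j)
      ; size = trans (length-++ (verticesOf g)) (trans (cong₂ _+_ (gadget-size g) (gadget-size g′)) (sym (*-distribˡ-+ m 3 3))) ; w≤ = ≤-refl ; few = ≤-refl }
      where
      uz : Unique (z ∷ z′ ∷ zs)
      uz = Unique-↭ Z≡ Zs-unique
      back : ∀ {v} → v ∈ z ∷ z′ ∷ zs → v ∈ Zs
      back = ∈-resp-↭ (↭-sym Z≡)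
      z′∉g : z′ ∉ verticesOf g
      z′∉g i = unique-head uz (subst (_∈ z′ ∷ zs) (gadget-∈ g i (back (there (here refl)))) (here refl))

    abstract
      -- Census for a set with all but one vertex in class b.
      classBound : ∀ F J (roles : ∀ {v} → v ∈ Zs → v ∉ J → ∃ (Single F v)) → (∀ {v} → v ∈ Zs → v ∈ F) → (∀ {v} → v ∈ J → v ∈ Zs) → ∀ {R} → allFin n ↭ J ++ R → ∀ b (S : Special (μ + μ) b F) →
        D + (μ + μ) ≤ # (λ v → same b (Extend.χ* F J roles v)) of R + # (λ y → e (y ∷ Special.v S ∷ Special.w S)) of J
      classBound F J roles Zs⊆F J⊆Zs {R} all≡ b (mkSpecial v w u l d z c a) =
          ≤-trans (+-monoʳ-≤ D big) (subst (λ c → D + # (λ x → same c (χ x)) of (v ∷ w) ≤ # (λ x → same c (χ* x)) of R + # (λ y → e (y ∷ v ∷ w)) of J) par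
            (census F J R χ* Zs⊆F J⊆Zs all≡ normal role (v ∷ w) u (cong suc (trans (cong suc l) (sym (+-suc μ μ)))) d has-adm))
        where
        open Extend F J roles
        par : true xor parity χ (v ∷ w) ≡ b
        par = trans (cong (true xor_) (cong₂ _xor_ c (parity-even χ b μ w l a))) (not-not-xor b)
        big : μ + μ ≤ # (λ x → same b (χ x)) of (v ∷ w)
        big = ≤-trans (≤-reflexive (sym (trans (#-all (λ x → same b (χ x)) w (λ i → same-intro b _ (a i))) l))) (m≤n+m _ _)
        wit : ∃ λ x → x ∈ w
        wit = go w l
          where
          go : ∀ (w : List V) → length w ≡ μ + μ → ∃ λ x → x ∈ w
          go (x ∷ w) _ = x , here refl
          go [] e = ⊥-elim (1+n≰n (≤-trans (≤-trans (≤-trans (s≤s z≤n) μ-large) (m≤m+n μ μ)) (≤-reflexive (sym e))))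
        has-adm : adm (v ∷ w) ≡ true
        has-adm = has-bool b (proj₁ wit , there (proj₂ wit) , a (proj₂ wit)) (v , here refl , c)

      special′ : ∀ b F → length F ≤ 2100 * unit → Special (μ + μ) b F
      special′ b F h = special (μ + μ) b F (≤-trans (n≤1+n _) (≤-reflexive (ring-68 μ))) h

      fewJokers : ∀ F J → length F ≤ 2000 * unit → (∀ {v} → v ∈ Zs → v ∈ F) → (∀ {v} → v ∈ J → v ∈ Zs) → Unique J → (∀ {v} → v ∈ Zs → v ∉ J → ∃ (Single F v)) → 2 * D + 4 * m ≤ n + 4 + length J
      fewJokers F J F≤ Zs⊆F J⊆Zs uJ roles = go (rest uJ)
        where
        open Extend F J roles
        go : (∃ λ R → allFin n ↭ J ++ R) → 2 * D + 4 * m ≤ n + 4 + length J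
        go (R , all≡) = arith D μ n (length J) (length R) _ _ (bound true) (bound false) (trans (sym (length-++ J)) (trans (sym (↭-length all≡)) length-allFin))
            (trans (sym (∑-+ R _ _)) (trans (∑-cong R (λ v → same-split true (χ* v))) (trans (∑-const R 1) (*-identityʳ _))))
          where
          bound : ∀ b → D + (μ + μ) ≤ # (λ v → same b (χ* v)) of R + length J
          bound b = ≤-trans (classBound F J roles Zs⊆F J⊆Zs all≡ b (special′ b F (≤-trans F≤ (*-monoˡ-≤ unit (≤ᵇ⇒≤ 2000 2100 tt))))) (+-monoʳ-≤ _ (#≤length J _))
          arith : ∀ D μ n j r x y → D + (μ + μ) ≤ x + j → D + (μ + μ) ≤ y + j → j + r ≡ n → x + y ≡ r → 2 * D + 4 * suc μ ≤ n + 4 + j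
          arith D μ _ j _ x y h k refl refl = lin 0 (h ⊕ k) (ring-118 D μ j x y)

    module Balanced (z₁ : V) (zs F : List V) (F≤ : length F ≤ 1000 * unit) (Zs⊆F : ∀ {v} → v ∈ Zs → v ∈ F) (Z≡ : Zs ↭ z₁ ∷ zs) (single : ∀ {v} → v ∈ zs → ∃ (Single F v))
      (h : ℕ) (τ≡ : h + h ≡ τ) (odd-h : odd (h * m) ≡ odd h) where

      z₁∈ : z₁ ∈ Zs
      z₁∈ = ∈-resp-↭ (↭-sym Z≡) (here refl)

      J : List V
      J = z₁ ∷ []

      J⊆Zs : ∀ {v} → v ∈ J → v ∈ Zs
      J⊆Zs (here refl) = z₁∈

      roles : ∀ {v} → v ∈ Zs → v ∉ J → ∃ (Single F v)
      roles i j = go (∈-resp-↭ Z≡ i) j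
        where
        go : ∀ {v} → v ∈ z₁ ∷ zs → v ∉ J → ∃ (Single F v)
        go (here e) j = ⊥-elim (j (here e))
        go (there k) _ = single k

      open Extend F J roles

      H : ℕ
      H = h * m

      abstract
        n≡ : n ≡ H + H
        n≡ = trans n-parts (trans (cong (m *_) (sym τ≡)) (ring-125 m h))

      module Complement (R : List V) (all≡ : allFin n ↭ z₁ ∷ R) where

        c : Bool → ℕ
        c b = # (λ v → same b (χ* v)) of R

        abstract
          c-sum : suc (c true + c false) ≡ H + H
          c-sum = trans (cong suc (trans (sym (∑-+ R _ _)) (trans (∑-cong R (λ v → same-split true (χ* v))) (trans (∑-const R 1) (*-identityʳ _))))) (trans (sym (↭-length all≡)) (trans length-allFin n≡))

          degree-large : H ≤ D + (μ + μ)
          degree-large = *-cancelˡ-≤ 2 (lin 0 (eq≥ n≡ ⊕ D-large) (ring-119 H n D μ))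

          bound : ∀ b (S : Special (μ + μ) b F) → D + (μ + μ) ≤ c b + (⟦ e (z₁ ∷ Special.v S ∷ Special.w S) ⟧ + 0)
          bound b S = classBound F J roles Zs⊆F J⊆Zs all≡ b S

          c-large : ∀ b → H ≤ c b + 1
          c-large b = ≤-trans degree-large (≤-trans (bound b S) (+-monoʳ-≤ (c b) (≤-trans (≤-reflexive (+-identityʳ _)) (⟦⟧≤1 (e (z₁ ∷ Special.v S ∷ Special.w S))))))
            where
            S : Special (μ + μ) b F
            S = special′ b F (≤-trans F≤ (*-monoˡ-≤ unit (≤ᵇ⇒≤ 1000 2100 tt)))

          minority : ∃ λ b → c b + 1 ≡ H × c (not b) ≡ H
          minority = go (c true + 1 ≤? H)
            where
            go : Dec (c true + 1 ≤ H) → ∃ λ b → c b + 1 ≡ H × c (not b) ≡ H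
            go (yes k) = true , eq , +-cancelˡ-≡ H (c false) H (trans (cong (_+ c false) (sym eq)) (trans (cong (_+ c false) (+-comm (c true) 1)) c-sum))
              where
              eq : c true + 1 ≡ H
              eq = ≤-antisym k (c-large true)
            go (no k) = false , eq , +-cancelʳ-≡ H (c true) H (trans (cong (c true +_) (sym eq)) (trans (ring-116 (c true) (c false)) c-sum))
              where
              arith : ∀ a b H → suc (a + b) ≡ H + H → H < a + 1 → b + 1 ≤ H
              arith a b H s l = +-cancelˡ-≤ H (b + 1) H (≤-trans (+-monoˡ-≤ (b + 1) (≤-pred (≤-trans l (≤-reflexive (+-comm a 1))))) (≤-trans (≤-reflexive (ring-116 a b)) (≤-reflexive s)))
              eq : c false + 1 ≡ H
              eq = ≤-antisym (arith (c true) (c false) H c-sum (≰⇒> k)) (c-large false)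

        module Minor (b : Bool) (cb : c b + 1 ≡ H) (cb′ : c (not b) ≡ H) where

          abstract
            adjacent : ∀ (S : Special (μ + μ) b F) → e (z₁ ∷ Special.v S ∷ Special.w S) ≡ true
            adjacent S = go (bool-case (e (z₁ ∷ Special.v S ∷ Special.w S)))
              where
              go : e (z₁ ∷ Special.v S ∷ Special.w S) ≡ true ⊎ e (z₁ ∷ Special.v S ∷ Special.w S) ≡ false → e (z₁ ∷ Special.v S ∷ Special.w S) ≡ true
              go (inj₁ h) = h
              go (inj₂ h) = ⊥-elim (1+n≰n (≤-trans (≤-reflexive (trans (+-comm 1 (c b)) cb)) (≤-trans degree-large (≤-trans (bound b S) (≤-reflexive (trans (cong (λ x → c b + (⟦ x ⟧ + 0)) h) (+-identityʳ (c b))))))))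

            f : V → Bool
            f v = choose (v ≟ᶠ z₁)
              where
              choose : Dec (v ≡ z₁) → Bool
              choose (yes _) = b
              choose (no _) = χ* v

            f-z₁ : f z₁ ≡ b
            f-z₁ with z₁ ≟ᶠ z₁
            ... | yes _ = refl
            ... | no k = ⊥-elim (k refl)

            f-other : ∀ {v} → v ≢ z₁ → f v ≡ χ* v
            f-other {v} k with v ≟ᶠ z₁
            ... | yes e = ⊥-elim (k e)
            ... | no _ = refl

            f-normal : Normal f
            f-normal {v} k = trans (f-other (λ e → k (subst (_∈ Zs) (sym e) z₁∈))) (normal k)

            f-role : ∀ {z} → z ∈ zs → Role f F z
            f-role {z} i S h d a = trans (f-other z≢) (role (∈-resp-↭ (↭-sym Z≡) (there i)) (λ { (here e) → z≢ e }) S h d a)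
              where
              z≢ : z ≢ z₁
              z≢ e = unique-head (Unique-↭ Z≡ Zs-unique) (subst (_∈ zs) e i)

            -- Both classes of f have exactly n/2 elements.
            f-total : parity f (allFin n) ≡ odd h
            f-total = trans (parity-↭ f all≡) (trans (cong₂ _xor_ f-z₁ (trans (parity-cong f χ* R (λ i → f-other (λ e → unique-head (Unique-↭ all≡ allFin-unique) (subst (_∈ R) e i)))) (trans (parity-odd-# χ* R) (cong odd (∑-cong R (λ v → sym (true-same (χ* v)))))))) (trans (cases b cb cb′) odd-h))
              where
              true-same : ∀ x → ⟦ same true x ⟧ ≡ ⟦ x ⟧
              true-same true = refl
              true-same false = refl
              cases : ∀ b → c b + 1 ≡ H → c (not b) ≡ H → b xor odd (c true) ≡ odd H
              cases true p q = trans (cong odd (+-comm 1 (c true))) (cong odd p)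
              cases false p q = cong odd q

          module Path (sp : Special ν b F) (A C : List V) (uA : Unique A) (uC : Unique C) (lA : length A ≡ m) (lC : length C ≡ m)
            (dA : Disj A ((Special.v sp ∷ Special.w sp) ++ F)) (dC : Disj C (A ++ ((Special.v sp ∷ Special.w sp) ++ F))) (zA : Disj A Zs) (zC : Disj C Zs)
            (allA : ∀ {x} → x ∈ A → χ x ≡ b) (allC : ∀ {x} → x ∈ C → χ x ≡ b) where
            open Special sp

            T : List V
            T = v ∷ w

            abstract
              edgeWith : ∀ B → Unique B → length B ≡ m → Disj B (T ++ F) → Disj B Zs → (∀ {x} → x ∈ B → χ x ≡ b) → (z₁ ∷ T) ~ B
              edgeWith B uB lB dB zB allB = edge-~ {z₁ ∷ T} {B} (cong suc (trans (cong suc size) (sym μ≡))) (adjacent (mkSpecial v (w ++ B)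
                (unique-++ uniq uB (λ i j → dB j (∈-++⁺ˡ i))) (trans (length-++ w) (trans (cong₂ _+_ size lB) (trans (+-suc ν μ) (cong (_+ μ) (sym μ≡)))))
                (λ i j → [ (λ k → off-F k j) , (λ k → dB k (∈-++⁺ʳ T j)) ]′ (∈-++⁻ T i)) (λ i j → [ (λ k → off-Zs k j) , (λ k → zB k j) ]′ (∈-++⁻ T i)) χv (λ i → [ χw , allB ]′ (∈-++⁻ w i))))

              zA~ : (z₁ ∷ T) ~ A
              zA~ = edgeWith A uA lA dA zA allA

              zC~ : (z₁ ∷ T) ~ C
              zC~ = edgeWith C uC lC (λ i j → dC i (∈-++⁺ʳ A j)) zC allC

              trail : Trail A C (A ++ ((z₁ ∷ T) ++ C))
              trail = join (part (uA , lA)) (~-sym {z₁ ∷ T} {A} zA~) (join (part (~-properˡ {z₁ ∷ T} {C} zC~)) zC~ (part (uC , lC)))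

            WG : List V
            WG = A ++ ((z₁ ∷ T) ++ C)

            abstract
              WG-unique : Unique WG
              WG-unique = unique-++ uA (~-unique {z₁ ∷ T} {C} zC~) (λ i j → [ (λ { (here refl) → zA i z₁∈ ; (there k) → dA i (∈-++⁺ˡ k) }) , (λ k → dC k (∈-++⁺ˡ i)) ]′ (∈-++⁻ (z₁ ∷ T) j))

              parity-eq : parity χ A ≡ parity χ C
              parity-eq = parity-const χ b A C allA allC (trans lA (sym lC))

              P-eq : P A ≡ P C
              P-eq = trans (col-par (uA , lA) zA) (trans (cong (c₀ xor_) parity-eq) (sym (col-par (uC , lC) zC)))

              wA : parity χ w xor parity χ A ≡ false
              wA = trans (sym (parity-++ χ w A)) (parity-even χ b μ (w ++ A) (trans (length-++ w) (trans (cong₂ _+_ size lA) (trans (+-suc ν μ) (cong (_+ μ) (sym μ≡))))) (λ i → [ χw , allA ]′ (∈-++⁻ w i)))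

              onχ : ∀ xs → Disj xs Zs → parity f xs ≡ parity χ xs
              onχ xs d = parity-cong f χ xs (λ i → f-normal (d i))

              parityWG : parity f WG ≡ not (c₀ xor P A)
              parityWG = trans (parity-++ f A ((z₁ ∷ T) ++ C)) (trans (cong (parity f A xor_) (parity-++ f (z₁ ∷ T) C)) (trans (cong₂ (λ x y → x xor ((f z₁ xor parity f T) xor y)) (onχ A zA) (trans (onχ C zC) (sym parity-eq)))
                  (trans (cong₂ (λ x y → parity χ A xor ((x xor y) xor parity χ A)) f-z₁ (trans (onχ T off-Zs) (cong (_xor parity χ w) χv))) (trans (xor-around b (parity χ w) (parity χ A) wA) (cong not (par-P (uA , lA) zA))))))

            core : ∀ {x y : ℕ} → Bag x y 0 WG → x + y ≤ 2 → Core zs (WG ++ F)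
            core bg k = record
              { Js = z₁ ∷ [] ; WG = WG ; bag = bg ; uniq = WG-unique ; Zs≡ = Z≡ ; Js⊆ = λ { (here refl) → ∈-++⁺ʳ A (here refl) }
              ; WG⊆ = λ i → inj₂ (∈-++⁺ˡ i)
              ; zs-off = λ i j → [ (λ k → zA k (back i)) , (λ k → [ (λ { (here refl) → unique-head (Unique-↭ Z≡ Zs-unique) i ; (there k′) → off-Zs k′ (back i) }) , (λ k′ → zC k′ (back i)) ]′ (∈-++⁻ (z₁ ∷ T) k)) ]′ (∈-++⁻ A j)
              ; size = trans (length-++ A) (trans (cong₂ _+_ lA (trans (length-++ (z₁ ∷ T)) (cong₂ _+_ (~-length {z₁ ∷ T} {C} zC~) lC))) (ring-117 m)) ; w≤ = ≤ᵇ⇒≤ 3 6 tt ; few = ≤-trans (≤-reflexive (+-identityʳ _)) k }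
              where
              back : ∀ {v} → v ∈ zs → v ∈ Zs
              back i = ∈-resp-↭ (↭-sym Z≡) (there i)

            module Last (si : Singles zs (WG ++ F)) where
              open Singles si renaming (W to WS; size to sizeS)

              abstract
                role′ : ∀ {z} → z ∈ zs → Role f (WG ++ F) z
                role′ i S h d a = f-role i S h (λ j k → d j (∈-++⁺ʳ WG k)) a

                finishS : ∀ pG qG {x′ y′} (bg : Bag x′ y′ 0 WG) (k : x′ + y′ ≤ 2) → pG + y′ ≡ qG + x′ → pG + qG ≡ 3 → pG ≤ 3 → qG ≤ 3 → parity f WG ≡ π pG qG → Hamilton
                finishS pG qG {x′} {y′} bg k surplus three p3 q3 pw = Finishing.cycle (FromCore.layout (core bg k) si (h ∸ (pG + x)) (h ∸ (qG + y)) ev fits par′)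
                  where
                  len : length zs + 3 ≤ h
                  len = *-cancelˡ-≤ 2 (≤-trans (≤-reflexive (ring-114 (length zs))) (≤-trans (zs-big zs (FromCore.len-zs (core bg k) si)) (≤-reflexive (trans (sym τ≡) (cong (h +_) (sym (+-identityʳ h)))))))
                  px : pG + x + (h ∸ (pG + x)) ≡ h
                  px = m+[n∸m]≡n (≤-trans (p3 ⊕ ≤-trans (m≤m+n x y) (≤-reflexive total)) (≤-trans (≤-reflexive (+-comm 3 (length zs))) len))
                  qy : qG + y + (h ∸ (qG + y)) ≡ h
                  qy = m+[n∸m]≡n (≤-trans (q3 ⊕ ≤-trans (m≤n+m y x) (≤-reflexive total)) (≤-trans (≤-reflexive (+-comm 3 (length zs))) len))
                  ev : h ∸ (pG + x) + (x′ + x) ≡ h ∸ (qG + y) + (y′ + y)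
                  ev = even-arith (h ∸ (pG + x)) (h ∸ (qG + y)) x y x′ y′ pG qG (trans px (sym qy)) surplus
                    where
                    even-arith : ∀ p q x y a b pG qG → pG + x + p ≡ qG + y + q → pG + b ≡ qG + a → p + (a + x) ≡ q + (b + y)
                    even-arith p q x y a b pG qG e s = +-cancelʳ-≡ (pG + b) _ _ (trans (ring-112 p a x pG b) (trans (cong (_+ (a + b)) e) (trans (ring-113 q b y qG a) (cong (q + (b + y) +_) (sym s)))))
                  fits : h ∸ (pG + x) + (h ∸ (qG + y)) + (3 + length zs) ≡ τ
                  fits = trans (cong₂ (λ u v → h ∸ (pG + x) + (h ∸ (qG + y)) + (u + v)) (sym three) (sym total)) (trans (ring-115 (h ∸ (pG + x)) (h ∸ (qG + y)) pG qG x y) (trans (cong₂ _+_ px qy) τ≡))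
                  par′ : ∀ W → allFin n ↭ (WG ++ WS) ++ W → parity χ W ≡ π (h ∸ (pG + x)) (h ∸ (qG + y))
                  par′ W all = xor-cancel (parity f (WG ++ WS)) _ _ (trans (cong (parity f (WG ++ WS) xor_) (sym (onχ W offW))) (trans (sym (parity-++ f (WG ++ WS) W)) (trans (sym (parity-↭ f all)) (trans f-total
                      (trans (sym πhh) (cong (_xor π (h ∸ (pG + x)) (h ∸ (qG + y))) (sym (trans (parity-++ f WG WS) (trans (cong₂ _xor_ pw (par f f-normal role′)) (sym (π-+ pG qG x y)))))))))))
                    where
                    offW : Disj W Zs
                    offW i j = unique-disj (WG ++ WS) (Unique-↭ all allFin-unique) (inG (∈-resp-↭ Z≡ j)) i
                      where
                      inG : ∀ {v} → v ∈ z₁ ∷ zs → v ∈ WG ++ WS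
                      inG (here refl) = ∈-++⁺ˡ (∈-++⁺ʳ A (here refl))
                      inG (there k) = ∈-++⁺ʳ WG (cover k)
                    πhh : π (pG + x) (qG + y) xor π (h ∸ (pG + x)) (h ∸ (qG + y)) ≡ odd h
                    πhh = trans (sym (π-+ (pG + x) (qG + y) (h ∸ (pG + x)) (h ∸ (qG + y)))) (trans (cong₂ π px qy) (select-same (odd h) c₀))

                finishPath : Hamilton
                finishPath = go (bool-case (P A))
                  where
                  go : P A ≡ true ⊎ P A ≡ false → Hamilton
                  go (inj₁ p) = finishS 2 1 (bagPP (A , C , trail , p , trans (sym P-eq) p)) (s≤s z≤n) refl refl (≤ᵇ⇒≤ 2 3 tt) (≤ᵇ⇒≤ 1 3 tt) (trans parityWG (trans (cong (λ z → not (c₀ xor z)) p) (not-xor-true c₀)))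
                  go (inj₂ p) = finishS 1 2 (bagQQ (A , C , trail , notP-Q (uA , lA) p , notP-Q (uC , lC) (trans (sym P-eq) p))) (s≤s z≤n) refl refl (≤ᵇ⇒≤ 1 3 tt) (≤ᵇ⇒≤ 2 3 tt) (trans parityWG (trans (cong (λ z → not (c₀ xor z)) p) (not-xor-false c₀)))

module DiffCase where

  open Base
  open Arithmetic
  open Xor
  open Hyper
  open Tri
  open Absorb
  open Cover
  open Parity
  open Mixed
  open Bags
  open Many
  open Few
  open Layouts

  -- The three kinds of degree conditions; odd (h * m) ≡ odd h is the special congruence of the theorem.
  data DegreeCase (hg : HG) : Set where
    special : let open HG hg in ∀ h → h + h ≡ τ → odd (h * m) ≡ odd h → DegreeCase hg
    even    : let open HG hg in ∀ h → h + h ≡ τ → n + 6 ≤ 2 * D + 4 * m → DegreeCase hg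
    uneven  : let open HG hg in ∀ h → suc (h + h) ≡ τ → n + 5 ≤ 2 * D + 4 * m → DegreeCase hg

  module FewFinish (hg : HG) (df : Diff hg) (cl : Togglers.Cleared hg df) (chi : Chi hg (Togglers.FewTogglers.exact hg df cl)) where
    open HG hg
    open Diff df
    open Trails hg
    open Togglers hg df
    open FewTogglers cl using (exact)
    open Chi chi
    open Fresh hg exact chi
    open FewBase hg df cl chi
    open Laying hg df cl chi renaming (special to specialSet)
    open Mixing hg exact chi adm

    abstract
      zs-small : ∀ (Js zs : List V) → Zs ↭ Js ++ zs → m * length zs ≤ 33 * unit
      zs-small Js zs p = ≤-trans (*-monoʳ-≤ m (≤-trans (m≤n+m _ (length Js)) (≤-trans (≤-reflexive (trans (sym (length-++ Js)) (sym (↭-length p)))) Zs-few))) (≤-trans (≤-reflexive (ring-120 m (suc K))) (*-monoʳ-≤ 33 mmK≤unit))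

      zs-unique : ∀ (Js zs : List V) → Zs ↭ Js ++ zs → Unique zs
      zs-unique Js zs p = unique-ʳ Js (Unique-↭ p Zs-unique)

      balanced : ∀ z₁ zs F → length F ≤ 100 * unit → (∀ {v} → v ∈ Zs → v ∈ F) → Zs ↭ z₁ ∷ zs → (∀ {v} → v ∈ zs → ∃ (Single F v)) → ∀ h → h + h ≡ τ → odd (h * m) ≡ odd h → Hamilton
      balanced z₁ zs F F≤ Zs⊆F Z≡ single h τ≡ oh = go (rest {z₁ ∷ []} ([] ∷ []))
        where
        module B = Balanced z₁ zs F (≤-trans F≤ (*-monoˡ-≤ unit (≤ᵇ⇒≤ 100 1000 tt))) Zs⊆F Z≡ single h τ≡ oh
        go : (∃ λ R → allFin n ↭ (z₁ ∷ []) ++ R) → Hamilton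
        go (R , all≡) = go₂ C.minority
          where
          module C = B.Complement R all≡
          go₂ : (∃ λ b → C.c b + 1 ≡ B.H × C.c (not b) ≡ B.H) → Hamilton
          go₂ (b , cb , cb′) = go₃ (specialSet ν b F (≤-trans (≤-reflexive (sym μ≡)) μ≤2m) (≤-trans F≤ (*-monoˡ-≤ unit (≤ᵇ⇒≤ 100 2100 tt))))
            where
            module Mn = C.Minor b cb cb′
            go₃ : Special ν b F → Hamilton
            go₃ sp = go₄ (freshMono m b (T ++ F) (room m (T ++ F) m≤2m (≤-trans TF≤ (*-monoˡ-≤ unit (≤ᵇ⇒≤ 101 2100 tt)))))
              where
              T : List V
              T = Special.v sp ∷ Special.w sp
              m≤2m : m ≤ 2 * m
              m≤2m = m≤m+n m _
              lT : length T ≡ μ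
              lT = trans (cong suc (Special.size sp)) (sym μ≡)
              TF≤ : length (T ++ F) ≤ 101 * unit
              TF≤ = ≤-trans (≤-reflexive (trans (length-++ T) (cong (_+ length F) lT))) (≤-trans (n≤1+n μ) m≤unit ⊕ F≤)
              go₄ : (∃ λ p → Σ (FreshSet m p (T ++ F)) λ x → ∀ {v} → v ∈ FreshSet.w x → χ v ≡ b) → Hamilton
              go₄ (pA , mkFresh A uA lA dA zA _ , allA) = go₅ (freshMono m b (A ++ (T ++ F)) (room m (A ++ (T ++ F)) m≤2m (≤-trans ATF≤ (*-monoˡ-≤ unit (≤ᵇ⇒≤ 102 2100 tt)))))
                where
                ATF≤ : length (A ++ (T ++ F)) ≤ 102 * unit
                ATF≤ = ≤-trans (≤-reflexive (trans (length-++ A) (cong (_+ length (T ++ F)) lA))) (m≤unit ⊕ TF≤)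
                go₅ : (∃ λ p → Σ (FreshSet m p (A ++ (T ++ F))) λ x → ∀ {v} → v ∈ FreshSet.w x → χ v ≡ b) → Hamilton
                go₅ (pC , mkFresh C′ uC lC dC zC _ , allC) = Pt.Last.finishPath (singlesOf (Pt.WG ++ F) WGF≤ (λ i → ∈-++⁺ʳ Pt.WG (Zs⊆F i)) zs (zs-unique (z₁ ∷ []) zs Z≡) (λ i → ∈-resp-↭ (↭-sym Z≡) (there i)) (zs-small (z₁ ∷ []) zs Z≡))
                  where
                  module Pt = Mn.Path sp A C′ uA uC lA lC dA dC zA zC allA allC
                  WGF≤ : length (Pt.WG ++ F) ≤ 1800 * unit
                  WGF≤ = ≤-trans (≤-reflexive (trans (length-++ Pt.WG) (cong (_+ length F) (trans (length-++ A) (cong₂ _+_ lA (trans (length-++ (z₁ ∷ T)) (cong₂ _+_ (cong suc lT) lC)))))))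
                    (≤-trans ((m≤unit ⊕ (m≤unit ⊕ m≤unit)) ⊕ F≤) (≤-trans (≤-reflexive (ring-127 unit)) (*-monoˡ-≤ unit (≤ᵇ⇒≤ 103 1800 tt))))

    split-∈ : ∀ {z : V} {xs} → z ∈ xs → ∃ λ ys → xs ↭ z ∷ ys
    split-∈ {z} i with ∈-∃++ i
    ... | as , bs , refl = as ++ bs , shift z as bs

    module Joker (z₁ : V) (zs : List V) (Z≡ : Zs ↭ z₁ ∷ zs) (Gt : Gadget (OkP true) Zs z₁) (Gf : Gadget (OkP false) Zs z₁) where

      F₂ : List V
      F₂ = verticesOf Gt ++ (verticesOf Gf ++ Zs)

      Zs⊆F₂ : ∀ {v} → v ∈ Zs → v ∈ F₂
      Zs⊆F₂ i = ∈-++⁺ʳ (verticesOf Gt) (∈-++⁺ʳ (verticesOf Gf) i)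

      t⊆ : ∀ {v} → v ∈ verticesOf Gt → v ∈ F₂
      t⊆ i = ∈-++⁺ˡ i

      f⊆ : ∀ {v} → v ∈ verticesOf Gf → v ∈ F₂
      f⊆ i = ∈-++⁺ʳ (verticesOf Gt) (∈-++⁺ˡ i)

      abstract
        g≤ : ∀ {Ok F z} (g : Gadget Ok F z) → length (verticesOf g) ≤ 3 * unit
        g≤ g = ≤-trans (≤-reflexive (trans (gadget-size g) (*-comm m 3))) (*-monoʳ-≤ 3 m≤unit)

        F₂≤ : length F₂ ≤ 39 * unit
        F₂≤ = ≤-trans (≤-reflexive (trans (length-++ (verticesOf Gt)) (cong (length (verticesOf Gt) +_) (length-++ (verticesOf Gf))))) (≤-trans (g≤ Gt ⊕ (g≤ Gf ⊕ Zs-small)) (≤-reflexive (ring-129 unit)))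

        back : ∀ {v} → v ∈ z₁ ∷ zs → v ∈ Zs
        back = ∈-resp-↭ (↭-sym Z≡)

        differ : parity χ (verticesOf Gt) ≡ not (parity χ (verticesOf Gf))
        differ = trans (gadget-parity Gt) (trans (not-xor-flip (χ z₁)) (cong not (sym (gadget-parity Gf))))

        oneGadget : ∀ h → h + h + 3 ≡ τ → Hamilton
        oneGadget h e′ = chooseM (core₁ Gt Z≡ t⊆) (core₁ Gf Z≡ f⊆) (singlesOf F₂ (≤-trans F₂≤ (*-monoˡ-≤ unit (≤ᵇ⇒≤ 39 1800 tt))) Zs⊆F₂ zs (zs-unique (z₁ ∷ []) zs Z≡) (λ i → back (there i)) (zs-small (z₁ ∷ []) zs Z≡))
          h e′ e′ refl refl refl refl differ

        twoGadgets : ∀ z₂ → z₂ ∈ zs → Mixed F₂ z₂ → ∀ h → h + h + 6 ≡ τ → Hamilton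
        twoGadgets z₂ i mx h e′ = go (split-∈ i)
          where
          g₂ : Gadget (OkP true) F₂ z₂
          g₂ = gadgetOf true F₂ (≤-trans F₂≤ (*-monoˡ-≤ unit (≤ᵇ⇒≤ 39 2000 tt))) z₂ (Zs⊆F₂ (back (there i))) mx
          F₃ : List V
          F₃ = verticesOf g₂ ++ F₂
          F₃≤ : length F₃ ≤ 1800 * unit
          F₃≤ = ≤-trans (≤-reflexive (length-++ (verticesOf g₂))) (≤-trans (g≤ g₂ ⊕ F₂≤) (≤-trans (≤-reflexive (sym (*-distribʳ-+ unit 3 39))) (*-monoˡ-≤ unit (≤ᵇ⇒≤ 42 1800 tt))))
          go : (∃ λ ys → zs ↭ z₂ ∷ ys) → Hamilton
          go (ys , p) = chooseM (core₂ Gt g₂ Z₂ Zs⊆F₂ t⊆ (λ j → ∈-++⁺ʳ (verticesOf g₂) (t⊆ j)) ∈-++⁺ˡ) (core₂ Gf g₂ Z₂ Zs⊆F₂ f⊆ (λ j → ∈-++⁺ʳ (verticesOf g₂) (f⊆ j)) ∈-++⁺ˡ)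
              (singlesOf F₃ F₃≤ (λ j → ∈-++⁺ʳ (verticesOf g₂) (Zs⊆F₂ j)) ys (zs-unique (z₁ ∷ z₂ ∷ []) ys Z₂) (λ j → ∈-resp-↭ (↭-sym Z₂) (there (there j))) (zs-small (z₁ ∷ z₂ ∷ []) ys Z₂))
              h e′ e′ refl refl refl refl (trans (parity-++ χ (verticesOf Gt) (verticesOf g₂)) (trans (cong (_xor parity χ (verticesOf g₂)) differ) (trans (not-xor (parity χ (verticesOf Gf)) _) (cong not (sym (parity-++ χ (verticesOf Gf) (verticesOf g₂)))))))
            where
            Z₂ : Zs ↭ z₁ ∷ z₂ ∷ ys
            Z₂ = ↭-trans Z≡ (prep z₁ p)

        τ-large : 6 ≤ τ
        τ-large = ≤-trans (m≤n+m 6 (2 * length {A = V} [])) (zs-big [] z≤n)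

        minus₃ : ∀ h → h + h ≡ τ → ∃ λ h′ → h′ + h′ + 6 ≡ τ
        minus₃ (suc (suc (suc h))) e′ = h , trans (ring-130 h) e′
        minus₃ zero e′ = ⊥-elim (1+n≰n (≤-trans (s≤s z≤n) (≤-trans τ-large (≤-reflexive (sym e′)))))
        minus₃ (suc zero) e′ = ⊥-elim (absurd 3 (≤-trans τ-large (≤-reflexive (sym e′))) refl)
        minus₃ (suc (suc zero)) e′ = ⊥-elim (absurd 1 (≤-trans τ-large (≤-reflexive (sym e′))) refl)

        minus₁ : ∀ h → suc (h + h) ≡ τ → ∃ λ h′ → h′ + h′ + 3 ≡ τ
        minus₁ (suc h) e′ = h , trans (ring-131 h) e′
        minus₁ zero e′ = ⊥-elim (absurd 4 (≤-trans τ-large (≤-reflexive (sym e′))) refl)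

        roleOf : (∀ {z} → z ∈ zs → ∃ (Single F₂ z)) → ∀ {v} → v ∈ Zs → v ∉ z₁ ∷ [] → ∃ (Single F₂ v)
        roleOf none i j = go (∈-resp-↭ Z≡ i) j
          where
          go : ∀ {v} → v ∈ z₁ ∷ zs → v ∉ z₁ ∷ [] → ∃ (Single F₂ v)
          go (here q) j = ⊥-elim (j (here q))
          go (there k) _ = none k

        cycle : DegreeCase hg → Hamilton
        cycle (uneven h e′ _) = let h′ , q = minus₁ h e′ in oneGadget h′ q
        cycle (even h e′ d) = go (findMixed F₂ zs)
          where
          go : (∃ λ z → z ∈ zs × Mixed F₂ z) ⊎ (∀ {z} → z ∈ zs → ∃ (Single F₂ z)) → Hamilton
          go (inj₁ (z₂ , i , mx)) = let h′ , q = minus₃ h e′ in twoGadgets z₂ i mx h′ q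
          go (inj₂ none) = ⊥-elim (absurd 0 (d ⊕ fewJokers F₂ (z₁ ∷ []) (≤-trans F₂≤ (*-monoˡ-≤ unit (≤ᵇ⇒≤ 39 2000 tt))) Zs⊆F₂ (λ { (here refl) → back (here refl) }) ([] ∷ []) (roleOf none)) (ring-128 n D m))
        cycle (special h e′ o) = go (findMixed F₂ zs)
          where
          go : (∃ λ z → z ∈ zs × Mixed F₂ z) ⊎ (∀ {z} → z ∈ zs → ∃ (Single F₂ z)) → Hamilton
          go (inj₁ (z₂ , i , mx)) = let h′ , q = minus₃ h e′ in twoGadgets z₂ i mx h′ q
          go (inj₂ none) = balanced z₁ zs F₂ (≤-trans F₂≤ (*-monoˡ-≤ unit (≤ᵇ⇒≤ 39 100 tt))) Zs⊆F₂ Z≡ none h e′ o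

    abstract
      noJoker : (∀ {z} → z ∈ Zs → ∃ (Single Zs z)) → 2 * D + 4 * m ≤ n + 4 + 0
      noJoker none = fewJokers Zs [] (≤-trans Zs-small (*-monoˡ-≤ unit (≤ᵇ⇒≤ 33 2000 tt))) id (λ ()) [] (λ i _ → none i)

      cycle : DegreeCase hg → Hamilton
      cycle dc = go (findMixed Zs Zs)
        where
        alone : (∀ {z} → z ∈ Zs → ∃ (Single Zs z)) → DegreeCase hg → Hamilton
        alone none (even h e′ d) = ⊥-elim (absurd 1 (d ⊕ noJoker none) (ring-132 n D m))
        alone none (uneven h e′ d) = ⊥-elim (absurd 0 (d ⊕ noJoker none) (ring-133 n D m))
        alone none (special h e′ o) = go₂ (split-∈ (proj₂ Zs-some))
          where
          go₂ : (∃ λ zs → Zs ↭ proj₁ Zs-some ∷ zs) → Hamilton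
          go₂ (zs , p) = balanced (proj₁ Zs-some) zs Zs (≤-trans Zs-small (*-monoˡ-≤ unit (≤ᵇ⇒≤ 33 100 tt))) id p (λ i → none (∈-resp-↭ (↭-sym p) (there i))) h e′ o
        go : (∃ λ z → z ∈ Zs × Mixed Zs z) ⊎ (∀ {z} → z ∈ Zs → ∃ (Single Zs z)) → Hamilton
        go (inj₂ none) = alone none dc
        go (inj₁ (z₁ , i , mx)) = go₂ (split-∈ i)
          where
          Z≤ : length Zs ≤ 2000 * unit
          Z≤ = ≤-trans Zs-small (*-monoˡ-≤ unit (≤ᵇ⇒≤ 33 2000 tt))
          go₂ : (∃ λ zs → Zs ↭ z₁ ∷ zs) → Hamilton
          go₂ (zs , p) = Joker.cycle z₁ zs p (gadgetOf true Zs Z≤ z₁ i mx) (gadgetOf false Zs Z≤ z₁ i mx) dc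

  module DiffFinish (hg : HG) (df : Diff hg) where
    open HG hg
    open Trails hg
    open Togglers hg df

    abstract
      hamilton : DegreeCase hg → Hamilton
      hamilton dc = go (collect (4 * K) ≤-refl)
        where
        go : Collected (4 * K) ⊎ Cleared → Hamilton
        go (inj₁ c) = ManyTogglers.cycle c
        go (inj₂ cl) = FewFinish.cycle hg df cl (Colouring.chi hg (FewTogglers.exact cl)) dc

module Bridges where

  open Base
  open Arithmetic
  open Hyper
  open Tri
  open Absorb
  open Cover

  module TwoBridges (hg : HG) (same : Same hg) where
    open HG hg
    open Same same
    open Trails hg
    open Covering hg

    colour : Bool → Pred
    colour true = X
    colour false = Y

    XItem YItem : List V → Set
    XItem W = ∃ λ A → ∃ λ B → Trail A B W × X A ≡ true × X B ≡ true
    YItem W = ∃ λ A → ∃ λ B → Trail A B W × Y A ≡ true × Y B ≡ true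

    Mono : Bool → Part → Part → List V → Set
    Mono b A B W = Trail A B W × colour b A ≡ true × colour b B ≡ true

    -- Cut at the last part of the colour of its first part, a path falls into at most two monochromatic pieces.
    data Cut (A : Part) (W : List V) : Set where
      whole : ∀ b B → Mono b A B W → Cut A W
      pieces : ∀ b B C E W₁ W₂ → Mono b A B W₁ → B ~ C → Mono (not b) C E W₂ → W₁ ++ W₂ ↭ W → Cut A W

    cut-∷ : ∀ b A′ A {W} → colour b A′ ≡ true → A′ ~ A → Cut A W → Cut A′ (A′ ++ W)
    cut-∷ true A′ A h a (whole true B (t , p , q)) = whole true B (join (part (~-properˡ {A′} {A} a)) a t , h , q)
    cut-∷ false A′ A h a (whole false B (t , p , q)) = whole false B (join (part (~-properˡ {A′} {A} a)) a t , h , q)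
    cut-∷ true A′ A h a (whole false B t) = pieces true A′ A B A′ _ (part (~-properˡ {A′} {A} a) , h , h) a t ↭-refl
    cut-∷ false A′ A h a (whole true B t) = pieces false A′ A B A′ _ (part (~-properˡ {A′} {A} a) , h , h) a t ↭-refl
    cut-∷ true A′ A h a (pieces true B C E W₁ W₂ (t , p , q) k t₂ w) = pieces true B C E _ W₂ (join (part (~-properˡ {A′} {A} a)) a t , h , q) k t₂ (↭-trans (↭-reflexive (++-assoc A′ W₁ W₂)) (++⁺ˡ A′ w))
    cut-∷ false A′ A h a (pieces false B C E W₁ W₂ (t , p , q) k t₂ w) = pieces false B C E _ W₂ (join (part (~-properˡ {A′} {A} a)) a t , h , q) k t₂ (↭-trans (↭-reflexive (++-assoc A′ W₁ W₂)) (++⁺ˡ A′ w))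
    cut-∷ true A′ A h a (pieces false B C E W₁ W₂ (t , p , q) k (t₂ , p₂ , q₂) w) = whole true E (perm′ (++⁺ˡ A′ w) (join (part (~-properˡ {A′} {A} a)) a (join t k t₂)) , h , q₂)
    cut-∷ false A′ A h a (pieces true B C E W₁ W₂ (t , p , q) k (t₂ , p₂ , q₂) w) = whole false E (perm′ (++⁺ˡ A′ w) (join (part (~-properˡ {A′} {A} a)) a (join t k t₂)) , h , q₂)

    some-colour : ∀ {A} → Proper A → ∃ λ b → colour b A ≡ true
    some-colour pA = [ (λ h → true , h) , (λ h → false , h) ]′ (XorY pA)

    cut : ∀ A ps → Chain A ps → Cut A (A ++ concat ps)
    cut A [] pA = let b , h = some-colour pA in whole b A (perm′ (↭-reflexive (sym (++-identityʳ A))) (part pA) , h , h)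
    cut A (B ∷ ps) (a , c) = let b , h = some-colour (~-properˡ {A} {B} a) in cut-∷ b A B h a (cut B ps c)

    record Sorted (W : List V) (k : ℕ) : Set where
      constructor mkSorted
      field
        xs ys : List (List V)
        Xs    : All XItem xs
        Ys    : All YItem ys
        kx    : length xs ≤ k
        ky    : length ys ≤ k
        all≡  : concat xs ++ concat ys ↭ W

    sort : ∀ {A W} → Cut A W → Sorted W 1
    sort {W = W} (whole true B h) = mkSorted (W ∷ []) [] ((_ , B , h) ∷ []) [] ≤-refl z≤n (↭-reflexive (trans (++-identityʳ (W ++ [])) (++-identityʳ W)))
    sort {W = W} (whole false B h) = mkSorted [] (W ∷ []) [] ((_ , B , h) ∷ []) z≤n ≤-refl (↭-reflexive (++-identityʳ W))
    sort (pieces true B C E W₁ W₂ h k h₂ w) = mkSorted (W₁ ∷ []) (W₂ ∷ []) ((_ , B , h) ∷ []) ((C , E , h₂) ∷ []) ≤-refl ≤-refl (↭-trans (++⁺ (↭-reflexive (++-identityʳ W₁)) (↭-reflexive (++-identityʳ W₂))) w)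
    sort (pieces false B C E W₁ W₂ h k h₂ w) = mkSorted (W₂ ∷ []) (W₁ ∷ []) ((C , E , h₂) ∷ []) ((_ , B , h) ∷ []) ≤-refl ≤-refl (↭-trans (++⁺ (↭-reflexive (++-identityʳ W₂)) (↭-reflexive (++-identityʳ W₁))) (↭-trans (++-comm W₂ W₁) w))

    sorted-++ : ∀ {W W′ k k′} → Sorted W k → Sorted W′ k′ → Sorted (W ++ W′) (k + k′)
    sorted-++ (mkSorted xs ys Xs Ys kx ky p) (mkSorted xs′ ys′ Xs′ Ys′ kx′ ky′ p′) =
      mkSorted (xs ++ xs′) (ys ++ ys′) (all-++ Xs Xs′) (all-++ Ys Ys′) (≤-trans (≤-reflexive (length-++ xs)) (kx ⊕ kx′)) (≤-trans (≤-reflexive (length-++ ys)) (ky ⊕ ky′))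
        (↭-trans (++⁺ (↭-reflexive (concat-++ xs xs′)) (↭-reflexive (concat-++ ys ys′)))
          (↭-trans (perm 4 (λ a b c d → (a ∙ b) ∙ (c ∙ d) ⊜ (a ∙ c) ∙ (b ∙ d)) ↭-refl (concat xs) (concat xs′) (concat ys) (concat ys′)) (++⁺ p p′)))

    sortAll : ∀ πs → All IsPath πs → Sorted (concatMap verts πs) (length πs)
    sortAll [] [] = mkSorted [] [] [] [] z≤n z≤n ↭-refl
    sortAll ((A , ps) ∷ πs) (c ∷ cs) = sorted-++ (sort (cut A ps c)) (sortAll πs cs)

    record Bridge (F : List V) : Set where
      constructor mkBridge
      field
        {A B}  : Part
        {W}    : List V
        trail  : Trail A B W
        XA     : X A ≡ true
        YB     : Y B ≡ true
        fresh  : Unique (W ++ F)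
        short  : length W ≤ 3 * m

    module FX = Framed XX
    module FY = Framed YY

    proper₁ : Proper (proj₁ X-some)
    proper₁ = proj₁ (proj₂ X-some)

    proper₂ : Proper (proj₁ Y-some)
    proper₂ = proj₁ (proj₂ Y-some)

    module GX = FX.Start proper₁ (proj₂ (proj₂ X-some)) proper₁ (proj₂ (proj₂ X-some))
    module GY = FY.Start proper₂ (proj₂ (proj₂ Y-some)) proper₂ (proj₂ (proj₂ Y-some))

    AbsorberX AbsorberY : List V → Set
    AbsorberX F = GX.Absorber (2 * K) F (16 * unit)
    AbsorberY F = GY.Absorber (2 * K) F (16 * unit)

    module Assemble (b₁ : Bridge []) (b₂ : Bridge (Bridge.W b₁ ++ [])) (aX : AbsorberX (Bridge.W b₂ ++ (Bridge.W b₁ ++ [])))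
      (aY : AbsorberY (GX.Absorber.W aX ++ (Bridge.W b₂ ++ (Bridge.W b₁ ++ []))))
      where
      module B₁ = Bridge b₁
      module B₂ = Bridge b₂
      module RX = GX.Absorber aX
      module RY = GY.Absorber aY

      F₀ : List V
      F₀ = RY.W ++ (RX.W ++ (B₂.W ++ (B₁.W ++ [])))

      module Links (s₁ : Slot X X F₀ B₁.A RX.first)
        (s₂ : Slot X X ((Slot.C s₁ ++ Slot.E s₁) ++ F₀) RX.last B₂.A)
        (s₃ : Slot Y Y ((Slot.C s₂ ++ Slot.E s₂) ++ ((Slot.C s₁ ++ Slot.E s₁) ++ F₀)) B₂.B RY.first)
        (s₄ : Slot Y Y ((Slot.C s₃ ++ Slot.E s₃) ++ ((Slot.C s₂ ++ Slot.E s₂) ++ ((Slot.C s₁ ++ Slot.E s₁) ++ F₀))) RY.last B₁.B) where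

        S₁ S₂ S₃ S₄ used : List V
        S₁ = Slot.C s₁ ++ Slot.E s₁
        S₂ = Slot.C s₂ ++ Slot.E s₂
        S₃ = Slot.C s₃ ++ Slot.E s₃
        S₄ = Slot.C s₄ ++ Slot.E s₄
        used = S₄ ++ (S₃ ++ (S₂ ++ (S₁ ++ F₀)))

        abstract
          used-unique : Unique used
          used-unique = FY.slot-unique s₄ (FY.slot-unique s₃ (FX.slot-unique s₂ (FX.slot-unique s₁ RY.fresh)))

        closed : ∀ xs ys → All XItem xs → All YItem ys → length xs ≤ 2 * K → length ys ≤ 2 * K →
          Trail B₁.B (Slot.E s₄) (B₁.W ++ (S₁ ++ ((RX.W ++ concat xs) ++ (S₂ ++ (B₂.W ++ (S₃ ++ ((RY.W ++ concat ys) ++ S₄)))))))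
        closed xs ys Xs Ys kx ky = join (reverse B₁.trail) (Slot.AC s₁) (join (FX.slot-trail s₁) (Slot.EB s₁) (join (RX.absorbs xs (itemsX Xs) kx) (Slot.AC s₂)
          (join (FX.slot-trail s₂) (Slot.EB s₂) (join B₂.trail (Slot.AC s₃) (join (FY.slot-trail s₃) (Slot.EB s₃) (join (RY.absorbs ys (itemsY Ys) ky) (Slot.AC s₄) (FY.slot-trail s₄)))))))
          where
          itemsX : ∀ {xs} → All XItem xs → All FX.Item xs
          itemsX [] = []
          itemsX (h ∷ hs) = inj₁ h ∷ itemsX hs
          itemsY : ∀ {xs} → All YItem xs → All FY.Item xs
          itemsY [] = []
          itemsY (h ∷ hs) = inj₁ h ∷ itemsY hs

        abstract
          order : ∀ x y → B₁.W ++ (S₁ ++ ((RX.W ++ x) ++ (S₂ ++ (B₂.W ++ (S₃ ++ ((RY.W ++ y) ++ S₄)))))) ↭ used ++ (x ++ y)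
          order x y = ↭-trans
            (perm 10 (λ b s r x s₂ b₂ s₃ r₂ y s₄ → b ∙ (s ∙ ((r ∙ x) ∙ (s₂ ∙ (b₂ ∙ (s₃ ∙ ((r₂ ∙ y) ∙ s₄)))))) ⊜ (s₄ ∙ (s₃ ∙ (s₂ ∙ (s ∙ (r₂ ∙ (r ∙ (b₂ ∙ b))))))) ∙ (x ∙ y)) ↭-refl B₁.W S₁ RX.W x S₂ B₂.W S₃ RY.W y S₄)
            (↭-reflexive (cong (λ z → (S₄ ++ (S₃ ++ (S₂ ++ (S₁ ++ (RY.W ++ (RX.W ++ (B₂.W ++ z))))))) ++ (x ++ y)) (sym (++-identityʳ B₁.W))))

          used-length : ∃ λ f → length used ≡ m * f
          used-length = let k , h = trail-length (perm′ (order [] []) (closed [] [] [] [] z≤n z≤n)) in k , trans (sym (cong length (++-identityʳ used))) h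

          used-short : length used ≤ β
          used-short = ≤-trans (≤-reflexive lengths) (≤-trans (+-monoʳ-≤ (2 * m + (2 * m + (2 * m + 2 * m))) (RY.short ⊕ (RX.short ⊕ (B₂.short ⊕ B₁.short))))
            (≤-trans (≤-reflexive (ring-55 m unit)) (≤-trans (+-monoˡ-≤ (32 * unit) (*-monoʳ-≤ 14 m≤unit)) (≤-trans (≤-reflexive (sym (*-distribʳ-+ unit 14 32))) (units≤β 46 (≤ᵇ⇒≤ 46 5000 tt))))))
            where
            ls : ∀ (xs ys : List V) {a b} → length xs ≡ a → length ys ≡ b → length (xs ++ ys) ≡ a + b
            ls xs ys p q = trans (length-++ xs) (cong₂ _+_ p q)
            lengths : length used ≡ 2 * m + (2 * m + (2 * m + 2 * m)) + (length RY.W + (length RX.W + (length B₂.W + length B₁.W)))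
            lengths = trans (ls S₄ _ (FY.slot-length s₄) (ls S₃ _ (FY.slot-length s₃) (ls S₂ _ (FX.slot-length s₂) (ls S₁ _ (FX.slot-length s₁)
              (ls RY.W _ refl (ls RX.W _ refl (ls B₂.W _ refl (cong length (++-identityʳ B₁.W)))))))))
              (ring-56 (2 * m) (2 * m) (2 * m) (2 * m) _)

          cycle : Hamilton
          cycle = go (coverRest used (proj₁ used-length) used-unique used-short (proj₂ used-length))
            where
            go : Covered used → Hamilton
            go cov = finish (sortAll πs paths)
              where
              open Covered cov renaming (whole to whole′; Xs to left)
              finish : Sorted (concatMap verts πs) (length πs) → Hamilton
              finish (mkSorted xs ys Xs Ys kx ky p) = B₁.B , Slot.E s₄ , _ , closed xs ys Xs Ys (≤-trans kx few) (≤-trans ky few) , Slot.EB s₄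
                , ↭-trans (order (concat xs) (concat ys)) (↭-trans (++⁺ˡ used (↭-trans p whole′)) (↭-sym rest≡))

      abstract
        F₀-short : length F₀ ≤ 46 * unit
        F₀-short = ≤-trans (≤-reflexive (trans (length-++ RY.W) (cong (length RY.W +_) (trans (length-++ RX.W) (cong (length RX.W +_) (trans (length-++ B₂.W) (cong (length B₂.W +_) (cong length (++-identityʳ B₁.W)))))))))
          (≤-trans (RY.short ⊕ (RX.short ⊕ (≤-trans B₂.short (*-monoʳ-≤ 3 m≤unit) ⊕ ≤-trans B₁.short (*-monoʳ-≤ 3 m≤unit)))) (≤-trans (≤-reflexive (ring-57 unit)) (*-monoˡ-≤ unit (≤ᵇ⇒≤ 38 46 tt))))

        more : ∀ {A B P Q} F (sl : Slot P Q F A B) j → length F ≤ j * unit → length ((Slot.C sl ++ Slot.E sl) ++ F) ≤ (2 + j) * unit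
        more F sl j h = ≤-trans (≤-reflexive (trans (length-++ (Slot.C sl ++ Slot.E sl)) (cong (_+ length F) (trans (length-++ (Slot.C sl)) (cong₂ _+_ (~-length {Slot.C sl} {Slot.E sl} (Slot.CE sl)) (~-lengthʳ {Slot.C sl} {Slot.E sl} (Slot.CE sl)))))))
          (≤-trans ((m≤unit ⊕ m≤unit) ⊕ h) (≤-reflexive (ring-58 unit j)))

        hamilton : Hamilton
        hamilton = step₁ (frame-slot XX F₀ (≤-trans F₀-short (units≤β 46 (≤ᵇ⇒≤ 46 5000 tt))) (first-proper B₁.trail) (first-proper (GX.plain aX)) B₁.XA RX.Qfirst)
          where
          step₁ : Slot X X F₀ B₁.A RX.first → Hamilton
          step₁ s₁ = step₂ (frame-slot XX _ (≤-trans f₁ (units≤β 48 (≤ᵇ⇒≤ 48 5000 tt))) (last-proper (GX.plain aX)) (first-proper B₂.trail) RX.Plast B₂.XA)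
            where
            f₁ : length ((Slot.C s₁ ++ Slot.E s₁) ++ F₀) ≤ 48 * unit
            f₁ = more F₀ s₁ 46 F₀-short
            step₂ : Slot X X ((Slot.C s₁ ++ Slot.E s₁) ++ F₀) RX.last B₂.A → Hamilton
            step₂ s₂ = step₃ (frame-slot YY _ (≤-trans f₂ (units≤β 50 (≤ᵇ⇒≤ 50 5000 tt))) (last-proper B₂.trail) (first-proper (GY.plain aY)) B₂.YB RY.Qfirst)
              where
              f₂ : length ((Slot.C s₂ ++ Slot.E s₂) ++ ((Slot.C s₁ ++ Slot.E s₁) ++ F₀)) ≤ 50 * unit
              f₂ = more _ s₂ 48 f₁
              step₃ : Slot Y Y ((Slot.C s₂ ++ Slot.E s₂) ++ ((Slot.C s₁ ++ Slot.E s₁) ++ F₀)) B₂.B RY.first → Hamilton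
              step₃ s₃ = Links.cycle s₁ s₂ s₃ (frame-slot YY _ (≤-trans (more _ s₃ 50 f₂) (units≤β 52 (≤ᵇ⇒≤ 52 5000 tt))) (last-proper (GY.plain aY)) (last-proper B₁.trail) RY.Plast B₁.YB)

    abstract
      twoBridges : (b₁ : Bridge []) → Bridge (Bridge.W b₁ ++ []) → Hamilton
      twoBridges b₁ b₂ = step (GX.makeAbsorber 2 (2 * K) F 2K (Bridge.fresh b₂) (≤-trans (+-monoʳ-≤ (16 * unit) F≤) (≤-trans (≤-reflexive (sym (*-distribʳ-+ unit 16 6))) (units≤β 22 (≤ᵇ⇒≤ 22 5000 tt)))))
        where
        F : List V
        F = Bridge.W b₂ ++ (Bridge.W b₁ ++ [])
        F≤ : length F ≤ 6 * unit
        F≤ = ≤-trans (≤-reflexive (trans (length-++ (Bridge.W b₂)) (cong (length (Bridge.W b₂) +_) (cong length (++-identityʳ (Bridge.W b₁))))))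
          (≤-trans (≤-trans (Bridge.short b₂) (*-monoʳ-≤ 3 m≤unit) ⊕ ≤-trans (Bridge.short b₁) (*-monoʳ-≤ 3 m≤unit)) (≤-reflexive (sym (*-distribʳ-+ unit 3 3))))
        2K : suc (2 * K) ≤ 2 * (m * suc K)
        2K = ≤-trans (≤-trans (n≤1+n _) (≤-reflexive (ring-59 K))) (*-monoʳ-≤ 2 (m≤m+n (suc K) (μ * suc K)))
        step : AbsorberX F → Hamilton
        step aX = Assemble.hamilton b₁ b₂ aX (GY.makeAbsorber 2 (2 * K) (GX.Absorber.W aX ++ F) 2K (GX.Absorber.fresh aX)
            (≤-trans (+-monoʳ-≤ (16 * unit) F′≤) (≤-trans (≤-reflexive (sym (*-distribʳ-+ unit 16 22))) (units≤β 38 (≤ᵇ⇒≤ 38 5000 tt)))))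
          where
          F′≤ : length (GX.Absorber.W aX ++ F) ≤ 22 * unit
          F′≤ = ≤-trans (≤-reflexive (length-++ (GX.Absorber.W aX))) (≤-trans (GX.Absorber.short aX ⊕ F≤) (≤-reflexive (sym (*-distribʳ-+ unit 16 6))))

module SameCase where

  open Base
  open Arithmetic
  open Xor
  open Hyper
  open Tri
  open Absorb
  open Cover
  open Bridges
  open Parity
  open Mixed

  module SameFinish (hg : HG) (sm : Same hg) where
    open HG hg
    open Same sm renaming (X to Xc; Y to Yc)
    open Trails hg
    open TwoBridges hg sm

    Clear : List V → Set
    Clear F = (∀ {A} → Proper A → Disj A F → Xc A ≡ true → Yc A ≡ true → ⊥) × (∀ {A B} → A ~ B → Disj A F → Disj B F → Xc A ≡ true → Yc B ≡ true → ⊥)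

    abstract
      findBridge : ∀ F → Unique F → Bridge F ⊎ Clear F
      findBridge F u = go (search U both) (search U (λ A → does (1 ≤? # (across A) of U)))
        where
        both : Part → Bool
        both A = (does (unique? A) ∧ not (hits F A)) ∧ (Xc A ∧ Yc A)
        across : Part → Part → Bool
        across A B = (adj A B ∧ (not (hits F A) ∧ not (hits F B))) ∧ (Xc A ∧ Yc B)
        go : (∃ λ A → A ∈ U × both A ≡ true) ⊎ (∀ A → A ∈ U → both A ≡ false) →
          (∃ λ A → A ∈ U × does (1 ≤? # (across A) of U) ≡ true) ⊎ (∀ A → A ∈ U → does (1 ≤? # (across A) of U) ≡ false) → Bridge F ⊎ Clear F
        go (inj₁ (A , i , h)) _ = inj₁ (mkBridge (part (decided (unique? A) a , tup-length m i)) c d (unique-++ (decided (unique? A) a) u (hits-disj F A (not-true b)))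
            (≤-trans (≤-reflexive (tup-length m i)) (m≤m+n m _)))
          where
          h₁ : (does (unique? A) ∧ not (hits F A)) ≡ true × (Xc A ∧ Yc A) ≡ true
          h₁ = ∧-elim {does (unique? A) ∧ not (hits F A)} h
          a : does (unique? A) ≡ true
          a = ∧-fst {does (unique? A)} (proj₁ h₁)
          b : not (hits F A) ≡ true
          b = ∧-snd {does (unique? A)} (proj₁ h₁)
          c : Xc A ≡ true
          c = ∧-fst {Xc A} (proj₂ h₁)
          d : Yc A ≡ true
          d = ∧-snd {Xc A} (proj₂ h₁)
        go (inj₂ _) (inj₁ (A , i , h)) = edge (#-find U (across A) (decided (1 ≤? _) h))
          where
          edge : (∃ λ B → B ∈ U × across A B ≡ true) → Bridge F ⊎ Clear F
          edge (B , j , k) with ∧-elim {adj A B ∧ (not (hits F A) ∧ not (hits F B))} k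
          ... | k₁ , k₂ with ∧-elim {adj A B} k₁ | ∧-elim {Xc A} k₂
          ... | a , k₃ | c , d with ∧-elim {not (hits F A)} k₃
          ... | oA , oB = inj₁ (mkBridge (join (part (~-properˡ {A} {B} a)) a (part (~-properʳ {A} {B} a))) c d
                  (unique-++ (~-unique {A} {B} a) u (λ x y → [ (λ z → hits-disj F A (not-true oA) z y) , (λ z → hits-disj F B (not-true oB) z y) ]′ (∈-++⁻ A x)))
                  (≤-trans (≤-reflexive (trans (length-++ A) (cong₂ _+_ (~-length {A} {B} a) (~-lengthʳ {A} {B} a)))) (≤-trans (m≤m+n (m + m) m) (≤-reflexive (ring-71 m)))))
        go (inj₂ n₁) (inj₂ n₂) = inj₂ ((λ {A} p d x y → true≢false (∧-intro (∧-intro (decide (unique? A) (proj₁ p)) (not-false (disj-hits F A d))) (∧-intro x y)) (n₁ A (∈-tup m A (proj₂ p))))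
          , (λ {A} {B} a dA dB x y → true≢false (decide (1 ≤? _) (#-pos (across A) (∈-tup m B (~-lengthʳ {A} {B} a)) (∧-intro (∧-intro a (∧-intro (not-false (disj-hits F A dA)) (not-false (disj-hits F B dB)))) (∧-intro x y)))) (n₂ A (∈-tup m A (~-length {A} {B} a)))))

    module Cleared (Z : List V) (Zu : Unique Z) (Z≤ : length Z ≤ 3 * m) (clear : Clear Z) where

      abstract
        ex-edge : ∀ {A B} → A ~ B → Disj A Z → Disj B Z → Xc A xor Xc B ≡ false
        ex-edge {A} {B} a dA dB = go (bool-case (Xc A)) (bool-case (Xc B))
          where
          not-X : ∀ {A} → Proper A → Xc A ≡ false → Yc A ≡ true
          not-X p h = [ (λ k → true≢false k h) , id ]′ (XorY p)
          go : Xc A ≡ true ⊎ Xc A ≡ false → Xc B ≡ true ⊎ Xc B ≡ false → Xc A xor Xc B ≡ false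
          go (inj₁ p) (inj₁ q) = cong₂ _xor_ p q
          go (inj₂ p) (inj₂ q) = cong₂ _xor_ p q
          go (inj₁ p) (inj₂ q) = ⊥-elim (proj₂ clear {A} {B} a dA dB p (not-X (~-properʳ {A} {B} a) q))
          go (inj₂ p) (inj₁ q) = ⊥-elim (proj₂ clear {B} {A} (~-sym {A} {B} a) dB dA q (not-X (~-properˡ {A} {B} a) p))

        Z≤3 : length Z ≤ 3 * unit
        Z≤3 = ≤-trans Z≤ (*-monoʳ-≤ 3 m≤unit)

        ex-rainbow : ∀ F → length F + 30 * unit ≤ β → ∀ c → ∃ λ A → Proper A × Disj A F × Xc A ≡ c
        ex-rainbow F h true = go (frame-slot XX F (≤-trans (m≤m+n _ _) h) proper₁ proper₁ (proj₂ (proj₂ X-some)) (proj₂ (proj₂ X-some)))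
          where
          go : Slot Xc Xc F (proj₁ X-some) (proj₁ X-some) → ∃ λ A → Proper A × Disj A F × Xc A ≡ true
          go (mkSlot C E AC CE EB QC PE offC offE) = C , ~-properˡ {C} {E} CE , offC , QC
        ex-rainbow F h false = go (frame-slot YY (F ++ Z) (≤-trans (≤-reflexive (length-++ F)) (≤-trans (+-monoʳ-≤ (length F) (≤-trans Z≤3 (*-monoˡ-≤ unit (≤ᵇ⇒≤ 3 30 tt)))) h)) proper₂ proper₂ (proj₂ (proj₂ Y-some)) (proj₂ (proj₂ Y-some)))
          where
          go : Slot Yc Yc (F ++ Z) (proj₁ Y-some) (proj₁ Y-some) → ∃ λ A → Proper A × Disj A F × Xc A ≡ false
          go (mkSlot C E AC CE EB QC PE offC offE) = C , ~-properˡ {C} {E} CE , (λ i j → offC i (∈-++⁺ˡ j))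
            , [ (λ p → ⊥-elim (proj₁ clear (~-properˡ {C} {E} CE) (λ i j → offC i (∈-++⁺ʳ F j)) p QC)) , id ]′ (bool-case (Xc C))

      exact : Exact hg
      exact = record { Z = Z ; Z-unique = Zu ; Z-few = ≤-trans Z≤ (*-mono-≤ (≤ᵇ⇒≤ 3 30 tt) (≤-trans (≤-reflexive (sym (*-identityʳ m))) (*-monoʳ-≤ m (s≤s z≤n)))) ; col = Xc ; col-↭ = X-↭ ; δ = false
                     ; edge-col = λ {A} {B} → ex-edge {A} {B} ; rainbow = ex-rainbow }

      module WithChi (chi : Chi hg exact) where
        open Chi chi
        open Fresh hg exact chi
        open Mixing hg exact chi (λ _ → true)

        splitS : ∀ (S : List V) → (Bool.true ≡ true) → suc (length S) ≡ m + m → ∃ λ T → ∃ λ B → S ↭ T ++ B × length T ≡ μ × ⊤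
        splitS S _ l = let T , B , p , q = split μ S (≤-trans (m≤m+n μ m) (≤-reflexive (sym (suc-injective l)))) in T , B , ↭-reflexive p , q , tt

        room : ∀ k {G : List V} → k ≤ 2 * m → length G ≤ 2100 * unit → k + length G + 66 * unit ≤ β
        room k h g = ≤-trans (+-monoˡ-≤ (66 * unit) (≤-trans h (*-monoʳ-≤ 2 m≤unit) ⊕ g)) (≤-trans (≤-reflexive (ring-72 unit)) (units≤β 2168 (≤ᵇ⇒≤ 2168 5000 tt)))

        freshT : ∀ G → length G ≤ 2100 * unit → ∃ λ T → Unique T × length T ≡ μ × Disj T G × ⊤
        freshT G h = let p , x = freshSome μ G (room μ {G} (≤-trans (n≤1+n μ) (m≤m+n m _)) h) in FreshSet.w x , FreshSet.unique x , FreshSet.size x , FreshSet.off-F x , tt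

        gadgetOf : ∀ F → length F ≤ 2000 * unit → ∀ z → z ∈ F → Mixed F z → Gadget (λ _ → ⊤) F z
        gadgetOf F F≤ z z∈ = Build.gadget (λ _ → ⊤) F F≤ splitS freshT z z∈

        abstract
          toBridge : ∀ {F z} (g : Gadget (λ _ → ⊤) F z) → (∀ {v} → v ∈ Zs → v ∈ F) → ∀ G → Unique (verticesOf g ++ G) → Σ (Bridge G) λ b → Bridge.W b ↭ verticesOf g
          toBridge {F} {z} g Zs⊆F G u = go (bool-case (Xc A)) (bool-case (Xc C))
            where
            open Gadget g
            pA : Proper A
            pA = ~-properˡ {A} {z ∷ T} AT
            pC : Proper C
            pC = ~-properʳ {z ∷ T} {C} TC
            not-X : ∀ {A} → Proper A → Xc A ≡ false → Yc A ≡ true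
            not-X p h = [ (λ k → true≢false k h) , id ]′ (XorY p)
            t : Trail A C (A ++ ((z ∷ T) ++ C))
            t = join (part pA) AT (join (part (~-properʳ {A} {z ∷ T} AT)) TC (part pC))
            len : length (A ++ ((z ∷ T) ++ C)) ≤ 3 * m
            len = ≤-reflexive (trans (length-++ A) (trans (cong₂ _+_ (proj₂ pA) (trans (length-++ (z ∷ T)) (cong₂ _+_ (~-length {z ∷ T} {C} TC) (proj₂ pC)))) (ring-70 m)))
            ne : Xc A xor Xc C ≡ true
            ne = trans (cong₂ _xor_ (col-par pA (λ i j → offA i (Zs⊆F j))) (col-par pC (λ i j → offC i (Zs⊆F j)))) (trans (xor-common c₀ _ _) differ)
            go : Xc A ≡ true ⊎ Xc A ≡ false → Xc C ≡ true ⊎ Xc C ≡ false → Σ (Bridge G) λ b → Bridge.W b ↭ verticesOf g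
            go (inj₁ p) (inj₁ q) = true≢false ne (cong₂ _xor_ p q)
            go (inj₂ p) (inj₂ q) = true≢false ne (cong₂ _xor_ p q)
            go (inj₁ p) (inj₂ q) = mkBridge t p (not-X pC q) u len , ↭-refl
            go (inj₂ p) (inj₁ q) = mkBridge (perm′ ↭-refl (reverse′ t)) q (not-X pA p) u len , ↭-refl
              where
              reverse′ : ∀ {A B W} → Trail A B W → Trail B A W
              reverse′ = reverse

          -- With at most one joker both classes of the extended χ would be too small for the degree.
          fewJokers : ∀ F J → length F ≤ 1000 * unit → (∀ {v} → v ∈ Zs → v ∈ F) → (∀ {v} → v ∈ J → v ∈ Zs) → Unique J → length J ≤ 1 → (∀ {v} → v ∈ Zs → v ∉ J → ∃ (Single F v)) → ⊥
          fewJokers F J F≤ Zs⊆F J⊆Zs uJ lJ roles = go (rest uJ)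
            where
            open Extend F J roles
            go : (∃ λ R → allFin n ↭ J ++ R) → ⊥
            go (R , all≡) = arith n μ D (length J) (length R) (# (λ v → same true (χ* v)) of R) (# (λ v → same false (χ* v)) of R) D-large (class true) (class false) lJ
                (trans (sym (length-++ J)) (trans (sym (↭-length all≡)) length-allFin)) (trans (sym (∑-+ R _ _)) (trans (∑-cong R (λ v → same-split true (χ* v))) (trans (∑-const R 1) (*-identityʳ _))))
              where
              class : ∀ b → D + (m + μ) ≤ # (λ v → same b (χ* v)) of R + length J
              class b = mono (freshMono (suc (μ + μ)) b F (room (suc (μ + μ)) {F} (≤-trans (n≤1+n _) (≤-reflexive (ring-68 μ))) (≤-trans F≤ (*-monoˡ-≤ unit (≤ᵇ⇒≤ 1000 2100 tt)))))
                where
                mono : (∃ λ p → Σ (FreshSet (suc (μ + μ)) p F) λ x → ∀ {v} → v ∈ FreshSet.w x → χ v ≡ b) → D + (m + μ) ≤ # (λ v → same b (χ* v)) of R + length J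
                mono (p , mkFresh S u l dF dZ _ , all) = subst (λ c → D + c ≤ # (λ v → same b (χ* v)) of R + length J) (trans (#-all _ S (λ i → same-intro b _ (all i))) l)
                    (subst (λ c → D + # (λ v → same c (χ v)) of S ≤ # (λ v → same c (χ* v)) of R + length J) (parity-odd χ b μ S l all)
                      (≤-trans (census F J R χ* Zs⊆F J⊆Zs all≡ normal role S u (trans (cong suc l) (sym (cong suc (+-suc μ μ)))) dF refl) (+-monoʳ-≤ _ (#≤length J _))))
              arith : ∀ n μ D j r x y → n + 4 ≤ 2 * D + 4 * suc μ → D + (suc μ + μ) ≤ x + j → D + (suc μ + μ) ≤ y + j → j ≤ 1 → j + r ≡ n → x + y ≡ r → ⊥
              arith _ μ D j _ x y h a b k refl refl = absurd 0 (h ⊕ a ⊕ b ⊕ k) (ring-69 μ D j x y)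

        abstract
          second : ∀ z₁ zs (g₁ : Gadget (λ _ → ⊤) Zs z₁) → Zs ↭ z₁ ∷ zs → Hamilton
          second z₁ zs g₁ p = go (findMixed F zs)
            where
            W₁ F : List V
            W₁ = verticesOf g₁
            F = W₁ ++ Zs
            Zs⊆F : ∀ {v} → v ∈ Zs → v ∈ F
            Zs⊆F i = ∈-++⁺ʳ W₁ i
            uz : Unique (z₁ ∷ zs)
            uz = Unique-↭ p Zs-unique
            b₁ : Σ (Bridge []) λ b → Bridge.W b ↭ W₁
            b₁ = toBridge g₁ id [] (subst Unique (sym (++-identityʳ W₁)) (Gadget.unique g₁))
            W₁≤ : length W₁ ≤ 3 * unit
            W₁≤ = ≤-trans (≤-reflexive (sym (↭-length (proj₂ b₁)))) (≤-trans (Bridge.short (proj₁ b₁)) (*-monoʳ-≤ 3 m≤unit))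
            F≤ : length F ≤ 36 * unit
            F≤ = ≤-trans (≤-reflexive (length-++ W₁)) (≤-trans (W₁≤ ⊕ Zs-small) (≤-reflexive (sym (*-distribʳ-+ unit 3 33))))
            go : (∃ λ z → z ∈ zs × Mixed F z) ⊎ (∀ {z} → z ∈ zs → ∃ (Single F z)) → Hamilton
            go (inj₂ none) = ⊥-elim (fewJokers F (z₁ ∷ []) (≤-trans F≤ (*-monoˡ-≤ unit (≤ᵇ⇒≤ 36 1000 tt))) Zs⊆F (λ { (here refl) → ∈-resp-↭ (↭-sym p) (here refl) }) ([] ∷ []) ≤-refl
              λ {v} i j → drop-head (∈-resp-↭ p i) j)
              where
              drop-head : ∀ {v} → v ∈ z₁ ∷ zs → v ∉ z₁ ∷ [] → ∃ (Single F v)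
              drop-head (here refl) j = ⊥-elim (j (here refl))
              drop-head (there i) j = none i
            go (inj₁ (z₂ , i , mx)) = twoBridges (proj₁ b₁) (proj₁ (toBridge g₂ Zs⊆F (Bridge.W (proj₁ b₁) ++ []) (subst (λ l → Unique (verticesOf g₂ ++ l)) (sym (++-identityʳ _))
                (unique-++ (Gadget.unique g₂) (unique-ˡ _ (Bridge.fresh (proj₁ b₁))) (λ x y → dis x (∈-resp-↭ (proj₂ b₁) y))))))
              where
              z₂∈ : z₂ ∈ Zs
              z₂∈ = ∈-resp-↭ (↭-sym p) (there i)
              g₂ : Gadget (λ _ → ⊤) F z₂
              g₂ = gadgetOf F (≤-trans F≤ (*-monoˡ-≤ unit (≤ᵇ⇒≤ 36 2000 tt))) z₂ (Zs⊆F z₂∈) mx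
              z₂∉ : z₂ ∉ W₁
              z₂∉ j = unique-head uz (subst (_∈ zs) (gadget-∈ g₁ j z₂∈) i)
              dis : Disj (verticesOf g₂) W₁
              dis = gadget-off g₂ z₂∉ ∈-++⁺ˡ

          hamilton : Hamilton
          hamilton = go (findMixed Zs Zs)
            where
            go : (∃ λ z → z ∈ Zs × Mixed Zs z) ⊎ (∀ {z} → z ∈ Zs → ∃ (Single Zs z)) → Hamilton
            go (inj₂ none) = ⊥-elim (fewJokers Zs [] (≤-trans Zs-small (*-monoˡ-≤ unit (≤ᵇ⇒≤ 33 1000 tt))) id (λ ()) [] z≤n (λ i _ → none i))
            go (inj₁ (z₁ , i , mx)) = go′ (∈-∃++ i)
              where
              go′ : (∃ λ as → ∃ λ bs → Zs ≡ as ++ z₁ ∷ bs) → Hamilton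
              go′ (as , bs , eq) = second z₁ (as ++ bs) (gadgetOf Zs (≤-trans Zs-small (*-monoˡ-≤ unit (≤ᵇ⇒≤ 33 2000 tt))) z₁ i mx) (↭-trans (↭-reflexive eq) (shift z₁ as bs))

      abstract
        hamilton : Hamilton
        hamilton = WithChi.hamilton (Colouring.chi hg exact)

    abstract
      hamilton : Hamilton
      hamilton = go (findBridge [] [])
        where
        go : Bridge [] ⊎ Clear [] → Hamilton
        go (inj₂ c) = Cleared.hamilton [] [] z≤n c
        go (inj₁ b) = go′ (findBridge (Bridge.W b ++ []) (Bridge.fresh b))
          where
          go′ : Bridge (Bridge.W b ++ []) ⊎ Clear (Bridge.W b ++ []) → Hamilton
          go′ (inj₁ b′) = twoBridges b b′
          go′ (inj₂ c) = Cleared.hamilton (Bridge.W b ++ []) (Bridge.fresh b) (≤-trans (≤-reflexive (cong length (++-identityʳ (Bridge.W b)))) (Bridge.short b)) c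

module Final where

  open Base
  open Arithmetic
  open Hyper
  open Tri
  open SameCase
  open Few
  open DiffCase
  open Constants
  open Interface
  open import Defs
  open import Data.Nat using (_/_)
  open import Data.Nat.Properties using (m≤n+m∸n; m≤n+o⇒m∸n≤o; m+n∸m≡n; *-cancelʳ-≡)
  open import Data.Nat.DivMod using (m*n/n≡m; m≡m%n+[m/n]*n; m%n<n)
  open import Data.Nat.Divisibility using (_∣_; divides; *-cancelˡ-∣; _∣?_)
  import Data.Integer as ℤ
  open import Data.Integer.Properties using (drop‿+<+) renaming (+-monoˡ-< to ℤ-mono)
  open import Data.Integer.Tactic.RingSolver using () renaming (solve-∀ to solveℤ-∀)
  open import Data.Fin.Subset using (Subset; ∣_∣)

  abstract
    above : ∀ a k c d → (ℤ.+ a ℤ.- ℤ.+ k) ℤ.+ ℤ.+ c ℤ.< ℤ.+ d → suc (a + c) ≤ k + d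
    above a k c d h = ≤-trans (drop‿+<+ (subst (ℤ._< ℤ.+ (d + k)) (cancelℤ (ℤ.+ a) (ℤ.+ k) (ℤ.+ c)) (ℤ-mono (ℤ.+ k) h))) (≤-reflexive (+-comm d k))
      where
      cancelℤ : ∀ x y z → ((x ℤ.- y) ℤ.+ z) ℤ.+ y ≡ x ℤ.+ z
      cancelℤ = solveℤ-∀

    odd-divisor : ∀ {d} → 2 ∣ d → odd d ≡ false
    odd-divisor (divides q refl) = trans (cong odd (trans (*-comm q 2) (cong (q +_) (+-identityʳ q)))) (odd-double q)

    halving : ∀ t → (∃ λ h → h + h ≡ t) ⊎ (∃ λ h → suc (h + h) ≡ t)
    halving zero = inj₁ (0 , refl)
    halving (suc t) = [ (λ { (h , e) → inj₂ (h , cong suc e) }) , (λ { (h , e) → inj₁ (suc h , cong suc (trans (+-suc h h) e)) }) ]′ (halving t)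

  module Assembly (μ n τ : ℕ) (2≤μ : 2 ≤ μ) (n≡ : n ≡ suc μ * τ) (sc : Scale 6000 (suc μ) n) (H : Hypergraph (suc μ * 2) n) where

    private
      m k : ℕ
      m = suc μ
      k = m * 2
      k≡ : k ≡ m + m
      k≡ = trans (*-comm m 2) (cong (m +_) (+-identityʳ m))

    open Translate H

    Degree : ℕ → Set
    Degree D = (S : Subset n) → ∣ S ∣ ≡ k ∸ 1 → D ≤ degree H S

    graph : ∀ D → n + 4 ≤ 2 * D + 4 * m → Degree D → HG
    graph D D-large deg = record
      { n = n ; μ = μ ; D = D ; s = 6000 ; β = β ; L = L ; κ = κ ; K = K ; p₀ = p₀ ; τ = τ
      ; e = e ; e-↭ = λ {xs} {ys} → e-↭ {xs} {ys} ; e-unique = λ {xs} h → proj₁ (e-elim {xs} h) ; e-length = λ {xs} h → trans (proj₁ (proj₂ (e-elim {xs} h))) k≡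
      ; codegree = λ {S} u l → ≤-trans (deg (toSubset S) (trans (size-toSubset S u) (cong (_∸ 1) (trans l (sym k≡))))) (codegree S u (trans l (sym k≡)))
      ; D-large = D-large ; μ-large = 2≤μ ; s-large = ≤-refl ; n-large = n-large ; n-parts = n≡ ; κ-pos = κ-pos ; p₀-large = p₀-large
      ; K-large = K-large ; β-large = β-large ; L-large = L-large }
      where open Scale sc

    cycle : ∀ D (D-large : n + 4 ≤ 2 * D + 4 * m) (deg : Degree D) → DegreeCase (graph D D-large deg) → HasHamiltonCycle H m
    cycle D D-large deg dc = hamilton-cycle hg H k≡ (λ W h → proj₂ (proj₂ (e-elim {W} h))) ([ SameFinish.hamilton hg , (λ df → DiffFinish.hamilton hg df dc) ]′ (Trichotomy.trichotomy hg))
      where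
      hg : HG
      hg = graph D D-large deg

    module Threshold (c : ℕ) (above-c : MinDegreeAbove H (k ∸ 1) ((ℤ.+ (n / 2) ℤ.- ℤ.+ k) ℤ.+ ℤ.+ c)) where

      D : ℕ
      D = suc (n / 2 + c) ∸ k

      abstract
        deg : Degree D
        deg S l = m≤n+o⇒m∸n≤o (suc (n / 2 + c)) k (above (n / 2) k c (degree H S) (above-c S l))

        double : 2 * (n / 2) + (2 * c + 2) ≤ 2 * D + 4 * m
        double = ≤-trans (≤-reflexive (ring-150 (n / 2) c)) (≤-trans (*-monoʳ-≤ 2 (m≤n+m∸n (suc (n / 2 + c)) k)) (≤-reflexive (ring-151 m D)))

    module _ (deg₁ : Special k n → MinDegreeAbove H (k ∸ 1) ((ℤ.+ (n / 2) ℤ.- ℤ.+ k) ℤ.+ ℤ.+ 1))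
             (deg₂ : ¬ Special k n → MinDegreeAbove H (k ∸ 1) ((ℤ.+ (n / 2) ℤ.- ℤ.+ k) ℤ.+ ℤ.+ 2)) where

      abstract
        finish-uneven : ∀ h → suc (h + h) ≡ τ → HasHamiltonCycle H m
        finish-uneven h eq = cycle D (≤-trans (+-monoʳ-≤ n (n≤1+n 4)) bound) deg (uneven h eq bound)
          where
          notSpecial : ¬ Special k n
          notSpecial (d , _) = case trans (sym (odd-divisor (*-cancelˡ-∣ m (subst (k ∣_) (trans n≡ (cong (m *_) (sym eq))) d)))) (cong not (odd-double h)) of λ ()
          open Threshold 2 (deg₂ notSpecial)
          bound : n + 5 ≤ 2 * D + 4 * m
          bound = ≤-trans (≤-trans (+-monoˡ-≤ 5 (≤-trans (≤-reflexive (m≡m%n+[m/n]*n n 2)) (+-monoˡ-≤ (n / 2 * 2) (≤-pred (m%n<n n 2))))) (≤-reflexive (ring-148 (n / 2)))) double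

        finish-even : ∀ h → h + h ≡ τ → HasHamiltonCycle H m
        finish-even h eq = go (2 ∣? (n / 2 ∸ n / k))
          where
          n≡₂ : n ≡ h * m * 2
          n≡₂ = trans n≡ (trans (cong (m *_) (sym eq)) (ring-149 m h))
          n≡ₖ : n ≡ h * k
          n≡ₖ = trans n≡₂ (*-assoc h m 2)
          n/2 : n / 2 ≡ h * m
          n/2 = trans (cong (_/ 2) n≡₂) (m*n/n≡m (h * m) 2)
          n/k : n / k ≡ h
          n/k = trans (cong (_/ k) n≡ₖ) (m*n/n≡m h k)
          difference : n / 2 ∸ n / k ≡ h * μ
          difference = trans (cong₂ _∸_ (trans n/2 (*-suc h μ)) n/k) (m+n∸m≡n h (h * μ))
          n₂ : n ≡ 2 * (n / 2)
          n₂ = trans n≡₂ (trans (*-comm (h * m) 2) (cong (2 *_) (sym n/2)))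
          xor-false : ∀ b → b xor false ≡ b
          xor-false true = refl
          xor-false false = refl
          congruence : odd (h * μ) ≡ false → odd (h * m) ≡ odd h
          congruence o = trans (cong odd (*-suc h μ)) (trans (odd-+ h (h * μ)) (trans (cong (odd h xor_) o) (xor-false (odd h))))
          go : Dec (2 ∣ (n / 2 ∸ n / k)) → HasHamiltonCycle H m
          go (yes d) = cycle D bound deg (special h eq (congruence (trans (cong odd (sym difference)) (odd-divisor d))))
            where
            open Threshold 1 (deg₁ (divides h n≡ₖ , d))
            bound : n + 4 ≤ 2 * D + 4 * m
            bound = subst (λ z → z + 4 ≤ 2 * D + 4 * m) (sym n₂) double
          go (no ¬d) = cycle D (≤-trans (+-monoʳ-≤ n (m≤m+n 4 2)) bound) deg (even h eq bound)
            where
            open Threshold 2 (deg₂ (λ sp → ¬d (proj₂ sp)))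
            bound : n + 6 ≤ 2 * D + 4 * m
            bound = subst (λ z → z + 6 ≤ 2 * D + 4 * m) (sym n₂) double

        finish : HasHamiltonCycle H m
        finish = [ (λ { (h , eq) → finish-even h eq }) , (λ { (h , eq) → finish-uneven h eq }) ]′ (halving τ)

  Claim : ℕ → ℕ → Set
  Claim k m = Σ ℕ λ n₀ → (n : ℕ) → m ∣ n → n₀ ≤ n → (H : Hypergraph k n) →
    (Special k n → MinDegreeAbove H (k ∸ 1) ((ℤ.+ (n / 2) ℤ.- ℤ.+ k) ℤ.+ ℤ.+ 1)) →
    (¬ Special k n → MinDegreeAbove H (k ∸ 1) ((ℤ.+ (n / 2) ℤ.- ℤ.+ k) ℤ.+ ℤ.+ 2)) → HasHamiltonCycle H m

  claim : ∀ m → 3 ≤ m → Claim (m * 2) m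
  claim (suc μ) (s≤s 2≤μ) = let n₀ , sc = scale 6000 (suc μ) ≤-refl (s≤s z≤n) in
    n₀ , λ { n (divides t eq) l H → Assembly.finish μ n t 2≤μ (trans eq (*-comm t (suc μ))) (sc n l) H }

  main : ∀ k → 2 ∣ k → 6 ≤ k → Claim k (k / 2)
  main k (divides q refl) 6≤k = subst (Claim (q * 2)) (sym (m*n/n≡m q 2)) (claim q (cancel 2 (s≤s z≤n) (≤-trans 6≤k (≤-reflexive (*-comm q 2)))))

open import Defs
open import Data.Nat using (ℕ; _≤_; _/_)
open import Data.Nat.Divisibility using (_∣_)
open import Data.Integer using (+_; _-_; _+_)
open import Data.Product using (Σ; _×_)
open import Relation.Nullary using (¬_)

theorem1p1 : (k : ℕ) → 2 ∣ k → 6 ≤ k →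
    Σ ℕ λ n₀ → (n : ℕ) → (k / 2) ∣ n → n₀ ≤ n →
    (H : Hypergraph k n) →
    (Special k n → MinDegreeAbove H (k Data.Nat.∸ 1) ((+ (n / 2) - + k) + + 1)) →
    (¬ Special k n → MinDegreeAbove H (k Data.Nat.∸ 1) ((+ (n / 2) - + k) + + 2)) →
    HasHamiltonCycle H (k / 2)
theorem1p1 = Final.main
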